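{- Let $n, e, f \in \mathbb N$. For an integer $q \geqslant 2$ let $\zeta$ be a primitive complex $q$th root of unity, $\rho = (1-\zeta)(1-\zeta^{ -1})$, and let $\mathcal X_n(q,e)$ be as defined in the context. Then: (a) If $n$ is even then $|\mathcal X_n(2,e)| \leqslant 2^{\lfloor e^2/2\rfloor -e+1}$. (b) If $n$ is odd then $|\mathcal X_n(2,e)| \leqslant 2^{\lceil e^2/2\rceil -e+1}$. (c) If $p$ is an odd prime then $|\mathcal X_n(p^f,e)| \leqslant p^{(e-1)^2}$. (d) If $f > 1$ and $n$ is even then $|\mathcal X_n(2^f,e)| \leqslant 2^{(e-1)(e-2)+\lceil 2^{2-f}e \rceil - 1}$. (e) If $f > 1$ and $n$ is odd then $|\mathcal X_n(2^f,e)| \leqslant 2^{(e-1)^2+\lceil 2^{2-f}e \rceil - 1-\lfloor e/4\rfloor}$.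
   Context: For an integer $q\geqslant 2$, $\zeta$ is a primitive complex $q$th root of unity and $\mathcal C_q=\{\zeta^j : j\in\mathbb Z\}$. $\mathcal H_n(q)$ denotes the set of all Hermitean $n\times n$ matrices all of whose entries lie in $\mathcal C_q$. For a matrix $H$, $\chi_H(x)=\det(xI-H)$. Let $\rho=(1-\zeta)(1-\zeta^{ -1})$. For $q>2$, $\mathcal X_n(q,e)$ denotes the set of congruence classes of the polynomials $\chi_H(x)$, $H \in \mathcal H_n(q)$, modulo the ideal $\rho^e\mathbb Z[\zeta+\zeta^{ -1}][x]$ of $\mathbb Z[\zeta+\zeta^{ -1}][x]$. For $q=2$ (so $\zeta=-1$ and $\mathcal H_n(2)$ is the set of symmetric $\{\pm1\}$-matrices of order $n$), $\mathcal X_n(2,e)$ denotes the set of congruence classes of $\chi_H(x)$, $H\in\mathcal H_n(2)$, modulo $2^e\mathbb Z[x]$. -}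

module Defs where

open import Data.Nat as ℕ using (ℕ; zero; suc; _∸_; _^_)
open import Data.Nat.Divisibility using (_∣_)
open import Data.Nat.DivMod using (_/_)
open import Data.Integer as ℤ using (ℤ)
open import Data.Fin using (Fin; toℕ; punchIn)
import Data.Fin as Fin
open import Data.List using (List; []; _∷_; map; foldr; allFin; replicate; _++_; upTo)
open import Data.Bool using (if_then_else_)
open import Data.Product using (Σ; ∃; _×_; _,_)
open import Relation.Binary.PropositionalEquality using (_≡_)
open import Relation.Nullary.Decidable using (⌊_⌋)

record RawR : Set₁ where
  field
    Car : Set
    0r 1r : Car
    add mul : Car → Car → Car
    neg : Car → Car

open RawR public

ℤR : RawR
ℤR = record { Car = ℤ ; 0r = ℤ.0ℤ ; 1r = ℤ.1ℤ ; add = ℤ._+_ ; mul = ℤ._*_ ; neg = ℤ.-_ }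

-- Polynomials over a raw ring as coefficient lists (constant term first)

module P (R : RawR) where
  addP : List (Car R) → List (Car R) → List (Car R)
  addP [] q = q
  addP (a ∷ p) [] = a ∷ p
  addP (a ∷ p) (b ∷ q) = add R a b ∷ addP p q

  negP : List (Car R) → List (Car R)
  negP = map (neg R)

  subP : List (Car R) → List (Car R) → List (Car R)
  subP p q = addP p (negP q)

  mulP : List (Car R) → List (Car R) → List (Car R)
  mulP [] q = []
  mulP (a ∷ p) q = addP (map (mul R a) q) (0r R ∷ mulP p q)

  monoP : ℕ → List (Car R)
  monoP k = replicate k (0r R) ++ (1r R ∷ [])

  powP : List (Car R) → ℕ → List (Car R)
  powP p zero = 1r R ∷ []
  powP p (suc k) = mulP p (powP p k)

  coeff : List (Car R) → ℕ → Car R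
  coeff [] k = 0r R
  coeff (a ∷ p) zero = a
  coeff (a ∷ p) (suc k) = coeff p k

  compose : List (Car R) → List (Car R) → List (Car R)
  compose g s = foldr (λ c acc → addP (c ∷ []) (mulP s acc)) [] g

PolyR : RawR → RawR
PolyR R = record { Car = List (Car R) ; 0r = [] ; 1r = 1r R ∷ [] ; add = addP ; mul = mulP ; neg = negP }
  where open P R

module Det (R : RawR) where
  signed : ℕ → Car R → Car R
  signed zero b = b
  signed (suc k) b = neg R (signed k b)

  det : (n : ℕ) → (Fin n → Fin n → Car R) → Car R
  det zero M = 1r R
  det (suc n) M =
    foldr (λ j acc → add R (signed (toℕ j) (mul R (M Fin.zero j)
                                              (det n (λ r c → M (Fin.suc r) (punchIn j c))))) acc)
          (0r R) (allFin (suc n))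

-- ℤ[y] (y plays the role of ζ) and ℤ[y][x]

ℤy : RawR
ℤy = PolyR ℤR

ℤyx : RawR
ℤyx = PolyR ℤy

open P ℤR public using () renaming
  (addP to _+y_; subP to _-y_; mulP to _*y_; monoP to yʸ; powP to _^y_; coeff to coeffy; compose to composey)
open P ℤy public using () renaming
  (subP to _-x_; monoP to xˣ; coeff to coeffx)

-- Φ_{p^f}(y) = Σ_{i<p} y^(i·p^(f-1)), the cyclotomic polynomial of order p^f (p prime, f ≥ 1)
cyclo : ℕ → ℕ → List ℤ
cyclo p f = foldr (λ i acc → yʸ (i ℕ.* p ^ (f ∸ 1)) +y acc) [] (upTo p)

_≈y_ : List ℤ → List ℤ → Set
a ≈y b = ∀ k → coeffy a k ≡ coeffy b k

-- a ≡ b in ℤ[ζ] = ℤ[y]/(Φ) : Φ divides a - b in ℤ[y]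
EqMod : List ℤ → List ℤ → List ℤ → Set
EqMod Φ a b = Σ (List ℤ) (λ c → (a -y b) ≈y (c *y Φ))

-- Hermitean matrices with entries in C_q, given by exponent matrices:
-- entry (i,j) is ζ^(a i j); Hermitean means ζ^(a j i) = conj ζ^(a i j) = ζ^(-a i j)

Herm : ℕ → ℕ → Set
Herm q n = Σ (Fin n → Fin n → Fin q) (λ a → ∀ i j → q ∣ (toℕ (a i j) ℕ.+ toℕ (a j i)))

-- characteristic polynomial det(xI - H), computed in ℤ[y][x]
-- (its image in ℤ[ζ][x] under y ↦ ζ is χ_H)
charPoly : (q n : ℕ) → Herm q n → List (List ℤ)
charPoly q n (a , _) =
  Det.det ℤyx n (λ i j → (if ⌊ i Fin.≟ j ⌋ then xˣ 1 else []) -x (yʸ (toℕ (a i j)) ∷ []))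

-- ρ = (1 - ζ)(1 - ζ^{-1}),  ζ^{-1} = ζ^{q-1}
ρy : ℕ → List ℤ
ρy q = ((ℤ.1ℤ ∷ []) -y yʸ 1) *y ((ℤ.1ℤ ∷ []) -y yʸ (q ∸ 1))

modulus : ℕ → ℕ → List ℤ
modulus q e = if ⌊ q ℕ.≟ 2 ⌋ then (ℤ.+ (2 ^ e) ∷ []) else (ρy q ^y e)

-- P ≡ Q modulo (modulus) · ℤ[ζ+ζ^{-1}][x], for q = p^f:
-- every coefficient difference equals modulus · g(ζ+ζ^{-1}) in ℤ[ζ] for some g ∈ ℤ[t]
Congr : (p f e : ℕ) → List (List ℤ) → List (List ℤ) → Set
Congr p f e P Q =
  ∀ k → Σ (List ℤ) (λ g →
    EqMod (cyclo p f) (coeffx P k -y coeffx Q k)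
          (modulus (p ^ f) e *y composey g (yʸ 1 +y yʸ (p ^ f ∸ 1))))

-- |X_n(p^f, e)| ≤ N : the congruence classes of the χ_H, H ∈ H_n(p^f), inject into Fin N
XCardLe : (p f n e N : ℕ) → Set
XCardLe p f n e N =
  Σ (Herm (p ^ f) n → Fin N) (λ cls →
    ∀ H H' → cls H ≡ cls H' → Congr p f e (charPoly (p ^ f) n H) (charPoly (p ^ f) n H'))

ceilDiv : ℕ → ℕ → ℕ
ceilDiv m zero = 0
ceilDiv m (suc d) = (m ℕ.+ d) / suc d

{-# OPTIONS --safe #-}

-- Put π = 1 - ζ and write H = J - πA, J the all-ones matrix. Since J has rank one,
-- det (I - xH) = det (I + πxA) - x ∂_J det (I + πxA), so the coefficient a_k of x^k lies in
-- (π^(k-1)). It is real because H is Hermitean, and real elements have even valuation at π, so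
-- ρ^⌊k/2⌋ divides a_k. Moreover a₁ = 2t - n and a₂ = 2t (t - n), where t is the number of
-- diagonal entries equal to -1. Counting the ρ-adic digits left for the other a_k proves (c).
--
-- For p = 2 split J = I + N + Nᵀ with N strictly upper triangular. As A is symmetric modulo π,
-- ∂_N and ∂_Nᵀ cancel, and ∂_I contributes n - k times a coefficient of det (I + xA); this
-- vanishes when n - k is even, which gains one digit. That proves (a), (b) and (d).
--
-- For (e) one works modulo π², where Aᵀ = (1 + π) A, so that ∂_N survives in odd degrees. Lift A
-- to an integral skew-symmetric B. Then det (I + 2N + xB) is the determinant of a skew-symmetric
-- matrix of even order n + 1, hence a square; read modulo 4 this expresses ∂_N det (I + xB)
-- modulo 2 by products of the leading digits of the a_(2i+1), with the effect that the leading
-- digit of a_(4m+3), m ≥ 1, is determined by the coefficients before it.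

module Submission where

open import Defs
open import Level using (0ℓ)
open import Algebra.Bundles using (CommutativeRing; RawRing)
open import Algebra.Structures using (IsCommutativeRing)
import Algebra.Morphism.RingMonomorphism
open import Algebra.Morphism.Structures using (IsRingMonomorphism)
import Algebra.Properties.AbelianGroup
import Algebra.Properties.Ring
import Algebra.Solver.Ring
import Algebra.Solver.Ring.AlmostCommutativeRing as ACR
open import Data.Bool using (if_then_else_)
open import Data.Empty using (⊥-elim)
open import Data.Fin as Fin using (Fin; zero; suc; toℕ; fromℕ<; punchIn; combine)
import Data.Fin.Properties as Finₚ
open import Data.Integer as ℤ using (ℤ; +_; -[1+_]; ∣_∣; _⊖_)
open import Data.Integer.DivMod using (_%ℕ_; _/ℕ_; a≡a%ℕn+[a/ℕn]*n; n%ℕd<d)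
import Data.Integer.Properties as ℤₚ
open import Data.List using (List; []; _∷_; map; foldr; tabulate; applyUpTo)
open import Data.Maybe using (just; nothing)
open import Data.Nat as ℕ using (ℕ; zero; suc; _∸_; ⌊_/2⌋; ⌈_/2⌉)
open import Data.Nat.DivMod using (_mod_; _%_; _/_; m≡m%n+[m/n]*n; m%n<n; +-distrib-/-∣ˡ)
open import Data.Nat.Divisibility using (_∣_; divides; ∣⇒≤)
open import Data.Nat.Primality using (Prime; prime⇒irreducible; prime⇒nonZero)
import Data.Nat.Properties as ℕₚ
open import Data.Nat.Solver using (module +-*-Solver)
open import Data.Product using (Σ; ∃; _×_; _,_; proj₁; proj₂)
open import Data.Sum using (_⊎_; inj₁; inj₂; [_,_])
open import Relation.Binary.Core using (Rel)
import Relation.Binary.Reasoning.Setoid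
open import Relation.Binary.PropositionalEquality as ≡ using (_≡_; _≢_)
open import Relation.Binary.Structures using (IsEquivalence)
open import Relation.Nullary using (¬_; Dec; yes; no)
open import Relation.Nullary.Decidable using (⌊_⌋; dec-no)

-- ℤ[ζ] is ℤ[y] modulo Φ under a coarser equality, and the valuation theory rests on evaluating
-- polynomials at y = 1 and y = -1. Since Φ(1) = p, an integer divisible by π is divisible by p, and
-- π can be cancelled. For q > 2 also Φ(-1) is nonzero, so ζ + 1 can be cancelled, and then every
-- element fixed by conjugation is a polynomial in ζ + ζ⁻¹ = 2 - ρ. Such a polynomial is a digit in
-- 0, ..., p - 1 plus ρ times another one. Stripping digits shows that real valuations are even, and
-- it also yields the class maps. The bounds are free of n because the power dividing a_k grows with
-- k: whatever n is, only boundedly many coefficients can be nonzero modulo the given power. The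
-- obstacle in (e) is that the extra relation is quadratic and comes from integers modulo 4, while A
-- is understood only modulo π. The exponents bridge the gap: A is congruent to the exponent matrix
-- modulo π, and since 4 divides q that matrix is symmetric with zero diagonal modulo 2, exactly
-- what an integral skew-symmetric lift requires.

CR : Set₁
CR = CommutativeRing 0ℓ 0ℓ

ℤᶜ : CR
ℤᶜ = ℤₚ.+-*-commutativeRing

-- Integers in commutative rings, and ring homomorphisms

module Cast (C : CR) where
  open CommutativeRing C hiding (zero)
  open Algebra.Properties.Ring ring using (-0#≈0#; -‿distribˡ-*; -‿distribʳ-*)
  open Algebra.Properties.AbelianGroup +-abelianGroup using (⁻¹-∙-comm; ⁻¹-involutive)
  open Relation.Binary.Reasoning.Setoid setoid

  -- The separate clause for 1 makes `ιℕ 1` equal to `1#` by definition, so that the constants 0 and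
  -- 1 of the solver are the ring's own zero and unit.
  ιℕ : ℕ → Carrier
  ιℕ 0 = 0#
  ιℕ 1 = 1#
  ιℕ (suc (suc n)) = 1# + ιℕ (suc n)

  ιℕ-suc : ∀ n → ιℕ (suc n) ≈ 1# + ιℕ n
  ιℕ-suc zero = sym (+-identityʳ 1#)
  ιℕ-suc (suc n) = refl

  ι : ℤ → Carrier
  ι (+ n) = ιℕ n
  ι -[1+ n ] = - ιℕ (suc n)

  ιℕ-+ : ∀ m n → ιℕ (m ℕ.+ n) ≈ ιℕ m + ιℕ n
  ιℕ-+ zero n = sym (+-identityˡ _)
  ιℕ-+ (suc m) n = begin
    ιℕ (suc (m ℕ.+ n))   ≈⟨ ιℕ-suc (m ℕ.+ n) ⟩
    1# + ιℕ (m ℕ.+ n)    ≈⟨ +-congˡ (ιℕ-+ m n) ⟩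
    1# + (ιℕ m + ιℕ n)   ≈⟨ +-assoc _ _ _ ⟨
    1# + ιℕ m + ιℕ n     ≈⟨ +-congʳ (ιℕ-suc m) ⟨
    ιℕ (suc m) + ιℕ n    ∎

  ιℕ-* : ∀ m n → ιℕ (m ℕ.* n) ≈ ιℕ m * ιℕ n
  ιℕ-* zero n = sym (zeroˡ _)
  ιℕ-* (suc m) n = begin
    ιℕ (n ℕ.+ m ℕ.* n)        ≈⟨ ιℕ-+ n (m ℕ.* n) ⟩
    ιℕ n + ιℕ (m ℕ.* n)       ≈⟨ +-cong (sym (*-identityˡ _)) (ιℕ-* m n) ⟩
    1# * ιℕ n + ιℕ m * ιℕ n   ≈⟨ distribʳ _ _ _ ⟨
    (1# + ιℕ m) * ιℕ n        ≈⟨ *-congʳ (ιℕ-suc m) ⟨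
    ιℕ (suc m) * ιℕ n         ∎

  ι-⊖ : ∀ m n → ι (m ⊖ n) ≈ ιℕ m - ιℕ n
  ι-⊖ m zero = sym (trans (+-congˡ -0#≈0#) (+-identityʳ _))
  ι-⊖ zero (suc n) = sym (+-identityˡ _)
  ι-⊖ (suc m) (suc n) = begin
    ι (suc m ⊖ suc n)               ≡⟨ ≡.cong ι (ℤₚ.[1+m]⊖[1+n]≡m⊖n m n) ⟩
    ι (m ⊖ n)                       ≈⟨ ι-⊖ m n ⟩
    ιℕ m - ιℕ n                     ≈⟨ +-identityˡ _ ⟨
    0# + (ιℕ m - ιℕ n)              ≈⟨ +-congʳ (-‿inverseʳ 1#) ⟨
    1# - 1# + (ιℕ m - ιℕ n)         ≈⟨ +-assoc _ _ _ ⟩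
    1# + (- 1# + (ιℕ m - ιℕ n))     ≈⟨ +-congˡ (+-assoc _ _ _) ⟨
    1# + (- 1# + ιℕ m - ιℕ n)       ≈⟨ +-congˡ (+-congʳ (+-comm _ _)) ⟩
    1# + (ιℕ m - 1# - ιℕ n)         ≈⟨ +-congˡ (+-assoc _ _ _) ⟩
    1# + (ιℕ m + (- 1# - ιℕ n))     ≈⟨ +-assoc _ _ _ ⟨
    1# + ιℕ m + (- 1# - ιℕ n)       ≈⟨ +-cong (sym (ιℕ-suc m)) (trans (⁻¹-∙-comm _ _) (-‿cong (sym (ιℕ-suc n)))) ⟩
    ιℕ (suc m) - ιℕ (suc n)         ∎

  ι-neg : ∀ i → ι (ℤ.- i) ≈ - ι i
  ι-neg (+ zero) = sym -0#≈0#
  ι-neg (+ suc n) = refl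
  ι-neg -[1+ n ] = sym (⁻¹-involutive _)

  ι-+ : ∀ i j → ι (i ℤ.+ j) ≈ ι i + ι j
  ι-+ (+ m) (+ n) = ιℕ-+ m n
  ι-+ (+ m) -[1+ n ] = ι-⊖ m (suc n)
  ι-+ -[1+ m ] (+ n) = trans (ι-⊖ n (suc m)) (+-comm _ _)
  ι-+ -[1+ m ] -[1+ n ] = begin
    - ιℕ (suc (suc (m ℕ.+ n)))        ≡⟨ ≡.cong (λ k → - ιℕ k) (≡.sym (ℕₚ.+-suc (suc m) n)) ⟩
    - ιℕ (suc m ℕ.+ suc n)            ≈⟨ -‿cong (ιℕ-+ (suc m) (suc n)) ⟩
    - (ιℕ (suc m) + ιℕ (suc n))       ≈⟨ ⁻¹-∙-comm _ _ ⟨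
    - ιℕ (suc m) - ιℕ (suc n)         ∎

  ι-* : ∀ i j → ι (i ℤ.* j) ≈ ι i * ι j
  ι-* (+ m) (+ n) = trans (reflexive (≡.cong ι (≡.sym (ℤₚ.pos-* m n)))) (ιℕ-* m n)
  ι-* (+ m) -[1+ n ] = begin
    ι (+ m ℤ.* -[1+ n ])        ≡⟨ ≡.cong ι (≡.sym (ℤₚ.neg-distribʳ-* (+ m) (+ suc n))) ⟩
    ι (ℤ.- (+ m ℤ.* + suc n))   ≈⟨ ι-neg (+ m ℤ.* + suc n) ⟩
    - ι (+ m ℤ.* + suc n)       ≈⟨ -‿cong (ι-* (+ m) (+ suc n)) ⟩
    - (ιℕ m * ιℕ (suc n))       ≈⟨ -‿distribʳ-* _ _ ⟩
    ιℕ m * - ιℕ (suc n)         ∎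
  ι-* -[1+ m ] (+ n) = begin
    ι (-[1+ m ] ℤ.* + n)        ≡⟨ ≡.cong ι (≡.sym (ℤₚ.neg-distribˡ-* (+ suc m) (+ n))) ⟩
    ι (ℤ.- (+ suc m ℤ.* + n))   ≈⟨ ι-neg (+ suc m ℤ.* + n) ⟩
    - ι (+ suc m ℤ.* + n)       ≈⟨ -‿cong (ι-* (+ suc m) (+ n)) ⟩
    - (ιℕ (suc m) * ιℕ n)       ≈⟨ -‿distribˡ-* _ _ ⟩
    - ιℕ (suc m) * ιℕ n         ∎
  ι-* -[1+ m ] -[1+ n ] = begin
    ιℕ (suc m ℕ.* suc n)              ≈⟨ ιℕ-* (suc m) (suc n) ⟩
    ιℕ (suc m) * ιℕ (suc n)           ≈⟨ *-congˡ (⁻¹-involutive _) ⟨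
    ιℕ (suc m) * - - ιℕ (suc n)       ≈⟨ -‿distribʳ-* _ _ ⟨
    - (ιℕ (suc m) * - ιℕ (suc n))     ≈⟨ -‿distribˡ-* _ _ ⟩
    - ιℕ (suc m) * - ιℕ (suc n)       ∎

-- The ring solver with integer coefficients cancels x - x, which a solver
-- taking its coefficients in an abstract ring cannot do.
module Solve (C : CR) where
  open CommutativeRing C hiding (zero)
  open Cast C

  private
    morphism : CommutativeRing.rawRing ℤᶜ ACR.-Raw-AlmostCommutative⟶ ACR.fromCommutativeRing C
    morphism = record
      { ⟦_⟧ = ι ; +-homo = ι-+ ; *-homo = ι-* ; -‿homo = ι-neg ; 0-homo = refl ; 1-homo = refl }

    weak≟ : ∀ i j → _
    weak≟ i j with i ℤ.≟ j
    ... | yes eq = just (reflexive (≡.cong ι eq))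
    ... | no _ = nothing

  open Algebra.Solver.Ring (CommutativeRing.rawRing ℤᶜ) (ACR.fromCommutativeRing C) morphism weak≟ public
    using (solve; _:=_; con; _:+_; _:*_; _:-_; :-_; _:^_)

record Hom (C D : CR) : Set where
  private
    module C = CommutativeRing C
    module D = CommutativeRing D
  field
    to     : C.Carrier → D.Carrier
    ≈-cong : ∀ {x y} → x C.≈ y → to x D.≈ to y
    +-hom  : ∀ x y → to (x C.+ y) D.≈ to x D.+ to y
    *-hom  : ∀ x y → to (x C.* y) D.≈ to x D.* to y
    1-hom  : to C.1# D.≈ D.1#

  open Algebra.Properties.AbelianGroup D.+-abelianGroup using (identityʳ-unique; inverseʳ-unique)

  0-hom : to C.0# D.≈ D.0#
  0-hom = identityʳ-unique (to C.0#) (to C.0#) (D.trans (D.sym (+-hom _ _)) (≈-cong (C.+-identityʳ _)))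

  neg-hom : ∀ x → to (C.- x) D.≈ D.- to x
  neg-hom x = inverseʳ-unique (to x) (to (C.- x))
    (D.trans (D.sym (+-hom _ _)) (D.trans (≈-cong (C.-‿inverseʳ x)) 0-hom))

  sub-hom : ∀ x y → to (x C.- y) D.≈ to x D.- to y
  sub-hom x y = D.trans (+-hom _ _) (D.+-congˡ (neg-hom y))

infixr 9 _∘ʰ_
_∘ʰ_ : ∀ {C D E} → Hom D E → Hom C D → Hom C E
_∘ʰ_ {C} {D} {E} g f = record
  { to = λ x → G.to (F.to x)
  ; ≈-cong = λ e → G.≈-cong (F.≈-cong e)
  ; +-hom = λ x y → E.trans (G.≈-cong (F.+-hom x y)) (G.+-hom _ _)
  ; *-hom = λ x y → E.trans (G.≈-cong (F.*-hom x y)) (G.*-hom _ _)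
  ; 1-hom = E.trans (G.≈-cong F.1-hom) G.1-hom }
  where
  module E = CommutativeRing E
  module F = Hom f
  module G = Hom g

ιʰ : ∀ C → Hom ℤᶜ C
ιʰ C = record { to = ι ; ≈-cong = λ { ≡.refl → refl } ; +-hom = ι-+ ; *-hom = ι-* ; 1-hom = refl }
  where
  open CommutativeRing C hiding (zero)
  open Cast C

module _ {C D : CR} (h : Hom C D) where
  private
    module C = CommutativeRing C
    module D = CommutativeRing D
    module CC = Cast C
    module DC = Cast D
  open Hom h

  hom-ιℕ : ∀ n → to (CC.ιℕ n) D.≈ DC.ιℕ n
  hom-ιℕ zero = 0-hom
  hom-ιℕ (suc n) = D.trans (≈-cong (CC.ιℕ-suc n)) (D.trans (+-hom _ _)
    (D.trans (D.+-cong 1-hom (hom-ιℕ n)) (D.sym (DC.ιℕ-suc n))))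

  hom-ι : ∀ i → to (CC.ι i) D.≈ DC.ι i
  hom-ι (+ n) = hom-ιℕ n
  hom-ι -[1+ n ] = D.trans (neg-hom _) (D.-‿cong (hom-ιℕ (suc n)))

ιℕ-id : ∀ n → Cast.ιℕ ℤᶜ n ≡ + n
ιℕ-id zero = ≡.refl
ιℕ-id (suc n) = ≡.trans (Cast.ιℕ-suc ℤᶜ n) (≡.cong (λ j → ℤ.1ℤ ℤ.+ j) (ιℕ-id n))

ι-id : ∀ i → Cast.ι ℤᶜ i ≡ i
ι-id (+ n) = ιℕ-id n
ι-id -[1+ n ] = ≡.cong ℤ.-_ (ιℕ-id (suc n))

hom-ℤ : ∀ {D} (h : Hom ℤᶜ D) (i : ℤ) → CommutativeRing._≈_ D (Hom.to h i) (Cast.ι D i)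
hom-ℤ {D} h i = D.trans (Hom.≈-cong h (≡.sym (ι-id i))) (hom-ι h i)
  where module D = CommutativeRing D

module Pow (C : CR) where
  open CommutativeRing C hiding (zero)
  open Relation.Binary.Reasoning.Setoid setoid

  infixr 8 _^_
  _^_ : Carrier → ℕ → Carrier
  x ^ zero = 1#
  x ^ suc n = x * x ^ n

  ^-cong : ∀ {x y} n → x ≈ y → x ^ n ≈ y ^ n
  ^-cong zero e = refl
  ^-cong (suc n) e = *-cong e (^-cong n e)

  ^-+ : ∀ x m n → x ^ (m ℕ.+ n) ≈ x ^ m * x ^ n
  ^-+ x zero n = sym (*-identityˡ _)
  ^-+ x (suc m) n = trans (*-congˡ (^-+ x m n)) (sym (*-assoc _ _ _))

  1^ : ∀ n → 1# ^ n ≈ 1#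
  1^ zero = refl
  1^ (suc n) = trans (*-identityˡ _) (1^ n)

  ^-*-distrib : ∀ x y n → (x * y) ^ n ≈ x ^ n * y ^ n
  ^-*-distrib x y zero = sym (*-identityˡ _)
  ^-*-distrib x y (suc n) = begin
    x * y * (x * y) ^ n        ≈⟨ *-congˡ (^-*-distrib x y n) ⟩
    x * y * (x ^ n * y ^ n)    ≈⟨ solve 4 (λ a b c d → a :* b :* (c :* d) := a :* c :* (b :* d)) refl x y (x ^ n) (y ^ n) ⟩
    x * x ^ n * (y * y ^ n)    ∎
    where open Solve C

  ^-*ℕ : ∀ x m n → x ^ (m ℕ.* n) ≈ (x ^ n) ^ m
  ^-*ℕ x zero n = refl
  ^-*ℕ x (suc m) n = trans (^-+ x n (m ℕ.* n)) (*-congˡ (^-*ℕ x m n))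

  inverse-^ : ∀ x y n → x * y ≈ 1# → x ^ n * y ^ n ≈ 1#
  inverse-^ x y n e = trans (sym (^-*-distrib x y n)) (trans (^-cong n e) (1^ n))

module _ {C D : CR} (h : Hom C D) where
  private
    module C = Pow C
    module D = Pow D
    module DR = CommutativeRing D
  open Hom h

  hom-^ : ∀ x n → to (x C.^ n) DR.≈ to x D.^ n
  hom-^ x zero = 1-hom
  hom-^ x (suc n) = DR.trans (*-hom _ _) (DR.*-congˡ (hom-^ x n))

-- Determinants by Laplace expansion

module AltSum (C : CR) where
  open CommutativeRing C hiding (zero)
  open Algebra.Properties.Ring ring using (-0#≈0#)
  open Relation.Binary.Reasoning.Setoid setoid
  open Solve C

  opaque
    -- The signs of the Laplace expansion are carried by nested subtraction; a shift of index is
    -- then exactly one change of sign, which suits induction on the size.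
    alt : ∀ {n} → (Fin n → Carrier) → Carrier
    alt {zero} f = 0#
    alt {suc n} f = f zero - alt (λ i → f (suc i))

    alt-zero : (f : Fin 0 → Carrier) → alt f ≈ 0#
    alt-zero f = refl

    alt-suc : ∀ {n} (f : Fin (suc n) → Carrier) → alt f ≈ f zero - alt (λ i → f (suc i))
    alt-suc f = refl

  alt-cong : ∀ {n} {f g : Fin n → Carrier} → (∀ i → f i ≈ g i) → alt f ≈ alt g
  alt-cong {zero} e = trans (alt-zero _) (sym (alt-zero _))
  alt-cong {suc n} e = trans (alt-suc _) (trans (+-cong (e zero) (-‿cong (alt-cong (λ i → e (suc i))))) (sym (alt-suc _)))

  alt-0 : ∀ {n} {f : Fin n → Carrier} → (∀ i → f i ≈ 0#) → alt f ≈ 0#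
  alt-0 {zero} e = alt-zero _
  alt-0 {suc n} e = trans (alt-suc _)
    (trans (+-cong (e zero) (-‿cong (alt-0 (λ i → e (suc i))))) (trans (+-identityˡ _) -0#≈0#))

  alt-+ : ∀ {n} (f g : Fin n → Carrier) → alt (λ i → f i + g i) ≈ alt f + alt g
  alt-+ {zero} f g = trans (alt-zero _) (sym (trans (+-cong (alt-zero _) (alt-zero _)) (+-identityʳ _)))
  alt-+ {suc n} f g = begin
    alt (λ i → f i + g i)
      ≈⟨ alt-suc _ ⟩
    f zero + g zero - alt (λ i → f (suc i) + g (suc i))
      ≈⟨ +-congˡ (-‿cong (alt-+ (λ i → f (suc i)) (λ i → g (suc i)))) ⟩
    f zero + g zero - (alt (λ i → f (suc i)) + alt (λ i → g (suc i)))
      ≈⟨ solve 4 (λ a b c d → a :+ b :- (c :+ d) := a :- c :+ (b :- d)) refl _ _ _ _ ⟩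
    f zero - alt (λ i → f (suc i)) + (g zero - alt (λ i → g (suc i)))
      ≈⟨ +-cong (alt-suc f) (alt-suc g) ⟨
    alt f + alt g ∎

  alt-*ˡ : ∀ {n} a (f : Fin n → Carrier) → alt (λ i → a * f i) ≈ a * alt f
  alt-*ˡ {zero} a f = trans (alt-zero _) (sym (trans (*-congˡ (alt-zero f)) (zeroʳ a)))
  alt-*ˡ {suc n} a f = begin
    alt (λ i → a * f i)                              ≈⟨ alt-suc _ ⟩
    a * f zero - alt (λ i → a * f (suc i))           ≈⟨ +-congˡ (-‿cong (alt-*ˡ a (λ i → f (suc i)))) ⟩
    a * f zero - a * alt (λ i → f (suc i))           ≈⟨ solve 3 (λ a b c → a :* b :- a :* c := a :* (b :- c)) refl _ _ _ ⟩
    a * (f zero - alt (λ i → f (suc i)))             ≈⟨ *-congˡ (alt-suc f) ⟨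
    a * alt f                                        ∎

  alt-neg : ∀ {n} (f : Fin n → Carrier) → alt (λ i → - f i) ≈ - alt f
  alt-neg f = trans (alt-cong (λ i → neg1 (f i))) (trans (alt-*ˡ (- 1#) f) (sym (neg1 (alt f))))
    where
    neg1 : ∀ x → - x ≈ - 1# * x
    neg1 = solve 1 (λ x → :- x := :- con ℤ.1ℤ :* x) refl

  alt-swap : ∀ {m n} (f : Fin m → Fin n → Carrier) →
    alt (λ i → alt (λ j → f i j)) ≈ alt (λ j → alt (λ i → f i j))
  alt-swap {zero} f = trans (alt-zero _) (sym (alt-0 (λ _ → alt-zero _)))
  alt-swap {suc m} f = begin
    alt (λ i → alt (λ j → f i j))
      ≈⟨ alt-suc _ ⟩
    alt (f zero) - alt (λ i → alt (f (suc i)))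
      ≈⟨ +-congˡ (trans (-‿cong (alt-swap (λ i → f (suc i)))) (sym (alt-neg _))) ⟩
    alt (f zero) + alt (λ j → - alt (λ i → f (suc i) j))
      ≈⟨ alt-+ _ _ ⟨
    alt (λ j → f zero j - alt (λ i → f (suc i) j))
      ≈⟨ alt-cong (λ j → sym (alt-suc _)) ⟩
    alt (λ j → alt (λ i → f i j)) ∎

module Det′ (C : CR) where
  open CommutativeRing C hiding (zero)
  open Algebra.Properties.Ring ring using (-0#≈0#)
  open Relation.Binary.Reasoning.Setoid setoid
  open Solve C
  open Pow C
  open AltSum C

  Mat : ℕ → Set
  Mat n = Fin n → Fin n → Carrier

  det : (n : ℕ) → Mat n → Carrier
  det zero M = 1#
  det (suc n) M = alt (λ j → M zero j * det n (λ r c → M (suc r) (punchIn j c)))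

  det-cong : ∀ n {M N : Mat n} → (∀ i j → M i j ≈ N i j) → det n M ≈ det n N
  det-cong zero e = refl
  det-cong (suc n) e = alt-cong (λ j → *-cong (e zero j) (det-cong n (λ r c → e (suc r) (punchIn j c))))

  det-scale : ∀ n a (M : Mat n) → det n (λ i j → a * M i j) ≈ a ^ n * det n M
  det-scale zero a M = sym (*-identityˡ _)
  det-scale (suc n) a M = trans
    (alt-cong (λ j → trans (*-congˡ (det-scale n a (λ r c → M (suc r) (punchIn j c))))
      (solve 4 (λ a b c d → a :* b :* (c :* d) := a :* c :* (b :* d)) refl _ _ _ _)))
    (alt-*ˡ _ _)

  -- Off the corner, expanding the minors of row 0 along their first columns gives a double sum over
  -- minors of order two less. The expansion along column 0 gives the same sum in the other order,
  -- so `alt-swap` finishes.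
  det-col : ∀ n (M : Mat (suc n)) →
    det (suc n) M ≈ alt (λ i → M i zero * det n (λ r c → M (punchIn i r) (suc c)))
  det-col zero M = trans (alt-suc _) (trans (+-congˡ (-‿cong (trans (alt-zero _) (sym (alt-zero _))))) (sym (alt-suc _)))
  det-col (suc m) M = trans (alt-suc _) (trans (+-congˡ (-‿cong (begin
    alt (λ j → M zero (suc j) * det (suc m) (λ r c → M (suc r) (punchIn (suc j) c)))
      ≈⟨ alt-cong (λ j → trans (*-congˡ (det-col m (λ r c → M (suc r) (punchIn (suc j) c)))) (sym (alt-*ˡ _ _))) ⟩
    alt (λ j → alt (λ i → M zero (suc j) * (M (suc i) zero * minor i j)))
      ≈⟨ alt-swap _ ⟩
    alt (λ i → alt (λ j → M zero (suc j) * (M (suc i) zero * minor i j)))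
      ≈⟨ alt-cong (λ i → trans (alt-cong (λ j → solve 3 (λ a b c → a :* (b :* c) := b :* (a :* c)) refl _ _ _)) (alt-*ˡ _ _)) ⟩
    alt (λ i → M (suc i) zero * det (suc m) (λ r c → M (punchIn (suc i) r) (suc c))) ∎))) (sym (alt-suc _)))
    where
    minor : Fin (suc m) → Fin (suc m) → Carrier
    minor i j = det m (λ r c → M (suc (punchIn i r)) (suc (punchIn j c)))

  det-transpose : ∀ n (M : Mat n) → det n (λ i j → M j i) ≈ det n M
  det-transpose zero M = refl
  det-transpose (suc n) M = trans
    (alt-cong (λ j → *-congˡ (det-transpose n (λ r c → M (punchIn j r) (suc c)))))
    (sym (det-col n M))

  -- Expanding along row 0 and then along column 0 collects the two border entries of each term in
  -- one product. In det (I - xH) such a product has degree two in x, which isolates the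
  -- contribution to a₂.
  det-border : ∀ n (M : Mat (suc (suc n))) →
    det (suc (suc n)) M ≈
      M zero zero * det (suc n) (λ r c → M (suc r) (suc c))
      - alt (λ j → alt (λ i → M zero (suc j) * M (suc i) zero
            * det n (λ r c → M (suc (punchIn i r)) (suc (punchIn j c)))))
  det-border n M = trans (alt-suc _) (+-congˡ (-‿cong (alt-cong (λ j →
    trans (*-congˡ (det-col n (λ r c → M (suc r) (punchIn (suc j) c))))
    (trans (sym (alt-*ˡ _ _)) (alt-cong (λ i → sym (*-assoc _ _ _))))))))

  det-col-unit : ∀ n (M : Mat (suc n)) → (∀ i → M (suc i) zero ≈ 0#) →
    det (suc n) M ≈ M zero zero * det n (λ r c → M (suc r) (suc c))
  det-col-unit n M e = begin
    det (suc n) M ≈⟨ trans (det-col n M) (alt-suc _) ⟩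
    M zero zero * det n (λ r c → M (suc r) (suc c)) - alt (λ i → M (suc i) zero * det n (λ r c → M (punchIn (suc i) r) (suc c)))
      ≈⟨ +-congˡ (trans (-‿cong (alt-0 (λ i → trans (*-congʳ (e i)) (zeroˡ _)))) -0#≈0#) ⟩
    M zero zero * det n (λ r c → M (suc r) (suc c)) + 0# ≈⟨ +-identityʳ _ ⟩
    M zero zero * det n (λ r c → M (suc r) (suc c)) ∎

  Sel : ℕ → ℕ → Set
  Sel n m = Fin n → Fin m

  -- Column selections are functions and are compared value by value; `Ext` says that a quantity
  -- indexed by selections respects this comparison, as minors do.
  Ext : ∀ {n m} → (Sel n m → Carrier) → Set
  Ext Ψ = ∀ {g h} → (∀ c → g c ≡ h c) → Ψ g ≈ Ψ h

  -- The expansion of a determinant along its first two rows u and v.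
  pairSum : ∀ {n} (u v : Fin (suc (suc n)) → Carrier) (Ψ : Sel n (suc (suc n)) → Carrier) → Carrier
  pairSum u v Ψ = alt (λ j → u j * alt (λ k → v (punchIn j k) * Ψ (λ c → punchIn j (punchIn k c))))

  lift : ∀ {n m} → Sel n m → Sel (suc n) (suc m)
  lift g zero = zero
  lift g (suc c) = suc (g c)

  private
    tailSum : ∀ {n} (u v : Fin (suc (suc n)) → Carrier) (Ψ : Sel n (suc (suc n)) → Carrier) → Carrier
    tailSum {zero} u v Ψ = 0#
    tailSum {suc n} u v Ψ = pairSum (λ j → u (suc j)) (λ j → v (suc j)) (λ g → Ψ (lift g))

    lift-ext : ∀ {n m} {Ψ : Sel (suc n) (suc m) → Carrier} → Ext Ψ → Ext (λ g → Ψ (lift g))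
    lift-ext ext e = ext (λ { zero → ≡.refl ; (suc c) → ≡.cong suc (e c) })

    -- Separates the pairs of columns that contain column 0, which contribute the 2×2 minors of the
    -- rows u and v, from the pairs that avoid it, which form a smaller pair sum. Antisymmetry in u
    -- and v is visible in the first part and inductive in the second.
    pairSum-step : ∀ {n} (u v : Fin (suc (suc n)) → Carrier) (Ψ : Sel n (suc (suc n)) → Carrier) → Ext Ψ →
      pairSum u v Ψ ≈
        alt (λ k → (u zero * v (suc k) - u (suc k) * v zero) * Ψ (λ c → suc (punchIn k c))) + tailSum u v Ψ
    pairSum-step {n} u v Ψ ext = begin
      pairSum u v Ψ
        ≈⟨ trans (alt-suc _) (+-congˡ (-‿cong (alt-cong (λ j → *-congˡ (alt-suc _))))) ⟩
      u zero * alt (λ k → v (suc k) * φ k) - alt (λ j → u (suc j) * (v zero * φ j - inner j))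
        ≈⟨ +-cong (sym (alt-*ˡ _ _)) (trans (sym (alt-neg _)) (alt-cong (λ j →
             solve 4 (λ a b c d → :- (a :* (b :* c :- d)) := :- (a :* b :* c) :+ a :* d) refl _ _ _ _))) ⟩
      alt (λ k → u zero * (v (suc k) * φ k)) + alt (λ j → - (u (suc j) * v zero * φ j) + u (suc j) * inner j)
        ≈⟨ +-congˡ (alt-+ _ _) ⟩
      alt (λ k → u zero * (v (suc k) * φ k)) + (alt (λ j → - (u (suc j) * v zero * φ j)) + alt (λ j → u (suc j) * inner j))
        ≈⟨ trans (sym (+-assoc _ _ _)) (+-cong (trans (sym (alt-+ _ _)) (alt-cong (λ k →
             solve 5 (λ a b c d e → a :* (b :* c) :+ :- (d :* e :* c) := (a :* b :- d :* e) :* c) refl _ _ _ _ _))) (rest u v Ψ ext)) ⟩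
      alt (λ k → (u zero * v (suc k) - u (suc k) * v zero) * φ k) + tailSum u v Ψ ∎
      where
      φ : Fin (suc n) → Carrier
      φ k = Ψ (λ c → suc (punchIn k c))
      inner : Fin (suc n) → Carrier
      inner j = alt (λ k → v (punchIn (suc j) (suc k)) * Ψ (λ c → punchIn (suc j) (punchIn (suc k) c)))
      rest : ∀ {n} (u v : Fin (suc (suc n)) → Carrier) (Ψ : Sel n (suc (suc n)) → Carrier) → Ext Ψ →
        alt (λ j → u (suc j) * alt (λ k → v (punchIn (suc j) (suc k)) * Ψ (λ c → punchIn (suc j) (punchIn (suc k) c))))
        ≈ tailSum u v Ψ
      rest {zero} u v Ψ ext = alt-0 (λ j → trans (*-congˡ (alt-zero _)) (zeroʳ _))
      rest {suc n} u v Ψ ext = alt-cong (λ j → *-congˡ (alt-cong (λ k → *-congˡ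
        (ext (λ { zero → ≡.refl ; (suc c) → ≡.refl })))))

  pairSum-swap : ∀ {n} (u v : Fin (suc (suc n)) → Carrier) (Ψ : Sel n (suc (suc n)) → Carrier) → Ext Ψ →
    pairSum u v Ψ ≈ - pairSum v u Ψ
  pairSum-swap {n} u v Ψ ext = begin
    pairSum u v Ψ                  ≈⟨ pairSum-step u v Ψ ext ⟩
    alt (λ k → (u zero * v (suc k) - u (suc k) * v zero) * Ψ (λ c → suc (punchIn k c))) + tailSum u v Ψ
      ≈⟨ +-cong (trans (alt-cong (λ k → solve 5 (λ a b c d e → (a :* b :- c :* d) :* e := :- ((d :* c :- b :* a) :* e)) refl _ _ _ _ _)) (alt-neg _)) (tail n u v Ψ ext) ⟩
    - alt (λ k → (v zero * u (suc k) - v (suc k) * u zero) * Ψ (λ c → suc (punchIn k c))) + - tailSum v u Ψ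
      ≈⟨ solve 2 (λ a b → :- a :+ :- b := :- (a :+ b)) refl _ _ ⟩
    - (alt (λ k → (v zero * u (suc k) - v (suc k) * u zero) * Ψ (λ c → suc (punchIn k c))) + tailSum v u Ψ)
      ≈⟨ -‿cong (pairSum-step v u Ψ ext) ⟨
    - pairSum v u Ψ                ∎
    where
    tail : ∀ n (u v : Fin (suc (suc n)) → Carrier) (Ψ : Sel n (suc (suc n)) → Carrier) → Ext Ψ →
      tailSum u v Ψ ≈ - tailSum v u Ψ
    tail zero u v Ψ ext = sym -0#≈0#
    tail (suc n) u v Ψ ext = pairSum-swap _ _ _ (lift-ext {Ψ = Ψ} ext)

  pairSum-diag : ∀ {n} (u : Fin (suc (suc n)) → Carrier) (Ψ : Sel n (suc (suc n)) → Carrier) → Ext Ψ →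
    pairSum u u Ψ ≈ 0#
  pairSum-diag {n} u Ψ ext = trans (pairSum-step u u Ψ ext) (trans
    (+-cong (alt-0 (λ k → solve 3 (λ a b c → (a :* b :- b :* a) :* c := con ℤ.0ℤ) refl _ _ _)) (tail n u Ψ ext))
    (+-identityʳ _))
    where
    tail : ∀ n (u : Fin (suc (suc n)) → Carrier) (Ψ : Sel n (suc (suc n)) → Carrier) → Ext Ψ →
      tailSum u u Ψ ≈ 0#
    tail zero u Ψ ext = refl
    tail (suc n) u Ψ ext = pairSum-diag _ _ (lift-ext {Ψ = Ψ} ext)

  pairSum-+ʳ : ∀ {n} (u v w : Fin (suc (suc n)) → Carrier) a (Ψ : Sel n (suc (suc n)) → Carrier) →
    pairSum u (λ j → v j + a * w j) Ψ ≈ pairSum u v Ψ + a * pairSum u w Ψ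
  pairSum-+ʳ u v w a Ψ = begin
    alt (λ j → u j * alt (λ k → (v (punchIn j k) + a * w (punchIn j k)) * Ψ′ j k))
      ≈⟨ alt-cong (λ j → *-congˡ (trans (alt-cong (λ k →
           solve 4 (λ v a w p → (v :+ a :* w) :* p := v :* p :+ a :* (w :* p)) refl _ _ _ _))
           (trans (alt-+ _ _) (+-congˡ (alt-*ˡ a _))))) ⟩
    alt (λ j → u j * (alt (λ k → v (punchIn j k) * Ψ′ j k) + a * alt (λ k → w (punchIn j k) * Ψ′ j k)))
      ≈⟨ trans (alt-cong (λ j → solve 4 (λ u x a y → u :* (x :+ a :* y) := u :* x :+ a :* (u :* y)) refl _ _ _ _))
           (trans (alt-+ _ _) (+-congˡ (alt-*ˡ a _))) ⟩
    pairSum u v Ψ + a * pairSum u w Ψ ∎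
    where
    Ψ′ : _ → _ → Carrier
    Ψ′ j k = Ψ (λ c → punchIn j (punchIn k c))

  infixr 5 _▹_
  _▹_ : ∀ {m n} → (Fin m → Carrier) → (Fin n → Fin m → Carrier) → Fin (suc n) → Fin m → Carrier
  (w ▹ M) zero = w
  (w ▹ M) (suc i) = M i

  rowSel-ext : ∀ {n m} (M : Fin n → Fin m → Carrier) → Ext (λ (g : Sel n m) → det n (λ r c → M r (g c)))
  rowSel-ext {n} M e = det-cong n (λ r c → reflexive (≡.cong (M r) (e c)))

  -- Exchanging the first two rows makes the row w absorb one more row.
  det-addRow : ∀ n (w : Fin (suc n) → Carrier) (M : Fin n → Fin (suc n) → Carrier) (δ : Fin n → Carrier) →
    det (suc n) (w ▹ (λ i j → M i j + δ i * w j)) ≈ det (suc n) (w ▹ M)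
  det-addRow zero w M δ = refl
  det-addRow (suc m) w M δ = begin
    pairSum w (λ j → M zero j + δ zero * w j) Ψ          ≈⟨ pairSum-+ʳ w (M zero) w (δ zero) Ψ ⟩
    pairSum w (M zero) Ψ + δ zero * pairSum w w Ψ        ≈⟨ +-congˡ (trans (*-congˡ (pairSum-diag w Ψ Ψ-ext)) (zeroʳ _)) ⟩
    pairSum w (M zero) Ψ + 0#                            ≈⟨ +-identityʳ _ ⟩
    pairSum w (M zero) Ψ                                 ≈⟨ pairSum-swap w (M zero) Ψ Ψ-ext ⟩
    - pairSum (M zero) w Ψ                               ≈⟨ -‿cong (alt-cong (λ j → *-congˡ (
      det-addRow m (λ c → w (punchIn j c)) (λ r c → M (suc r) (punchIn j c)) (λ i → δ (suc i))))) ⟩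
    - pairSum (M zero) w Ψ₀                              ≈⟨ pairSum-swap w (M zero) Ψ₀ (rowSel-ext (λ r → M (suc r))) ⟨
    pairSum w (M zero) Ψ₀                                ∎
    where
    Ψ Ψ₀ : Sel m (suc (suc m)) → Carrier
    Ψ g = det m (λ r c → M (suc r) (g c) + δ (suc r) * w (g c))
    Ψ₀ g = det m (λ r c → M (suc r) (g c))
    Ψ-ext : Ext Ψ
    Ψ-ext = rowSel-ext (λ r c → M (suc r) c + δ (suc r) * w c)

  idMat : ∀ n → Mat n
  idMat (suc n) zero zero = 1#
  idMat (suc n) zero (suc j) = 0#
  idMat (suc n) (suc i) zero = 0#
  idMat (suc n) (suc i) (suc j) = idMat n i j

  det-id : ∀ n → det n (idMat n) ≈ 1#
  det-id zero = refl
  det-id (suc n) = trans (det-col-unit n (idMat (suc n)) (λ i → refl)) (trans (*-identityˡ _) (det-id n))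

  det-row-0 : ∀ n (M : Mat (suc n)) → (∀ j → M zero j ≈ 0#) → det (suc n) M ≈ 0#
  det-row-0 n M e = alt-0 (λ j → trans (*-congʳ (e j)) (zeroˡ _))

  det-col-0 : ∀ n (M : Mat (suc n)) → (∀ i → M i zero ≈ 0#) → det (suc n) M ≈ 0#
  det-col-0 n M e = trans (det-col n M) (alt-0 (λ j → trans (*-congʳ (e j)) (zeroˡ _)))

  idMinor : ∀ {n} → Fin (suc n) → Fin (suc n) → Carrier
  idMinor {n} i j = det n (λ r c → idMat (suc n) (punchIn i r) (punchIn j c))

  sumF : ∀ {n} → (Fin n → Carrier) → Carrier
  sumF {zero} f = 0#
  sumF {suc n} f = f zero + sumF (λ i → f (suc i))

  -- An off-diagonal minor of the identity has a zero row or a zero column, so the double sum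
  -- collapses to the diagonal, where the signs of the two alternating sums cancel.
  idMinor-trace : ∀ n (g : Fin (suc n) → Fin (suc n) → Carrier) →
    alt (λ j → alt (λ i → g i j * idMinor i j)) ≈ sumF (λ i → g i i)
  idMinor-trace n g = begin
    alt (λ j → alt (λ i → g i j * idMinor i j))
      ≈⟨ trans (alt-suc _) (+-cong (alt-suc _) (-‿cong (alt-cong (λ j → alt-suc _)))) ⟩
    g zero zero * idMinor {n} zero zero - alt (λ i → g (suc i) zero * idMinor (suc i) zero)
      - alt (λ j → g zero (suc j) * idMinor zero (suc j) - alt (λ i → g (suc i) (suc j) * idMinor (suc i) (suc j)))
      ≈⟨ +-cong (+-cong (trans (*-congˡ (det-id n)) (*-identityʳ _)) (-‿cong (alt-0 (lower n g))))
           (-‿cong (trans (alt-cong (upper n g)) (alt-neg _))) ⟩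
    g zero zero - 0# - - alt (λ j → alt (λ i → g (suc i) (suc j) * idMinor (suc i) (suc j)))
      ≈⟨ solve 2 (λ a b → a :- con ℤ.0ℤ :- :- b := a :+ b) refl _ _ ⟩
    g zero zero + alt (λ j → alt (λ i → g (suc i) (suc j) * idMinor (suc i) (suc j)))
      ≈⟨ +-congˡ (diag n g) ⟩
    sumF (λ i → g i i) ∎
    where
    lower : ∀ n (g : Fin (suc n) → Fin (suc n) → Carrier) i → g (suc i) zero * idMinor {n} (suc i) zero ≈ 0#
    lower (suc n) g i = trans (*-congˡ (det-row-0 n (λ r c → idMat (suc (suc n)) (punchIn (suc i) r) (suc c)) (λ j → refl))) (zeroʳ _)
    upper : ∀ n (g : Fin (suc n) → Fin (suc n) → Carrier) j →
      g zero (suc j) * idMinor {n} zero (suc j) - alt (λ i → g (suc i) (suc j) * idMinor {n} (suc i) (suc j))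
      ≈ - alt (λ i → g (suc i) (suc j) * idMinor {n} (suc i) (suc j))
    upper (suc n) g j = trans (+-congʳ (trans (*-congˡ (det-col-0 n (λ r c → idMat (suc (suc n)) (suc r) (punchIn (suc j) c)) (λ i → refl))) (zeroʳ _))) (+-identityˡ _)
    diag : ∀ n (g : Fin (suc n) → Fin (suc n) → Carrier) →
      alt (λ j → alt (λ i → g (suc i) (suc j) * idMinor {n} (suc i) (suc j))) ≈ sumF (λ i → g (suc i) (suc i))
    diag zero g = alt-zero _
    diag (suc n) g = trans (alt-cong (λ j → alt-cong (λ i → *-congˡ
      (trans (det-col-unit n (λ r c → idMat (suc (suc n)) (punchIn (suc i) r) (punchIn (suc j) c)) (λ r → refl)) (*-identityˡ _)))))
      (idMinor-trace n (λ i j → g (suc i) (suc j)))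

module _ {C D : CR} (h : Hom C D) where
  private
    module D = CommutativeRing D
    module AC = AltSum C
    module AD = AltSum D
    module DC = Det′ C
    module DD = Det′ D
  open Hom h

  hom-alt : ∀ {n} (f : Fin n → CommutativeRing.Carrier C) → to (AC.alt f) D.≈ AD.alt (λ i → to (f i))
  hom-alt {zero} f = D.trans (≈-cong (AC.alt-zero f)) (D.trans 0-hom (D.sym (AD.alt-zero _)))
  hom-alt {suc n} f = D.trans (≈-cong (AC.alt-suc f)) (D.trans (sub-hom _ _)
    (D.trans (D.+-congˡ (D.-‿cong (hom-alt (λ i → f (suc i))))) (D.sym (AD.alt-suc _))))

  hom-det : ∀ n (M : DC.Mat n) → to (DC.det n M) D.≈ DD.det n (λ i j → to (M i j))
  hom-det zero M = 1-hom
  hom-det (suc n) M = D.trans (hom-alt _) (AD.alt-cong (λ j → D.trans (*-hom _ _)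
    (D.*-congˡ (hom-det n (λ r c → M (suc r) (punchIn j c))))))

  hom-id : ∀ n i j → to (DC.idMat n i j) D.≈ DD.idMat n i j
  hom-id (suc n) zero zero = 1-hom
  hom-id (suc n) zero (suc j) = 0-hom
  hom-id (suc n) (suc i) zero = 0-hom
  hom-id (suc n) (suc i) (suc j) = hom-id n i j

-- Quotient rings, dual numbers and power series

module Quotient (C : CR) (m : CommutativeRing.Carrier C) where
  open CommutativeRing C hiding (zero)
  open Solve C

  infix 4 _~_
  _~_ : Rel Carrier 0ℓ
  x ~ y = Σ Carrier (λ c → x - y ≈ c * m)

  ≈⇒~ : ∀ {x y} → x ≈ y → x ~ y
  ≈⇒~ {x} {y} e = 0# , trans (+-congʳ e) (trans (-‿inverseʳ y) (sym (zeroˡ m)))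

  opaque
    ~-isEquivalence : IsEquivalence _~_
    ~-isEquivalence = record
      { refl = ≈⇒~ refl
      ; sym = λ { {x} {y} (c , e) → - c ,
          trans (solve 2 (λ x y → y :- x := :- (x :- y)) refl x y)
          (trans (-‿cong e) (solve 2 (λ c m → :- (c :* m) := :- c :* m) refl c m)) }
      ; trans = λ { {x} {y} {z} (c , e) (d , e′) → c + d ,
          trans (solve 3 (λ x y z → x :- z := x :- y :+ (y :- z)) refl x y z)
          (trans (+-cong e e′) (sym (distribʳ m c d))) } }

    isCommutativeRing~ : IsCommutativeRing _~_ _+_ _*_ -_ 0# 1#
    isCommutativeRing~ = record
      { isRing = record
        { +-isAbelianGroup = record
          { isGroup = record
            { isMonoid = record
              { isSemigroup = record
                { isMagma = record
                  { isEquivalence = ~-isEquivalence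
                  ; ∙-cong = λ { {x} {y} {u} {v} (c , e) (d , e′) → c + d ,
                      trans (solve 4 (λ x y u v → x :+ u :- (y :+ v) := x :- y :+ (u :- v)) refl x y u v)
                      (trans (+-cong e e′) (sym (distribʳ m c d))) } }
                ; assoc = λ x y z → ≈⇒~ (+-assoc x y z) }
              ; identity = (λ x → ≈⇒~ (+-identityˡ x)) , (λ x → ≈⇒~ (+-identityʳ x)) }
            ; inverse = (λ x → ≈⇒~ (-‿inverseˡ x)) , (λ x → ≈⇒~ (-‿inverseʳ x))
            ; ⁻¹-cong = λ { {x} {y} (c , e) → - c ,
                trans (solve 2 (λ x y → :- x :- :- y := :- (x :- y)) refl x y)
                (trans (-‿cong e) (solve 2 (λ c m → :- (c :* m) := :- c :* m) refl c m)) } }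
          ; comm = λ x y → ≈⇒~ (+-comm x y) }
        ; *-cong = λ { {x} {y} {u} {v} (c , e) (d , e′) → c * u + y * d ,
            trans (solve 4 (λ x y u v → x :* u :- y :* v := (x :- y) :* u :+ y :* (u :- v)) refl x y u v)
            (trans (+-cong (*-congʳ e) (*-congˡ e′))
            (solve 5 (λ c m u y d → c :* m :* u :+ y :* (d :* m) := (c :* u :+ y :* d) :* m) refl c m u y d)) }
        ; *-assoc = λ x y z → ≈⇒~ (*-assoc x y z)
        ; *-identity = (λ x → ≈⇒~ (*-identityˡ x)) , (λ x → ≈⇒~ (*-identityʳ x))
        ; distrib = (λ x y z → ≈⇒~ (distribˡ x y z)) , (λ x y z → ≈⇒~ (distribʳ x y z)) }
      ; *-comm = λ x y → ≈⇒~ (*-comm x y) }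

  -- The carrier stays the same and only equality is coarsened, so the quotient map is the identity
  -- on elements and every element is its own representative.
  Quot : CR
  Quot = record { isCommutativeRing = isCommutativeRing~ }

  quot : Hom C Quot
  quot = record { to = λ x → x ; ≈-cong = ≈⇒~ ; +-hom = λ _ _ → ≈⇒~ refl ; *-hom = λ _ _ → ≈⇒~ refl ; 1-hom = ≈⇒~ refl }

  module _ {D : CR} (h : Hom C D) (hm : CommutativeRing._≈_ D (Hom.to h m) (CommutativeRing.0# D)) where
    private module D = CommutativeRing D
    open Hom h
    open Algebra.Properties.AbelianGroup D.+-abelianGroup using () renaming (x∙y⁻¹≈ε⇒x≈y to x-y≈0⇒x≈y)

    lift-hom : Hom Quot D
    lift-hom = record
      { to = to
      ; ≈-cong = λ { {x} {y} (c , e) → x-y≈0⇒x≈y _ _ (D.trans (D.sym (sub-hom x y))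
          (D.trans (≈-cong e) (D.trans (*-hom c m) (D.trans (D.*-congˡ hm) (D.zeroʳ _))))) }
      ; +-hom = +-hom ; *-hom = *-hom ; 1-hom = 1-hom }

-- The ring C[s]/(s²): the second component of a determinant is its derivative.
module DualNumbers (C : CR) where
  open CommutativeRing C hiding (zero)
  open Solve C

  D : Set
  D = Carrier × Carrier

  opaque
    _+ᵈ_ _*ᵈ_ : D → D → D
    (a , b) +ᵈ (c , d) = a + c , b + d
    (a , b) *ᵈ (c , d) = a * c , b * c + a * d

    -ᵈ_ : D → D
    -ᵈ (a , b) = - a , - b

    +ᵈ-proj₂ : ∀ x y → proj₂ (x +ᵈ y) ≡ proj₂ x + proj₂ y
    +ᵈ-proj₂ x y = ≡.refl
    *ᵈ-proj₂ : ∀ x y → proj₂ (x *ᵈ y) ≡ proj₂ x * proj₁ y + proj₁ x * proj₂ y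
    *ᵈ-proj₂ x y = ≡.refl
    -ᵈ-proj₂ : ∀ x → proj₂ (-ᵈ x) ≡ - proj₂ x
    -ᵈ-proj₂ x = ≡.refl

  _≈ᵈ_ : Rel D 0ℓ
  (a , b) ≈ᵈ (c , d) = a ≈ c × b ≈ d

  opaque
    unfolding _+ᵈ_
    isCommutativeRingᵈ : IsCommutativeRing _≈ᵈ_ _+ᵈ_ _*ᵈ_ -ᵈ_ (0# , 0#) (1# , 0#)
    isCommutativeRingᵈ = record
      { isRing = record
        { +-isAbelianGroup = record
          { isGroup = record
            { isMonoid = record
              { isSemigroup = record
                { isMagma = record
                  { isEquivalence = record
                    { refl = refl , refl
                    ; sym = λ { (e , e′) → sym e , sym e′ }
                    ; trans = λ { (e , e′) (f , f′) → trans e f , trans e′ f′ } }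
                  ; ∙-cong = λ { (e , e′) (f , f′) → +-cong e f , +-cong e′ f′ } }
                ; assoc = λ { (a , a′) (b , b′) (c , c′) → +-assoc a b c , +-assoc a′ b′ c′ } }
              ; identity = (λ { (a , a′) → +-identityˡ a , +-identityˡ a′ }) , (λ { (a , a′) → +-identityʳ a , +-identityʳ a′ }) }
            ; inverse = (λ { (a , a′) → -‿inverseˡ a , -‿inverseˡ a′ }) , (λ { (a , a′) → -‿inverseʳ a , -‿inverseʳ a′ })
            ; ⁻¹-cong = λ { (e , e′) → -‿cong e , -‿cong e′ } }
          ; comm = λ { (a , a′) (b , b′) → +-comm a b , +-comm a′ b′ } }
        ; *-cong = λ { (e , e′) (f , f′) → *-cong e f , +-cong (*-cong e′ f) (*-cong e f′) }
        ; *-assoc = λ { (a , a′) (b , b′) (c , c′) → *-assoc a b c ,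
            solve 6 (λ a a′ b b′ c c′ → (a′ :* b :+ a :* b′) :* c :+ a :* b :* c′
              := a′ :* (b :* c) :+ a :* (b′ :* c :+ b :* c′)) refl a a′ b b′ c c′ }
        ; *-identity =
            (λ { (a , a′) → *-identityˡ a , solve 2 (λ a a′ → con ℤ.0ℤ :* a :+ con ℤ.1ℤ :* a′ := a′) refl a a′ }) ,
            (λ { (a , a′) → *-identityʳ a , solve 2 (λ a a′ → a′ :* con ℤ.1ℤ :+ a :* con ℤ.0ℤ := a′) refl a a′ })
        ; distrib =
            (λ { (a , a′) (b , b′) (c , c′) → distribˡ a b c ,
              solve 6 (λ a a′ b b′ c c′ → a′ :* (b :+ c) :+ a :* (b′ :+ c′)
                := a′ :* b :+ a :* b′ :+ (a′ :* c :+ a :* c′)) refl a a′ b b′ c c′ }) ,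
            (λ { (a , a′) (b , b′) (c , c′) → distribʳ a b c ,
              solve 6 (λ a a′ b b′ c c′ → (b′ :+ c′) :* a :+ (b :+ c) :* a′
                := b′ :* a :+ b :* a′ :+ (c′ :* a :+ c :* a′)) refl a a′ b b′ c c′ }) }
      ; *-comm = λ { (a , a′) (b , b′) → *-comm a b ,
          solve 4 (λ a a′ b b′ → a′ :* b :+ a :* b′ := b′ :* a :+ b :* a′) refl a a′ b b′ } }

  Dual : CR
  Dual = record { isCommutativeRing = isCommutativeRingᵈ }

  opaque
    unfolding _+ᵈ_
    value : Hom Dual C
    value = record { to = proj₁ ; ≈-cong = proj₁ ; +-hom = λ _ _ → refl ; *-hom = λ _ _ → refl ; 1-hom = refl }

    value-to : ∀ x → Hom.to value x ≡ proj₁ x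
    value-to x = ≡.refl

    at : ∀ s → s * s ≈ 0# → Hom Dual C
    at s e = record
      { to = λ { (a , b) → a + s * b }
      ; ≈-cong = λ { (e , e′) → +-cong e (*-congˡ e′) }
      ; +-hom = λ { (a , b) (c , d) → solve 5 (λ s a b c d → a :+ c :+ s :* (b :+ d) := a :+ s :* b :+ (c :+ s :* d)) refl s a b c d }
      ; *-hom = λ { (a , b) (c , d) → sym (trans
          (solve 5 (λ s a b c d → (a :+ s :* b) :* (c :+ s :* d) := a :* c :+ s :* (b :* c :+ a :* d) :+ s :* s :* (b :* d)) refl s a b c d)
          (trans (+-congˡ (trans (*-congʳ e) (zeroˡ _))) (+-identityʳ _))) }
      ; 1-hom = trans (+-congˡ (zeroʳ s)) (+-identityʳ _) }

    at-to : ∀ s e x → Hom.to (at s e) x ≡ proj₁ x + s * proj₂ x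
    at-to s e x = ≡.refl

opaque
  unfolding DualNumbers._+ᵈ_
  mapDual : ∀ {C D : CR} → Hom C D → Hom (DualNumbers.Dual C) (DualNumbers.Dual D)
  mapDual {C} {D} h = record
    { to = λ { (a , b) → to a , to b }
    ; ≈-cong = λ { (e , e′) → ≈-cong e , ≈-cong e′ }
    ; +-hom = λ { (a , b) (c , d) → +-hom a c , +-hom b d }
    ; *-hom = λ { (a , b) (c , d) → *-hom a c , D.trans (+-hom _ _) (D.+-cong (*-hom b c) (*-hom a d)) }
    ; 1-hom = 1-hom , 0-hom }
    where
    open Hom h
    module D = CommutativeRing D

  mapDual-to : ∀ {C D : CR} (h : Hom C D) x → Hom.to (mapDual h) x ≡ (Hom.to h (proj₁ x) , Hom.to h (proj₂ x))
  mapDual-to h x = ≡.refl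

module PowerSeries (C : CR) where
  open CommutativeRing C hiding (zero)
  open Relation.Binary.Reasoning.Setoid setoid
  open Solve C

  infixl 7 _*ˢ_
  infixl 6 _+ˢ_
  infix 4 _≈ˢ_

  Series : Set
  Series = ℕ → Carrier

  tl : Series → Series
  tl f k = f (suc k)

  private
    conv : Series → Series → Series
    conv f g zero = f 0 * g 0
    conv f g (suc k) = f 0 * g (suc k) + conv (tl f) g k

    conv-cong : ∀ {f f′ g g′} → (∀ k → f k ≈ f′ k) → (∀ k → g k ≈ g′ k) → ∀ k → conv f g k ≈ conv f′ g′ k
    conv-cong e e′ zero = *-cong (e 0) (e′ 0)
    conv-cong e e′ (suc k) = +-cong (*-cong (e 0) (e′ (suc k))) (conv-cong (λ k → e (suc k)) e′ k)

    conv-distribʳ : ∀ h f g k → conv (λ k → f k + g k) h k ≈ conv f h k + conv g h k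
    conv-distribʳ h f g zero = distribʳ _ _ _
    conv-distribʳ h f g (suc k) = trans (+-congˡ (conv-distribʳ h (tl f) (tl g) k))
      (solve 5 (λ a b c d e → (a :+ b) :* c :+ (d :+ e) := a :* c :+ d :+ (b :* c :+ e)) refl _ _ _ _ _)

    conv-scale : ∀ a f g k → conv (λ k → a * f k) g k ≈ a * conv f g k
    conv-scale a f g zero = *-assoc _ _ _
    conv-scale a f g (suc k) = trans (+-congˡ (conv-scale a (tl f) g k))
      (solve 4 (λ a b c d → a :* b :* c :+ a :* d := a :* (b :* c :+ d)) refl _ _ _ _)

    conv-zeroˡ : ∀ g k → conv (λ _ → 0#) g k ≈ 0#
    conv-zeroˡ g zero = zeroˡ _
    conv-zeroˡ g (suc k) = trans (+-cong (zeroˡ _) (conv-zeroˡ g k)) (+-identityʳ _)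

    conv-sucʳ : ∀ f g k → conv f g (suc k) ≈ conv f (tl g) k + f (suc k) * g 0
    conv-sucʳ f g zero = refl
    conv-sucʳ f g (suc k) = trans (+-congˡ (conv-sucʳ (tl f) g k)) (sym (+-assoc _ _ _))

    conv-comm : ∀ f g k → conv f g k ≈ conv g f k
    conv-comm f g zero = *-comm _ _
    conv-comm f g (suc k) = begin
      f 0 * g (suc k) + conv (tl f) g k   ≈⟨ +-cong (*-comm _ _) (conv-comm (tl f) g k) ⟩
      g (suc k) * f 0 + conv g (tl f) k   ≈⟨ +-comm _ _ ⟩
      conv g (tl f) k + g (suc k) * f 0   ≈⟨ conv-sucʳ g f k ⟨
      conv g f (suc k)                    ∎

    conv-assoc : ∀ f g h k → conv (conv f g) h k ≈ conv f (conv g h) k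
    conv-assoc f g h zero = *-assoc _ _ _
    conv-assoc f g h (suc k) = begin
      f 0 * g 0 * h (suc k) + conv (λ k → f 0 * tl g k + conv (tl f) g k) h k
        ≈⟨ +-congˡ (trans (conv-distribʳ h (λ k → f 0 * tl g k) (conv (tl f) g) k)
             (+-cong (conv-scale (f 0) (tl g) h k) (conv-assoc (tl f) g h k))) ⟩
      f 0 * g 0 * h (suc k) + (f 0 * conv (tl g) h k + conv (tl f) (conv g h) k)
        ≈⟨ solve 5 (λ a b c d e → a :* b :* c :+ (a :* d :+ e) := a :* (b :* c :+ d) :+ e) refl _ _ _ _ _ ⟩
      f 0 * (g 0 * h (suc k) + conv (tl g) h k) + conv (tl f) (conv g h) k ∎

  1ˢ : Series
  1ˢ zero = 1#
  1ˢ (suc k) = 0#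

  private
    conv-identityˡ : ∀ f k → conv 1ˢ f k ≈ f k
    conv-identityˡ f zero = *-identityˡ _
    conv-identityˡ f (suc k) = trans (+-cong (*-identityˡ _) (conv-zeroˡ f k)) (+-identityʳ _)

  opaque
    _+ˢ_ _*ˢ_ : Series → Series → Series
    f +ˢ g = λ k → f k + g k
    _*ˢ_ = conv

    -ˢ_ : Series → Series
    -ˢ f = λ k → - f k

    +ˢ-at : ∀ f g k → (f +ˢ g) k ≡ f k + g k
    +ˢ-at f g k = ≡.refl

    -ˢ-at : ∀ f k → (-ˢ f) k ≡ - f k
    -ˢ-at f k = ≡.refl

    *ˢ-zero : ∀ f g → (f *ˢ g) 0 ≡ f 0 * g 0
    *ˢ-zero f g = ≡.refl

    *ˢ-suc : ∀ f g k → (f *ˢ g) (suc k) ≡ f 0 * g (suc k) + (tl f *ˢ g) k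
    *ˢ-suc f g k = ≡.refl

  _≈ˢ_ : Rel Series 0ℓ
  f ≈ˢ g = ∀ k → f k ≈ g k

  opaque
    unfolding _+ˢ_
    *ˢ-sucʳ : ∀ f g k → (f *ˢ g) (suc k) ≈ (f *ˢ tl g) k + f (suc k) * g 0
    *ˢ-sucʳ = conv-sucʳ

    isCommutativeRingˢ : IsCommutativeRing _≈ˢ_ _+ˢ_ _*ˢ_ -ˢ_ (λ _ → 0#) 1ˢ
    isCommutativeRingˢ = record
      { isRing = record
        { +-isAbelianGroup = record
          { isGroup = record
            { isMonoid = record
              { isSemigroup = record
                { isMagma = record
                  { isEquivalence = record
                    { refl = λ k → refl
                    ; sym = λ e k → sym (e k)
                    ; trans = λ e e′ k → trans (e k) (e′ k) }
                  ; ∙-cong = λ e e′ k → +-cong (e k) (e′ k) }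
                ; assoc = λ f g h k → +-assoc _ _ _ }
              ; identity = (λ f k → +-identityˡ _) , (λ f k → +-identityʳ _) }
            ; inverse = (λ f k → -‿inverseˡ _) , (λ f k → -‿inverseʳ _)
            ; ⁻¹-cong = λ e k → -‿cong (e k) }
          ; comm = λ f g k → +-comm _ _ }
        ; *-cong = conv-cong
        ; *-assoc = conv-assoc
        ; *-identity = conv-identityˡ , (λ f k → trans (conv-comm f 1ˢ k) (conv-identityˡ f k))
        ; distrib = (λ f g h k → trans (conv-comm f _ k) (trans (conv-distribʳ f g h k) (+-cong (conv-comm g f k) (conv-comm h f k)))) , conv-distribʳ }
      ; *-comm = conv-comm }

  PS : CR
  PS = record { isCommutativeRing = isCommutativeRingˢ }

  const : Carrier → Series
  const a zero = a
  const a (suc k) = 0#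

  const-* : ∀ a f k → (const a *ˢ f) k ≈ a * f k
  const-* a f zero = reflexive (*ˢ-zero _ _)
  const-* a f (suc k) = trans (reflexive (*ˢ-suc _ _ k))
    (trans (+-congˡ (CommutativeRing.zeroˡ PS f k)) (+-identityʳ _))

  lin : Carrier → Carrier → Series
  lin a b zero = a
  lin a b (suc k) = const b k

  lin-*-zero : ∀ a b f → (lin a b *ˢ f) 0 ≈ a * f 0
  lin-*-zero a b f = reflexive (*ˢ-zero _ _)

  lin-*-suc : ∀ a b f k → (lin a b *ˢ f) (suc k) ≈ a * f (suc k) + b * f k
  lin-*-suc a b f k = trans (reflexive (*ˢ-suc _ _ k)) (+-congˡ (const-* b f k))

  lin-cong : ∀ {a a′ b b′} → a ≈ a′ → b ≈ b′ → lin a b ≈ˢ lin a′ b′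
  lin-cong e e′ zero = e
  lin-cong e e′ (suc zero) = e′
  lin-cong e e′ (suc (suc k)) = refl

  X : Series
  X = lin 0# 1#

  X-*-suc : ∀ f k → (X *ˢ f) (suc k) ≈ f k
  X-*-suc f k = trans (lin-*-suc 0# 1# f k) (solve 2 (λ a b → con ℤ.0ℤ :* a :+ con ℤ.1ℤ :* b := b) refl _ _)

  opaque
    unfolding _+ˢ_
    head : Hom PS C
    head = record { to = λ f → f 0 ; ≈-cong = λ e → e 0 ; +-hom = λ _ _ → refl ; *-hom = λ _ _ → refl ; 1-hom = refl }

    head-to : ∀ f → Hom.to head f ≡ f 0
    head-to f = ≡.refl

  constʰ : Hom C PS
  constʰ = record
    { to = const
    ; ≈-cong = λ { e zero → e ; e (suc k) → refl }
    ; +-hom = λ { a b zero → sym (reflexive (+ˢ-at _ _ 0)) ; a b (suc k) → sym (trans (reflexive (+ˢ-at _ _ (suc k))) (+-identityʳ _)) }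
    ; *-hom = λ { a b zero → sym (const-* a _ 0) ; a b (suc k) → sym (trans (const-* a _ (suc k)) (zeroʳ _)) }
    ; 1-hom = λ { zero → refl ; (suc k) → refl } }

  open Pow C

  private
    rescale : Carrier → Series → Series
    rescale a f k = a ^ k * f k

    rescale-* : ∀ a f g k → rescale a (conv f g) k ≈ conv (rescale a f) (rescale a g) k
    rescale-* a f g zero = solve 2 (λ x y → con ℤ.1ℤ :* (x :* y) := con ℤ.1ℤ :* x :* (con ℤ.1ℤ :* y)) refl _ _
    rescale-* a f g (suc k) = begin
      a * a ^ k * (f 0 * g (suc k) + conv (tl f) g k)
        ≈⟨ solve 5 (λ a b x y z → a :* b :* (x :* y :+ z) := con ℤ.1ℤ :* x :* (a :* b :* y) :+ a :* (b :* z)) refl _ _ _ _ _ ⟩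
      1# * f 0 * (a * a ^ k * g (suc k)) + a * rescale a (conv (tl f) g) k
        ≈⟨ +-congˡ (trans (*-congˡ (rescale-* a (tl f) g k)) (trans (sym (conv-scale a _ _ k))
             (conv-cong (λ k → sym (*-assoc _ _ _)) (λ k → refl) k))) ⟩
      1# * f 0 * (a * a ^ k * g (suc k)) + conv (tl (rescale a f)) (rescale a g) k ∎

  opaque
    unfolding _+ˢ_
    rescaleʰ : Carrier → Hom PS PS
    rescaleʰ a = record
      { to = rescale a ; ≈-cong = λ e k → *-congˡ (e k) ; +-hom = λ f g k → distribˡ _ _ _ ; *-hom = rescale-* a
      ; 1-hom = λ { zero → *-identityˡ _ ; (suc k) → zeroʳ _ } }

    rescale-at : ∀ a f k → Hom.to (rescaleʰ a) f k ≡ a ^ k * f k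
    rescale-at a f k = ≡.refl

  open Cast C using (ιℕ; ιℕ-suc)

  private
    euler : Series → Series
    euler f k = ιℕ k * f k

    euler-* : ∀ f g k → euler (conv f g) k ≈ conv (euler f) g k + conv f (euler g) k
    euler-* f g zero = solve 2 (λ x y → con ℤ.0ℤ :* (x :* y) := con ℤ.0ℤ :* x :* y :+ x :* (con ℤ.0ℤ :* y)) refl _ _
    euler-* f g (suc k) = begin
      ιℕ (suc k) * (f 0 * g (suc k) + conv (tl f) g k)
        ≈⟨ trans (distribˡ _ _ _) (+-congˡ (*-congʳ (ιℕ-suc k))) ⟩
      ιℕ (suc k) * (f 0 * g (suc k)) + (1# + ιℕ k) * conv (tl f) g k
        ≈⟨ solve 5 (λ n x y m z → n :* (x :* y) :+ (con ℤ.1ℤ :+ m) :* z := x :* (n :* y) :+ (z :+ m :* z)) refl _ _ _ _ _ ⟩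
      f 0 * (ιℕ (suc k) * g (suc k)) + (conv (tl f) g k + euler (conv (tl f) g) k)
        ≈⟨ +-congˡ (+-congˡ (euler-* (tl f) g k)) ⟩
      f 0 * (ιℕ (suc k) * g (suc k)) + (conv (tl f) g k + (conv (euler (tl f)) g k + conv (tl f) (euler g) k))
        ≈⟨ solve 6 (λ x y z a b c → c :+ (a :+ (b :+ z)) := con ℤ.0ℤ :* x :* y :+ (a :+ b) :+ (c :+ z)) refl
             (f 0) (g (suc k)) _ _ _ _ ⟩
      0# * f 0 * g (suc k) + (conv (tl f) g k + conv (euler (tl f)) g k) + conv f (euler g) (suc k)
        ≈⟨ +-congʳ (+-congˡ (trans (sym (conv-distribʳ g (tl f) (euler (tl f)) k)) (conv-cong (λ k → tl-euler k) (λ k → refl) k))) ⟩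
      conv (euler f) g (suc k) + conv f (euler g) (suc k) ∎
      where
      tl-euler : ∀ k → f (suc k) + ιℕ k * f (suc k) ≈ ιℕ (suc k) * f (suc k)
      tl-euler k = trans (solve 2 (λ x y → y :+ x :* y := (con ℤ.1ℤ :+ x) :* y) refl _ _) (*-congʳ (sym (ιℕ-suc k)))

  -- f ↦ f + s x f′(x) modulo s².
  opaque
    unfolding _+ˢ_ DualNumbers._+ᵈ_
    eulerʰ : Hom PS (DualNumbers.Dual PS)
    eulerʰ = record
      { to = λ f → f , euler f
      ; ≈-cong = λ e → e , (λ k → *-congˡ (e k))
      ; +-hom = λ f g → (λ k → refl) , (λ k → distribˡ _ _ _)
      ; *-hom = λ f g → (λ k → refl) , euler-* f g
      ; 1-hom = (λ k → refl) , (λ { zero → zeroˡ _ ; (suc k) → zeroʳ _ }) }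

    eulerʰ-to : ∀ f → Hom.to eulerʰ f ≡ (f , (λ k → ιℕ k * f k))
    eulerʰ-to f = ≡.refl

opaque
  unfolding PowerSeries._+ˢ_
  mapPS : ∀ {C D : CR} → Hom C D → Hom (PowerSeries.PS C) (PowerSeries.PS D)
  mapPS {C} {D} h = record
    { to = λ f k → to (f k)
    ; ≈-cong = λ e k → ≈-cong (e k)
    ; +-hom = λ f g k → +-hom _ _
    ; *-hom = conv-hom
    ; 1-hom = λ { zero → 1-hom ; (suc k) → 0-hom } }
    where
    open Hom h
    module D = CommutativeRing D
    module PC = PowerSeries C
    module PD = PowerSeries D
    conv-hom : ∀ f g k → to ((f PC.*ˢ g) k) D.≈ ((λ k → to (f k)) PD.*ˢ (λ k → to (g k))) k
    conv-hom f g zero = *-hom _ _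
    conv-hom f g (suc k) = D.trans (+-hom _ _) (D.+-cong (*-hom _ _) (conv-hom (PC.tl f) g k))

  mapPS-to : ∀ {C D : CR} (h : Hom C D) f k → Hom.to (mapPS h) f k ≡ Hom.to h (f k)
  mapPS-to h f k = ≡.refl

mapPS-lin : ∀ {C D : CR} (h : Hom C D) a b →
  PowerSeries._≈ˢ_ D (Hom.to (mapPS h) (PowerSeries.lin C a b)) (PowerSeries.lin D (Hom.to h a) (Hom.to h b))
mapPS-lin {C} {D} h a b zero = D.reflexive (mapPS-to h _ 0)
  where module D = CommutativeRing D
mapPS-lin {C} {D} h a b (suc zero) = D.reflexive (mapPS-to h _ 1)
  where module D = CommutativeRing D
mapPS-lin {C} {D} h a b (suc (suc k)) = D.trans (D.reflexive (mapPS-to h _ (suc (suc k)))) (Hom.0-hom h)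
  where module D = CommutativeRing D

-- Directional derivatives of determinants

module Derivative (C : CR) where
  open CommutativeRing C hiding (zero)
  open Algebra.Properties.Ring ring using (-0#≈0#)
  open Relation.Binary.Reasoning.Setoid setoid
  open Solve C
  open Pow C
  open AltSum C
  open Det′ C
  open Cast C using (ιℕ; ιℕ-suc)
  private
    module DN = DualNumbers C
    module D = CommutativeRing (DualNumbers.Dual C)
    module DD = Det′ (DualNumbers.Dual C)
    module DA = AltSum (DualNumbers.Dual C)
    module DP = Pow (DualNumbers.Dual C)

  -- Taken as the infinitesimal part of a determinant over the dual numbers, so that congruence,
  -- transposition and base change are inherited from determinants.
  ∂ : (n : ℕ) → Mat n → Mat n → Carrier
  ∂ n Y L = proj₂ (DD.det n (λ i j → Y i j , L i j))

  value-det : ∀ n (Y L : Mat n) → proj₁ (DD.det n (λ i j → Y i j , L i j)) ≈ det n Y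
  value-det n Y L = begin
    proj₁ (DD.det n (λ i j → Y i j , L i j))                ≡⟨ DN.value-to _ ⟨
    Hom.to DN.value (DD.det n (λ i j → Y i j , L i j))      ≈⟨ hom-det DN.value n _ ⟩
    det n (λ i j → Hom.to DN.value (Y i j , L i j))         ≈⟨ det-cong n (λ i j → reflexive (DN.value-to _)) ⟩
    det n Y                                                 ∎

  ∂-cong : ∀ n {Y Y′ L L′ : Mat n} → (∀ i j → Y i j ≈ Y′ i j) → (∀ i j → L i j ≈ L′ i j) → ∂ n Y L ≈ ∂ n Y′ L′
  ∂-cong n e e′ = proj₂ (DD.det-cong n (λ i j → e i j , e′ i j))

  ∂-transpose : ∀ n (Y L : Mat n) → ∂ n (λ i j → Y j i) (λ i j → L j i) ≈ ∂ n Y L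
  ∂-transpose n Y L = proj₂ (DD.det-transpose n (λ i j → Y i j , L i j))

  private
    alt-proj₂ : ∀ {n} (f : Fin n → DN.D) → proj₂ (DA.alt f) ≈ alt (λ i → proj₂ (f i))
    alt-proj₂ {zero} f = trans (proj₂ (DA.alt-zero f)) (sym (alt-zero _))
    alt-proj₂ {suc n} f = begin
      proj₂ (DA.alt f)
        ≈⟨ proj₂ (DA.alt-suc f) ⟩
      proj₂ (f zero DN.+ᵈ (DN.-ᵈ DA.alt (λ i → f (suc i))))
        ≡⟨ ≡.trans (DN.+ᵈ-proj₂ _ _) (≡.cong (λ z → proj₂ (f zero) + z) (DN.-ᵈ-proj₂ _)) ⟩
      proj₂ (f zero) - proj₂ (DA.alt (λ i → f (suc i)))
        ≈⟨ +-congˡ (-‿cong (alt-proj₂ (λ i → f (suc i)))) ⟩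
      proj₂ (f zero) - alt (λ i → proj₂ (f (suc i)))
        ≈⟨ alt-suc _ ⟨
      alt (λ i → proj₂ (f i)) ∎

  ∂-suc : ∀ n (Y L : Mat (suc n)) → ∂ (suc n) Y L ≈
    alt (λ j → L zero j * det n (λ r c → Y (suc r) (punchIn j c))
             + Y zero j * ∂ n (λ r c → Y (suc r) (punchIn j c)) (λ r c → L (suc r) (punchIn j c)))
  ∂-suc n Y L = trans (alt-proj₂ _) (alt-cong (λ j → trans (reflexive (DN.*ᵈ-proj₂ _ _))
    (+-congʳ (*-congˡ (value-det n _ (λ r c → L (suc r) (punchIn j c)))))))

  ∂-+ : ∀ n (Y L L′ : Mat n) → ∂ n Y (λ i j → L i j + L′ i j) ≈ ∂ n Y L + ∂ n Y L′
  ∂-+ zero Y L L′ = sym (+-identityʳ _)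
  ∂-+ (suc n) Y L L′ = begin
    ∂ (suc n) Y (λ i j → L i j + L′ i j)
      ≈⟨ ∂-suc n Y (λ i j → L i j + L′ i j) ⟩
    alt (λ j → (L zero j + L′ zero j) * m j + Y zero j * ∂ n (Yⱼ j) (λ r c → L (suc r) (punchIn j c) + L′ (suc r) (punchIn j c)))
      ≈⟨ alt-cong (λ j → trans (+-congˡ (*-congˡ (∂-+ n (Yⱼ j) _ _)))
           (solve 6 (λ a b c d e f → (a :+ b) :* c :+ d :* (e :+ f) := a :* c :+ d :* e :+ (b :* c :+ d :* f)) refl _ _ _ _ _ _)) ⟩
    alt (λ j → L zero j * m j + Y zero j * ∂ n (Yⱼ j) (λ r c → L (suc r) (punchIn j c))
             + (L′ zero j * m j + Y zero j * ∂ n (Yⱼ j) (λ r c → L′ (suc r) (punchIn j c))))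
      ≈⟨ alt-+ _ _ ⟩
    _ ≈⟨ +-cong (∂-suc n Y L) (∂-suc n Y L′) ⟨
    ∂ (suc n) Y L + ∂ (suc n) Y L′ ∎
    where
    Yⱼ : Fin (suc n) → Mat n
    Yⱼ j r c = Y (suc r) (punchIn j c)
    m : Fin (suc n) → Carrier
    m j = det n (Yⱼ j)

  ∂-* : ∀ n a (Y L : Mat n) → ∂ n Y (λ i j → a * L i j) ≈ a * ∂ n Y L
  ∂-* zero a Y L = sym (zeroʳ _)
  ∂-* (suc n) a Y L = begin
    ∂ (suc n) Y (λ i j → a * L i j)
      ≈⟨ ∂-suc n Y (λ i j → a * L i j) ⟩
    alt (λ j → a * L zero j * m j + Y zero j * ∂ n (Yⱼ j) (λ r c → a * L (suc r) (punchIn j c)))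
      ≈⟨ alt-cong (λ j → trans (+-congˡ (*-congˡ (∂-* n a (Yⱼ j) _)))
           (solve 5 (λ a b c d e → a :* b :* c :+ d :* (a :* e) := a :* (b :* c :+ d :* e)) refl _ _ _ _ _)) ⟩
    alt (λ j → a * (L zero j * m j + Y zero j * ∂ n (Yⱼ j) (λ r c → L (suc r) (punchIn j c))))
      ≈⟨ trans (alt-*ˡ a _) (*-congˡ (sym (∂-suc n Y L))) ⟩
    a * ∂ (suc n) Y L ∎
    where
    Yⱼ : Fin (suc n) → Mat n
    Yⱼ j r c = Y (suc r) (punchIn j c)
    m : Fin (suc n) → Carrier
    m j = det n (Yⱼ j)

  -- Euler's identity: the determinant is homogeneous of degree n in the entries.
  ∂-self : ∀ n (Y : Mat n) → ∂ n Y Y ≈ ιℕ n * det n Y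
  ∂-self zero Y = sym (zeroˡ _)
  ∂-self (suc n) Y = begin
    ∂ (suc n) Y Y ≈⟨ ∂-suc n Y Y ⟩
    _ ≈⟨ alt-cong (λ j → trans (+-congˡ (*-congˡ (∂-self n (λ r c → Y (suc r) (punchIn j c)))))
           (trans (solve 3 (λ y k d → y :* d :+ y :* (k :* d) := (con ℤ.1ℤ :+ k) :* (y :* d)) refl _ _ _)
             (*-congʳ (sym (ιℕ-suc n))))) ⟩
    _ ≈⟨ alt-*ˡ (ιℕ (suc n)) _ ⟩
    ιℕ (suc n) * det (suc n) Y ∎

  ones : ∀ {n} → Mat n
  ones i j = 1#

  private
    -- This is a determinant with constant top row, differentiated along J in the other rows: each
    -- of its terms has two constant rows. The induction exchanges the constant row with the next
    -- one by `pairSum-swap`.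
    ones-twice : ∀ n (N : Fin n → Fin (suc n) → Carrier) →
      alt (λ j → ∂ n (λ r c → N r (punchIn j c)) ones) ≈ 0#
    ones-twice zero N = alt-0 (λ j → refl)
    ones-twice (suc m) N = begin
      alt (λ j → ∂ (suc m) (λ r c → N r (punchIn j c)) ones)
        ≈⟨ alt-cong (λ j → trans (∂-suc m (λ r c → N r (punchIn j c)) ones) (trans (alt-+ _ _) (+-cong (sym (*-identityˡ _)) (sym (*-identityˡ _))))) ⟩
      alt (λ j → 1# * alt (λ k → 1# * Ψ₁ (λ c → punchIn j (punchIn k c)))
               + 1# * alt (λ k → N zero (punchIn j k) * Ψ₂ (λ c → punchIn j (punchIn k c))))
        ≈⟨ alt-+ _ _ ⟩
      pairSum (λ _ → 1#) (λ _ → 1#) Ψ₁ + pairSum (λ _ → 1#) (N zero) Ψ₂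
        ≈⟨ +-cong (pairSum-diag _ Ψ₁ (rowSel-ext (λ r → N (suc r)))) (pairSum-swap _ _ Ψ₂
             (λ e → ∂-cong m (λ r c → reflexive (≡.cong (N (suc r)) (e c))) (λ _ _ → refl))) ⟩
      0# - pairSum (N zero) (λ _ → 1#) Ψ₂
        ≈⟨ trans (+-identityˡ _) (trans (-‿cong (alt-0 (λ j → trans (*-congˡ
             (trans (alt-cong (λ k → *-identityˡ _)) (ones-twice m (λ r c → N (suc r) (punchIn j c))))) (zeroʳ _)))) -0#≈0#) ⟩
      0# ∎
      where
      Ψ₁ Ψ₂ : Sel m (suc (suc m)) → Carrier
      Ψ₁ g = det m (λ r c → N (suc r) (g c))
      Ψ₂ g = ∂ m (λ r c → N (suc r) (g c)) ones

  -- By induction along row 0. The coefficient of s² that appears on the way is `ones-twice`, which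
  -- is why a perturbation by a multiple of J is affine in s.
  det-rank1 : ∀ n (Y : Mat n) s → det n (λ i j → Y i j + s) ≈ det n Y + s * ∂ n Y ones
  det-rank1 zero Y s = sym (trans (+-congˡ (zeroʳ s)) (+-identityʳ _))
  det-rank1 (suc n) Y s = begin
    alt (λ j → (Y zero j + s) * det n (λ r c → Y (suc r) (punchIn j c) + s))
      ≈⟨ alt-cong (λ j → trans (*-congˡ (det-rank1 n (λ r c → Y (suc r) (punchIn j c)) s))
           (solve 4 (λ y s d e → (y :+ s) :* (d :+ s :* e) := y :* d :+ (s :* (con ℤ.1ℤ :* d :+ y :* e) :+ s :* s :* e)) refl _ _ _ _)) ⟩
    alt (λ j → Y zero j * det n (Yⱼ j) + (s * (1# * det n (Yⱼ j) + Y zero j * ∂ n (Yⱼ j) ones) + s * s * ∂ n (Yⱼ j) ones))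
      ≈⟨ trans (alt-+ _ _) (+-congˡ (trans (alt-+ _ _) (+-cong (alt-*ˡ s _) (alt-*ˡ (s * s) _)))) ⟩
    _ ≈⟨ +-congˡ (+-cong (*-congˡ (∂-suc n Y ones)) (trans (sym (zeroʳ (s * s))) (*-congˡ (sym (ones-twice n (λ r → Y (suc r))))))) ⟨
    det (suc n) Y + (s * ∂ (suc n) Y ones + 0#)
      ≈⟨ +-congˡ (+-identityʳ _) ⟩
    det (suc n) Y + s * ∂ (suc n) Y ones ∎
    where
    Yⱼ : Fin (suc n) → Mat n
    Yⱼ j r c = Y (suc r) (punchIn j c)

  -- Evaluating the infinitesimal at s is a ring homomorphism exactly because s² = 0. The case of
  -- interest is s = 2 modulo 4.
  det-square-zero : ∀ n (Y L : Mat n) s → s * s ≈ 0# → det n (λ i j → Y i j + s * L i j) ≈ det n Y + s * ∂ n Y L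
  det-square-zero n Y L s e = begin
    det n (λ i j → Y i j + s * L i j)                                       ≈⟨ det-cong n (λ i j → reflexive (DN.at-to s e _)) ⟨
    det n (λ i j → Hom.to (DN.at s e) (Y i j , L i j))                       ≈⟨ hom-det (DN.at s e) n _ ⟨
    Hom.to (DN.at s e) (DD.det n (λ i j → Y i j , L i j))                    ≡⟨ DN.at-to s e _ ⟩
    proj₁ (DD.det n (λ i j → Y i j , L i j)) + s * ∂ n Y L                   ≈⟨ +-congʳ (value-det n Y L) ⟩
    det n Y + s * ∂ n Y L                                                   ∎

  idMat-sym : ∀ n i j → idMat n i j ≡ idMat n j i
  idMat-sym (suc n) zero zero = ≡.refl
  idMat-sym (suc n) zero (suc j) = ≡.refl
  idMat-sym (suc n) (suc i) zero = ≡.refl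
  idMat-sym (suc n) (suc i) (suc j) = idMat-sym n i j

  upper : ∀ {n} → Mat n
  upper zero zero = 0#
  upper zero (suc j) = 1#
  upper (suc i) zero = 0#
  upper (suc i) (suc j) = upper i j

  ones-split : ∀ n (i j : Fin n) → ones i j ≈ idMat n i j + (upper i j + upper j i)
  ones-split (suc n) zero zero = solve 0 (con (+ 1) := con (+ 1) :+ (con (+ 0) :+ con (+ 0))) refl
  ones-split (suc n) zero (suc j) = solve 0 (con (+ 1) := con (+ 0) :+ (con (+ 1) :+ con (+ 0))) refl
  ones-split (suc n) (suc i) zero = solve 0 (con (+ 1) := con (+ 0) :+ (con (+ 0) :+ con (+ 1))) refl
  ones-split (suc n) (suc i) (suc j) = ones-split n i j

module _ {C D : CR} (h : Hom C D) where
  private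
    module D = CommutativeRing D
    module DC = Derivative C
    module DD = Derivative D
  open Hom h

  hom-∂ : ∀ n (Y L : Det′.Mat C n) → to (DC.∂ n Y L) D.≈ DD.∂ n (λ i j → to (Y i j)) (λ i j → to (L i j))
  hom-∂ n Y L = D.trans (D.reflexive (≡.sym (≡.cong proj₂ (mapDual-to h _))))
    (D.trans (proj₂ (hom-det (mapDual h) n (λ i j → Y i j , L i j)))
    (proj₂ (Det′.det-cong (DualNumbers.Dual D) n {M = λ i j → Hom.to (mapDual h) (Y i j , L i j)}
      (λ i j → CommutativeRing.reflexive (DualNumbers.Dual D) (mapDual-to h _)))))

  hom-upper : ∀ {n} (i j : Fin n) → to (DC.upper i j) D.≈ DD.upper i j
  hom-upper zero zero = 0-hom
  hom-upper zero (suc j) = 1-hom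
  hom-upper (suc i) zero = 0-hom
  hom-upper (suc i) (suc j) = hom-upper i j

-- Coefficients of det (I + xA) and of its derivatives

module Charpoly (C : CR) where
  open CommutativeRing C hiding (zero)
  open Algebra.Properties.Ring ring using (-0#≈0#)
  open Relation.Binary.Reasoning.Setoid setoid
  open Solve C
  open Pow C
  open Cast C using (ιℕ; ιℕ-suc)
  open PowerSeries C
  module S = CommutativeRing PS
  module Sᴬ = AltSum PS
  module Sᴹ = Det′ PS
  module Sᴰ = Derivative PS
  open Det′ C
  open AltSum C

  alt-at : ∀ {n} (f : Fin n → Series) k → Sᴬ.alt f k ≈ alt (λ i → f i k)
  alt-at {zero} f k = trans (Sᴬ.alt-zero f k) (sym (alt-zero _))
  alt-at {suc n} f k = begin
    Sᴬ.alt f k                                                ≈⟨ Sᴬ.alt-suc f k ⟩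
    (f zero +ˢ (-ˢ Sᴬ.alt (λ i → f (suc i)))) k               ≡⟨ ≡.trans (+ˢ-at _ _ k) (≡.cong (λ z → f zero k + z) (-ˢ-at _ k)) ⟩
    f zero k - Sᴬ.alt (λ i → f (suc i)) k                     ≈⟨ +-congˡ (-‿cong (alt-at (λ i → f (suc i)) k)) ⟩
    f zero k - alt (λ i → f (suc i) k)                        ≈⟨ alt-suc _ ⟨
    alt (λ i → f i k)                                         ∎

  pencil : ∀ n → Mat n → Mat n → Sᴹ.Mat n
  pencil n A B i j = lin (A i j) (B i j)

  pencil-cong : ∀ n {A A′ B B′ : Mat n} → (∀ i j → A i j ≈ A′ i j) → (∀ i j → B i j ≈ B′ i j) →
    ∀ k → Sᴹ.det n (pencil n A B) k ≈ Sᴹ.det n (pencil n A′ B′) k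
  pencil-cong n e e′ = Sᴹ.det-cong n (λ i j → lin-cong (e i j) (e′ i j))

  private
    minor : ∀ {n} → Mat (suc n) → Fin (suc n) → Mat n
    minor A j r c = A (suc r) (punchIn j c)

  pencil-degree : ∀ n A B k → n ℕ.< k → Sᴹ.det n (pencil n A B) k ≈ 0#
  pencil-degree zero A B (suc k) _ = refl
  pencil-degree (suc n) A B (suc k) (ℕ.s≤s n<k) = trans (alt-at _ (suc k)) (alt-0 (λ j →
    trans (lin-*-suc _ _ _ k) (trans (+-cong
      (trans (*-congˡ (pencil-degree n (minor A j) (minor B j) (suc k) (ℕₚ.m<n⇒m<1+n n<k))) (zeroʳ _))
      (trans (*-congˡ (pencil-degree n (minor A j) (minor B j) k n<k)) (zeroʳ _))) (+-identityʳ _))))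

  -- Reversal of coefficients passes from det (xI - H) to det (I - xH), where the index of a
  -- coefficient is also the number of factors π to be expected in it, up to one.
  pencil-reverse : ∀ n A B j k → j ℕ.+ k ≡ n → Sᴹ.det n (pencil n B A) j ≈ Sᴹ.det n (pencil n A B) k
  pencil-reverse zero A B zero zero _ = refl
  pencil-reverse (suc n) A B j k eq = trans (alt-at _ j) (trans (alt-cong (λ i → term i j k eq)) (sym (alt-at _ k)))
    where
    f g : Fin (suc n) → Series
    f i = Sᴹ.det n (pencil n (minor B i) (minor A i))
    g i = Sᴹ.det n (pencil n (minor A i) (minor B i))
    term : ∀ i j k → j ℕ.+ k ≡ suc n → (lin (B zero i) (A zero i) *ˢ f i) j ≈ (lin (A zero i) (B zero i) *ˢ g i) k
    term i zero (suc k) ≡.refl = begin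
      (lin (B zero i) (A zero i) *ˢ f i) 0          ≈⟨ lin-*-zero _ _ _ ⟩
      B zero i * f i 0                              ≈⟨ *-congˡ (pencil-reverse n (minor A i) (minor B i) 0 k ≡.refl) ⟩
      B zero i * g i k                              ≈⟨ +-identityˡ _ ⟨
      0# + B zero i * g i k                         ≈⟨ +-congʳ (trans (*-congˡ (pencil-degree n (minor A i) (minor B i) (suc k) ℕₚ.≤-refl)) (zeroʳ _)) ⟨
      A zero i * g i (suc k) + B zero i * g i k     ≈⟨ lin-*-suc _ _ _ k ⟨
      (lin (A zero i) (B zero i) *ˢ g i) (suc k)    ∎
    term i (suc j) zero eq = begin
      (lin (B zero i) (A zero i) *ˢ f i) (suc j)    ≈⟨ lin-*-suc _ _ _ j ⟩
      B zero i * f i (suc j) + A zero i * f i j     ≈⟨ +-congʳ (trans (*-congˡ (pencil-degree n (minor B i) (minor A i) (suc j) (ℕₚ.≤-reflexive (≡.trans (≡.sym eq) (ℕₚ.+-identityʳ _))))) (zeroʳ _)) ⟩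
      0# + A zero i * f i j                         ≈⟨ +-identityˡ _ ⟩
      A zero i * f i j                              ≈⟨ *-congˡ (pencil-reverse n (minor A i) (minor B i) j 0 (ℕₚ.suc-injective eq)) ⟩
      A zero i * g i 0                              ≈⟨ lin-*-zero _ _ _ ⟨
      (lin (A zero i) (B zero i) *ˢ g i) 0          ∎
    term i (suc j) (suc k) eq = begin
      (lin (B zero i) (A zero i) *ˢ f i) (suc j)    ≈⟨ lin-*-suc _ _ _ j ⟩
      B zero i * f i (suc j) + A zero i * f i j
        ≈⟨ +-cong (*-congˡ (pencil-reverse n (minor A i) (minor B i) (suc j) k (ℕₚ.suc-injective (≡.trans (≡.sym (ℕₚ.+-suc (suc j) k)) eq))))
                  (*-congˡ (pencil-reverse n (minor A i) (minor B i) j (suc k) (ℕₚ.suc-injective eq))) ⟩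
      B zero i * g i k + A zero i * g i (suc k)     ≈⟨ +-comm _ _ ⟩
      A zero i * g i (suc k) + B zero i * g i k     ≈⟨ lin-*-suc _ _ _ k ⟨
      (lin (A zero i) (B zero i) *ˢ g i) (suc k)    ∎

  I+x : ∀ n → Mat n → Sᴹ.Mat n
  I+x n A = pencil n (idMat n) A

  -- The coefficients of det (I + xA), and of its derivatives in the all-ones
  -- and the strictly upper triangular all-ones directions.
  c : ∀ n → Mat n → ℕ → Carrier
  c n A k = Sᴹ.det n (I+x n A) k

  e : ∀ n → Mat n → ℕ → Carrier
  e n A k = Sᴰ.∂ n (I+x n A) Sᴰ.ones k

  d : ∀ n → Mat n → ℕ → Carrier
  d n A k = Sᴰ.∂ n (I+x n A) Sᴰ.upper k

  rescale-lin : ∀ a x y → Hom.to (rescaleʰ a) (lin x y) ≈ˢ lin x (a * y)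
  rescale-lin a x y zero = trans (reflexive (rescale-at a _ 0)) (*-identityˡ _)
  rescale-lin a x y (suc zero) = trans (reflexive (rescale-at a _ 1)) (*-congʳ (*-identityʳ _))
  rescale-lin a x y (suc (suc k)) = trans (reflexive (rescale-at a _ (suc (suc k)))) (zeroʳ _)

  c-scale : ∀ n a A k → c n (λ i j → a * A i j) k ≈ a ^ k * c n A k
  c-scale n a A k = begin
    Sᴹ.det n (I+x n (λ i j → a * A i j)) k                        ≈⟨ Sᴹ.det-cong n (λ i j → rescale-lin a _ _) k ⟨
    Sᴹ.det n (λ i j → Hom.to (rescaleʰ a) (I+x n A i j)) k        ≈⟨ hom-det (rescaleʰ a) n (I+x n A) k ⟨
    Hom.to (rescaleʰ a) (Sᴹ.det n (I+x n A)) k                    ≡⟨ rescale-at a _ k ⟩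
    a ^ k * c n A k                                               ∎

  -- The substitution of ax for x is an endomorphism of the ring of series. The directions of
  -- interest, J and N, have constant entries and are fixed by it.
  ∂-rescale : ∀ n a A (L : Sᴹ.Mat n) → (∀ i j → Hom.to (rescaleʰ a) (L i j) ≈ˢ L i j) →
    ∀ k → Sᴰ.∂ n (I+x n (λ i j → a * A i j)) L k ≈ a ^ k * Sᴰ.∂ n (I+x n A) L k
  ∂-rescale n a A L eL k = begin
    Sᴰ.∂ n (I+x n (λ i j → a * A i j)) L k
      ≈⟨ Sᴰ.∂-cong n {Y = λ i j → Hom.to (rescaleʰ a) (I+x n A i j)} {L = λ i j → Hom.to (rescaleʰ a) (L i j)} (λ i j → rescale-lin a _ _) eL k ⟨
    Sᴰ.∂ n (λ i j → Hom.to (rescaleʰ a) (I+x n A i j)) (λ i j → Hom.to (rescaleʰ a) (L i j)) k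
      ≈⟨ hom-∂ (rescaleʰ a) n (I+x n A) L k ⟨
    Hom.to (rescaleʰ a) (Sᴰ.∂ n (I+x n A) L) k
      ≡⟨ rescale-at a _ k ⟩
    a ^ k * Sᴰ.∂ n (I+x n A) L k ∎

  e-scale : ∀ n a A k → e n (λ i j → a * A i j) k ≈ a ^ k * e n A k
  e-scale n a A = ∂-rescale n a A Sᴰ.ones (λ i j → Hom.1-hom (rescaleʰ a))

  d-scale : ∀ n a A k → d n (λ i j → a * A i j) k ≈ a ^ k * d n A k
  d-scale n a A = ∂-rescale n a A Sᴰ.upper (λ i j → hom-upper (rescaleʰ a) i j)

  -- H = J - πA, so det (I - xH) = det (I + πxA - xJ), a rank one update of det (I + πxA).
  coeff-expand : ∀ n π (h A : Mat n) → (∀ i j → h i j ≈ 1# - π * A i j) → ∀ k →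
    c n (λ i j → - h i j) (suc k) ≈ π ^ suc k * c n A (suc k) - π ^ k * e n A k
  coeff-expand n π h A eh k = begin
    c n (λ i j → - h i j) (suc k)
      ≈⟨ Sᴹ.det-cong n entry (suc k) ⟩
    Sᴹ.det n (λ i j → I+x n (λ i j → π * A i j) i j S.+ (S.- X)) (suc k)
      ≈⟨ Sᴰ.det-rank1 n (I+x n (λ i j → π * A i j)) (S.- X) (suc k) ⟩
    (Sᴹ.det n (I+x n (λ i j → π * A i j)) S.+ (S.- X) S.* E) (suc k)
      ≡⟨ +ˢ-at _ _ (suc k) ⟩
    c n (λ i j → π * A i j) (suc k) + ((S.- X) S.* E) (suc k)
      ≈⟨ +-cong (c-scale n π A (suc k)) (trans (SP.-‿distribˡ-* X E (suc k) ⟨trans⟩ reflexive (-ˢ-at _ (suc k))) (-‿cong (trans (X-*-suc E k) (e-scale n π A k)))) ⟩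
    π ^ suc k * c n A (suc k) - π ^ k * e n A k ∎
    where
    module SP = Algebra.Properties.Ring S.ring
    E : Series
    E = Sᴰ.∂ n (I+x n (λ i j → π * A i j)) Sᴰ.ones
    infixr 2 _⟨trans⟩_
    _⟨trans⟩_ : ∀ {x y z} → y ≈ x → y ≈ z → x ≈ z
    p ⟨trans⟩ q = trans (sym p) q
    entry : ∀ i j → lin (idMat n i j) (- h i j) ≈ˢ (lin (idMat n i j) (π * A i j) S.+ (S.- X))
    entry i j k = sym (trans (reflexive (≡.trans (+ˢ-at _ _ k) (≡.cong (λ z → lin (idMat n i j) (π * A i j) k + z) (-ˢ-at X k)))) (at k))
      where
      at : ∀ k → lin (idMat n i j) (π * A i j) k - X k ≈ lin (idMat n i j) (- h i j) k
      at zero = trans (+-congˡ -0#≈0#) (+-identityʳ _)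
      at (suc zero) = trans (solve 1 (λ x → x :- con (+ 1) := :- (con (+ 1) :- x)) refl _) (-‿cong (sym (eh i j)))
      at (suc (suc k)) = trans (+-congˡ -0#≈0#) (+-identityʳ _)

  -- With Y = I + xA the direction I is Y minus xA. The derivative along Y is n det Y by
  -- homogeneity, the one along xA is x times the x-derivative of det Y; on the coefficient of x^k
  -- the difference is n - k.
  ∂-identity : ∀ n A k → Sᴰ.∂ n (I+x n A) (Sᴹ.idMat n) k ≈ (ιℕ n - ιℕ k) * c n A k
  ∂-identity n A k = begin
    Sᴰ.∂ n Y (Sᴹ.idMat n) k
      ≈⟨ solve 2 (λ x y → x := x :+ y :- y) refl _ _ ⟩
    Sᴰ.∂ n Y (Sᴹ.idMat n) k + ιℕ k * c n A k - ιℕ k * c n A k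
      ≈⟨ +-congʳ sum ⟩
    ιℕ n * c n A k - ιℕ k * c n A k
      ≈⟨ solve 3 (λ a b c → a :* c :- b :* c := (a :- b) :* c) refl _ _ _ ⟩
    (ιℕ n - ιℕ k) * c n A k ∎
    where
    Y : Sᴹ.Mat n
    Y = I+x n A
    δY : Sᴹ.Mat n
    δY i j = lin 0# (A i j)
    euler-lin : ∀ a b → (λ k → ιℕ k * lin a b k) ≈ˢ lin 0# b
    euler-lin a b zero = zeroˡ _
    euler-lin a b (suc zero) = *-identityˡ _
    euler-lin a b (suc (suc k)) = zeroʳ _
    split : ∀ i j → Y i j ≈ˢ (Sᴹ.idMat n i j S.+ δY i j)
    split i j = λ k → sym (trans (reflexive (+ˢ-at _ _ k)) (trans (+-congʳ (sym (hom-id constʰ n i j k))) (at k)))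
      where
      at : ∀ k → const (idMat n i j) k + δY i j k ≈ Y i j k
      at zero = +-identityʳ _
      at (suc k) = +-identityˡ _
    euler-det : ιℕ k * c n A k ≈ Sᴰ.∂ n Y δY k
    euler-det = begin
      ιℕ k * c n A k
        ≡⟨ ≡.cong (λ z → proj₂ z k) (eulerʰ-to (Sᴹ.det n Y)) ⟨
      proj₂ (Hom.to eulerʰ (Sᴹ.det n Y)) k
        ≈⟨ proj₂ (hom-det eulerʰ n Y) k ⟩
      proj₂ (Det′.det (DualNumbers.Dual PS) n (λ i j → Hom.to eulerʰ (Y i j))) k
        ≈⟨ proj₂ (Det′.det-cong (DualNumbers.Dual PS) n {N = λ i j → Y i j , δY i j}
             (λ i j → (λ k → reflexive (≡.cong (λ z → proj₁ z k) (eulerʰ-to (Y i j)))) ,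
                      (λ k → trans (reflexive (≡.cong (λ z → proj₂ z k) (eulerʰ-to (Y i j)))) (euler-lin _ _ k)))) k ⟩
      Sᴰ.∂ n Y δY k ∎
    sum : Sᴰ.∂ n Y (Sᴹ.idMat n) k + ιℕ k * c n A k ≈ ιℕ n * c n A k
    sum = begin
      Sᴰ.∂ n Y (Sᴹ.idMat n) k + ιℕ k * c n A k             ≈⟨ +-congˡ euler-det ⟩
      Sᴰ.∂ n Y (Sᴹ.idMat n) k + Sᴰ.∂ n Y δY k              ≡⟨ +ˢ-at _ _ k ⟨
      (Sᴰ.∂ n Y (Sᴹ.idMat n) S.+ Sᴰ.∂ n Y δY) k            ≈⟨ Sᴰ.∂-+ n Y _ _ k ⟨
      Sᴰ.∂ n Y (λ i j → Sᴹ.idMat n i j S.+ δY i j) k       ≈⟨ Sᴰ.∂-cong n (λ i j → S.refl {Y i j}) split k ⟨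
      Sᴰ.∂ n Y Y k                                         ≈⟨ Sᴰ.∂-self n Y k ⟩
      (Cast.ιℕ PS n S.* Sᴹ.det n Y) k                      ≈⟨ S.*-congʳ (S.sym (hom-ιℕ constʰ n)) k ⟩
      (const (ιℕ n) S.* Sᴹ.det n Y) k                      ≈⟨ const-* _ _ k ⟩
      ιℕ n * c n A k                                       ∎

  -- Transposing turns the derivative along Nᵀ into one along N with A scaled by `lam`, whence
  -- `lam ^ k`. A multiplier instead of plain symmetry covers both approximations in use: 1 modulo π
  -- for q = 2, and 1 + π modulo π² for higher powers of two.
  e-transpose : ∀ n A lam → (∀ i j → A j i ≈ lam * A i j) → ∀ k →
    e n A k ≈ (ιℕ n - ιℕ k) * c n A k + (1# + lam ^ k) * d n A k
  e-transpose n A lam eA k = begin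
    e n A k
      ≈⟨ Sᴰ.∂-cong n (λ i j → S.refl {Y i j}) (Sᴰ.ones-split n) k ⟩
    Sᴰ.∂ n Y (λ i j → Sᴹ.idMat n i j S.+ (Sᴰ.upper i j S.+ Sᴰ.upper j i)) k
      ≈⟨ trans (Sᴰ.∂-+ n Y _ _ k) (trans (reflexive (+ˢ-at _ _ k)) (+-congˡ (trans (Sᴰ.∂-+ n Y _ _ k) (reflexive (+ˢ-at _ _ k))))) ⟩
    Sᴰ.∂ n Y (Sᴹ.idMat n) k + (d n A k + Sᴰ.∂ n Y (λ i j → Sᴰ.upper j i) k)
      ≈⟨ +-cong (∂-identity n A k) (+-congˡ lower) ⟩
    (ιℕ n - ιℕ k) * c n A k + (d n A k + lam ^ k * d n A k)
      ≈⟨ +-congˡ (solve 2 (λ x y → x :+ y :* x := (con (+ 1) :+ y) :* x) refl _ _) ⟩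
    (ιℕ n - ιℕ k) * c n A k + (1# + lam ^ k) * d n A k ∎
    where
    Y : Sᴹ.Mat n
    Y = I+x n A
    lower : Sᴰ.∂ n Y (λ i j → Sᴰ.upper j i) k ≈ lam ^ k * d n A k
    lower = begin
      Sᴰ.∂ n Y (λ i j → Sᴰ.upper j i) k                        ≈⟨ Sᴰ.∂-transpose n Y (λ i j → Sᴰ.upper j i) k ⟨
      Sᴰ.∂ n (λ i j → Y j i) Sᴰ.upper k                        ≈⟨ Sᴰ.∂-cong n (λ i j → lin-cong (reflexive (Derivative.idMat-sym C n j i)) (eA i j)) (λ i j → S.refl {Sᴰ.upper i j}) k ⟩
      Sᴰ.∂ n (I+x n (λ i j → lam * A i j)) Sᴰ.upper k          ≈⟨ d-scale n lam A k ⟩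
      lam ^ k * d n A k                                        ∎

module FirstCoefficients (C : CR) where
  open CommutativeRing C hiding (zero)
  open Algebra.Properties.Ring ring using (-0#≈0#)
  open Relation.Binary.Reasoning.Setoid setoid
  open Solve C
  open Cast C using (ιℕ; ιℕ-suc)
  open PowerSeries C
  open Det′ C
  open AltSum C
  open Charpoly C

  sumF-cong : ∀ {n} {f g : Fin n → Carrier} → (∀ i → f i ≈ g i) → sumF f ≈ sumF g
  sumF-cong {zero} eq = refl
  sumF-cong {suc n} eq = +-cong (eq zero) (sumF-cong (λ i → eq (suc i)))

  sumF-1 : ∀ n → sumF {n} (λ _ → 1#) ≈ ιℕ n
  sumF-1 zero = refl
  sumF-1 (suc n) = trans (+-congˡ (sumF-1 n)) (sym (ιℕ-suc n))

  private
    quad : ∀ u v m → (lin 0# u *ˢ lin 0# v *ˢ m) 0 ≈ 0#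
                   × (lin 0# u *ˢ lin 0# v *ˢ m) 1 ≈ 0#
                   × (lin 0# u *ˢ lin 0# v *ˢ m) 2 ≈ u * v * m 0
    quad u v m =
      trans (S.*-assoc _ _ m 0) (trans (lin-*-zero _ _ _) (zeroˡ _)) ,
      trans (S.*-assoc _ _ m 1) (trans (lin-*-suc _ _ _ 0) (trans (+-congˡ (*-congˡ (lin-*-zero _ _ _)))
        (solve 3 (λ a b c → con (+ 0) :* a :+ b :* (con (+ 0) :* c) := con (+ 0)) refl _ _ _))) ,
      trans (S.*-assoc _ _ m 2) (trans (lin-*-suc _ _ _ 1) (trans (+-congˡ (*-congˡ (lin-*-suc _ _ _ 0)))
        (solve 5 (λ a b c d e → con (+ 0) :* a :+ b :* (con (+ 0) :* c :+ d :* e) := b :* d :* e) refl _ _ _ _ _)))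

    -- R collects the products of an entry in the border row and one in the border column. Both are
    -- multiples of x, so R begins at x², where only the diagonal minors of I count and each product
    -- h(0,i) h(i,0) is 1.
    border : ∀ n (h : Mat (suc n)) → (∀ i j → h i j * h j i ≈ 1#) →
      Σ Series (λ R → (R 0 ≈ 0#) × (R 1 ≈ 0#) × (R 2 ≈ ιℕ n) ×
        (∀ k → c (suc n) (λ i j → - h i j) k ≈
           (lin 1# (- h zero zero) *ˢ Sᴹ.det n (I+x n (λ i j → - h (suc i) (suc j)))) k - R k))
    border zero h _ = (λ _ → 0#) , refl , refl , refl , λ k → trans (Sᴬ.alt-suc _ k)
      (trans (reflexive (≡.trans (+ˢ-at _ _ k) (≡.cong (λ z → (lin 1# (- h zero zero) *ˢ S.1#) k + z) (-ˢ-at _ k))))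
      (+-congˡ (-‿cong (Sᴬ.alt-zero _ k))))
    border (suc m) h hh = R ,
        at0 (λ i j → proj₁ (quad _ _ (minor i j))) ,
        at0 (λ i j → proj₁ (proj₂ (quad _ _ (minor i j)))) ,
        R2 ,
        λ k → trans (Sᴹ.det-border m M k) (reflexive (≡.trans (+ˢ-at _ _ k) (≡.cong (λ z → (lin 1# (- h zero zero) *ˢ _) k + z) (-ˢ-at _ k))))
      where
      M : Sᴹ.Mat (suc (suc m))
      M = I+x (suc (suc m)) (λ i j → - h i j)
      minor : Fin (suc m) → Fin (suc m) → Series
      minor i j = Sᴹ.det m (λ r c → M (suc (punchIn i r)) (suc (punchIn j c)))
      term : Fin (suc m) → Fin (suc m) → Series
      term i j = M zero (suc j) *ˢ M (suc i) zero *ˢ minor i j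
      R : Series
      R = Sᴬ.alt (λ j → Sᴬ.alt (λ i → term i j))
      at : ∀ k → R k ≈ alt (λ j → alt (λ i → term i j k))
      at k = trans (alt-at _ k) (alt-cong (λ j → alt-at _ k))
      at0 : ∀ {k} → (∀ i j → term i j k ≈ 0#) → R k ≈ 0#
      at0 {k} eq = trans (at k) (alt-0 (λ j → alt-0 (λ i → eq i j)))
      minor0 : ∀ i j → minor i j 0 ≈ idMinor i j
      minor0 i j = trans (reflexive (≡.sym (head-to _))) (trans (hom-det head m _)
        (det-cong m (λ r c → reflexive (head-to _))))
      R2 : R 2 ≈ ιℕ (suc m)
      R2 = begin
        R 2 ≈⟨ at 2 ⟩
        alt (λ j → alt (λ i → term i j 2))
          ≈⟨ alt-cong (λ j → alt-cong (λ i → trans (proj₂ (proj₂ (quad _ _ (minor i j)))) (*-congˡ (minor0 i j)))) ⟩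
        alt (λ j → alt (λ i → - h zero (suc j) * - h (suc i) zero * idMinor i j))
          ≈⟨ idMinor-trace m (λ i j → - h zero (suc j) * - h (suc i) zero) ⟩
        sumF (λ i → - h zero (suc i) * - h (suc i) zero)
          ≈⟨ sumF-cong (λ i → trans (solve 2 (λ a b → :- a :* :- b := a :* b) refl _ _) (hh zero (suc i))) ⟩
        sumF {suc m} (λ i → 1#) ≈⟨ sumF-1 (suc m) ⟩
        ιℕ (suc m) ∎

  -- The idempotents `b` mark the diagonal entries -1. A principal 2×2 minor is h(i,i) h(j,j) - 1
  -- because the off-diagonal product is 1, so that a₂, like a₁, depends on the diagonal alone.
  first-coefficients : ∀ n (h : Mat n) (b : Fin n → Carrier) → (∀ i j → h i j * h j i ≈ 1#) →
    (∀ i → h i i ≈ 1# - (b i + b i)) → (∀ i → b i * b i ≈ b i) →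
      c n (λ i j → - h i j) 0 ≈ 1#
    × c n (λ i j → - h i j) 1 ≈ sumF b + sumF b - ιℕ n
    × c n (λ i j → - h i j) 2 ≈ (sumF b + sumF b) * (sumF b - ιℕ n)
  first-coefficients zero h b hh hd bb = refl ,
    solve 0 (con (+ 0) := con (+ 0) :+ con (+ 0) :- con (+ 0)) refl ,
    solve 0 (con (+ 0) := (con (+ 0) :+ con (+ 0)) :* (con (+ 0) :- con (+ 0))) refl
  first-coefficients (suc n) h b hh hd bb
    with border n h hh | first-coefficients n (λ i j → h (suc i) (suc j)) (λ i → b (suc i))
           (λ i j → hh (suc i) (suc j)) (λ i → hd (suc i)) (λ i → bb (suc i))
  ... | R , R0 , R1 , R2 , eq | a0 , a1 , a2 =
    (begin
      c (suc n) (λ i j → - h i j) 0   ≈⟨ trans (eq 0) (+-cong (trans (lin-*-zero _ _ _) (*-congˡ a0)) (-‿cong R0)) ⟩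
      1# * 1# - 0#                    ≈⟨ solve 0 (con (+ 1) :* con (+ 1) :- con (+ 0) := con (+ 1)) refl ⟩
      1#                              ∎) ,
    (begin
      c (suc n) (λ i j → - h i j) 1   ≈⟨ trans (eq 1) (+-cong (trans (lin-*-suc _ _ _ 0) (+-cong (*-congˡ a1) (*-cong (-‿cong (hd zero)) a0))) (-‿cong R1)) ⟩
      1# * (τ + τ - ιℕ n) + - (1# - (b zero + b zero)) * 1# - 0#
        ≈⟨ solve 3 (λ t n b → con (+ 1) :* (t :+ t :- n) :+ :- (con (+ 1) :- (b :+ b)) :* con (+ 1) :- con (+ 0)
             := b :+ t :+ (b :+ t) :- (con (+ 1) :+ n)) refl τ (ιℕ n) (b zero) ⟩
      b zero + τ + (b zero + τ) - (1# + ιℕ n) ≈⟨ +-congˡ (-‿cong (ιℕ-suc n)) ⟨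
      b zero + τ + (b zero + τ) - ιℕ (suc n) ∎) ,
    (begin
      c (suc n) (λ i j → - h i j) 2   ≈⟨ trans (eq 2) (+-cong (trans (lin-*-suc _ _ _ 1) (+-cong (*-congˡ a2) (*-cong (-‿cong (hd zero)) a1))) (-‿cong R2)) ⟩
      1# * ((τ + τ) * (τ - ιℕ n)) + - (1# - (b zero + b zero)) * (τ + τ - ιℕ n) - ιℕ n
        ≈⟨ solve 3 (λ t n b → con (+ 1) :* ((t :+ t) :* (t :- n)) :+ :- (con (+ 1) :- (b :+ b)) :* (t :+ t :- n) :- n
             := (b :+ t :+ (b :+ t)) :* (b :+ t :- (con (+ 1) :+ n)) :+ (b :+ b :- (b :* b :+ b :* b))) refl τ (ιℕ n) (b zero) ⟩
      (b zero + τ + (b zero + τ)) * (b zero + τ - (1# + ιℕ n)) + (b zero + b zero - (b zero * b zero + b zero * b zero))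
        ≈⟨ +-cong (*-congˡ (+-congˡ (-‿cong (sym (ιℕ-suc n))))) (trans (+-congˡ (-‿cong (+-cong (bb zero) (bb zero)))) (-‿inverseʳ _)) ⟩
      (b zero + τ + (b zero + τ)) * (b zero + τ - ιℕ (suc n)) + 0# ≈⟨ +-identityʳ _ ⟩
      (b zero + τ + (b zero + τ)) * (b zero + τ - ιℕ (suc n)) ∎)
    where
    τ : Carrier
    τ = sumF (λ i → b (suc i))

-- Skew-symmetric determinants of even order

dbl : ℕ → ℕ
dbl zero = zero
dbl (suc n) = suc (suc (dbl n))

-- Elimination with pivot M₀₁ turns a skew-symmetric matrix into another one, of
-- smaller order, whose determinant differs by the square of the pivot.
module SkewDet (C : CR) (U : CommutativeRing.Carrier C → Set) where
  open CommutativeRing C hiding (zero)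
  open Algebra.Properties.Ring ring using (-0#≈0#)
  open Relation.Binary.Reasoning.Setoid setoid
  open Solve C
  open Det′ C
  open AltSum C

  private
    schur : ∀ n → Mat (suc (suc n)) → Carrier → Mat n
    schur n M v i j = M (suc (suc i)) (suc (suc j))
      + v * (M (suc zero) (suc (suc i)) * M zero (suc (suc j)) - M zero (suc (suc i)) * M (suc zero) (suc (suc j)))

    pivot : ∀ n (M : Mat (suc (suc n))) v → (∀ i → M i i ≈ 0#) → (∀ i j → M j i ≈ - M i j) →
      M zero (suc zero) * v ≈ 1# →
      det (suc (suc n)) M ≈ M zero (suc zero) * M zero (suc zero) * det n (schur n M v)
    pivot n M v diag skew uv = begin
      det (suc (suc n)) M
        ≈⟨ det-cong (suc (suc n)) {M} {w₀ ▹ (λ i → M (suc i))} (λ { zero j → refl ; (suc i) j → refl }) ⟩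
      det (suc (suc n)) (w₀ ▹ (λ i → M (suc i)))
        ≈⟨ det-addRow (suc n) w₀ (λ i → M (suc i)) δ ⟨
      det (suc (suc n)) (w₀ ▹ (λ i j → M (suc i) j + δ i * w₀ j))
        ≈⟨ alt-cong (λ j → *-congˡ (trans (det-cong (suc n) {λ r k → M (suc r) (punchIn j k) + δ r * w₀ (punchIn j k)} {w₁ j ▹ N j} (λ { zero k → trans (+-congˡ (zeroˡ _)) (+-identityʳ _) ; (suc i) k → refl }))
             (sym (det-addRow n (w₁ j) (N j) β)))) ⟩
      det (suc (suc n)) (w₀ ▹ M′)
        ≈⟨ det-col (suc n) (w₀ ▹ M′) ⟩
      alt (λ i → (w₀ ▹ M′) i zero * m i)
        ≈⟨ trans (alt-suc _) (+-congˡ (-‿cong (alt-suc _))) ⟩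
      w₀ zero * m zero - (w₁₀ zero * m (suc zero) - alt (λ i → M′ (suc i) zero * m (suc (suc i))))
        ≈⟨ +-cong (trans (*-congʳ (diag zero)) (zeroˡ _)) (-‿cong (+-cong (*-congʳ (skew zero (suc zero)))
             (trans (-‿cong (alt-0 (λ i → trans (*-congʳ (col₀ i)) (zeroˡ _)))) -0#≈0#))) ⟩
      0# - (- u * m (suc zero) + 0#)
        ≈⟨ solve 2 (λ u x → con (+ 0) :- (:- u :* x :+ con (+ 0)) := u :* x) refl _ _ ⟩
      u * m (suc zero)
        ≈⟨ *-congˡ (det-col-unit n (λ r c → (w₀ ▹ M′) (punchIn (suc zero) r) (suc c)) col₁) ⟩
      u * (u * det n (λ r c → M′ (suc r) (suc (suc c))))
        ≈⟨ trans (sym (*-assoc _ _ _)) (*-congˡ (det-cong n entry)) ⟩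
      u * u * det n (schur n M v) ∎
      where
      u : Carrier
      u = M zero (suc zero)
      w₀ w₁₀ : Fin (suc (suc n)) → Carrier
      w₀ = M zero
      w₁₀ = M (suc zero)
      α β : Fin n → Carrier
      -- Row 0 is zero in column 0 and u in column 1, row 1 is -u in column 0 and zero in column 1.
      -- Hence multiples of row 0 clear column 1 and multiples of row 1 clear column 0, without
      -- disturbing each other.
      α i = - (M (suc (suc i)) (suc zero) * v)
      β i = M (suc (suc i)) zero * v
      δ : Fin (suc n) → Carrier
      δ zero = 0#
      δ (suc i) = α i
      w₁ : Fin (suc (suc n)) → Fin (suc n) → Carrier
      w₁ j k = M (suc zero) (punchIn j k)
      N : Fin (suc (suc n)) → Fin n → Fin (suc n) → Carrier
      N j i k = M (suc (suc i)) (punchIn j k) + α i * w₀ (punchIn j k)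
      M′ : Fin (suc n) → Fin (suc (suc n)) → Carrier
      M′ = w₁₀ ▹ (λ i j → M (suc (suc i)) j + α i * w₀ j + β i * w₁₀ j)
      m : Fin (suc (suc n)) → Carrier
      m i = det (suc n) (λ r c → (w₀ ▹ M′) (punchIn i r) (suc c))
      col₀ : ∀ i → M′ (suc i) zero ≈ 0#
      col₀ i = begin
        M (suc (suc i)) zero + α i * M zero zero + β i * M (suc zero) zero
          ≈⟨ +-cong (+-congˡ (*-congˡ (diag zero))) (*-congˡ (skew zero (suc zero))) ⟩
        M (suc (suc i)) zero + α i * 0# + M (suc (suc i)) zero * v * - u
          ≈⟨ solve 4 (λ x a u v → x :+ a :* con (+ 0) :+ x :* v :* :- u := x :* (con (+ 1) :- u :* v)) refl _ _ _ _ ⟩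
        M (suc (suc i)) zero * (1# - u * v)
          ≈⟨ trans (*-congˡ (trans (+-congˡ (-‿cong uv)) (-‿inverseʳ _))) (zeroʳ _) ⟩
        0# ∎
      col₁ : ∀ i → M′ (suc i) (suc zero) ≈ 0#
      col₁ i = begin
        M (suc (suc i)) (suc zero) + α i * u + β i * M (suc zero) (suc zero)
          ≈⟨ +-congˡ (*-congˡ (diag (suc zero))) ⟩
        M (suc (suc i)) (suc zero) + α i * u + β i * 0#
          ≈⟨ solve 4 (λ x b u v → x :+ :- (x :* v) :* u :+ b :* con (+ 0) := x :* (con (+ 1) :- u :* v)) refl _ _ _ _ ⟩
        M (suc (suc i)) (suc zero) * (1# - u * v)
          ≈⟨ trans (*-congˡ (trans (+-congˡ (-‿cong uv)) (-‿inverseʳ _))) (zeroʳ _) ⟩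
        0# ∎
      entry : ∀ i j → M′ (suc i) (suc (suc j)) ≈ schur n M v i j
      entry i j = begin
        x + - (M (suc (suc i)) (suc zero) * v) * y + M (suc (suc i)) zero * v * z
          ≈⟨ +-cong (+-congˡ (*-congʳ (-‿cong (*-congʳ (skew (suc zero) (suc (suc i))))))) (*-congʳ (*-congʳ (skew zero (suc (suc i))))) ⟩
        x + - (- M (suc zero) (suc (suc i)) * v) * y + - M zero (suc (suc i)) * v * z
          ≈⟨ solve 6 (λ x a v y b z → x :+ :- (:- a :* v) :* y :+ :- b :* v :* z := x :+ v :* (a :* y :- b :* z)) refl _ _ _ _ _ _ ⟩
        schur n M v i j ∎
        where
        x y z : Carrier
        x = M (suc (suc i)) (suc (suc j))
        y = M zero (suc (suc j))
        z = M (suc zero) (suc (suc j))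

    schur-diag : ∀ n (M : Mat (suc (suc n))) v → (∀ i → M i i ≈ 0#) → ∀ i → schur n M v i i ≈ 0#
    schur-diag n M v diag i = trans (+-congʳ (diag (suc (suc i))))
      (solve 3 (λ v a b → con (+ 0) :+ v :* (a :* b :- b :* a) := con (+ 0)) refl
        v (M (suc zero) (suc (suc i))) (M zero (suc (suc i))))

    schur-skew : ∀ n (M : Mat (suc (suc n))) v → (∀ i j → M j i ≈ - M i j) → ∀ i j → schur n M v j i ≈ - schur n M v i j
    schur-skew n M v skew i j = trans (+-congʳ (skew (suc (suc i)) (suc (suc j))))
      (solve 6 (λ x v a b c d → :- x :+ v :* (a :* b :- c :* d) := :- (x :+ v :* (d :* c :- b :* a))) refl
        (M (suc (suc i)) (suc (suc j))) v (M (suc zero) (suc (suc j))) (M zero (suc (suc i)))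
        (M zero (suc (suc j))) (M (suc zero) (suc (suc i))))

  module _
    (U-unit : ∀ {u} → U u → ∃ (λ v → u * v ≈ 1#))
    (U-schur : ∀ {x a b c d} v → U x → U a → U b → U c → U d → U (x + v * (a * b - c * d)))
    where

    -- `U` is the invariant of the entries above the diagonal: it makes the pivot a unit, and by
    -- `U-schur` it passes to the eliminated matrix. The root is the product of the pivots, a
    -- Pfaffian up to sign.
    skew-det-square : ∀ r (M : Mat (dbl r)) → (∀ i → M i i ≈ 0#) → (∀ i j → M j i ≈ - M i j) →
      (∀ i j → i Fin.< j → U (M i j)) → ∃ (λ p → det (dbl r) M ≈ p * p)
    skew-det-square zero M diag skew upper = 1# , sym (*-identityˡ _)
    skew-det-square (suc r) M diag skew upper = u * proj₁ IH , trans (pivot (dbl r) M v diag skew uv)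
      (trans (*-congˡ (proj₂ IH)) (solve 2 (λ u p → u :* u :* (p :* p) := u :* p :* (u :* p)) refl u (proj₁ IH)))
      where
      u v : Carrier
      u = M zero (suc zero)
      v = proj₁ (U-unit (upper zero (suc zero) (ℕ.s≤s ℕ.z≤n)))
      uv : u * v ≈ 1#
      uv = proj₂ (U-unit (upper zero (suc zero) (ℕ.s≤s ℕ.z≤n)))
      row₀ : ∀ i → U (M zero (suc (suc i)))
      row₀ i = upper zero (suc (suc i)) (ℕ.s≤s ℕ.z≤n)
      row₁ : ∀ i → U (M (suc zero) (suc (suc i)))
      row₁ i = upper (suc zero) (suc (suc i)) (ℕ.s≤s (ℕ.s≤s ℕ.z≤n))
      IH : ∃ (λ p → det (dbl r) (schur (dbl r) M v) ≈ p * p)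
      IH = skew-det-square r (schur (dbl r) M v) (schur-diag (dbl r) M v diag) (schur-skew (dbl r) M v skew)
        (λ i j i<j → U-schur v (upper (suc (suc i)) (suc (suc j)) (ℕ.s≤s (ℕ.s≤s i<j))) (row₁ i) (row₀ j) (row₀ i) (row₁ j))

module Geometric (C : CR) where
  open CommutativeRing C hiding (zero)
  open Relation.Binary.Reasoning.Setoid setoid
  open Solve C
  open Pow C

  geom : ℕ → Carrier → Carrier
  geom zero x = 0#
  geom (suc n) x = 1# + x * geom n x

  geom-cong : ∀ n {x y} → x ≈ y → geom n x ≈ geom n y
  geom-cong zero e = refl
  geom-cong (suc n) e = +-congˡ (*-cong e (geom-cong n e))

  geom-telescope : ∀ n x → (1# - x) * geom n x ≈ 1# - x ^ n
  geom-telescope zero x = solve 1 (λ x → (con (+ 1) :- x) :* con (+ 0) := con (+ 1) :- con (+ 1)) refl x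
  geom-telescope (suc n) x = begin
    (1# - x) * (1# + x * geom n x)      ≈⟨ solve 2 (λ x g → (con (+ 1) :- x) :* (con (+ 1) :+ x :* g) := con (+ 1) :- x :+ x :* ((con (+ 1) :- x) :* g)) refl x (geom n x) ⟩
    1# - x + x * ((1# - x) * geom n x)  ≈⟨ +-congˡ (*-congˡ (geom-telescope n x)) ⟩
    1# - x + x * (1# - x ^ n)           ≈⟨ solve 2 (λ x g → con (+ 1) :- x :+ x :* (con (+ 1) :- g) := con (+ 1) :- x :* g) refl x (x ^ n) ⟩
    1# - x * x ^ n                      ∎

-- The sum of p i * p j over i < j with i + j = 2 m - 1.
module HalfSum (C : CR) where
  open CommutativeRing C hiding (zero)
  open Relation.Binary.Reasoning.Setoid setoid
  open Solve C
  open PowerSeries C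

  halfSum : Series → ℕ → Carrier
  halfSum p zero = 0#
  halfSum p (suc m) = p 0 * p (suc (dbl m)) + halfSum (tl p) m

  halfSum-cong : ∀ m {p q : Series} → (∀ i → i ℕ.< dbl m → p i ≈ q i) → halfSum p m ≈ halfSum q m
  halfSum-cong zero e = refl
  halfSum-cong (suc m) e = +-cong (*-cong (e 0 (ℕ.s≤s ℕ.z≤n)) (e (suc (dbl m)) ℕₚ.≤-refl))
    (halfSum-cong m (λ i i<m → e (suc i) (ℕ.s≤s (ℕₚ.m<n⇒m<1+n i<m))))

  private
    square-step : ∀ p k → (p *ˢ p) (suc (suc k)) ≈ p 0 * p (suc (suc k)) + p 0 * p (suc (suc k)) + (tl p *ˢ tl p) k
    square-step p k = begin
      (p *ˢ p) (suc (suc k))                                                 ≡⟨ *ˢ-suc p p (suc k) ⟩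
      p 0 * p (suc (suc k)) + (tl p *ˢ p) (suc k)                            ≈⟨ +-congˡ (*ˢ-sucʳ (tl p) p k) ⟩
      p 0 * p (suc (suc k)) + ((tl p *ˢ tl p) k + p (suc (suc k)) * p 0)     ≈⟨ solve 3 (λ a b c → a :* b :+ (c :+ b :* a) := a :* b :+ a :* b :+ c) refl _ _ _ ⟩
      p 0 * p (suc (suc k)) + p 0 * p (suc (suc k)) + (tl p *ˢ tl p) k       ∎

  -- An odd sum of two indices has no middle term, so every product occurs twice. In `square-even`
  -- the middle term is the square that remains modulo 2.
  square-odd : ∀ m p → (p *ˢ p) (suc (dbl m)) ≈ halfSum p (suc m) + halfSum p (suc m)
  square-odd zero p = trans (reflexive (≡.trans (*ˢ-suc p p 0) (≡.cong (λ z → p 0 * p 1 + z) (*ˢ-zero (tl p) p))))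
    (solve 2 (λ a b → a :* b :+ b :* a := a :* b :+ con (+ 0) :+ (a :* b :+ con (+ 0))) refl (p 0) (p 1))
  square-odd (suc m) p = trans (square-step p (suc (dbl m))) (trans (+-congˡ (square-odd m (tl p)))
    (solve 2 (λ a b → a :+ a :+ (b :+ b) := a :+ b :+ (a :+ b)) refl (p 0 * p (suc (suc (suc (dbl m))))) (halfSum (tl p) (suc m))))

  square-even : ∀ i p → ∃ (λ z → (p *ˢ p) (dbl i) ≈ p i * p i + (z + z))
  square-even zero p = 0# , trans (reflexive (*ˢ-zero p p)) (solve 1 (λ x → x := x :+ (con (+ 0) :+ con (+ 0))) refl _)
  square-even (suc i) p = p 0 * p (suc (suc (dbl i))) + proj₁ IH , trans (square-step p (dbl i)) (trans (+-congˡ (proj₂ IH))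
    (solve 3 (λ a b c → a :+ a :+ (b :+ (c :+ c)) := b :+ (a :+ c :+ (a :+ c))) refl _ _ _))
    where
    IH : ∃ (λ z → (tl p *ˢ tl p) (dbl i) ≈ tl p i * tl p i + (z + z))
    IH = square-even i (tl p)

hom-halfSum : ∀ {C D : CR} (h : Hom C D) m p →
  CommutativeRing._≈_ D (Hom.to h (HalfSum.halfSum C p m)) (HalfSum.halfSum D (λ k → Hom.to h (p k)) m)
hom-halfSum h zero p = Hom.0-hom h
hom-halfSum {C} {D} h (suc m) p = D.trans (Hom.+-hom h _ _) (D.+-cong (Hom.*-hom h _ _) (hom-halfSum h m (λ k → p (suc k))))
  where module D = CommutativeRing D

module DerivativeScale (C : CR) where
  open CommutativeRing C hiding (zero)
  open Relation.Binary.Reasoning.Setoid setoid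
  open Solve C
  open Pow C
  open AltSum C
  open Det′ C
  open Derivative C

  -- Homogeneity of degree n - 1 in Y. The extra factor a on the left avoids the exponent n - 1,
  -- which has no meaning at n = 0.
  ∂-scale : ∀ n a (Y L : Mat n) → a * ∂ n (λ i j → a * Y i j) L ≈ a ^ n * ∂ n Y L
  ∂-scale zero a Y L = trans (zeroʳ _) (sym (zeroʳ _))
  ∂-scale (suc n) a Y L = begin
    a * ∂ (suc n) (λ i j → a * Y i j) L
      ≈⟨ trans (*-congˡ (∂-suc n (λ i j → a * Y i j) L)) (sym (alt-*ˡ a _)) ⟩
    alt (λ j → a * (L zero j * det n (λ r c → a * Yⱼ j r c) + a * Y zero j * ∂ n (λ r c → a * Yⱼ j r c) (Lⱼ j)))
      ≈⟨ alt-cong (λ j → trans (solve 5 (λ a l x y z → a :* (l :* x :+ a :* y :* z) := a :* (l :* x) :+ a :* (y :* (a :* z))) refl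
             a (L zero j) (det n (λ r c → a * Yⱼ j r c)) (Y zero j) (∂ n (λ r c → a * Yⱼ j r c) (Lⱼ j)))
           (+-cong (*-congˡ (*-congˡ (det-scale n a (Yⱼ j)))) (*-congˡ (*-congˡ (∂-scale n a (Yⱼ j) (Lⱼ j)))))) ⟩
    alt (λ j → a * (L zero j * (a ^ n * det n (Yⱼ j))) + a * (Y zero j * (a ^ n * ∂ n (Yⱼ j) (Lⱼ j))))
      ≈⟨ alt-cong (λ j → solve 6 (λ a l b x y z → a :* (l :* (b :* x)) :+ a :* (y :* (b :* z)) := a :* b :* (l :* x :+ y :* z)) refl
             a (L zero j) (a ^ n) (det n (Yⱼ j)) (Y zero j) (∂ n (Yⱼ j) (Lⱼ j))) ⟩
    alt (λ j → a ^ suc n * (L zero j * det n (Yⱼ j) + Y zero j * ∂ n (Yⱼ j) (Lⱼ j)))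
      ≈⟨ trans (alt-*ˡ (a ^ suc n) _) (*-congˡ (sym (∂-suc n Y L))) ⟩
    a ^ suc n * ∂ (suc n) Y L ∎
    where
    Yⱼ Lⱼ : Fin (suc n) → Mat n
    Yⱼ j r c = Y (suc r) (punchIn j c)
    Lⱼ j r c = L (suc r) (punchIn j c)

  neg1^dbl : ∀ r → (- 1#) ^ dbl r ≈ 1#
  neg1^dbl zero = refl
  neg1^dbl (suc r) = trans (*-congˡ (*-congˡ (neg1^dbl r))) (solve 0 (:- con (+ 1) :* (:- con (+ 1) :* con (+ 1)) := con (+ 1)) refl)

  -- For skew Y of even order, adj Y is skew, so its entries sum to zero (up to 2-torsion).
  ∂-skew : ∀ r (Y : Mat (dbl r)) → (∀ i j → Y j i ≈ - Y i j) → ∂ (dbl r) Y ones ≈ - ∂ (dbl r) Y ones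
  ∂-skew r Y skew = begin
    ∂ (dbl r) Y ones                                ≈⟨ ∂-transpose (dbl r) Y ones ⟨
    ∂ (dbl r) (λ i j → Y j i) ones                  ≈⟨ ∂-cong (dbl r) (λ i j → trans (skew i j) (neg1 _)) (λ _ _ → refl) ⟩
    ∂ (dbl r) (λ i j → - 1# * Y i j) ones           ≈⟨ solve 1 (λ x → x := :- (:- con (+ 1) :* x)) refl _ ⟩
    - (- 1# * ∂ (dbl r) (λ i j → - 1# * Y i j) ones)  ≈⟨ -‿cong (∂-scale (dbl r) (- 1#) Y ones) ⟩
    - ((- 1#) ^ dbl r * ∂ (dbl r) Y ones)           ≈⟨ -‿cong (trans (*-congʳ (neg1^dbl r)) (*-identityˡ _)) ⟩
    - ∂ (dbl r) Y ones                              ∎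
    where
    neg1 : ∀ x → - x ≈ - 1# * x
    neg1 = solve 1 (λ x → :- x := :- con (+ 1) :* x) refl

module F₂ = Quotient ℤᶜ (+ 2)

-- Integral skew-symmetric matrices and their determinants modulo 4

module SkewInteger where
  open PowerSeries ℤᶜ
  open Charpoly ℤᶜ using (c; d; I+x; module S; module Sᴹ; module Sᴰ; c-scale)
  open HalfSum ℤᶜ
  open Det′ ℤᶜ using (Mat; idMat)
  module ZD = Derivative ℤᶜ
  module ZS = Solve ℤᶜ
  module SS = Solve PS
  module SP = Pow PS
  module ZP = Pow ℤᶜ

  neg-self : ∀ (z : ℤ) → z ≡ ℤ.- z → z ≡ + 0
  neg-self (+ zero) e = ≡.refl
  neg-self (+ suc n) ()
  neg-self -[1+ n ] ()

  double-cancel : ∀ x y → x ℤ.+ x ≡ y ℤ.+ y → x ≡ y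
  double-cancel x y e = ℤₚ.*-cancelˡ-≡ (+ 2) x y (≡.trans (≡.sym (two x)) (≡.trans e (two y)))
    where
    two : ∀ x → x ℤ.+ x ≡ + 2 ℤ.* x
    two = ZS.solve 1 (λ x → x ZS.:+ x ZS.:= ZS.con (+ 2) ZS.:* x) ≡.refl

  private
    U : Series → Set
    U f = f 0 ≡ + 1

    X^-below : ∀ L f k → k ℕ.< L → (f *ˢ (X SP.^ L)) k ≡ + 0
    X^-below (suc L) f k k<L = ≡.trans (S.trans (S.*-congˡ {f} (S.*-comm X (X SP.^ L))) (S.trans (S.sym (S.*-assoc f (X SP.^ L) X)) (S.*-comm (f *ˢ (X SP.^ L)) X)) k) (go k k<L)
      where
      go : ∀ k → k ℕ.< suc L → (X *ˢ (f *ˢ (X SP.^ L))) k ≡ + 0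
      go zero _ = lin-*-zero _ _ (f *ˢ (X SP.^ L))
      go (suc k) (ℕ.s≤s k<L) = ≡.trans (X-*-suc (f *ˢ (X SP.^ L)) k) (X^-below L f k k<L)

  module Truncated (L : ℕ) where
    module Q = Quotient PS (X SP.^ L)
    module QR = CommutativeRing Q.Quot

    ~-below : ∀ {f g} → f Q.~ g → ∀ k → k ℕ.< L → f k ≡ g k
    ~-below {f} {g} (h , eq) k k<L = ℤₚ.i-j≡0⇒i≡j (f k) (g k)
      (≡.trans (≡.sym (≡.trans (+ˢ-at f _ k) (≡.cong (λ z → f k ℤ.+ z) (-ˢ-at g k)))) (≡.trans (eq k) (X^-below L h k k<L)))

    -- Constant term 1 means u = 1 - xg, and the finite geometric sum in xg inverts this modulo x^L.
    U-unit : ∀ {u} → U u → ∃ (λ v → (u *ˢ v) Q.~ S.1#)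
    U-unit {u} u0 = geom L (X *ˢ g) , S.- (g SP.^ L) ,
      S.trans (S.+-congʳ (S.trans (S.*-congʳ {geom L (X *ˢ g)} split) (geom-telescope L (X *ˢ g))))
      (S.trans (S.+-congʳ (S.+-congˡ (S.-‿cong (SP.^-*-distrib X g L))))
      (SS.solve 2 (λ a b → SS.con (+ 1) SS.:- a SS.:* b SS.:- SS.con (+ 1) SS.:= (SS.:- b) SS.:* a) S.refl (X SP.^ L) (g SP.^ L)))
      where
      open Geometric PS
      g : Series
      g = S.- tl u
      split : u ≈ˢ (S.1# S.- X *ˢ g)
      split k = ≡.sym (≡.trans (+ˢ-at S.1# _ k) (≡.trans (≡.cong (λ z → S.1# k ℤ.+ z) (-ˢ-at (X *ˢ g) k)) (at k)))
        where
        at : ∀ k → S.1# k ℤ.+ ℤ.- (X *ˢ g) k ≡ u k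
        at zero = ≡.trans (≡.cong (λ z → + 1 ℤ.+ ℤ.- z) (lin-*-zero _ _ g)) (≡.sym u0)
        at (suc k) = ≡.trans (≡.cong (λ z → + 0 ℤ.+ ℤ.- z) (≡.trans (X-*-suc g k) (-ˢ-at (tl u) k)))
          (ZS.solve 1 (λ x → ZS.con (+ 0) ZS.:+ ZS.:- (ZS.:- x) ZS.:= x) ≡.refl (u (suc k)))

    -- The constant term of ab - ef is 1 - 1 = 0, so that x keeps its constant term 1 for every v.
    U-schur : ∀ {x a b e f} v → U x → U a → U b → U e → U f → U (x S.+ v *ˢ (a *ˢ b S.- e *ˢ f))
    U-schur {x} {a} {b} {e} {f} v ux ua ub ue uf = ≡.trans (+ˢ-at x _ 0) (≡.cong₂ ℤ._+_ ux (≡.trans (*ˢ-zero v _)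
      (≡.trans (≡.cong (v 0 ℤ.*_) (≡.trans (+ˢ-at (a *ˢ b) _ 0) (≡.trans (≡.cong (λ w → (a *ˢ b) 0 ℤ.+ w) (-ˢ-at (e *ˢ f) 0))
        (≡.cong₂ (λ y z → y ℤ.+ ℤ.- z) (≡.trans (*ˢ-zero a b) (≡.cong₂ ℤ._*_ ua ub)) (≡.trans (*ˢ-zero e f) (≡.cong₂ ℤ._*_ ue uf))))))
        (ℤₚ.*-zeroʳ (v 0)))))

    square : ∀ r (M : Sᴹ.Mat (dbl r)) → (∀ i → M i i ≈ˢ S.0#) → (∀ i j → M j i ≈ˢ S.- M i j) →
      (∀ i j → i Fin.< j → U (M i j)) → ∃ (λ p → ∀ k → k ℕ.< L → Sᴹ.det (dbl r) M k ≡ (p *ˢ p) k)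
    square r M diag skew up = proj₁ sq , λ k k<L →
      ~-below (QR.trans (hom-det Q.quot (dbl r) M) (proj₂ sq)) k k<L
      where
      sq : ∃ (λ p → Det′.det Q.Quot (dbl r) M Q.~ (p *ˢ p))
      sq = SkewDet.skew-det-square Q.Quot U U-unit U-schur r M
        (λ i → Q.≈⇒~ (diag i)) (λ i j → Q.≈⇒~ (skew i j)) up

  sgn : ∀ {n} → Mat n
  sgn i j = ZD.upper i j ℤ.- ZD.upper j i

  sgn-1 : ∀ {n} (i j : Fin n) → i Fin.< j → sgn i j ≡ + 1
  sgn-1 zero (suc j) _ = ≡.refl
  sgn-1 (suc i) (suc j) (ℕ.s≤s i<j) = sgn-1 i j i<j

  -- Because J = I + N + Nᵀ, adding J to the skew-symmetric N - Nᵀ removes Nᵀ and doubles N.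
  sgn+1 : ∀ n (i j : Fin n) → sgn i j ℤ.+ + 1 ≡ idMat n i j ℤ.+ (+ 2) ℤ.* ZD.upper i j
  sgn+1 (suc n) zero zero = ≡.refl
  sgn+1 (suc n) zero (suc j) = ≡.refl
  sgn+1 (suc n) (suc i) zero = ≡.refl
  sgn+1 (suc n) (suc i) (suc j) = sgn+1 n i j

  module Odd (r : ℕ) (B : Mat (suc (dbl r))) (diag : ∀ i → B i i ≡ + 0) (skew : ∀ i j → B j i ≡ ℤ.- B i j) where
    n : ℕ
    n = suc (dbl r)

    -- The skew-symmetric N - Nᵀ + xB, bordered by a row of ones to make its order even. The border
    -- and N give constant term 1 to every entry above the diagonal, as elimination requires, and
    -- adding J turns the first column into a unit vector.
    Xm : Sᴹ.Mat (suc n)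
    Xm zero zero = S.0#
    Xm zero (suc j) = S.1#
    Xm (suc i) zero = S.- S.1#
    Xm (suc i) (suc j) = lin (sgn i j) (B i j)

    Xm-diag : ∀ i → Xm i i ≈ˢ S.0#
    Xm-diag zero k = ≡.refl
    Xm-diag (suc i) zero = ℤₚ.+-inverseʳ (ZD.upper i i)
    Xm-diag (suc i) (suc zero) = diag i
    Xm-diag (suc i) (suc (suc k)) = ≡.refl

    Xm-skew : ∀ i j → Xm j i ≈ˢ S.- Xm i j
    Xm-skew zero zero k = ≡.sym (-ˢ-at S.0# k)
    Xm-skew zero (suc j) k = ≡.refl
    Xm-skew (suc i) zero = SS.solve 0 (SS.con (+ 1) SS.:= SS.:- (SS.:- SS.con (+ 1))) S.refl
    Xm-skew (suc i) (suc j) k = ≡.trans (at k) (≡.sym (-ˢ-at (lin (sgn i j) (B i j)) k))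
      where
      at : ∀ k → lin (sgn j i) (B j i) k ≡ ℤ.- lin (sgn i j) (B i j) k
      at zero = ZS.solve 2 (λ x y → y ZS.:- x ZS.:= ZS.:- (x ZS.:- y)) ≡.refl (ZD.upper i j) (ZD.upper j i)
      at (suc zero) = skew i j
      at (suc (suc k)) = ≡.refl

    Xm-upper : ∀ i j → i Fin.< j → U (Xm i j)
    Xm-upper zero (suc j) _ = ≡.refl
    Xm-upper (suc i) (suc j) (ℕ.s≤s i<j) = sgn-1 i j i<j

    two : Series
    two = S.1# S.+ S.1#

    W : Sᴹ.Mat n
    W i j = I+x n B i j S.+ two S.* Sᴰ.upper i j

    W-entry : ∀ i j → (Xm (suc i) (suc j) S.+ S.1#) ≈ˢ W i j
    W-entry i j k = ≡.trans (+ˢ-at _ _ k) (≡.trans (at k) (≡.sym (≡.trans (+ˢ-at _ _ k)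
      (≡.cong (λ w → I+x n B i j k ℤ.+ w) (S.trans (S.*-cong (SS.solve 0 (SS.con (+ 1) SS.:+ SS.con (+ 1) SS.:= SS.con (+ 2)) S.refl) (S.sym (hom-upper constʰ i j))) (S.trans (S.*-congʳ (S.sym (hom-ι constʰ (+ 2)))) (S.sym (Hom.*-hom constʰ (+ 2) (ZD.upper i j)))) k)))))
      where
      at : ∀ k → lin (sgn i j) (B i j) k ℤ.+ S.1# k ≡ lin (idMat n i j) (B i j) k ℤ.+ const (+ 2 ℤ.* ZD.upper i j) k
      at zero = sgn+1 n i j
      at (suc k) = ≡.refl

    -- Adding J changes the determinant by its derivative along J. For a skew-symmetric matrix of
    -- even order this derivative is its own negative, hence 0 in ℤ. Afterwards the first column is
    -- a unit vector and the corner minor is `W`.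
    det-Xm : ∀ k → Sᴹ.det (suc n) Xm k ≡ Sᴹ.det n W k
    det-Xm k = begin
      Sᴹ.det (suc n) Xm k
        ≡⟨ ℤₚ.+-identityʳ _ ⟨
      Sᴹ.det (suc n) Xm k ℤ.+ + 0
        ≡⟨ ≡.cong (λ w → Sᴹ.det (suc n) Xm k ℤ.+ w) (neg-self _ (≡.trans (DerivativeScale.∂-skew PS (suc r) Xm Xm-skew k) (-ˢ-at _ k))) ⟨
      Sᴹ.det (suc n) Xm k ℤ.+ Sᴰ.∂ (suc n) Xm Sᴰ.ones k
        ≡⟨ ≡.cong (λ w → Sᴹ.det (suc n) Xm k ℤ.+ w) (S.*-identityˡ (Sᴰ.∂ (suc n) Xm Sᴰ.ones) k) ⟨
      Sᴹ.det (suc n) Xm k ℤ.+ (S.1# S.* Sᴰ.∂ (suc n) Xm Sᴰ.ones) k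
        ≡⟨ +ˢ-at _ _ k ⟨
      (Sᴹ.det (suc n) Xm S.+ S.1# S.* Sᴰ.∂ (suc n) Xm Sᴰ.ones) k
        ≡⟨ Sᴰ.det-rank1 (suc n) Xm S.1# k ⟨
      Sᴹ.det (suc n) (λ i j → Xm i j S.+ S.1#) k
        ≡⟨ Sᴹ.det-col-unit n (λ i j → Xm i j S.+ S.1#) (λ i → S.-‿inverseˡ S.1#) k ⟩
      ((S.0# S.+ S.1#) S.* Sᴹ.det n (λ i j → Xm (suc i) (suc j) S.+ S.1#)) k
        ≡⟨ S.trans (S.*-cong (S.+-identityˡ S.1#) (Sᴹ.det-cong n W-entry)) (S.*-identityˡ _) k ⟩
      Sᴹ.det n W k ∎
      where open ≡.≡-Reasoning

    module Q₄ = Quotient PS (two S.* two)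
    module QR = CommutativeRing Q₄.Quot

    -- The square of 2 vanishes modulo 4, so the summand 2N counts only to first order.
    det-W : Sᴹ.det n W Q₄.~ (Sᴹ.det n (I+x n B) S.+ two S.* Sᴰ.∂ n (I+x n B) Sᴰ.upper)
    det-W = QR.trans (hom-det Q₄.quot n W)
      (QR.trans (Derivative.det-square-zero Q₄.Quot n (I+x n B) Sᴰ.upper two (S.1# , (S.trans (S.+-congˡ (SP′.-0#≈0#)) (S.trans (S.+-identityʳ _) (S.sym (S.*-identityˡ _))))))
      (QR.sym (QR.+-cong (hom-det Q₄.quot n (I+x n B)) (QR.*-congˡ {two} (hom-∂ Q₄.quot n (I+x n B) Sᴰ.upper)))))
      where module SP′ = Algebra.Properties.Ring S.ring

    two-* : ∀ f k → (two S.* f) k ≡ f k ℤ.+ f k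
    two-* f k = ≡.trans (SS.solve 1 (λ x → (SS.con (+ 1) SS.:+ SS.con (+ 1)) SS.:* x SS.:= x SS.:+ x) S.refl f k) (+ˢ-at f f k)

    det-W-at : ∀ k → ∃ (λ z → Sᴹ.det n W k ≡ c n B k ℤ.+ (d n B k ℤ.+ d n B k) ℤ.+ (z ℤ.+ z ℤ.+ (z ℤ.+ z)))
    det-W-at k = proj₁ det-W k , (begin
      Sᴹ.det n W k
        ≡⟨ ZS.solve 2 (λ x y → x ZS.:= y ZS.:+ (x ZS.:- y)) ≡.refl (Sᴹ.det n W k) (R k) ⟩
      R k ℤ.+ (Sᴹ.det n W k ℤ.- R k)
        ≡⟨ ≡.cong (λ w → R k ℤ.+ w) (≡.trans (≡.cong (λ w → Sᴹ.det n W k ℤ.+ w) (≡.sym (-ˢ-at R k))) (≡.trans (≡.sym (+ˢ-at (Sᴹ.det n W) (S.- R) k)) (proj₂ det-W k))) ⟩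
      R k ℤ.+ (z S.* (two S.* two)) k
        ≡⟨ ≡.cong₂ ℤ._+_ (≡.trans (+ˢ-at _ _ k) (≡.cong (λ w → c n B k ℤ.+ w) (two-* _ k)))
             (≡.trans (SS.solve 2 (λ x t → x SS.:* (t SS.:* t) SS.:= t SS.:* (t SS.:* x)) S.refl z two k) (≡.trans (two-* (two S.* z) k) (≡.cong₂ ℤ._+_ (two-* z k) (two-* z k)))) ⟩
      c n B k ℤ.+ (d n B k ℤ.+ d n B k) ℤ.+ (z k ℤ.+ z k ℤ.+ (z k ℤ.+ z k)) ∎)
      where
      open ≡.≡-Reasoning
      z R : Series
      z = proj₁ det-W
      R = Sᴹ.det n (I+x n B) S.+ two S.* Sᴰ.∂ n (I+x n B) Sᴰ.upper

    neg1^odd : ∀ m → (ℤ.- + 1) ZP.^ suc (dbl m) ≡ ℤ.- + 1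
    neg1^odd m = ≡.cong ((ℤ.- + 1) ℤ.*_) (DerivativeScale.neg1^dbl ℤᶜ m)

    -- Transposing B replaces x by -x and fixes the determinant, so det (I + xB) is an even
    -- polynomial.
    c-odd : ∀ m → c n B (suc (dbl m)) ≡ + 0
    c-odd m = neg-self _ (begin
      c n B (suc (dbl m))
        ≡⟨ Sᴹ.det-transpose n (I+x n B) (suc (dbl m)) ⟨
      Sᴹ.det n (λ i j → I+x n B j i) (suc (dbl m))
        ≡⟨ Sᴹ.det-cong n (λ i j → lin-cong (ZD.idMat-sym n j i) (≡.trans (skew i j) (≡.sym (ℤₚ.-1*i≡-i (B i j))))) (suc (dbl m)) ⟩
      c n (λ i j → (ℤ.- + 1) ℤ.* B i j) (suc (dbl m))
        ≡⟨ c-scale n (ℤ.- + 1) B (suc (dbl m)) ⟩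
      (ℤ.- + 1) ZP.^ suc (dbl m) ℤ.* c n B (suc (dbl m))
        ≡⟨ ≡.trans (≡.cong (ℤ._* c n B (suc (dbl m))) (neg1^odd m)) (ℤₚ.-1*i≡-i _) ⟩
      ℤ.- c n B (suc (dbl m)) ∎)
      where open ≡.≡-Reasoning

    square-root : ∀ L → ∃ (λ p → ∀ k → k ℕ.< L → (p *ˢ p) k ≡ Sᴹ.det n W k)
    square-root L = proj₁ sq , λ k k<L → ≡.trans (≡.sym (proj₂ sq k k<L)) (det-Xm k)
      where
      sq : ∃ (λ p → ∀ k → k ℕ.< L → Sᴹ.det (dbl (suc r)) Xm k ≡ (p *ˢ p) k)
      sq = Truncated.square L (suc r) Xm Xm-diag Xm-skew Xm-upper

    even-square : ∀ (x : ℤ) → (x ℤ.* x) F₂.~ x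
    even-square x = go x
      where
      nat : ∀ m → (+ m ℤ.* + m) F₂.~ (+ m)
      nat zero = F₂.≈⇒~ {+ 0} ≡.refl
      nat (suc m) = proj₁ (nat m) ℤ.+ + m , ≡.trans
        (ZS.solve 1 (λ x → (ZS.con (+ 1) ZS.:+ x) ZS.:* (ZS.con (+ 1) ZS.:+ x) ZS.:- (ZS.con (+ 1) ZS.:+ x)
          ZS.:= (x ZS.:* x ZS.:- x) ZS.:+ x ZS.:* ZS.con (+ 2)) ≡.refl (+ m))
        (≡.trans (≡.cong (ℤ._+ + m ℤ.* + 2) (proj₂ (nat m))) (≡.sym (ℤₚ.*-distribʳ-+ (+ 2) (proj₁ (nat m)) (+ m))))
      go : ∀ x → (x ℤ.* x) F₂.~ x
      go (+ m) = nat m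
      go -[1+ m ] = proj₁ (nat (suc m)) ℤ.+ + suc m , ≡.trans
        (ZS.solve 1 (λ x → (ZS.:- x) ZS.:* (ZS.:- x) ZS.:- (ZS.:- x) ZS.:= (x ZS.:* x ZS.:- x) ZS.:+ x ZS.:* ZS.con (+ 2)) ≡.refl (+ suc m))
        (≡.trans (≡.cong (ℤ._+ + suc m ℤ.* + 2) (proj₂ (nat (suc m)))) (≡.sym (ℤₚ.*-distribʳ-+ (+ 2) (proj₁ (nat (suc m))) (+ suc m))))

    -- Compares p² with det (I + xB) + 2 ∂_N modulo 4. An even coefficient reduces modulo 2 to the
    -- middle square, and p i squared is p i modulo 2. In an odd coefficient det (I + xB) vanishes
    -- and both remaining sides are doubled, so dividing by 2 leaves ∂_N modulo 2.
    half-identity : ∀ L → ∃ (λ p →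
      (∀ i → dbl i ℕ.< L → p i F₂.~ c n B (dbl i)) ×
      (∀ m → suc (dbl m) ℕ.< L → d n B (suc (dbl m)) F₂.~ halfSum p (suc m)))
    half-identity L = p ,
      (λ i i<L → F.trans {p i} {p i ℤ.* p i} {c n B (dbl i)} (F.sym {p i ℤ.* p i} {p i} (even-square (p i))) (even i (proj₁ (square-even i p)) (proj₂ (square-even i p)) i<L (proj₁ (det-W-at (dbl i))) (proj₂ (det-W-at (dbl i))))) ,
      (λ m m<L → odd m m<L (proj₁ (det-W-at (suc (dbl m)))) (proj₂ (det-W-at (suc (dbl m)))))
      where
      module F = CommutativeRing F₂.Quot
      p : Series
      p = proj₁ (square-root L)
      pp : ∀ k → k ℕ.< L → (p *ˢ p) k ≡ Sᴹ.det n W k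
      pp = proj₂ (square-root L)
      even : ∀ i y → (p *ˢ p) (dbl i) ≡ p i ℤ.* p i ℤ.+ (y ℤ.+ y) → dbl i ℕ.< L → ∀ z →
        Sᴹ.det n W (dbl i) ≡ c n B (dbl i) ℤ.+ (d n B (dbl i) ℤ.+ d n B (dbl i)) ℤ.+ (z ℤ.+ z ℤ.+ (z ℤ.+ z)) →
        (p i ℤ.* p i) F₂.~ c n B (dbl i)
      even i y ey i<L z ez = d n B (dbl i) ℤ.+ (z ℤ.+ z) ℤ.- y , (begin
        p i ℤ.* p i ℤ.- C
          ≡⟨ ZS.solve 3 (λ q y C → q ZS.:- C ZS.:= (q ZS.:+ (y ZS.:+ y)) ZS.:- C ZS.:- (y ZS.:+ y)) ≡.refl (p i ℤ.* p i) y C ⟩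
        (p i ℤ.* p i ℤ.+ (y ℤ.+ y)) ℤ.- C ℤ.- (y ℤ.+ y)
          ≡⟨ ≡.cong (λ q → q ℤ.- C ℤ.- (y ℤ.+ y)) (≡.trans (≡.sym ey) (≡.trans (pp (dbl i) i<L) ez)) ⟩
        C ℤ.+ (D ℤ.+ D) ℤ.+ (z ℤ.+ z ℤ.+ (z ℤ.+ z)) ℤ.- C ℤ.- (y ℤ.+ y)
          ≡⟨ ZS.solve 4 (λ C D z y → C ZS.:+ (D ZS.:+ D) ZS.:+ (z ZS.:+ z ZS.:+ (z ZS.:+ z)) ZS.:- C ZS.:- (y ZS.:+ y)
               ZS.:= (D ZS.:+ (z ZS.:+ z) ZS.:- y) ZS.:* ZS.con (+ 2)) ≡.refl C D z y ⟩
        (D ℤ.+ (z ℤ.+ z) ℤ.- y) ℤ.* + 2 ∎)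
        where
        open ≡.≡-Reasoning
        C D : ℤ
        C = c n B (dbl i)
        D = d n B (dbl i)
      odd : ∀ m → suc (dbl m) ℕ.< L → ∀ z →
        Sᴹ.det n W (suc (dbl m)) ≡ c n B (suc (dbl m)) ℤ.+ (d n B (suc (dbl m)) ℤ.+ d n B (suc (dbl m))) ℤ.+ (z ℤ.+ z ℤ.+ (z ℤ.+ z)) →
        d n B (suc (dbl m)) F₂.~ halfSum p (suc m)
      odd m m<L z ez = ℤ.- z , ≡.trans (≡.cong (λ w → D ℤ.- w) h≡) (ZS.solve 2 (λ D z → D ZS.:- (D ZS.:+ (z ZS.:+ z)) ZS.:= (ZS.:- z) ZS.:* ZS.con (+ 2)) ≡.refl D z)
        where
        open ≡.≡-Reasoning
        D : ℤ
        D = d n B (suc (dbl m))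
        h≡ : halfSum p (suc m) ≡ D ℤ.+ (z ℤ.+ z)
        h≡ = double-cancel _ _ (begin
          halfSum p (suc m) ℤ.+ halfSum p (suc m)                      ≡⟨ square-odd m p ⟨
          (p *ˢ p) (suc (dbl m))                                       ≡⟨ ≡.trans (pp (suc (dbl m)) m<L) ez ⟩
          c n B (suc (dbl m)) ℤ.+ (D ℤ.+ D) ℤ.+ (z ℤ.+ z ℤ.+ (z ℤ.+ z))  ≡⟨ ≡.cong (λ q → q ℤ.+ (D ℤ.+ D) ℤ.+ (z ℤ.+ z ℤ.+ (z ℤ.+ z))) (c-odd m) ⟩
          + 0 ℤ.+ (D ℤ.+ D) ℤ.+ (z ℤ.+ z ℤ.+ (z ℤ.+ z))                 ≡⟨ ZS.solve 2 (λ D z → ZS.con (+ 0) ZS.:+ (D ZS.:+ D) ZS.:+ (z ZS.:+ z ZS.:+ (z ZS.:+ z)) ZS.:= D ZS.:+ (z ZS.:+ z) ZS.:+ (D ZS.:+ (z ZS.:+ z))) ≡.refl D z ⟩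
          D ℤ.+ (z ℤ.+ z) ℤ.+ (D ℤ.+ (z ℤ.+ z))                         ∎)

-- Counting the digits below a given power

module Counting where
  open import Data.Nat hiding (parity)
  open import Data.Nat.Properties
  open import Data.Fin using (inject≤)
  open ≡ using (refl; sym; trans; cong; subst)

  data Parity : ℕ → Set where
    even : ∀ m → Parity (dbl m)
    odd  : ∀ m → Parity (suc (dbl m))

  parity : ∀ n → Parity n
  parity zero = even 0
  parity (suc n) with parity n
  ... | even m = odd m
  ... | odd m = even (suc m)

  dbl-+ : ∀ n → dbl n ≡ n + n
  dbl-+ zero = refl
  dbl-+ (suc n) = cong suc (trans (cong suc (dbl-+ n)) (sym (+-suc n n)))

  dbl-mono : ∀ {m n} → m ≤ n → dbl m ≤ dbl n
  dbl-mono z≤n = z≤n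
  dbl-mono (s≤s le) = s≤s (s≤s (dbl-mono le))

  sumTo : (ℕ → ℕ) → ℕ → ℕ
  sumTo w zero = 0
  sumTo w (suc M) = sumTo w M + w M

  module _ (u c : ℕ → ℕ) (count : ∀ e i → u i ≤ e → i < c e) where
    private
      crude : ∀ e M → sumTo (λ i → suc e ∸ u i) M ≤ sumTo (λ i → e ∸ u i) M + M
      crude e zero = z≤n
      crude e (suc M) = begin
        sumTo (λ i → suc e ∸ u i) M + (suc e ∸ u M)        ≤⟨ +-mono-≤ (crude e M) (suc∸≤ e (u M)) ⟩
        sumTo (λ i → e ∸ u i) M + M + suc (e ∸ u M)
          ≡⟨ +-*-Solver.solve 3 (λ s m x → s :+ m :+ (con 1 :+ x) := s :+ x :+ (con 1 :+ m)) refl _ M (e ∸ u M) ⟩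
        sumTo (λ i → e ∸ u i) M + (e ∸ u M) + suc M        ∎
        where
        open ≤-Reasoning
        open +-*-Solver using (_:+_; _:=_; con)
        suc∸≤ : ∀ a b → suc a ∸ b ≤ suc (a ∸ b)
        suc∸≤ a zero = ≤-refl
        suc∸≤ zero (suc b) = ≤-trans (m∸n≤m 0 b) z≤n
        suc∸≤ (suc a) (suc b) = suc∸≤ a b

      -- Raising e by one lengthens the code of index i only if u i is at most e. If the last index
      -- has this property, then by `count` the total number of indices is at most c e and one unit
      -- for each is affordable; otherwise the last index contributes nothing.
      step : ∀ e M → sumTo (λ i → suc e ∸ u i) M ≤ sumTo (λ i → e ∸ u i) M + c e
      step e zero = z≤n
      step e (suc M) with u M ≤? e
      ... | yes le = ≤-trans (crude e (suc M)) (+-monoʳ-≤ (sumTo (λ i → e ∸ u i) (suc M)) (count e M le))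
      ... | no nle = begin
        sumTo (λ i → suc e ∸ u i) M + (suc e ∸ u M)     ≡⟨ cong (λ z → sumTo (λ i → suc e ∸ u i) M + z) (m≤n⇒m∸n≡0 (≰⇒> nle)) ⟩
        sumTo (λ i → suc e ∸ u i) M + 0                 ≡⟨ +-identityʳ _ ⟩
        sumTo (λ i → suc e ∸ u i) M                     ≤⟨ step e M ⟩
        sumTo (λ i → e ∸ u i) M + c e                   ≤⟨ +-monoˡ-≤ (c e) (m≤m+n _ (e ∸ u M)) ⟩
        sumTo (λ i → e ∸ u i) M + (e ∸ u M) + c e       ∎
        where open ≤-Reasoning

      zero-sum : ∀ M → sumTo (λ i → 0 ∸ u i) M ≡ 0
      zero-sum zero = refl
      zero-sum (suc M) = ≡.cong₂ _+_ (zero-sum M) (0∸n≡0 (u M))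

    -- Exchange of summation: e ∸ u counts the e′ < e with u ≤ e′.
    sumTo-∸ : ∀ e M → sumTo (λ i → e ∸ u i) M ≤ sumTo c e
    sumTo-∸ zero M = ≤-reflexive (zero-sum M)
    sumTo-∸ (suc e) M = ≤-trans (step e M) (+-monoˡ-≤ (c e) (sumTo-∸ e M))

  cast-injective : ∀ {m n} .(eq : m ≡ n) {i j : Fin m} → Fin.cast eq i ≡ Fin.cast eq j → i ≡ j
  cast-injective eq {i} {j} e = Finₚ.toℕ-injective (trans (sym (Finₚ.toℕ-cast eq i)) (trans (cong toℕ e) (Finₚ.toℕ-cast eq j)))

  module _ (p : ℕ) (w : ℕ → ℕ) where
    pack : ∀ M → (∀ i → Fin (p ^ w i)) → Fin (p ^ sumTo w M)
    pack zero κ = zero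
    pack (suc M) κ = Fin.cast (sym (^-distribˡ-+-* p (sumTo w M) (w M))) (combine (pack M κ) (κ M))

    pack-injective : ∀ M κ κ′ → pack M κ ≡ pack M κ′ → ∀ i → i < M → κ i ≡ κ′ i
    pack-injective (suc M) κ κ′ e i i<M
      with Finₚ.combine-injective (pack M κ) (κ M) (pack M κ′) (κ′ M) (cast-injective (sym (^-distribˡ-+-* p (sumTo w M) (w M))) e)
         | m≤n⇒m<n∨m≡n (≤-pred i<M)
    ... | e₁ , e₂ | inj₁ i<M′ = pack-injective M κ κ′ e₁ i i<M′
    ... | e₁ , e₂ | inj₂ refl = e₂

  module _ {ℋ : Set} (Cong : ℋ → ℋ → ℕ → Set) where
    -- T decides a₀, a₁, a₂ and the codes decide the rest in increasing order. In `next` a code may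
    -- be interpreted with the congruence of all earlier coefficients at hand; this is what permits
    -- a code to omit a digit that they determine.
    assemble : ∀ {N₀} p (w : ℕ → ℕ) M (T : ℋ → Fin N₀) (κ : ℋ → ∀ i → Fin (p ^ w i)) →
      (∀ H H′ → T H ≡ T H′ → ∀ k → k < 3 → Cong H H′ k) →
      (∀ H H′ i → (∀ k → k < 3 + i → Cong H H′ k) → κ H i ≡ κ H′ i → Cong H H′ (3 + i)) →
      ∀ N → N₀ * p ^ sumTo w M ≤ N →
      Σ (ℋ → Fin N) (λ cls → ∀ H H′ → cls H ≡ cls H′ → ∀ k → k < 3 + M → Cong H H′ k)
    assemble {N₀} p w M T κ first next N le = cls , sound
      where
      cls : ℋ → Fin N
      cls H = inject≤ (combine (T H) (pack p w M (κ H))) le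
      sound : ∀ H H′ → cls H ≡ cls H′ → ∀ k → k < 3 + M → Cong H H′ k
      sound H H′ e k k< = upto M ≤-refl k k<
        where
        e′ : T H ≡ T H′ × pack p w M (κ H) ≡ pack p w M (κ H′)
        e′ = Finₚ.combine-injective (T H) (pack p w M (κ H)) (T H′) (pack p w M (κ H′)) (Finₚ.inject≤-injective le le _ _ e)
        upto : ∀ m → m ≤ M → ∀ k → k < 3 + m → Cong H H′ k
        upto zero _ k k< = first H H′ (proj₁ e′) k k<
        upto (suc m) m<M k k< with m≤n⇒m<n∨m≡n (≤-pred k<)
        ... | inj₁ k<′ = upto m (≤-trans (n≤1+n m) m<M) k k<′
        ... | inj₂ refl = next H H′ m (upto m (≤-trans (n≤1+n m) m<M)) (pack-injective p w M (κ H) (κ H′) (proj₂ e′) m m<M)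

  -- Thresholds: a_{3+i} is divisible by the (u i)-th power of the prime.

  halfFloor : ∀ {i} → Parity i → ℕ
  halfFloor (even m) = suc m
  halfFloor (odd m) = suc (suc m)

  -- This is ⌈(3 + i)/2⌉, against ⌊(3 + i)/2⌋ for `halfFloor`: for even n one digit is gained at the
  -- odd coefficients.
  halfCeil : ∀ {i} → Parity i → ℕ
  halfCeil (even m) = suc (suc m)
  halfCeil (odd m) = suc (suc m)

  count-floor : ∀ e i → halfFloor (parity i) ≤ e → i < dbl e ∸ 1
  count-floor e i = go (parity i)
    where
    go : ∀ {i} (π : Parity i) → halfFloor π ≤ e → i < dbl e ∸ 1
    go (even m) le = ∸-monoˡ-≤ 1 (dbl-mono le)
    go (odd m) le = ≤-trans (n≤1+n _) (∸-monoˡ-≤ 1 (dbl-mono le))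

  count-ceil : ∀ e i → halfCeil (parity i) ≤ e → i < dbl e ∸ 2
  count-ceil e i = go (parity i)
    where
    go : ∀ {i} (π : Parity i) → halfCeil π ≤ e → i < dbl e ∸ 2
    go (even m) le = ≤-trans (n≤1+n _) (∸-monoˡ-≤ 2 (dbl-mono le))
    go (odd m) le = ∸-monoˡ-≤ 2 (dbl-mono le)

  -- A sum of consecutive odd numbers. There are 2e - 1 indices i with ⌊(3 + i)/2⌋ at most e, and
  -- summing over the levels below e + 1 gives the exponent of (c) at e + 1.
  sum-floor : ∀ e → sumTo (λ e → dbl e ∸ 1) (suc e) ≡ e * e
  sum-floor zero = refl
  sum-floor (suc e) = trans (≡.cong₂ _+_ (sum-floor e) (cong suc (dbl-+ e)))
    (+-*-Solver.solve 1 (λ e → e :* e :+ (con 1 :+ (e :+ e)) := (con 1 :+ e) :* (con 1 :+ e)) refl e)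
    where open +-*-Solver using (_:+_; _:*_; _:=_; con)

  sum-ceil : ∀ e → sumTo (λ e → dbl e ∸ 2) (suc e) + e ≡ e * e
  sum-ceil zero = refl
  sum-ceil (suc e) = begin
    sumTo (λ e → dbl e ∸ 2) (suc e) + dbl e + suc e    ≡⟨ cong (λ z → sumTo (λ e → dbl e ∸ 2) (suc e) + z + suc e) (dbl-+ e) ⟩
    sumTo (λ e → dbl e ∸ 2) (suc e) + (e + e) + suc e  ≡⟨ +-*-Solver.solve 2 (λ s e → s :+ (e :+ e) :+ (con 1 :+ e) := (s :+ e) :+ (con 1 :+ (e :+ e))) refl _ e ⟩
    sumTo (λ e → dbl e ∸ 2) (suc e) + e + suc (e + e)  ≡⟨ cong (_+ suc (e + e)) (sum-ceil e) ⟩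
    e * e + suc (e + e)                                ≡⟨ +-*-Solver.solve 1 (λ e → e :* e :+ (con 1 :+ (e :+ e)) := (con 1 :+ e) :* (con 1 :+ e)) refl e ⟩
    suc e * suc e                                      ∎
    where
    open ≡.≡-Reasoning
    open +-*-Solver using (_:+_; _:*_; _:=_; con)

  bound-floor : ∀ e → sumTo (λ e → dbl e ∸ 1) (suc e) ≤ (suc e * suc e + 1) ∸ 2 * suc e
  bound-floor e = m+n≤o⇒m≤o∸n _ (≤-reflexive (trans (cong (_+ 2 * suc e) (sum-floor e))
    (+-*-Solver.solve 1 (λ e → e :* e :+ con 2 :* (con 1 :+ e) := (con 1 :+ e) :* (con 1 :+ e) :+ con 1) refl e)))
    where open +-*-Solver using (_:+_; _:*_; _:=_; con)

  -- With E = e + 1 the right side is (E - 1)(E - 2) + s, expanded so that there is a single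
  -- truncated subtraction; s + 1 is the ceiling in (d).
  bound-ceil : ∀ e s → s + sumTo (λ e → dbl e ∸ 2) (suc e) ≤ (suc e * suc e + 2 + suc s) ∸ (3 * suc e + 1)
  bound-ceil e s = m+n≤o⇒m≤o∸n _ (≤-reflexive (begin
    s + S + (3 * suc e + 1)      ≡⟨ +-*-Solver.solve 3 (λ s S e → s :+ S :+ (con 3 :* (con 1 :+ e) :+ con 1) := s :+ (S :+ e) :+ (con 2 :* e :+ con 4)) refl s S e ⟩
    s + (S + e) + (2 * e + 4)    ≡⟨ cong (λ z → s + z + (2 * e + 4)) (sum-ceil e) ⟩
    s + e * e + (2 * e + 4)      ≡⟨ +-*-Solver.solve 2 (λ s e → s :+ e :* e :+ (con 2 :* e :+ con 4) := (con 1 :+ e) :* (con 1 :+ e) :+ con 2 :+ (con 1 :+ s)) refl s e ⟩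
    suc e * suc e + 2 + suc s    ∎))
    where
    open ≡.≡-Reasoning
    open +-*-Solver using (_:+_; _:*_; _:=_; con)
    S : ℕ
    S = sumTo (λ e → dbl e ∸ 2) (suc e)

  -- The extra digit saved at a_{4m+7} for odd n and q = 2^f with f ≥ 2.
  special : ∀ {m} → Parity m → ℕ
  special (even zero) = 0
  special (even (suc m)) = 1
  special (odd m) = 0

  halfSaved : ∀ {i} → Parity i → ℕ
  halfSaved (even m) = special (parity m) + suc m
  halfSaved (odd m) = suc (suc m)

  -- The indicator of e ≡ 3 modulo 4, whose partial sums are ⌊e/4⌋. At such a level the last index
  -- of the plain count, 2e - 2, is one whose threshold `special` has raised, so the count drops by
  -- one.
  s₃ : ℕ → ℕ
  s₃ 0 = 0
  s₃ 1 = 0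
  s₃ 2 = 0
  s₃ 3 = 1
  s₃ (suc (suc (suc (suc e)))) = s₃ e

  s₃-special : ∀ m → s₃ (suc m) ≡ 0 ⊎ (s₃ (suc m) ≡ 1 × ∃ (λ q → m ≡ dbl (suc q)))
  s₃-special 0 = inj₁ refl
  s₃-special 1 = inj₁ refl
  s₃-special 2 = inj₂ (refl , 0 , refl)
  s₃-special 3 = inj₁ refl
  s₃-special (suc (suc (suc (suc m)))) with s₃-special m
  ... | inj₁ e = inj₁ e
  ... | inj₂ (e , q , eq) = inj₂ (e , suc (suc q) , cong (λ x → suc (suc (suc (suc x)))) eq)

  dbl-injective : ∀ m n → dbl m ≡ dbl n → m ≡ n
  dbl-injective zero zero _ = refl
  dbl-injective (suc m) (suc n) e = cong suc (dbl-injective m n (suc-injective (suc-injective e)))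

  dbl≢odd : ∀ m n → ¬ (dbl m ≡ suc (dbl n))
  dbl≢odd (suc m) zero ()
  dbl≢odd (suc m) (suc n) e = dbl≢odd m n (suc-injective (suc-injective e))

  special-even : ∀ {m} (π : Parity m) q → m ≡ dbl (suc q) → special π ≡ 1
  special-even (even zero) q ()
  special-even (even (suc m)) q e = refl
  special-even (odd m) q e = ⊥-elim (dbl≢odd (suc q) m (sym e))

  s₃≤1 : ∀ e → s₃ e ≤ 1
  s₃≤1 0 = z≤n
  s₃≤1 1 = z≤n
  s₃≤1 2 = z≤n
  s₃≤1 3 = s≤s z≤n
  s₃≤1 (suc (suc (suc (suc e)))) = s₃≤1 e

  c-saved : ℕ → ℕ
  c-saved e = (dbl e ∸ 1) ∸ s₃ e

  count-saved : ∀ e i → halfSaved (parity i) ≤ e → i < c-saved e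
  count-saved e i = go (parity i)
    where
    two≤ : ∀ {i} → suc (suc i) ≤ dbl e ∸ 1 → i < c-saved e
    two≤ le = ≤-trans (∸-monoˡ-≤ 1 le) (∸-monoʳ-≤ (dbl e ∸ 1) (s₃≤1 e))
    go : ∀ {i} (π : Parity i) → halfSaved π ≤ e → i < c-saved e
    go (odd m) le = two≤ (∸-monoˡ-≤ 1 (dbl-mono le))
    go (even m) le with m≤n⇒m<n∨m≡n (≤-trans (m≤n+m (suc m) (special (parity m))) le)
    ... | inj₁ sm<e = two≤ (≤-trans (n≤1+n _) (∸-monoˡ-≤ 1 (dbl-mono sm<e)))
    ... | inj₂ refl with s₃-special m
    ...   | inj₁ e₀ = subst (λ z → dbl m < suc (dbl m) ∸ z) (sym e₀) ≤-refl
    ...   | inj₂ (_ , q , eq) = ⊥-elim (1+n≰n (subst (λ z → z + suc m ≤ suc m) (special-even (parity m) q eq) le))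

  sumTo-s₃ : ∀ E → sumTo s₃ E ≡ E / 4
  sumTo-s₃ 0 = refl
  sumTo-s₃ 1 = refl
  sumTo-s₃ 2 = refl
  sumTo-s₃ 3 = refl
  sumTo-s₃ (suc (suc (suc (suc E)))) = begin
    sumTo s₃ E + s₃ E + s₃ (1 + E) + s₃ (2 + E) + s₃ (3 + E)
      ≡⟨ +-*-Solver.solve 5 (λ a b c d e → a :+ b :+ c :+ d :+ e := (b :+ c :+ d :+ e) :+ a) refl (sumTo s₃ E) (s₃ E) (s₃ (1 + E)) (s₃ (2 + E)) (s₃ (3 + E)) ⟩
    (s₃ E + s₃ (1 + E) + s₃ (2 + E) + s₃ (3 + E)) + sumTo s₃ E   ≡⟨ ≡.cong₂ _+_ (four E) (sumTo-s₃ E) ⟩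
    1 + E / 4                                                    ≡⟨ +-distrib-/-∣ˡ {4} E {4} (divides 1 refl) ⟨
    (4 + E) / 4                                                  ∎
    where
    open ≡.≡-Reasoning
    open +-*-Solver using (_:+_; _:*_; _:=_; con)
    four : ∀ E → s₃ E + s₃ (1 + E) + s₃ (2 + E) + s₃ (3 + E) ≡ 1
    four 0 = refl
    four 1 = refl
    four 2 = refl
    four 3 = refl
    four (suc (suc (suc (suc E)))) = four E

  sum-saved : ∀ E → sumTo c-saved E + sumTo s₃ E ≡ sumTo (λ e → dbl e ∸ 1) E
  sum-saved zero = refl
  sum-saved (suc E) = trans
    (+-*-Solver.solve 4 (λ a b c d → a :+ b :+ (c :+ d) := a :+ c :+ (b :+ d)) refl (sumTo c-saved E) (c-saved E) (sumTo s₃ E) (s₃ E))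
    (≡.cong₂ _+_ (sum-saved E) (m∸n+n≡m (s₃≤ E)))
    where
    open +-*-Solver using (_:+_; _:*_; _:=_; con)
    s₃≤ : ∀ e → s₃ e ≤ dbl e ∸ 1
    s₃≤ zero = z≤n
    s₃≤ (suc e) = ≤-trans (s₃≤1 (suc e)) (s≤s z≤n)

  bound-saved : ∀ e s → s + sumTo c-saved (suc e) ≤ (suc e * suc e + 1 + suc s) ∸ (2 * suc e + 1 + suc e / 4)
  bound-saved e s = m+n≤o⇒m≤o∸n _ (≤-reflexive (begin
    s + S + (2 * suc e + 1 + suc e / 4)             ≡⟨ cong (λ z → s + S + (2 * suc e + 1 + z)) (sumTo-s₃ (suc e)) ⟨
    s + S + (2 * suc e + 1 + sumTo s₃ (suc e))      ≡⟨ +-*-Solver.solve 4 (λ s S e q → s :+ S :+ (con 2 :* (con 1 :+ e) :+ con 1 :+ q) := s :+ (S :+ q) :+ (con 2 :* e :+ con 3)) refl s S e (sumTo s₃ (suc e)) ⟩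
    s + (S + sumTo s₃ (suc e)) + (2 * e + 3)        ≡⟨ cong (λ z → s + z + (2 * e + 3)) (trans (sum-saved (suc e)) (sum-floor e)) ⟩
    s + e * e + (2 * e + 3)                         ≡⟨ +-*-Solver.solve 2 (λ s e → s :+ e :* e :+ (con 2 :* e :+ con 3) := (con 1 :+ e) :* (con 1 :+ e) :+ con 1 :+ (con 1 :+ s)) refl s e ⟩
    suc e * suc e + 1 + suc s                       ∎))
    where
    open ≡.≡-Reasoning
    open +-*-Solver using (_:+_; _:*_; _:=_; con)
    S : ℕ
    S = sumTo c-saved (suc e)

  -- Exponents of 2 for q = 2. With k = 3 + i the exponent is k if n - (k - 1) is even, and k - 1
  -- otherwise. There is no halving as for larger q, since the prime is π = 2 itself.
  valEven valOdd : ∀ {i} → Parity i → ℕ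
  valEven (even m) = 3 + dbl m
  valEven (odd m) = 3 + dbl m
  valOdd (even m) = 2 + dbl m
  valOdd (odd m) = 4 + dbl m

  cEven cOdd : ℕ → ℕ
  cEven zero = 0
  cEven (suc e) = dbl ⌊ e /2⌋
  cOdd zero = 0
  cOdd (suc zero) = 0
  cOdd (suc (suc e)) = suc (dbl ⌊ e /2⌋)

  half-dbl : ∀ m → ⌊ dbl m /2⌋ ≡ m
  half-dbl zero = refl
  half-dbl (suc m) = cong suc (half-dbl m)

  ≤half : ∀ {m e} → dbl m ≤ e → dbl m ≤ dbl ⌊ e /2⌋
  ≤half {m} le = dbl-mono (subst (_≤ _) (half-dbl m) (⌊n/2⌋-mono le))

  count-even : ∀ e i → valEven (parity i) ≤ e → i < cEven e
  count-even e i = go (parity i) e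
    where
    go : ∀ {i} (π : Parity i) e → valEven π ≤ e → i < cEven e
    go (even m) (suc e) (s≤s le) = ≤-trans (n≤1+n _) (≤half {suc m} le)
    go (odd m) (suc e) (s≤s le) = ≤half {suc m} le

  count-odd : ∀ e i → valOdd (parity i) ≤ e → i < cOdd e
  count-odd e i = go (parity i) e
    where
    go : ∀ {i} (π : Parity i) e → valOdd π ≤ e → i < cOdd e
    go (even m) (suc (suc e)) (s≤s (s≤s le)) = s≤s (≤half {m} le)
    go (odd m) (suc (suc e)) (s≤s (s≤s le)) = ≤-trans (n≤1+n _) (s≤s (≤half {suc m} le))

  half-+ : ∀ m n → ⌊ dbl m + n /2⌋ ≡ m + ⌊ n /2⌋
  half-+ zero n = refl
  half-+ (suc m) n = cong suc (half-+ m n)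

  square-step : ∀ E → suc (suc E) * suc (suc E) ≡ dbl (dbl E + 2) + E * E
  square-step E = trans
    (+-*-Solver.solve 1 (λ e → (con 2 :+ e) :* (con 2 :+ e) := (e :+ e :+ con 2 :+ (e :+ e :+ con 2)) :+ e :* e) refl E)
    (cong (_+ E * E) (sym (trans (dbl-+ (dbl E + 2)) (cong (λ z → z + 2 + (z + 2)) (dbl-+ E)))))
    where open +-*-Solver using (_:+_; _:*_; _:=_; con)

  half-suc : ∀ e → ⌊ e /2⌋ + ⌊ suc e /2⌋ ≡ e
  half-suc e = ⌊n/2⌋+⌈n/2⌉≡n e

  private
    shuffle : ∀ S x y e h → x + y ≤ e + e → S + e + suc e ≤ h + 1 →
      S + x + y + suc (suc e) + suc (suc (suc e)) ≤ e + e + 2 + 2 + h + 1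
    shuffle S x y e h le le′ = begin
      S + x + y + suc (suc e) + suc (suc (suc e))  ≡⟨ +-*-Solver.solve 4 (λ S x y e → S :+ x :+ y :+ (con 2 :+ e) :+ (con 3 :+ e) := (S :+ e :+ (con 1 :+ e)) :+ (x :+ y) :+ con 4) refl S x y e ⟩
      (S + e + suc e) + (x + y) + 4                ≤⟨ +-monoˡ-≤ 4 (+-mono-≤ le′ le) ⟩
      h + 1 + (e + e) + 4                          ≡⟨ +-*-Solver.solve 2 (λ e h → h :+ con 1 :+ (e :+ e) :+ con 4 := e :+ e :+ con 2 :+ con 2 :+ h :+ con 1) refl e h ⟩
      e + e + 2 + 2 + h + 1                        ∎
      where
      open ≤-Reasoning
      open +-*-Solver using (_:+_; _:*_; _:=_; con)

  -- The induction goes in steps of two: ⌊(E + 2)²/2⌋ exceeds ⌊E²/2⌋ by exactly 2E + 2, whereas the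
  -- increment of a single step depends on the parity.
  bound-even′ : ∀ e → sumTo cEven (suc e) + e + suc e ≤ ⌊ suc e * suc e /2⌋ + 1
  bound-even′ zero = s≤s z≤n
  bound-even′ (suc zero) = s≤s (s≤s (s≤s z≤n))
  bound-even′ (suc (suc e)) = ≤-trans
    (shuffle (sumTo cEven (suc e)) (dbl ⌊ e /2⌋) (dbl ⌊ suc e /2⌋) e ⌊ suc e * suc e /2⌋
      (≤-reflexive (trans (≡.cong₂ _+_ (dbl-+ ⌊ e /2⌋) (dbl-+ ⌊ suc e /2⌋))
        (trans (+-*-Solver.solve 2 (λ a b → a :+ a :+ (b :+ b) := a :+ b :+ (a :+ b)) refl ⌊ e /2⌋ ⌊ suc e /2⌋) (cong (λ z → z + z) (half-suc e)))))
      (bound-even′ e))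
    (≤-reflexive (cong (_+ 1) (sym (trans (cong ⌊_/2⌋ (square-step (suc e))) (trans (half-+ (dbl (suc e) + 2) (suc e * suc e))
      (cong (λ z → z + ⌊ suc e * suc e /2⌋) (trans (cong (λ z → suc (suc z) + 2) (dbl-+ e)) (+-*-Solver.solve 1 (λ e → con 2 :+ (e :+ e) :+ con 2 := e :+ e :+ con 2 :+ con 2) refl e))))))))
    where open +-*-Solver using (_:+_; _:*_; _:=_; con)

  bound-odd′ : ∀ e → sumTo cOdd (suc e) + e + suc e ≤ ⌈ suc e * suc e /2⌉ + 1
  bound-odd′ 0 = s≤s z≤n
  bound-odd′ 1 = s≤s (s≤s (s≤s z≤n))
  bound-odd′ 2 = s≤s (s≤s (s≤s (s≤s (s≤s (s≤s z≤n)))))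
  bound-odd′ (suc (suc (suc e))) = ≤-trans
    (shuffle (sumTo cOdd (2 + e)) (cOdd (2 + e)) (cOdd (3 + e)) (suc e) ⌈ (2 + e) * (2 + e) /2⌉ (≤-reflexive two) (bound-odd′ (suc e)))
    (≤-reflexive (cong (_+ 1) (sym (trans (cong (λ z → ⌊ suc z /2⌋) (square-step (2 + e)))
      (trans (cong ⌊_/2⌋ (sym (+-suc (dbl (dbl (2 + e) + 2)) ((2 + e) * (2 + e)))))
      (trans (half-+ (dbl (2 + e) + 2) (suc ((2 + e) * (2 + e))))
      (cong (λ z → z + ⌈ (2 + e) * (2 + e) /2⌉) (trans (cong (λ z → 4 + z + 2) (dbl-+ e))
        (+-*-Solver.solve 1 (λ e → con 4 :+ (e :+ e) :+ con 2 := con 1 :+ e :+ (con 1 :+ e) :+ con 2 :+ con 2) refl e)))))))))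
    where
    open +-*-Solver using (_:+_; _:*_; _:=_; con)
    two : cOdd (2 + e) + cOdd (3 + e) ≡ suc e + suc e
    two = trans (≡.cong₂ (λ a b → suc a + suc b) (dbl-+ ⌊ e /2⌋) (dbl-+ ⌊ suc e /2⌋))
      (trans (+-*-Solver.solve 2 (λ a b → con 1 :+ (a :+ a) :+ (con 1 :+ (b :+ b)) := con 1 :+ (a :+ b) :+ (con 1 :+ (a :+ b))) refl ⌊ e /2⌋ ⌊ suc e /2⌋)
      (cong (λ z → suc z + suc z) (half-suc e)))

  bound-odd : ∀ e → e + sumTo cOdd (suc e) ≤ (⌈ suc e * suc e /2⌉ + 1) ∸ suc e
  bound-odd e = m+n≤o⇒m≤o∸n _ (≤-trans (≤-reflexive (cong (_+ suc e) (+-comm e _))) (bound-odd′ e))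

  bound-even : ∀ e → e + sumTo cEven (suc e) ≤ (⌊ suc e * suc e /2⌋ + 1) ∸ suc e
  bound-even e = m+n≤o⇒m≤o∸n _ (≤-trans (≤-reflexive (cong (_+ suc e) (+-comm e _))) (bound-even′ e))

open Counting

-- Digit expansions of real elements

record DigitSystem (K : CR) : Set₁ where
  open CommutativeRing K hiding (zero)
  open Cast K using (ι; ιℕ)
  field
    p : ℕ
    ϖ : Carrier
    Real : Carrier → Set
    real-resp : ∀ {x y} → x ≈ y → Real x → Real y
    real-+ : ∀ {x y} → Real x → Real y → Real (x + y)
    real-* : ∀ {x y} → Real x → Real y → Real (x * y)
    real-ι : ∀ i → Real (ι i)
    real-ϖ : Real ϖ
    -- Repeated w times, this sorts the real elements into at most p^w classes modulo ϖ^w. The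
    -- instances have ϖ = ρ for q > 2 and ϖ = 2 for q = 2.
    digit : ∀ r → Real r → Σ (Fin p) (λ d → Σ Carrier (λ r′ → Real r′ × (r ≈ ιℕ (toℕ d) + ϖ * r′)))

mod-equal : ∀ N .{{_ : ℕ.NonZero N}} t t′ → t mod N ≡ t′ mod N → ∃ (λ j → + t ≡ + t′ ℤ.+ j ℤ.* + N)
mod-equal N t t′ e = + (t / N) ℤ.- + (t′ / N) , (begin
  + t                                                 ≡⟨ expand t ⟩
  + (t % N) ℤ.+ + (t / N) ℤ.* + N                     ≡⟨ ≡.cong (λ r → + r ℤ.+ + (t / N) ℤ.* + N) %-equal ⟩
  + (t′ % N) ℤ.+ + (t / N) ℤ.* + N
    ≡⟨ solve 4 (λ r a b n → r :+ a :* n := r :+ b :* n :+ (a :- b) :* n) ≡.refl (+ (t′ % N)) (+ (t / N)) (+ (t′ / N)) (+ N) ⟩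
  + (t′ % N) ℤ.+ + (t′ / N) ℤ.* + N ℤ.+ (+ (t / N) ℤ.- + (t′ / N)) ℤ.* + N
    ≡⟨ ≡.cong (ℤ._+ (+ (t / N) ℤ.- + (t′ / N)) ℤ.* + N) (expand t′) ⟨
  + t′ ℤ.+ (+ (t / N) ℤ.- + (t′ / N)) ℤ.* + N         ∎)
  where
  open ≡.≡-Reasoning
  open Solve ℤᶜ
  expand : ∀ t → + t ≡ + (t % N) ℤ.+ + (t / N) ℤ.* + N
  expand t = ≡.trans (≡.cong +_ (m≡m%n+[m/n]*n t N)) (≡.cong (λ z → + (t % N) ℤ.+ z) (ℤₚ.pos-* (t / N) N))
  %-equal : t % N ≡ t′ % N
  %-equal = ≡.trans (≡.sym (Finₚ.toℕ-fromℕ< (m%n<n t N))) (≡.trans (≡.cong toℕ e) (Finₚ.toℕ-fromℕ< (m%n<n t′ N)))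

module Coding (K : CR) (DS : DigitSystem K) where
  open CommutativeRing K hiding (zero)
  open Relation.Binary.Reasoning.Setoid setoid
  open Solve K
  open Pow K
  open Cast K
  open DigitSystem DS

  real-sub : ∀ {x y} → Real x → Real y → Real (x - y)
  real-sub {x} {y} rx ry = real-resp (solve 2 (λ x y → x :+ con (ℤ.- + 1) :* y := x :- y) refl x y) (real-+ rx (real-* (real-ι (ℤ.- + 1)) ry))

  real-^ : ∀ n → Real (ϖ ^ n)
  real-^ zero = real-ι (+ 1)
  real-^ (suc n) = real-* real-ϖ (real-^ n)

  CongMod : ℕ → Carrier → Carrier → Set
  CongMod e x y = Σ Carrier (λ u → Real u × (x - y ≈ ϖ ^ e * u))

  cong-refl : ∀ e {x y} → x ≈ y → CongMod e x y
  cong-refl e {x} {y} eq = 0# , real-ι (+ 0) , trans (+-congʳ eq) (trans (-‿inverseʳ y) (sym (zeroʳ _)))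

  code : ∀ w r → Real r → Fin (p ℕ.^ w)
  code zero r R = zero
  code (suc w) r R = combine (proj₁ (digit r R)) (code w (proj₁ (proj₂ (digit r R))) (proj₁ (proj₂ (proj₂ (digit r R)))))

  code-sound : ∀ w r R s S → code w r R ≡ code w s S → CongMod w r s
  code-sound zero r R s S _ = r - s , real-sub R S , sym (*-identityˡ _)
  code-sound (suc w) r R s S eq = proj₁ IH , proj₁ (proj₂ IH) , (begin
    r - s                                   ≈⟨ +-cong er (-‿cong es) ⟩
    ιℕ (toℕ d) + ϖ * r′ - (ιℕ (toℕ d′) + ϖ * s′)  ≡⟨ ≡.cong (λ x → ιℕ (toℕ x) + ϖ * r′ - (ιℕ (toℕ d′) + ϖ * s′)) (proj₁ eq′) ⟩
    ιℕ (toℕ d′) + ϖ * r′ - (ιℕ (toℕ d′) + ϖ * s′) ≈⟨ solve 4 (λ d v r s → d :+ v :* r :- (d :+ v :* s) := v :* (r :- s)) refl _ ϖ r′ s′ ⟩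
    ϖ * (r′ - s′)                           ≈⟨ *-congˡ (proj₂ (proj₂ IH)) ⟩
    ϖ * (ϖ ^ w * proj₁ IH)                  ≈⟨ *-assoc _ _ _ ⟨
    ϖ ^ suc w * proj₁ IH                    ∎)
    where
    d d′ : Fin p
    d = proj₁ (digit r R)
    d′ = proj₁ (digit s S)
    r′ s′ : Carrier
    r′ = proj₁ (proj₂ (digit r R))
    s′ = proj₁ (proj₂ (digit s S))
    R′ : Real r′
    R′ = proj₁ (proj₂ (proj₂ (digit r R)))
    S′ : Real s′
    S′ = proj₁ (proj₂ (proj₂ (digit s S)))
    er : r ≈ ιℕ (toℕ d) + ϖ * r′
    er = proj₂ (proj₂ (proj₂ (digit r R)))
    es : s ≈ ιℕ (toℕ d′) + ϖ * s′
    es = proj₂ (proj₂ (proj₂ (digit s S)))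
    eq′ : d ≡ d′ × code w r′ R′ ≡ code w s′ S′
    eq′ = Finₚ.combine-injective d (code w r′ R′) d′ (code w s′ S′) eq
    IH : CongMod w r′ s′
    IH = code-sound w r′ R′ s′ S′ (proj₂ eq′)

  -- The witness handles both signs of e - u at once: if u exceeds e, then x and y are already
  -- divisible by ϖ^e and the surplus ϖ^(u ∸ e) moves into the cofactor.
  cong-scale : ∀ e u {x y b b′} → x ≈ ϖ ^ u * b → y ≈ ϖ ^ u * b′ → CongMod (e ∸ u) b b′ → CongMod e x y
  cong-scale e u {x} {y} {b} {b′} ex ey (r , R , eq) = ϖ ^ (u ∸ e) * r , real-* (real-^ (u ∸ e)) R , (begin
    x - y                                 ≈⟨ +-cong ex (-‿cong ey) ⟩
    ϖ ^ u * b - ϖ ^ u * b′                ≈⟨ solve 3 (λ v b c → v :* b :- v :* c := v :* (b :- c)) refl _ b b′ ⟩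
    ϖ ^ u * (b - b′)                      ≈⟨ *-congˡ eq ⟩
    ϖ ^ u * (ϖ ^ (e ∸ u) * r)             ≈⟨ *-assoc _ _ _ ⟨
    ϖ ^ u * ϖ ^ (e ∸ u) * r               ≈⟨ *-congʳ (trans (sym (^-+ ϖ u (e ∸ u))) (trans (reflexive (≡.cong (ϖ ^_) (exchange u e))) (^-+ ϖ e (u ∸ e)))) ⟩
    ϖ ^ e * ϖ ^ (u ∸ e) * r               ≈⟨ *-assoc _ _ _ ⟩
    ϖ ^ e * (ϖ ^ (u ∸ e) * r)             ∎)
    where
    exchange : ∀ u e → u ℕ.+ (e ∸ u) ≡ e ℕ.+ (u ∸ e)
    exchange zero zero = ≡.refl
    exchange zero (suc e) = ≡.cong suc (≡.sym (ℕₚ.+-identityʳ e))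
    exchange (suc u) zero = ≡.cong suc (ℕₚ.+-identityʳ u)
    exchange (suc u) (suc e) = ≡.cong suc (exchange u e)

  code-step : ∀ e u {x y b b′} (R : Real b) (R′ : Real b′) → x ≈ ϖ ^ u * b → y ≈ ϖ ^ u * b′ →
    code (e ∸ u) b R ≡ code (e ∸ u) b′ R′ → CongMod e x y
  code-step e u R R′ ex ey eq = cong-scale e u ex ey (code-sound (e ∸ u) _ R _ R′ eq)

  -- The coefficients a₁ = 2t - n and a₂ = 2t (t - n) modulo 2^(s+1) depend on t modulo 2^s.
  trace-step : ∀ e s ν → Real ν → ι (+ (2 ℕ.^ suc s)) ≈ ϖ ^ e * ν →
    .{{_ : ℕ.NonZero (2 ℕ.^ s)}} → ∀ n t t′ → t mod (2 ℕ.^ s) ≡ t′ mod (2 ℕ.^ s) →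
      CongMod e (ιℕ t + ιℕ t - ιℕ n) (ιℕ t′ + ιℕ t′ - ιℕ n)
    × CongMod e ((ιℕ t + ιℕ t) * (ιℕ t - ιℕ n)) ((ιℕ t′ + ιℕ t′) * (ιℕ t′ - ιℕ n))
  trace-step e s ν Rν 2ˢ n t t′ eq =
    (ι j * ν , real-* (real-ι j) Rν , trans (trans
      (solve 3 (λ t t′ n → t :+ t :- n :- (t′ :+ t′ :- n) := t :- t′ :+ (t :- t′)) refl (ιℕ t) (ιℕ t′) (ιℕ n)) twice)
      (solve 3 (λ j w ν → j :* (w :* ν) := w :* (j :* ν)) refl (ι j) (ϖ ^ e) ν)) ,
    (ι j * ν * (ιℕ t + ιℕ t′ - ιℕ n) , real-* (real-* (real-ι j) Rν) (real-sub (real-+ (real-ι (+ t)) (real-ι (+ t′))) (real-ι (+ n))) , (begin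
      (ιℕ t + ιℕ t) * (ιℕ t - ιℕ n) - (ιℕ t′ + ιℕ t′) * (ιℕ t′ - ιℕ n)
        ≈⟨ solve 3 (λ t t′ n → (t :+ t) :* (t :- n) :- (t′ :+ t′) :* (t′ :- n) := (t :- t′ :+ (t :- t′)) :* (t :+ t′ :- n)) refl (ιℕ t) (ιℕ t′) (ιℕ n) ⟩
      (ιℕ t - ιℕ t′ + (ιℕ t - ιℕ t′)) * (ιℕ t + ιℕ t′ - ιℕ n)
        ≈⟨ *-congʳ twice ⟩
      ι j * (ϖ ^ e * ν) * (ιℕ t + ιℕ t′ - ιℕ n)
        ≈⟨ solve 4 (λ j w ν x → j :* (w :* ν) :* x := w :* (j :* ν :* x)) refl (ι j) (ϖ ^ e) ν _ ⟩
      ϖ ^ e * (ι j * ν * (ιℕ t + ιℕ t′ - ιℕ n)) ∎))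
    where
    j : ℤ
    j = proj₁ (mod-equal (2 ℕ.^ s) t t′ eq)
    diff : ιℕ t - ιℕ t′ ≈ ι j * ιℕ (2 ℕ.^ s)
    diff = begin
      ιℕ t - ιℕ t′                                ≈⟨ +-congʳ (reflexive (≡.cong ι (proj₂ (mod-equal (2 ℕ.^ s) t t′ eq)))) ⟩
      ι (+ t′ ℤ.+ j ℤ.* + (2 ℕ.^ s)) - ιℕ t′      ≈⟨ +-congʳ (trans (ι-+ (+ t′) (j ℤ.* + (2 ℕ.^ s))) (+-congˡ (ι-* j (+ (2 ℕ.^ s))))) ⟩
      ιℕ t′ + ι j * ιℕ (2 ℕ.^ s) - ιℕ t′          ≈⟨ solve 2 (λ x y → x :+ y :- x := y) refl _ _ ⟩
      ι j * ιℕ (2 ℕ.^ s)                          ∎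
    twice : ιℕ t - ιℕ t′ + (ιℕ t - ιℕ t′) ≈ ι j * (ϖ ^ e * ν)
    twice = begin
      ιℕ t - ιℕ t′ + (ιℕ t - ιℕ t′)               ≈⟨ +-cong diff diff ⟩
      ι j * ιℕ (2 ℕ.^ s) + ι j * ιℕ (2 ℕ.^ s)     ≈⟨ solve 2 (λ a b → a :* b :+ a :* b := a :* (con (+ 2) :* b)) refl _ _ ⟩
      ι j * (ι (+ 2) * ιℕ (2 ℕ.^ s))              ≈⟨ *-congˡ (trans (sym (ιℕ-* 2 (2 ℕ.^ s))) 2ˢ) ⟩
      ι j * (ϖ ^ e * ν)                           ∎

module _ {C D : CR} (h : Hom C D) where
  private
    module D = CommutativeRing D
    module CC = Charpoly C
    module CD = Charpoly D
  open Hom h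

  private
    entry : ∀ n (A : Det′.Mat C n) i j → PowerSeries._≈ˢ_ D (Hom.to (mapPS h) (CC.I+x n A i j)) (CD.I+x n (λ i j → to (A i j)) i j)
    entry n A i j k = D.trans (mapPS-lin h _ _ k) (PowerSeries.lin-cong D (hom-id h n i j) D.refl k)

  hom-c : ∀ n A k → to (CC.c n A k) D.≈ CD.c n (λ i j → to (A i j)) k
  hom-c n A k = D.trans (D.reflexive (≡.sym (mapPS-to h _ k))) (D.trans (hom-det (mapPS h) n (CC.I+x n A) k)
    (CD.Sᴹ.det-cong n (entry n A) k))

  hom-e : ∀ n A k → to (CC.e n A k) D.≈ CD.e n (λ i j → to (A i j)) k
  hom-e n A k = D.trans (D.reflexive (≡.sym (mapPS-to h _ k))) (D.trans (hom-∂ (mapPS h) n (CC.I+x n A) CC.Sᴰ.ones k)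
    (CD.Sᴰ.∂-cong n (entry n A) (λ i j → Hom.1-hom (mapPS h)) k))

  hom-d : ∀ n A k → to (CC.d n A k) D.≈ CD.d n (λ i j → to (A i j)) k
  hom-d n A k = D.trans (D.reflexive (≡.sym (mapPS-to h _ k))) (D.trans (hom-∂ (mapPS h) n (CC.I+x n A) CC.Sᴰ.upper k)
    (CD.Sᴰ.∂-cong n (entry n A) (λ i j → hom-upper (mapPS h) i j) k))

-- Reduction modulo 2 and modulo π

module CharTwo (C : CR) where
  open CommutativeRing C hiding (zero)
  open Relation.Binary.Reasoning.Setoid setoid
  open Solve C
  open Pow C
  open Cast C
  open Det′ C using (Mat)
  open Charpoly C

  module _ (two : 1# + 1# ≈ 0#) where
    neg-id : ∀ x → - x ≈ x
    neg-id x = begin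
      - x                   ≈⟨ solve 1 (λ x → :- x := x :- (con (+ 1) :+ con (+ 1)) :* x) refl x ⟩
      x - (1# + 1#) * x     ≈⟨ +-congˡ (-‿cong (trans (*-congʳ two) (zeroˡ x))) ⟩
      x - 0#                ≈⟨ solve 1 (λ x → x :- con (+ 0) := x) refl x ⟩
      x                     ∎

    ιℕ-dbl : ∀ m → ιℕ (dbl m) ≈ 0#
    ιℕ-dbl zero = refl
    ιℕ-dbl (suc m) = trans (+-congˡ (ιℕ-suc (dbl m))) (trans (sym (+-assoc _ _ _)) (trans (+-cong two (ιℕ-dbl m)) (+-identityʳ _)))

    ιℕ-odd : ∀ m → ιℕ (suc (dbl m)) ≈ 1#
    ιℕ-odd m = trans (ιℕ-suc (dbl m)) (trans (+-congˡ (ιℕ-dbl m)) (+-identityʳ _))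

    module _ (lam : Carrier) (lam² : lam * lam ≈ 1#) where
      lam^dbl : ∀ m → lam ^ dbl m ≈ 1#
      lam^dbl zero = refl
      lam^dbl (suc m) = trans (sym (*-assoc _ _ _)) (trans (*-cong lam² (lam^dbl m)) (*-identityˡ _))

      module _ {n : ℕ} (A : Mat n) (eA : ∀ i j → A j i ≈ lam * A i j) where
        private
          even-part : ∀ m → (1# + lam ^ dbl m) * d n A (dbl m) ≈ 0#
          even-part m = trans (*-congʳ (trans (+-congˡ (lam^dbl m)) two)) (zeroˡ _)

        -- For even n and k both n - k and 1 + `lam` ^ k vanish in characteristic two, the latter
        -- because the square of `lam` is 1.
        e-even-even : ∀ r → n ≡ dbl r → ∀ m → e n A (dbl m) ≈ 0#
        e-even-even r eq m = begin
          e n A (dbl m)  ≈⟨ e-transpose n A lam eA (dbl m) ⟩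
          (ιℕ n - ιℕ (dbl m)) * c n A (dbl m) + (1# + lam ^ dbl m) * d n A (dbl m)
            ≈⟨ +-cong (*-congʳ (+-cong (trans (reflexive (≡.cong ιℕ eq)) (ιℕ-dbl r)) (-‿cong (ιℕ-dbl m)))) (even-part m) ⟩
          (0# - 0#) * c n A (dbl m) + 0#  ≈⟨ solve 1 (λ x → (con (+ 0) :- con (+ 0)) :* x :+ con (+ 0) := con (+ 0)) refl _ ⟩
          0# ∎

        e-odd-even : ∀ r → n ≡ suc (dbl r) → ∀ m → e n A (dbl m) ≈ c n A (dbl m)
        e-odd-even r eq m = begin
          e n A (dbl m)  ≈⟨ e-transpose n A lam eA (dbl m) ⟩
          (ιℕ n - ιℕ (dbl m)) * c n A (dbl m) + (1# + lam ^ dbl m) * d n A (dbl m)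
            ≈⟨ +-cong (*-congʳ (+-cong (trans (reflexive (≡.cong ιℕ eq)) (ιℕ-odd r)) (-‿cong (ιℕ-dbl m)))) (even-part m) ⟩
          (1# - 0#) * c n A (dbl m) + 0#  ≈⟨ solve 1 (λ x → (con (+ 1) :- con (+ 0)) :* x :+ con (+ 0) := x) refl _ ⟩
          c n A (dbl m) ∎

        -- For odd n and k the identity part vanishes and `lam` ^ k is `lam`. The remaining factor 1
        -- + `lam` is 0 when `lam` is 1, and π when `lam` is 1 + π.
        e-odd-odd : ∀ r → n ≡ suc (dbl r) → ∀ m → e n A (suc (dbl m)) ≈ (1# + lam) * d n A (suc (dbl m))
        e-odd-odd r eq m = begin
          e n A (suc (dbl m))  ≈⟨ e-transpose n A lam eA (suc (dbl m)) ⟩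
          (ιℕ n - ιℕ (suc (dbl m))) * c n A (suc (dbl m)) + (1# + lam ^ suc (dbl m)) * d n A (suc (dbl m))
            ≈⟨ +-cong (*-congʳ (+-cong (trans (reflexive (≡.cong ιℕ eq)) (ιℕ-odd r)) (-‿cong (ιℕ-odd m))))
                 (*-congʳ (+-congˡ (trans (*-congˡ (lam^dbl m)) (*-identityʳ _)))) ⟩
          (1# - 1#) * c n A (suc (dbl m)) + (1# + lam) * d n A (suc (dbl m))
            ≈⟨ solve 2 (λ x y → (con (+ 1) :- con (+ 1)) :* x :+ y := y) refl _ _ ⟩
          (1# + lam) * d n A (suc (dbl m)) ∎

module UnitEntries (K : CR) (ζ : CommutativeRing.Carrier K) {n : ℕ} (a : Fin n → Fin n → ℕ) where
  open CommutativeRing K hiding (zero)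
  open Relation.Binary.Reasoning.Setoid setoid
  open Solve K
  open Pow K
  open Geometric K
  open Det′ K using (Mat)
  open Charpoly K

  π : Carrier
  π = 1# - ζ

  -- `A` is the quotient of 1 - ζ^a by π, written as a geometric sum to avoid division.
  h A : Mat n
  h i j = ζ ^ a i j
  A i j = geom (a i j) ζ

  h-A : ∀ i j → h i j ≈ 1# - π * A i j
  h-A i j = begin
    h i j                 ≈⟨ solve 1 (λ x → x := con (+ 1) :- (con (+ 1) :- x)) refl _ ⟩
    1# - (1# - h i j)     ≈⟨ +-congˡ (-‿cong (sym (geom-telescope (a i j) ζ))) ⟩
    1# - π * A i j        ∎

  coef : ℕ → Carrier
  coef = c n (λ i j → - h i j)

  coef-expand : ∀ k → coef (suc k) ≈ π ^ k * (π * c n A (suc k) - e n A k)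
  coef-expand k = trans (coeff-expand n π h A h-A k)
    (solve 4 (λ w v x y → w :* v :* x :- v :* y := v :* (w :* x :- y)) refl π (π ^ k) _ _)

module ModPi (K : CR) (ζ : CommutativeRing.Carrier K) where
  open CommutativeRing K hiding (zero)
  open Solve K
  open Geometric K
  module F = Quotient K (1# - ζ)
  module FR = CommutativeRing F.Quot

  ζ~1 : ζ F.~ 1#
  ζ~1 = - 1# , solve 1 (λ z → z :- con (+ 1) := :- con (+ 1) :* (con (+ 1) :- z)) refl ζ

  -- ζ is 1 modulo π, so the m terms of the sum are all 1. Hence an entry of A is its exponent
  -- modulo π, which opens the way to integer matrices.
  geom~ : ∀ m → geom m ζ F.~ Cast.ιℕ F.Quot m
  geom~ zero = FR.refl {0#}
  geom~ (suc m) = FR.trans {1# + ζ * geom m ζ} {1# + 1# * Cast.ιℕ F.Quot m} {Cast.ιℕ F.Quot (suc m)}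
    (FR.+-cong {1#} {1#} (FR.refl {1#}) (FR.*-cong {ζ} {1#} {geom m ζ} ζ~1 (geom~ m)))
    (FR.trans {1# + 1# * Cast.ιℕ F.Quot m} {1# + Cast.ιℕ F.Quot m} (F.≈⇒~ (+-congˡ (*-identityˡ _))) (FR.sym {Cast.ιℕ F.Quot (suc m)} (Cast.ιℕ-suc F.Quot m)))

-- Valuations at π and reality

record Cyclotomic (K : CR) : Set₁ where
  open CommutativeRing K hiding (zero)
  open Cast K using (ι; ιℕ)
  field
    ζ ζ̄ : Carrier
    ζζ̄ : ζ * ζ̄ ≈ 1#
    digits : DigitSystem K
  open DigitSystem digits public
  field
    ϖ-def : ϖ ≈ (1# - ζ) * (1# - ζ̄)
    π-cancel : ∀ x → (1# - ζ) * x ≈ 0# → x ≈ 0#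
    -- In ideal terms, π meets ℤ only in pℤ. Applied to differences of digits, it is the whole
    -- source of information on valuations.
    residue : ∀ i w → ι i ≈ (1# - ζ) * w → p ∣ ∣ i ∣
    conj : Hom K K
    conj-ζ : Hom.to conj ζ ≈ ζ̄
    fixed-real : ∀ x → Hom.to conj x ≈ x → Real x

module CyclotomicTheory (K : CR) (Z : Cyclotomic K) where
  open CommutativeRing K hiding (zero)
  open Algebra.Properties.AbelianGroup +-abelianGroup using () renaming (x∙y⁻¹≈ε⇒x≈y to x-y≈0⇒x≈y)
  open Relation.Binary.Reasoning.Setoid setoid
  open Solve K
  open Pow K
  open Cast K
  open Cyclotomic Z
  open Coding K digits

  π : Carrier
  π = 1# - ζ

  -- The unit with ρ = π² η, because 1 - ζ̄ = - ζ̄ (1 - ζ).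
  η : Carrier
  η = - ζ̄

  ϖ-π : ϖ ≈ π * (π * η)
  ϖ-π = begin
    ϖ                                         ≈⟨ ϖ-def ⟩
    π * (1# - ζ̄)                              ≈⟨ *-congˡ (+-congʳ (sym ζζ̄)) ⟩
    π * (ζ * ζ̄ - ζ̄)                           ≈⟨ *-congˡ (solve 2 (λ z w → z :* w :- w := (con (+ 1) :- z) :* :- w) refl ζ ζ̄) ⟩
    π * (π * η)                               ∎

  η-inverse : ∀ x → - ζ * (η * x) ≈ x
  η-inverse x = trans (solve 3 (λ z w x → :- z :* (:- w :* x) := z :* w :* x) refl ζ ζ̄ x) (trans (*-congʳ ζζ̄) (*-identityˡ x))

  π-cancel₂ : ∀ {x y} → π * x ≈ π * y → x ≈ y
  π-cancel₂ {x} {y} eq = x-y≈0⇒x≈y x y (π-cancel (x - y)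
    (trans (solve 3 (λ w x y → w :* (x :- y) := w :* x :- w :* y) refl π x y) (trans (+-congʳ eq) (-‿inverseʳ _))))

  π^-cancel : ∀ k {x y} → π ^ k * x ≈ π ^ k * y → x ≈ y
  π^-cancel zero eq = trans (sym (*-identityˡ _)) (trans eq (*-identityˡ _))
  π^-cancel (suc k) eq = π^-cancel k (π-cancel₂ (trans (sym (*-assoc _ _ _)) (trans eq (*-assoc _ _ _))))

  ϖ^-π : ∀ m → ϖ ^ m ≈ π ^ dbl m * η ^ m
  ϖ^-π zero = sym (*-identityˡ _)
  ϖ^-π (suc m) = trans (*-cong ϖ-π (ϖ^-π m))
    (solve 4 (λ w n x y → w :* (w :* n) :* (x :* y) := w :* (w :* x) :* (n :* y)) refl π η (π ^ dbl m) (η ^ m))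

  η^-inverse : ∀ m → (- ζ) ^ m * η ^ m ≈ 1#
  η^-inverse m = inverse-^ (- ζ) η m (trans (solve 2 (λ z w → :- z :* :- w := z :* w) refl ζ ζ̄) ζζ̄)

  ϖ^-cancel : ∀ m {x y} → ϖ ^ m * x ≈ ϖ ^ m * y → x ≈ y
  ϖ^-cancel m {x} {y} eq = begin
    x                               ≈⟨ *-identityˡ x ⟨
    1# * x                          ≈⟨ *-congʳ (η^-inverse m) ⟨
    (- ζ) ^ m * η ^ m * x           ≈⟨ *-assoc _ _ _ ⟩
    (- ζ) ^ m * (η ^ m * x)         ≈⟨ *-congˡ (π^-cancel (dbl m) (trans (sym (*-assoc _ _ _)) (trans (*-congʳ (sym (ϖ^-π m))) (trans eq (trans (*-congʳ (ϖ^-π m)) (*-assoc _ _ _)))))) ⟩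
    (- ζ) ^ m * (η ^ m * y)         ≈⟨ *-assoc _ _ _ ⟨
    (- ζ) ^ m * η ^ m * y           ≈⟨ *-congʳ (η^-inverse m) ⟩
    1# * y                          ≈⟨ *-identityˡ y ⟩
    y                               ∎

  -- The difference is an integer divisible by π, hence by p, and its absolute value is less than p.
  digit-unique : ∀ (d d′ : Fin p) w → ιℕ (toℕ d) - ιℕ (toℕ d′) ≈ π * w → d ≡ d′
  digit-unique d d′ w eq = Finₚ.toℕ-injective (ℤₚ.+-injective (ℤₚ.i-j≡0⇒i≡j (+ toℕ d) (+ toℕ d′) (ℤₚ.∣i∣≡0⇒i≡0 (small ∣ + toℕ d ℤ.- + toℕ d′ ∣ bound div))))
    where
    div : p ∣ ∣ + toℕ d ℤ.- + toℕ d′ ∣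
    div = residue (+ toℕ d ℤ.- + toℕ d′) w (trans (ι-+ (+ toℕ d) (ℤ.- + toℕ d′)) (trans (+-congˡ (ι-neg (+ toℕ d′))) eq))
    bound : ∣ + toℕ d ℤ.- + toℕ d′ ∣ ℕ.< p
    bound = ℕₚ.≤-<-trans (≡.subst (λ z → ∣ z ∣ ℕ.≤ toℕ d ℕ.⊔ toℕ d′) (≡.sym (ℤₚ.m-n≡m⊖n (toℕ d) (toℕ d′))) (ℤₚ.∣m⊝n∣≤m⊔n (toℕ d) (toℕ d′))) (ℕₚ.⊔-lub (Finₚ.toℕ<n d) (Finₚ.toℕ<n d′))
    small : ∀ m → m ℕ.< p → p ∣ m → m ≡ 0
    small zero _ _ = ≡.refl
    small (suc m) m<p dv = ⊥-elim (ℕₚ.<⇒≱ m<p (∣⇒≤ dv))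

  -- Modulo π only the last digit of z is left, and a digit divisible by π is 0. So one factor π in
  -- a real element forces a factor ρ with real cofactor.
  real-π : ∀ z → Real z → ∀ w → z ≈ π * w → Σ Carrier (λ r → Real r × z ≈ ϖ * r)
  real-π z R w eq = r′ , proj₁ (proj₂ (proj₂ (digit z R))) , (begin
    z                       ≈⟨ ez ⟩
    ιℕ (toℕ d) + ϖ * r′     ≈⟨ +-congʳ (reflexive (≡.cong ιℕ d≡0)) ⟩
    0# + ϖ * r′             ≈⟨ +-identityˡ _ ⟩
    ϖ * r′                  ∎)
    where
    d : Fin p
    d = proj₁ (digit z R)
    r′ : Carrier
    r′ = proj₁ (proj₂ (digit z R))
    ez : z ≈ ιℕ (toℕ d) + ϖ * r′
    ez = proj₂ (proj₂ (proj₂ (digit z R)))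
    small : ∀ m → m ℕ.< p → p ∣ m → m ≡ 0
    small zero _ _ = ≡.refl
    small (suc m) m<p dv = ⊥-elim (ℕₚ.<⇒≱ m<p (∣⇒≤ dv))
    d≡0 : toℕ d ≡ 0
    d≡0 = small (toℕ d) (Finₚ.toℕ<n d) (residue (+ toℕ d) (w - π * η * r′) (begin
      ιℕ (toℕ d)                        ≈⟨ solve 2 (λ x y → x := x :+ y :- y) refl _ (ϖ * r′) ⟩
      ιℕ (toℕ d) + ϖ * r′ - ϖ * r′      ≈⟨ +-cong (trans (sym ez) eq) (-‿cong (*-congʳ ϖ-π)) ⟩
      π * w - π * (π * η) * r′          ≈⟨ solve 4 (λ p w n r → p :* w :- p :* (p :* n) :* r := p :* (w :- p :* n :* r)) refl π w η r′ ⟩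
      π * (w - π * η * r′)              ∎))

  -- A real element has even valuation at π.
  real-valuation : ∀ m z → Real z → ∀ w → z ≈ π ^ suc (dbl m) * w → Σ Carrier (λ r → Real r × z ≈ ϖ ^ suc m * r)
  real-valuation zero z R w eq = r , Rr , trans er (*-congʳ (sym (*-identityʳ _)))
    where
    step : Σ Carrier (λ r → Real r × z ≈ ϖ * r)
    step = real-π z R w (trans eq (*-congʳ (*-identityʳ _)))
    r : Carrier
    r = proj₁ step
    Rr : Real r
    Rr = proj₁ (proj₂ step)
    er : z ≈ ϖ * r
    er = proj₂ (proj₂ step)
  real-valuation (suc m) z R w eq = r″ , proj₁ (proj₂ IH) , (begin
    z                         ≈⟨ er ⟩
    ϖ * r                     ≈⟨ *-congˡ (proj₂ (proj₂ IH)) ⟩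
    ϖ * (ϖ ^ suc m * r″)      ≈⟨ *-assoc _ _ _ ⟨
    ϖ ^ suc (suc m) * r″      ∎)
    where
    step : Σ Carrier (λ r → Real r × z ≈ ϖ * r)
    step = real-π z R (π * (π * π ^ dbl m) * w) (trans eq (*-assoc _ _ _))
    r : Carrier
    r = proj₁ step
    er : z ≈ ϖ * r
    er = proj₂ (proj₂ step)
    r-val : r ≈ π ^ suc (dbl m) * (- ζ * w)
    r-val = begin
      r                                      ≈⟨ η-inverse r ⟨
      - ζ * (η * r)                          ≈⟨ *-congˡ (π-cancel₂ (π-cancel₂ (begin
        π * (π * (η * r))                      ≈⟨ solve 3 (λ p n r → p :* (p :* (n :* r)) := p :* (p :* n) :* r) refl π η r ⟩
        π * (π * η) * r                        ≈⟨ *-congʳ ϖ-π ⟨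
        ϖ * r                                  ≈⟨ trans (sym er) eq ⟩
        π * (π * (π * π ^ dbl m)) * w          ≈⟨ solve 3 (λ p q w → p :* (p :* (p :* q)) :* w := p :* (p :* (p :* q :* w))) refl π (π ^ dbl m) w ⟩
        π * (π * (π * π ^ dbl m * w))          ∎))) ⟩
      - ζ * (π ^ suc (dbl m) * w)            ≈⟨ solve 3 (λ z p w → :- z :* (p :* w) := p :* (:- z :* w)) refl ζ (π ^ suc (dbl m)) w ⟩
      π ^ suc (dbl m) * (- ζ * w)            ∎
    IH : Σ Carrier (λ r″ → Real r″ × r ≈ ϖ ^ suc m * r″)
    IH = real-valuation m r (proj₁ (proj₂ step)) (- ζ * w) r-val
    r″ : Carrier
    r″ = proj₁ IH

  module Hermitian {n : ℕ} (a : Fin n → Fin n → ℕ) (hh : ∀ i j → ζ ^ a i j * ζ ^ a j i ≈ 1#) where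
    open UnitEntries K ζ a public hiding (π)
    open Charpoly K

    conj-h : ∀ i j → Hom.to conj (h i j) ≈ h j i
    conj-h i j = begin
      Hom.to conj (ζ ^ a i j)                 ≈⟨ trans (hom-^ conj ζ (a i j)) (^-cong (a i j) conj-ζ) ⟩
      ζ̄ ^ a i j                               ≈⟨ *-identityʳ _ ⟨
      ζ̄ ^ a i j * 1#                          ≈⟨ *-congˡ (hh i j) ⟨
      ζ̄ ^ a i j * (ζ ^ a i j * ζ ^ a j i)     ≈⟨ *-assoc _ _ _ ⟨
      ζ̄ ^ a i j * ζ ^ a i j * ζ ^ a j i       ≈⟨ *-congʳ (inverse-^ ζ̄ ζ (a i j) (trans (*-comm _ _) ζζ̄)) ⟩
      1# * ζ ^ a j i                          ≈⟨ *-identityˡ _ ⟩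
      ζ ^ a j i                               ∎

    -- Conjugation carries H to its transpose, and transposition leaves the determinant unchanged.
    coef-real : ∀ k → Real (coef k)
    coef-real k = fixed-real (coef k) (begin
      Hom.to conj (c n (λ i j → - h i j) k)          ≈⟨ hom-c conj n _ k ⟩
      c n (λ i j → Hom.to conj (- h i j)) k          ≈⟨ pencil-cong n (λ i j → reflexive (Derivative.idMat-sym K n i j)) (λ i j → trans (Hom.neg-hom conj _) (-‿cong (conj-h i j))) k ⟩
      Sᴹ.det n (λ i j → I+x n (λ i j → - h i j) j i) k   ≈⟨ Sᴹ.det-transpose n (I+x n (λ i j → - h i j)) k ⟩
      c n (λ i j → - h i j) k                        ∎)

    Lead : ℕ → ℕ → Set
    Lead u k = Σ Carrier (λ b → Real b × coef k ≈ ϖ ^ u * b)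

    lead-odd : ∀ m → Lead (suc m) (suc (suc (suc (dbl m))))
    lead-odd m = real-valuation m _ (coef-real _) (π * W) (trans (coef-expand (suc (suc (dbl m))))
      (solve 3 (λ p q w → p :* (p :* q) :* w := p :* q :* (p :* w)) refl π (π ^ dbl m) W))
      where
      W : Carrier
      W = π * c n A (suc (suc (suc (dbl m)))) - e n A (suc (suc (dbl m)))

    -- At even k = 2m + 2 the exponent k - 1 of π is odd, and reality rounds it up to k. At odd k,
    -- as in `lead-odd`, the exponent k - 1 is even already and nothing is gained.
    lead-even : ∀ m → Lead (suc m) (suc (suc (dbl m)))
    lead-even m = real-valuation m _ (coef-real _) _ (coef-expand (suc (dbl m)))

    lead : ∀ i → Lead (halfFloor (parity i)) (3 ℕ.+ i)
    lead i = go (parity i)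
      where
      go : ∀ {i} (π : Parity i) → Lead (halfFloor π) (3 ℕ.+ i)
      go (even m) = lead-odd m
      go (odd m) = lead-even (suc m)

-- For 4 dividing q the sums a(i,j) + a(j,i) and the diagonal exponents are even, so modulo 2 the
-- exponent matrix is skew-symmetric with zero diagonal. The signs and zeros chosen here make this
-- hold over ℤ without changing any entry modulo 2.
skewLift : ∀ {n} → (Fin n → Fin n → ℕ) → Fin n → Fin n → ℤ
skewLift a zero zero = + 0
skewLift a zero (suc j) = + a zero (suc j)
skewLift a (suc i) zero = ℤ.- + a zero (suc i)
skewLift a (suc i) (suc j) = skewLift (λ i j → a (suc i) (suc j)) i j

skewLift-diag : ∀ {n} (a : Fin n → Fin n → ℕ) i → skewLift a i i ≡ + 0
skewLift-diag a zero = ≡.refl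
skewLift-diag a (suc i) = skewLift-diag (λ i j → a (suc i) (suc j)) i

skewLift-skew : ∀ {n} (a : Fin n → Fin n → ℕ) i j → skewLift a j i ≡ ℤ.- skewLift a i j
skewLift-skew a zero zero = ≡.refl
skewLift-skew a zero (suc j) = ≡.refl
skewLift-skew a (suc i) zero = ≡.sym (ℤₚ.neg-involutive _)
skewLift-skew a (suc i) (suc j) = skewLift-skew (λ i j → a (suc i) (suc j)) i j

module _ (C : CR) (two : CommutativeRing._≈_ C (CommutativeRing._+_ C (CommutativeRing.1# C) (CommutativeRing.1# C)) (CommutativeRing.0# C)) where
  open CommutativeRing C hiding (zero)
  open Cast C
  open Solve C
  open CharTwo C

  ι-skewLift : ∀ {n} (a : Fin n → Fin n → ℕ) → (∀ i j → ∃ (λ z → a i j ℕ.+ a j i ≡ dbl z)) → (∀ i → ∃ (λ z → a i i ≡ dbl z)) →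
    ∀ i j → ιℕ (a i j) ≈ ι (skewLift a i j)
  ι-skewLift a ev ed zero zero = trans (reflexive (≡.cong ιℕ (proj₂ (ed zero)))) (ιℕ-dbl two (proj₁ (ed zero)))
  ι-skewLift a ev ed zero (suc j) = refl
  ι-skewLift a ev ed (suc i) zero = begin
    ιℕ (a (suc i) zero)
      ≈⟨ solve 2 (λ x y → x := x :+ y :- y) refl _ (ιℕ (a zero (suc i))) ⟩
    ιℕ (a (suc i) zero) + ιℕ (a zero (suc i)) - ιℕ (a zero (suc i))
      ≈⟨ +-cong (trans (sym (ιℕ-+ (a (suc i) zero) (a zero (suc i)))) (trans (reflexive (≡.cong ιℕ (proj₂ (ev (suc i) zero)))) (ιℕ-dbl two (proj₁ (ev (suc i) zero))))) (sym (ι-neg (+ a zero (suc i)))) ⟩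
    0# + ι (ℤ.- + a zero (suc i))
      ≈⟨ +-identityˡ _ ⟩
    ι (ℤ.- + a zero (suc i)) ∎
    where open Relation.Binary.Reasoning.Setoid setoid
  ι-skewLift a ev ed (suc i) (suc j) = ι-skewLift (λ i j → a (suc i) (suc j)) (λ i j → ev (suc i) (suc j)) (λ i → ed (suc i)) i j

-- Powers of two from 4 on, and the saved digit

module TwoPower (K : CR) (Z : Cyclotomic K) (ν : CommutativeRing.Carrier K)
  (two : CommutativeRing._≈_ K (CommutativeRing._+_ K (CommutativeRing.1# K) (CommutativeRing.1# K)) (CommutativeRing._*_ K (Cyclotomic.ϖ Z) ν)) where
  open CommutativeRing K hiding (zero)
  open Relation.Binary.Reasoning.Setoid setoid
  open Solve K
  open Pow K
  open Cast K
  open Cyclotomic Z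
  open Coding K digits
  open CyclotomicTheory K Z
  open ModPi K ζ
  module Q = Quotient K (π * π)
  module QR = CommutativeRing Q.Quot
  module FH = HalfSum F.Quot

  -- Here q ≥ 4 enters: 2 is divisible by ρ, so characteristic two persists modulo π² and not just
  -- modulo π.
  two-π² : 1# + 1# ≈ η * ν * (π * π)
  two-π² = trans two (trans (*-congʳ ϖ-π) (solve 3 (λ p n v → p :* (p :* n) :* v := n :* v :* (p :* p)) refl π η ν))

  Q⇒F : ∀ {x y} → x Q.~ y → x F.~ y
  Q⇒F (z , eq) = z * π , trans eq (sym (*-assoc _ _ _))

  twoQ : (1# + 1#) Q.~ 0#
  twoQ = η * ν , trans (solve 1 (λ x → x :- con (+ 0) := x) refl _) two-π²

  twoF : (1# + 1#) F.~ 0#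
  twoF = Q⇒F {1# + 1#} {0#} twoQ

  lam : Carrier
  lam = 1# + π

  lam² : (lam * lam) Q.~ 1#
  lam² = π * (η * ν) + 1# , (begin
    lam * lam - 1#                         ≈⟨ solve 1 (λ p → (con (+ 1) :+ p) :* (con (+ 1) :+ p) :- con (+ 1) := p :* (con (+ 1) :+ con (+ 1)) :+ p :* p) refl π ⟩
    π * (1# + 1#) + π * π                  ≈⟨ +-congʳ (*-congˡ two-π²) ⟩
    π * (η * ν * (π * π)) + π * π          ≈⟨ solve 3 (λ p n v → p :* (n :* v :* (p :* p)) :+ p :* p := (p :* (n :* v) :+ con (+ 1)) :* (p :* p)) refl π η ν ⟩
    (π * (η * ν) + 1#) * (π * π)           ∎)

  private
    F2 : ∀ m → Cast.ιℕ F.Quot m FR.* Cast.ιℕ F.Quot m FR.≈ Cast.ιℕ F.Quot m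
    F2 m = go (parity m)
      where
      open CharTwo F.Quot
      go : ∀ {m} → Parity m → Cast.ιℕ F.Quot m FR.* Cast.ιℕ F.Quot m FR.≈ Cast.ιℕ F.Quot m
      go (even m) = FR.trans {x * x} {x * 0#} {x} (FR.*-cong {x} {x} {x} {0#} (FR.refl {x}) (ιℕ-dbl twoF m))
        (FR.trans {x * 0#} {0#} {x} (FR.zeroʳ x) (FR.sym {x} {0#} (ιℕ-dbl twoF m)))
        where
        x : Carrier
        x = Cast.ιℕ F.Quot (dbl m)
      go (odd m) = FR.trans {x * x} {x * 1#} {x} (FR.*-cong {x} {x} {x} {1#} (FR.refl {x}) (ιℕ-odd twoF m)) (FR.*-identityʳ x)
        where
        x : Carrier
        x = Cast.ιℕ F.Quot (suc (dbl m))

  module Herm₂ {n : ℕ} (a : Fin n → Fin n → ℕ) (hh : ∀ i j → ζ ^ a i j * ζ ^ a j i ≈ 1#) where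
    open Hermitian a hh public
    open Charpoly K using (c; d; e)

    -- Expand (1 - πx)(1 - πy) = 1, where x and y are the two entries, and cancel one factor π.
    A-sum : ∀ i j → A i j + A j i ≈ π * (A i j * A j i)
    A-sum i j = π-cancel₂ (begin
      π * (x + y)
        ≈⟨ solve 3 (λ p x y → p :* (x :+ y) := con (+ 1) :- (con (+ 1) :- p :* x) :* (con (+ 1) :- p :* y) :+ p :* (p :* (x :* y))) refl π x y ⟩
      1# - (1# - π * x) * (1# - π * y) + π * (π * (x * y))
        ≈⟨ +-congʳ (+-congˡ (-‿cong (trans (*-cong (sym (h-A i j)) (sym (h-A j i))) (hh i j)))) ⟩
      1# - 1# + π * (π * (x * y))
        ≈⟨ solve 1 (λ x → con (+ 1) :- con (+ 1) :+ x := x) refl _ ⟩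
      π * (π * (x * y)) ∎)
      where
      x y : Carrier
      x = A i j
      y = A j i

    A-idem : ∀ i j → (A i j * A i j) F.~ A i j
    A-idem i j = FR.trans {x * x} {m * m} {x} (FR.*-cong {x} {m} {x} {m} x~m x~m)
      (FR.trans {m * m} {m} {x} (F2 (a i j)) (FR.sym {x} {m} x~m))
      where
      x m : Carrier
      x = A i j
      m = Cast.ιℕ F.Quot (a i j)
      x~m : x F.~ m
      x~m = geom~ (a i j)

    -- With x and y the two entries, `A-sum` and -1 = 1 modulo π² give y = x + πxy. The factor xy
    -- counts only modulo π, where y = x and x² = x, so that y = (1 + π) x.
    A-transpose : ∀ i j → A j i Q.~ (lam * A i j)
    A-transpose i j = x * x * y - z - η * ν * x * lam , (begin
      y - lam * x
        ≈⟨ solve 3 (λ p x y → y :- (con (+ 1) :+ p) :* x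
             := x :+ y :- p :* (x :* y) :+ p :* (x :* (x :+ y :- p :* (x :* y))) :+ (p :* p) :* (x :* x :* y) :- p :* (x :* x :- x) :- (con (+ 1) :+ con (+ 1)) :* (x :* (con (+ 1) :+ p))) refl π x y ⟩
      x + y - π * (x * y) + π * (x * (x + y - π * (x * y))) + π * π * (x * x * y) - π * (x * x - x) - (1# + 1#) * (x * lam)
        ≈⟨ +-cong (+-cong (+-congʳ (+-cong s0 (*-congˡ (*-congˡ s0)))) (-‿cong (*-congˡ ez))) (-‿cong (*-congʳ two-π²)) ⟩
      0# + π * (x * 0#) + π * π * (x * x * y) - π * (z * π) - η * ν * (π * π) * (x * lam)
        ≈⟨ solve 6 (λ p x y z t l → con (+ 0) :+ p :* (x :* con (+ 0)) :+ p :* p :* (x :* x :* y) :- p :* (z :* p) :- t :* (p :* p) :* (x :* l)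
             := (x :* x :* y :- z :- t :* x :* l) :* (p :* p)) refl π x y z (η * ν) lam ⟩
      (x * x * y - z - η * ν * x * lam) * (π * π) ∎)
      where
      x y z : Carrier
      x = A i j
      y = A j i
      z = proj₁ (A-idem i j)
      ez : x * x - x ≈ z * π
      ez = proj₂ (A-idem i j)
      s0 : x + y - π * (x * y) ≈ 0#
      s0 = trans (+-congʳ (A-sum i j)) (-‿inverseʳ _)

    private
      module CQ = Charpoly Q.Quot
      module C2 = CharTwo Q.Quot
      e~ : ∀ k → e n A k Q.~ CQ.e n A k
      e~ k = hom-e Q.quot n A k

    e-even : ∀ r → n ≡ dbl r → ∀ m → e n A (dbl m) Q.~ 0#
    e-even r eq m = QR.trans {e n A (dbl m)} {CQ.e n A (dbl m)} {0#} (e~ (dbl m)) (C2.e-even-even twoQ lam lam² A A-transpose r eq m)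

    -- At k = 2m + 3 the vanishing of the derivative along J raises the exponent of π in a_k from 2m
    -- + 2 to 2m + 3. This is odd, so reality rounds it up to 2m + 4.
    lead-ceil : ∀ r → n ≡ dbl r → ∀ i → Lead (halfCeil (parity i)) (3 ℕ.+ i)
    lead-ceil r eq i = go (parity i)
      where
      go : ∀ {i} (P : Parity i) → Lead (halfCeil P) (3 ℕ.+ i)
      go (odd m) = lead-even (suc m)
      go (even m) = real-valuation (suc m) _ (coef-real _) (x - z * π) (begin
        coef (3 ℕ.+ dbl m)                              ≈⟨ coef-expand (dbl (suc m)) ⟩
        π ^ dbl (suc m) * (π * x - e n A (dbl (suc m)))  ≈⟨ *-congˡ (+-congˡ (-‿cong (trans (solve 1 (λ x → x := x :- con (+ 0)) refl _) ez))) ⟩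
        π ^ dbl (suc m) * (π * x - z * (π * π))          ≈⟨ solve 4 (λ q p x z → q :* (p :* x :- z :* (p :* p)) := p :* q :* (x :- z :* p)) refl (π ^ dbl (suc m)) π x z ⟩
        π ^ suc (dbl (suc m)) * (x - z * π)              ∎)
        where
        x z : Carrier
        x = c n A (3 ℕ.+ dbl m)
        z = proj₁ (e-even r eq (suc m))
        ez : e n A (dbl (suc m)) - 0# ≈ z * (π * π)
        ez = proj₂ (e-even r eq (suc m))

    module OddOrder (r : ℕ) (n≡ : n ≡ suc (dbl r)) where
      e-odd-even : ∀ m → e n A (dbl m) Q.~ c n A (dbl m)
      e-odd-even m = QR.trans {e n A (dbl m)} {CQ.e n A (dbl m)} {c n A (dbl m)} (e~ (dbl m))
        (QR.trans {CQ.e n A (dbl m)} {CQ.c n A (dbl m)} {c n A (dbl m)} (C2.e-odd-even twoQ lam lam² A A-transpose r n≡ m) (QR.sym {c n A (dbl m)} {CQ.c n A (dbl m)} (hom-c Q.quot n A (dbl m))))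

      e-odd-odd : ∀ m → e n A (suc (dbl m)) Q.~ (π * d n A (suc (dbl m)))
      e-odd-odd m = QR.trans {e n A k} {CQ.e n A k} {π * d n A k} (e~ k)
        (QR.trans {CQ.e n A k} {(1# + lam) * CQ.d n A k} {π * d n A k} (C2.e-odd-odd twoQ lam lam² A A-transpose r n≡ m)
        (QR.*-cong {1# + lam} {π} {CQ.d n A k} {d n A k} lam1 (QR.sym {d n A k} {CQ.d n A k} (hom-d Q.quot n A k))))
        where
        k : ℕ
        k = suc (dbl m)
        lam1 : (1# + lam) Q.~ π
        lam1 = QR.trans {1# + lam} {0# + π} {π} (QR.trans {1# + lam} {1# + 1# + π} {0# + π} (Q.≈⇒~ (sym (+-assoc _ _ _)))
          (QR.+-cong {1# + 1#} {0#} {π} {π} twoQ (QR.refl {π}))) (QR.+-identityˡ π)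

      -- Real cofactors of the odd coefficients, with `b` for the even ones. Starting with a₁ itself
      -- lets it take part as g₀ in the quadratic relation below.
      g : ℕ → Carrier
      g zero = coef 1
      g (suc m) = proj₁ (lead-odd m)

      b : ℕ → Carrier
      b m = proj₁ (lead-even m)

      g-real : ∀ m → Real (g m)
      g-real zero = coef-real 1
      g-real (suc m) = proj₁ (proj₂ (lead-odd m))

      b-real : ∀ m → Real (b m)
      b-real m = proj₁ (proj₂ (lead-even m))

      g-eq : ∀ m → coef (suc (dbl m)) ≈ ϖ ^ m * g m
      g-eq zero = sym (*-identityˡ _)
      g-eq (suc m) = proj₂ (proj₂ (lead-odd m))

      b-eq : ∀ m → coef (suc (suc (dbl m))) ≈ ϖ ^ suc m * b m
      b-eq m = proj₂ (proj₂ (lead-even m))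

      η~1 : η F.~ 1#
      η~1 = FR.trans {η} {ζ̄} {1#} (CharTwo.neg-id F.Quot twoF ζ̄) (FR.trans {ζ̄} {ζ * ζ̄} {1#}
        (FR.sym {ζ * ζ̄} {ζ̄} (FR.trans {ζ * ζ̄} {1# * ζ̄} {ζ̄} (FR.*-cong {ζ} {1#} {ζ̄} {ζ̄} ζ~1 (FR.refl {ζ̄})) (FR.*-identityˡ ζ̄))) (F.≈⇒~ ζζ̄))

      η^~1 : ∀ m → (η ^ m) F.~ 1#
      η^~1 zero = FR.refl {1#}
      η^~1 (suc m) = FR.trans {η * η ^ m} {1# * 1#} {1#} (FR.*-cong {η} {1#} {η ^ m} {1#} η~1 (η^~1 m)) (FR.*-identityˡ 1#)

      -- ρ^m is π^(2m) times η^m, and η is 1 modulo π. So leading digits may be read off with π^(2m)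
      -- in place of ρ^m.
      unit-drop : ∀ m x y → π ^ dbl m * y ≈ ϖ ^ m * x → x F.~ y
      unit-drop m x y eq = FR.trans {x} {η ^ m * x} {y} (FR.sym {η ^ m * x} {x} (FR.trans {η ^ m * x} {1# * x} {x}
        (FR.*-cong {η ^ m} {1#} {x} {x} (η^~1 m) (FR.refl {x})) (FR.*-identityˡ x)))
        (F.≈⇒~ (π^-cancel (dbl m) (trans (sym (*-assoc _ _ _)) (trans (*-congʳ (sym (ϖ^-π m))) (sym eq)))))

      g~ : ∀ m → g m F.~ c n A (dbl m)
      g~ m = FR.trans {g m} {π * x - e n A (dbl m)} {c n A (dbl m)} (unit-drop m (g m) _ (trans (sym (coef-expand (dbl m))) (g-eq m)))
        (FR.trans {π * x - e n A (dbl m)} {0# - e n A (dbl m)} {c n A (dbl m)} (FR.+-cong {π * x} {0#} { - e n A (dbl m)} { - e n A (dbl m)} (x , trans (solve 2 (λ p x → p :* x :- con (+ 0) := x :* p) refl π x) refl) (FR.refl { - e n A (dbl m)}))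
        (FR.trans {0# - e n A (dbl m)} { - e n A (dbl m)} {c n A (dbl m)} (FR.+-identityˡ (- e n A (dbl m)))
        (FR.trans { - e n A (dbl m)} {e n A (dbl m)} {c n A (dbl m)} (CharTwo.neg-id F.Quot twoF (e n A (dbl m))) (Q⇒F {e n A (dbl m)} {c n A (dbl m)} (e-odd-even m)))))
        where
        x : Carrier
        x = c n A (suc (dbl m))

      -- By `e-odd-odd` the derivative along J supplies the missing factor π that takes a_(2m+2)
      -- from π^(2m+1) to π^(2m+2). In the leading digit ∂_N then stands beside the coefficient of
      -- det (I + xA).
      b~ : ∀ m → b m F.~ (c n A (dbl (suc m)) + d n A (suc (dbl m)))
      b~ m = FR.trans {b m} {x - y - z * π} {x + y} (unit-drop (suc m) (b m) (x - y - z * π) (trans (sym expand) (b-eq m)))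
        (FR.trans {x - y - z * π} {x - y} {x + y} (- z , solve 4 (λ x y z p → x :- y :- z :* p :- (x :- y) := :- z :* p) refl x y z π)
        (FR.+-cong {x} {x} { - y} {y} (FR.refl {x}) (CharTwo.neg-id F.Quot twoF y)))
        where
        x y z : Carrier
        x = c n A (dbl (suc m))
        y = d n A (suc (dbl m))
        z = proj₁ (e-odd-odd m)
        expand : coef (suc (suc (dbl m))) ≈ π ^ dbl (suc m) * (x - y - z * π)
        expand = begin
          coef (suc (suc (dbl m)))                           ≈⟨ coef-expand (suc (dbl m)) ⟩
          π ^ suc (dbl m) * (π * x - E)                      ≈⟨ *-congˡ (+-congˡ (-‿cong (trans (solve 2 (λ E y → E := y :+ (E :- y)) refl E (π * y)) (+-congˡ (proj₂ (e-odd-odd m)))))) ⟩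
          π ^ suc (dbl m) * (π * x - (π * y + z * (π * π)))  ≈⟨ solve 5 (λ q p x y z → q :* (p :* x :- (p :* y :+ z :* (p :* p))) := p :* q :* (x :- y :- z :* p)) refl (π ^ suc (dbl m)) π x y z ⟩
          π ^ dbl (suc m) * (x - y - z * π)                  ∎
          where
          E : Carrier
          E = e n A (suc (dbl m))

      module _ (ev : ∀ i j → ∃ (λ z → a i j ℕ.+ a j i ≡ dbl z)) (ed : ∀ i → ∃ (λ z → a i i ≡ dbl z)) where
        private
          B : Fin n → Fin n → ℤ
          B = skewLift a
          ιF : ℤ → Carrier
          ιF = Cast.ι F.Quot
          φ : Hom F₂.Quot F.Quot
          φ = F₂.lift-hom (ιʰ F.Quot) twoF
          A~B : ∀ i j → A i j F.~ ιF (B i j)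
          A~B i j = FR.trans {A i j} {Cast.ιℕ F.Quot (a i j)} {ιF (B i j)} (geom~ (a i j)) (ι-skewLift F.Quot twoF a ev ed i j)
          module CF = Charpoly F.Quot
          c~ : ∀ k → c n A k F.~ ιF (Charpoly.c ℤᶜ n B k)
          c~ k = FR.trans {c n A k} {CF.c n A k} {ιF (Charpoly.c ℤᶜ n B k)} (hom-c F.quot n A k)
            (FR.trans {CF.c n A k} {CF.c n (λ i j → ιF (B i j)) k} {ιF (Charpoly.c ℤᶜ n B k)}
              (CF.Sᴹ.det-cong n (λ i j → PowerSeries.lin-cong F.Quot (FR.refl {Det′.idMat F.Quot n i j}) (A~B i j)) k)
              (FR.sym {ιF (Charpoly.c ℤᶜ n B k)} (hom-c (ιʰ F.Quot) n B k)))
          d~ : ∀ k → d n A k F.~ ιF (Charpoly.d ℤᶜ n B k)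
          d~ k = FR.trans {d n A k} {CF.d n A k} {ιF (Charpoly.d ℤᶜ n B k)} (hom-d F.quot n A k)
            (FR.trans {CF.d n A k} {CF.d n (λ i j → ιF (B i j)) k} {ιF (Charpoly.d ℤᶜ n B k)}
              (CF.Sᴰ.∂-cong n (λ i j → PowerSeries.lin-cong F.Quot (FR.refl {Det′.idMat F.Quot n i j}) (A~B i j)) (λ i j → CF.S.refl {CF.Sᴰ.upper i j}) k)
              (FR.sym {ιF (Charpoly.d ℤᶜ n B k)} (hom-d (ιʰ F.Quot) n B k)))

          half : ∀ L → ∃ (λ p → (∀ i → dbl i ℕ.< L → p i F₂.~ Charpoly.c ℤᶜ n B (dbl i)) ×
            (∀ m → suc (dbl m) ℕ.< L → Charpoly.d ℤᶜ n B (suc (dbl m)) F₂.~ HalfSum.halfSum ℤᶜ p (suc m)))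
          half L = go n n≡ B (skewLift-diag a) (skewLift-skew a)
            where
            go : ∀ n → n ≡ suc (dbl r) → (B : Fin n → Fin n → ℤ) → (∀ i → B i i ≡ + 0) → (∀ i j → B j i ≡ ℤ.- B i j) →
              ∃ (λ p → (∀ i → dbl i ℕ.< L → p i F₂.~ Charpoly.c ℤᶜ n B (dbl i)) ×
                (∀ m → suc (dbl m) ℕ.< L → Charpoly.d ℤᶜ n B (suc (dbl m)) F₂.~ HalfSum.halfSum ℤᶜ p (suc m)))
            go .(suc (dbl r)) ≡.refl B diag skew = SkewInteger.Odd.half-identity r B diag skew L

        -- Over the lift B, ∂_N in degree 2m + 1 is half of an odd coefficient of a square, whose
        -- root has the g_i as coefficients modulo π. For m = 0, where g₀ is 1, the right side is 2
        -- g₁ = 0 and says nothing about g₁; this is why a₃ keeps its digit.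
        relation : ∀ m → b m F.~ (g (suc m) + FH.halfSum g (suc m))
        relation m = FR.trans {b m} {c n A (dbl (suc m)) + d n A (suc (dbl m))} {g (suc m) + FH.halfSum g (suc m)} (b~ m)
          (FR.+-cong {c n A (dbl (suc m))} {g (suc m)} {d n A (suc (dbl m))} {FH.halfSum g (suc m)} (FR.sym {g (suc m)} {c n A (dbl (suc m))} (g~ (suc m)))
          (FR.trans {d n A (suc (dbl m))} {ιF (Charpoly.d ℤᶜ n B (suc (dbl m)))} {FH.halfSum g (suc m)} (d~ (suc (dbl m)))
          (FR.trans {ιF (Charpoly.d ℤᶜ n B (suc (dbl m)))} {ιF (HalfSum.halfSum ℤᶜ sq (suc m))} {FH.halfSum g (suc m)}
            (Hom.≈-cong φ {Charpoly.d ℤᶜ n B (suc (dbl m))} {HalfSum.halfSum ℤᶜ sq (suc m)} (proj₂ (proj₂ (half L)) m (ℕ.s≤s (ℕ.s≤s low))))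
          (FR.trans {ιF (HalfSum.halfSum ℤᶜ sq (suc m))} {FH.halfSum (λ k → ιF (sq k)) (suc m)} {FH.halfSum g (suc m)} (hom-halfSum (ιʰ F.Quot) (suc m) sq)
            (FH.halfSum-cong (suc m) {λ k → ιF (sq k)} {g} (λ i i< → FR.trans {ιF (sq i)} {ιF (Charpoly.c ℤᶜ n B (dbl i))} {g i}
              (Hom.≈-cong φ {sq i} {Charpoly.c ℤᶜ n B (dbl i)} (proj₁ (proj₂ (half L)) i (ℕ.s≤s (dbl-mono (ℕₚ.<⇒≤ i<)))))
              (FR.trans {ιF (Charpoly.c ℤᶜ n B (dbl i))} {c n A (dbl i)} {g i} (FR.sym {c n A (dbl i)} {ιF (Charpoly.c ℤᶜ n B (dbl i))} (c~ (dbl i))) (FR.sym {g i} {c n A (dbl i)} (g~ i)))))))))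
          where
          -- The root must be known at every i < 2m + 2, and its value at i is read from the
          -- coefficient of x^(2i); the truncation therefore has to reach well beyond x^(2m+1).
          L : ℕ
          L = suc (dbl (dbl (suc m)))
          sq : ℕ → ℤ
          sq = proj₁ (half L)
          low : dbl m ℕ.≤ 3 ℕ.+ dbl (dbl m)
          low = ℕₚ.≤-trans (≡.subst (dbl m ℕ.≤_) (≡.sym (dbl-+ (dbl m))) (ℕₚ.m≤m+n (dbl m) (dbl m))) (ℕₚ.m≤n+m (dbl (dbl m)) 3)

  -- What the comparison of two matrices in case (e) uses of each one, detached from its exponents
  -- and from the proofs about them.
  record Profile : Set where
    field
      co g b : ℕ → Carrier
      g-real : ∀ m → Real (g m)
      b-real : ∀ m → Real (b m)
      g-eq : ∀ m → co (suc (dbl m)) ≈ ϖ ^ m * g m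
      b-eq : ∀ m → co (suc (suc (dbl m))) ≈ ϖ ^ suc m * b m
      g0 : g 0 F.~ 1#
      rel : ∀ m → b m F.~ (g (suc m) + FH.halfSum g (suc m))

  module _ (e : ℕ) where
    private
      -- For positive even m the leading digit of g_(m+1) is left out: only the quotient after
      -- removing it is coded, with one digit fewer. The other indices are coded in full.
      κ-even : Profile → ∀ m (P : Parity m) → Fin (p ℕ.^ (e ∸ (special P ℕ.+ suc m)))
      κ-even H m (even zero) = code (e ∸ 1) (Profile.g H 1) (Profile.g-real H 1)
      κ-even H m (even (suc q)) = code (e ∸ suc (suc m)) (proj₁ (proj₂ D)) (proj₁ (proj₂ (proj₂ D)))
        where
        D : Σ (Fin p) (λ d → Σ Carrier (λ r′ → Real r′ × (Profile.g H (suc m) ≈ ιℕ (toℕ d) + ϖ * r′)))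
        D = digit (Profile.g H (suc m)) (Profile.g-real H (suc m))
      κ-even H m (odd q) = code (e ∸ suc m) (Profile.g H (suc m)) (Profile.g-real H (suc m))

      κ-go : Profile → ∀ {i} (P : Parity i) → Fin (p ℕ.^ (e ∸ halfSaved P))
      κ-go H (even m) = κ-even H m (parity m)
      κ-go H (odd m) = code (e ∸ suc (suc m)) (Profile.b H (suc m)) (Profile.b-real H (suc m))

    κ-saved : Profile → ∀ i → Fin (p ℕ.^ (e ∸ halfSaved (parity i)))
    κ-saved H i = κ-go H (parity i)

    -- Cancelling ϖ^u leaves at least one factor ϖ on the right, and π divides it.
    leading : ∀ u {x y g g′} → u ℕ.< e → x ≈ ϖ ^ u * g → y ≈ ϖ ^ u * g′ → CongMod e x y → g F.~ g′
    leading u {x} {y} {g} {g′} u<e ex ey (r , R , eq) = π * η * (ϖ ^ (e ∸ suc u) * r) , (begin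
      g - g′                              ≈⟨ ϖ^-cancel u (begin
        ϖ ^ u * (g - g′)                    ≈⟨ solve 3 (λ v b c → v :* (b :- c) := v :* b :- v :* c) refl (ϖ ^ u) g g′ ⟩
        ϖ ^ u * g - ϖ ^ u * g′              ≈⟨ +-cong ex (-‿cong ey) ⟨
        x - y                               ≈⟨ eq ⟩
        ϖ ^ e * r                           ≈⟨ *-congʳ (reflexive (≡.cong (ϖ ^_) (≡.sym (≡.trans (ℕₚ.+-suc u (e ∸ suc u)) (ℕₚ.m+[n∸m]≡n u<e))))) ⟩
        ϖ ^ (u ℕ.+ suc (e ∸ suc u)) * r     ≈⟨ *-congʳ (^-+ ϖ u (suc (e ∸ suc u))) ⟩
        ϖ ^ u * (ϖ * ϖ ^ (e ∸ suc u)) * r   ≈⟨ solve 4 (λ a b c d → a :* (b :* c) :* d := a :* (b :* (c :* d))) refl (ϖ ^ u) ϖ (ϖ ^ (e ∸ suc u)) r ⟩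
        ϖ ^ u * (ϖ * (ϖ ^ (e ∸ suc u) * r)) ∎) ⟩
      ϖ * (ϖ ^ (e ∸ suc u) * r)           ≈⟨ *-congʳ ϖ-π ⟩
      π * (π * η) * (ϖ ^ (e ∸ suc u) * r) ≈⟨ solve 3 (λ p n x → p :* (p :* n) :* x := p :* n :* x :* p) refl π η (ϖ ^ (e ∸ suc u) * r) ⟩
      π * η * (ϖ ^ (e ∸ suc u) * r) * π   ∎)

    private
      module Special (H H′ : Profile) (q : ℕ) where
        module H = Profile H
        module H′ = Profile H′
        m : ℕ
        m = dbl (suc q)
        Earlier : Set
        Earlier = ∀ k → k ℕ.< 3 ℕ.+ dbl m → CongMod e (H.co k) (H′.co k)

        sq≤m : suc (suc q) ℕ.≤ m
        sq≤m = ℕ.s≤s (ℕ.s≤s (≡.subst (q ℕ.≤_) (≡.sym (dbl-+ q)) (ℕₚ.m≤m+n q q)))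

        module _ (early : Earlier) (m<e : suc m ℕ.< e) where
          g-agree : ∀ i → i ℕ.≤ m → H.g i F.~ H′.g i
          g-agree i i≤m = leading i {H.co (suc (dbl i))} {H′.co (suc (dbl i))} (ℕₚ.≤-<-trans i≤m (ℕₚ.<-trans (ℕₚ.n<1+n m) m<e)) (H.g-eq i) (H′.g-eq i)
            (early (suc (dbl i)) (ℕ.s≤s (ℕ.s≤s (ℕₚ.m≤n⇒m≤1+n (dbl-mono i≤m)))))

          b-agree : H.b (suc q) F.~ H′.b (suc q)
          b-agree = leading (suc (suc q)) {H.co (2 ℕ.+ dbl (suc q))} {H′.co (2 ℕ.+ dbl (suc q))} (ℕₚ.≤-<-trans sq≤m (ℕₚ.<-trans (ℕₚ.n<1+n m) m<e)) (H.b-eq (suc q)) (H′.b-eq (suc q))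
            (early (2 ℕ.+ dbl (suc q)) (ℕ.s≤s (ℕ.s≤s (ℕ.s≤s (dbl-mono (ℕₚ.≤-trans (ℕₚ.n≤1+n (suc q)) sq≤m))))))

          solved : Profile → Carrier
          solved P = Profile.b P (suc q) - Profile.g P (suc (suc q)) - FH.halfSum (λ i → Profile.g P (suc i)) (suc q)

          -- In the relation at q + 1 the top index 2q + 3 = m + 1 is paired only with 0, and g₀ is
          -- 1. All other indices are at most m, so the relation can be solved for g_(m+1).
          solve-g : ∀ (P : Profile) → Profile.g P (suc m) F.~ solved P
          solve-g P = FR.trans {x} {y + (1# * x + hs) - y - hs} {solved P} (F.≈⇒~ (solve 3 (λ x y s → x := y :+ (con (+ 1) :* x :+ s) :- y :- s) refl x y hs))
            (FR.+-cong {y + (1# * x + hs) - y} {Profile.b P (suc q) - y} { - hs} { - hs}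
              (FR.+-cong {y + (1# * x + hs)} {Profile.b P (suc q)} { - y} { - y}
                (FR.trans {y + (1# * x + hs)} {y + (g₀ * x + hs)} {Profile.b P (suc q)}
                  (FR.+-cong {y} {y} {1# * x + hs} {g₀ * x + hs} (FR.refl {y}) (FR.+-cong {1# * x} {g₀ * x} {hs} {hs} (FR.*-cong {1#} {g₀} {x} {x} (FR.sym {g₀} {1#} (Profile.g0 P)) (FR.refl {x})) (FR.refl {hs})))
                  (FR.sym {Profile.b P (suc q)} {y + (g₀ * x + hs)} (Profile.rel P (suc q))))
                (FR.refl { - y}))
              (FR.refl { - hs}))
            where
            x y hs g₀ : Carrier
            x = Profile.g P (suc m)
            y = Profile.g P (suc (suc q))
            g₀ = Profile.g P 0
            hs = FH.halfSum (λ i → Profile.g P (suc i)) (suc q)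

          top-agree : H.g (suc m) F.~ H′.g (suc m)
          top-agree = FR.trans {H.g (suc m)} {solved H} {H′.g (suc m)} (solve-g H) (FR.trans {solved H} {solved H′} {H′.g (suc m)}
            (FR.+-cong {H.b (suc q) - H.g (suc (suc q))} {H′.b (suc q) - H′.g (suc (suc q))} { - hs} { - hs′}
              (FR.+-cong {H.b (suc q)} {H′.b (suc q)} { - H.g (suc (suc q))} { - H′.g (suc (suc q))} b-agree (FR.-‿cong {H.g (suc (suc q))} {H′.g (suc (suc q))} (g-agree (suc (suc q)) sq≤m)))
              (FR.-‿cong {hs} {hs′} (FH.halfSum-cong (suc q) {λ i → H.g (suc i)} {λ i → H′.g (suc i)} (λ i i< → g-agree (suc i) i<))))
            (FR.sym {H′.g (suc m)} {solved H′} (solve-g H′)))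
            where
            hs hs′ : Carrier
            hs = FH.halfSum (λ i → H.g (suc i)) (suc q)
            hs′ = FH.halfSum (λ i → H′.g (suc i)) (suc q)

    step-saved : ∀ (H H′ : Profile) i → (∀ k → k ℕ.< 3 ℕ.+ i → CongMod e (Profile.co H k) (Profile.co H′ k)) →
      κ-saved H i ≡ κ-saved H′ i → CongMod e (Profile.co H (3 ℕ.+ i)) (Profile.co H′ (3 ℕ.+ i))
    step-saved H H′ i = go (parity i)
      where
      module H = Profile H
      module H′ = Profile H′
      plain : ∀ m → code (e ∸ suc m) (H.g (suc m)) (H.g-real (suc m)) ≡ code (e ∸ suc m) (H′.g (suc m)) (H′.g-real (suc m)) →
        CongMod e (H.co (3 ℕ.+ dbl m)) (H′.co (3 ℕ.+ dbl m))
      plain m eq = code-step e (suc m) (H.g-real (suc m)) (H′.g-real (suc m)) (H.g-eq (suc m)) (H′.g-eq (suc m)) eq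
      evenCase : ∀ m (P : Parity m) → (∀ k → k ℕ.< 3 ℕ.+ dbl m → CongMod e (H.co k) (H′.co k)) →
        κ-even H m P ≡ κ-even H′ m P → CongMod e (H.co (3 ℕ.+ dbl m)) (H′.co (3 ℕ.+ dbl m))
      evenCase m (even zero) early eq = plain 0 eq
      evenCase m (odd q) early eq = plain (suc (dbl q)) eq
      evenCase m (even (suc q)) early eq with suc (dbl (suc q)) ℕ.<? e
      -- ρ^e divides both coefficients here, so there is no digit to compare.
      ... | no nlt = cong-scale e (suc (dbl (suc q))) (H.g-eq (suc (dbl (suc q)))) (H′.g-eq (suc (dbl (suc q))))
        (≡.subst (λ w → CongMod w (H.g (suc (dbl (suc q)))) (H′.g (suc (dbl (suc q))))) (≡.sym (ℕₚ.m≤n⇒m∸n≡0 (ℕₚ.≮⇒≥ nlt)))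
          (H.g (suc (dbl (suc q))) - H′.g (suc (dbl (suc q))) , real-sub (H.g-real _) (H′.g-real _) , sym (*-identityˡ _)))
      -- The recovered leading digit is put back in front of the coded ones; this restores a full
      -- code of g_(m+1).
      ... | yes lt = cong-scale e (suc M) (H.g-eq (suc M)) (H′.g-eq (suc M))
        (≡.subst (λ w → CongMod w (H.g (suc M)) (H′.g (suc M))) (≡.sym (ℕₚ.+-∸-assoc 1 lt))
          (code-sound (suc (e ∸ suc (suc M))) (H.g (suc M)) (H.g-real (suc M)) (H′.g (suc M)) (H′.g-real (suc M)) (≡.cong₂ combine d≡ eq)))
        where
        M : ℕ
        M = dbl (suc q)
        D D′ : Σ (Fin p) _
        D = digit (H.g (suc M)) (H.g-real (suc M))
        D′ = digit (H′.g (suc M)) (H′.g-real (suc M))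
        r r′ z : Carrier
        r = proj₁ (proj₂ D)
        r′ = proj₁ (proj₂ D′)
        z = proj₁ (Special.top-agree H H′ q early lt)
        d≡ : proj₁ D ≡ proj₁ D′
        d≡ = digit-unique (proj₁ D) (proj₁ D′) (z - π * η * (r - r′)) (begin
          ιℕ (toℕ (proj₁ D)) - ιℕ (toℕ (proj₁ D′))
            ≈⟨ solve 5 (λ d d′ v r r′ → d :- d′ := (d :+ v :* r) :- (d′ :+ v :* r′) :- v :* (r :- r′)) refl _ _ ϖ r r′ ⟩
          (ιℕ (toℕ (proj₁ D)) + ϖ * r) - (ιℕ (toℕ (proj₁ D′)) + ϖ * r′) - ϖ * (r - r′)
            ≈⟨ +-cong (+-cong (sym (proj₂ (proj₂ (proj₂ D)))) (-‿cong (sym (proj₂ (proj₂ (proj₂ D′)))))) (-‿cong (*-congʳ ϖ-π)) ⟩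
          H.g (suc M) - H′.g (suc M) - π * (π * η) * (r - r′)
            ≈⟨ +-congʳ (proj₂ (Special.top-agree H H′ q early lt)) ⟩
          z * π - π * (π * η) * (r - r′)
            ≈⟨ solve 4 (λ z p n x → z :* p :- p :* (p :* n) :* x := p :* (z :- p :* n :* x)) refl z π η (r - r′) ⟩
          π * (z - π * η * (r - r′)) ∎)
      go : ∀ {i} (P : Parity i) → (∀ k → k ℕ.< 3 ℕ.+ i → CongMod e (H.co k) (H′.co k)) →
        κ-go H P ≡ κ-go H′ P → CongMod e (H.co (3 ℕ.+ i)) (H′.co (3 ℕ.+ i))
      go (even m) early eq = evenCase m (parity m) early eq
      go (odd m) early eq = code-step e (suc (suc m)) (H.b-real (suc m)) (H′.b-real (suc m)) (H.b-eq (suc m)) (H′.b-eq (suc m)) eq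

-- Coefficient lists as polynomials

record RawHom (R : RawR) (C : CR) : Set where
  open CommutativeRing C hiding (zero)
  field
    to  : Car R → Carrier
    to-0 : to (0r R) ≈ 0#
    to-1 : to (1r R) ≈ 1#
    to-add : ∀ x y → to (add R x y) ≈ to x + to y
    to-mul : ∀ x y → to (mul R x y) ≈ to x * to y
    to-neg : ∀ x → to (neg R x) ≈ - to x

module _ {R : RawR} {C : CR} (h : RawHom R C) where
  open CommutativeRing C hiding (zero)
  open RawHom h
  open P R
  private module S = CommutativeRing (PowerSeries.PS C)
  open PowerSeries C

  series : List (Car R) → Series
  series P k = to (coeff P k)

  private
    addP-at : ∀ p q k → to (coeff (addP p q) k) ≈ to (coeff p k) + to (coeff q k)
    addP-at [] q k = sym (trans (+-congʳ to-0) (+-identityˡ _))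
    addP-at (a ∷ p) [] k = sym (trans (+-congˡ to-0) (+-identityʳ _))
    addP-at (a ∷ p) (b ∷ q) zero = to-add a b
    addP-at (a ∷ p) (b ∷ q) (suc k) = addP-at p q k

    scale-at : ∀ a q k → to (coeff (map (mul R a) q) k) ≈ to a * to (coeff q k)
    scale-at a [] k = trans to-0 (sym (trans (*-congˡ to-0) (zeroʳ _)))
    scale-at a (b ∷ q) zero = to-mul a b
    scale-at a (b ∷ q) (suc k) = scale-at a q k

    negP-at : ∀ p k → to (coeff (negP p) k) ≈ - to (coeff p k)
    negP-at [] k = trans to-0 (trans (sym (Algebra.Properties.AbelianGroup.ε⁻¹≈ε +-abelianGroup)) (-‿cong (sym to-0)))
    negP-at (a ∷ p) zero = to-neg a
    negP-at (a ∷ p) (suc k) = negP-at p k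

    mulP-at : ∀ p q k → to (coeff (mulP p q) k) ≈ (series p *ˢ series q) k
    mulP-at [] q k = trans to-0 (sym (S.trans (S.*-congʳ {series q} {series []} (λ _ → to-0)) (S.zeroˡ (series q)) k))
    mulP-at (a ∷ p) q zero = trans (addP-at (map (mul R a) q) (0r R ∷ mulP p q) 0)
      (trans (+-cong (scale-at a q 0) to-0) (trans (+-identityʳ _) (sym (reflexive (*ˢ-zero _ _)))))
    mulP-at (a ∷ p) q (suc k) = trans (addP-at (map (mul R a) q) (0r R ∷ mulP p q) (suc k))
      (trans (+-cong (scale-at a q (suc k)) (mulP-at p q k)) (sym (reflexive (*ˢ-suc _ _ k))))

  -- Lists that differ by trailing zeros denote the same polynomial; passing to the sequence of
  -- coefficients, a power series, identifies them.
  polyHom : RawHom (PolyR R) PS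
  polyHom = record
    { to = series
    ; to-0 = λ k → to-0
    ; to-1 = λ { zero → to-1 ; (suc k) → to-0 }
    ; to-add = λ p q k → trans (addP-at p q k) (sym (reflexive (+ˢ-at _ _ k)))
    ; to-mul = mulP-at
    ; to-neg = λ p k → trans (negP-at p k) (sym (reflexive (-ˢ-at _ k))) }

  private
    module D = Det R
    module D′ = Det′ C
    open AltSum C
    open Solve C

    sg : ℕ → Carrier → Carrier
    sg zero x = x
    sg (suc k) x = - sg k x

    signed-at : ∀ k x → to (D.signed k x) ≈ sg k (to x)
    signed-at zero x = refl
    signed-at (suc k) x = trans (to-neg _) (-‿cong (signed-at k x))

    sumF-neg : ∀ {n} (f : Fin n → Carrier) → D′.sumF (λ i → - f i) ≈ - D′.sumF f
    sumF-neg {zero} f = solve 0 (con (+ 0) := :- con (+ 0)) refl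
    sumF-neg {suc n} f = trans (+-congˡ (sumF-neg (λ i → f (suc i)))) (solve 2 (λ x y → :- x :+ :- y := :- (x :+ y)) refl _ _)

    sumF-sg : ∀ {n} (f : Fin n → Carrier) → D′.sumF (λ i → sg (toℕ i) (f i)) ≈ alt f
    sumF-sg {zero} f = sym (alt-zero f)
    sumF-sg {suc n} f = trans (+-congˡ (trans (sumF-neg (λ i → sg (toℕ i) (f (suc i)))) (-‿cong (sumF-sg (λ i → f (suc i)))))) (sym (alt-suc f))

    foldr-sum : ∀ {n m} (G : Fin m → Car R) (g : Fin n → Fin m) (f : Fin n → Carrier) → (∀ i → to (G (g i)) ≈ f i) →
      to (foldr (λ j acc → add R (G j) acc) (0r R) (tabulate g)) ≈ D′.sumF f
    foldr-sum {zero} G g f e = to-0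
    foldr-sum {suc n} G g f e = trans (to-add _ _) (+-cong (e zero) (foldr-sum G (λ i → g (suc i)) (λ i → f (suc i)) (λ i → e (suc i))))

  raw-det : ∀ n (M : Fin n → Fin n → Car R) → to (D.det n M) ≈ D′.det n (λ i j → to (M i j))
  raw-det zero M = to-1
  raw-det (suc n) M = trans (foldr-sum _ (λ i → i) (λ j → sg (toℕ j) (to (M zero j) * D′.det n (λ r c → to (M (suc r) (punchIn j c)))))
    (λ j → trans (signed-at (toℕ j) _) (sg-cong (toℕ j) (trans (to-mul _ _) (*-congˡ (raw-det n (λ r c → M (suc r) (punchIn j c))))))))
    (sumF-sg _)
    where
    sg-cong : ∀ k {x y} → x ≈ y → sg k x ≈ sg k y
    sg-cong zero e = e
    sg-cong (suc k) e = -‿cong (sg-cong k e)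

ℤʳ : RawHom ℤR ℤᶜ
ℤʳ = record { to = λ x → x ; to-0 = ≡.refl ; to-1 = ≡.refl ; to-add = λ _ _ → ≡.refl ; to-mul = λ _ _ → ≡.refl ; to-neg = λ _ → ≡.refl }

module PY = P ℤR

opaque
  -- `_≈y_` is equality of coefficient sequences, so the lists embed in ℤ[[y]] and inherit its laws
  -- along this injection.
  isCommutativeRingʸ : IsCommutativeRing _≈y_ PY.addP PY.mulP PY.negP [] (ℤ.1ℤ ∷ [])
  isCommutativeRingʸ = M.isCommutativeRing (CommutativeRing.isCommutativeRing (PowerSeries.PS ℤᶜ))
    where
    module H = RawHom (polyHom ℤʳ)
    rawY : RawRing 0ℓ 0ℓ
    rawY = record { _≈_ = _≈y_ ; _+_ = PY.addP ; _*_ = PY.mulP ; -_ = PY.negP ; 0# = [] ; 1# = ℤ.1ℤ ∷ [] }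
    mono : IsRingMonomorphism rawY (CommutativeRing.rawRing (PowerSeries.PS ℤᶜ)) H.to
    mono = record
      { isRingHomomorphism = record
        { isSemiringHomomorphism = record
          { isNearSemiringHomomorphism = record
            { +-isMonoidHomomorphism = record
              { isMagmaHomomorphism = record
                { isRelHomomorphism = record { cong = λ e k → e k }
                ; homo = H.to-add }
              ; ε-homo = H.to-0 }
            ; *-homo = H.to-mul }
          ; 1#-homo = H.to-1 }
        ; -‿homo = H.to-neg }
      ; injective = λ e k → e k }
    module M = Algebra.Morphism.RingMonomorphism mono

ℤY : CR
ℤY = record { isCommutativeRing = isCommutativeRingʸ }

module Y = CommutativeRing ℤY

constY : Hom ℤᶜ ℤY
constY = record
  { to = λ c → c ∷ []
  ; ≈-cong = λ { ≡.refl k → ≡.refl }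
  ; +-hom = λ c d k → ≡.refl
  ; *-hom = λ { c d zero → ≡.sym (ℤₚ.+-identityʳ (c ℤ.* d)) ; c d (suc k) → ≡.refl }
  ; 1-hom = λ k → ≡.refl }

y : List ℤ
y = yʸ 1

cons-split : ∀ c g → (c ∷ g) Y.≈ ((c ∷ []) Y.+ y Y.* g)
cons-split c g k = ≡.sym (≡.trans (H.to-add (c ∷ []) (y Y.* g) k) (≡.trans (+ˢ-at _ _ k) (≡.trans (≡.cong (λ w → coeffy (c ∷ []) k ℤ.+ w) (H.to-mul y g k)) (at k))))
  where
  open PowerSeries ℤᶜ
  module H = RawHom (polyHom ℤʳ)
  module S = CommutativeRing PS
  y≈X : H.to y ≈ˢ X
  y≈X zero = ≡.refl
  y≈X (suc zero) = ≡.refl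
  y≈X (suc (suc k)) = ≡.refl
  at : ∀ k → coeffy (c ∷ []) k ℤ.+ (H.to y *ˢ H.to g) k ≡ coeffy (c ∷ g) k
  at zero = ≡.trans (≡.cong (λ w → c ℤ.+ w) (≡.trans (S.*-congʳ {H.to g} y≈X 0) (lin-*-zero _ _ _))) (ℤₚ.+-identityʳ c)
  at (suc k) = ≡.trans (ℤₚ.+-identityˡ _) (≡.trans (S.*-congʳ {H.to g} y≈X (suc k)) (X-*-suc (H.to g) k))

module Eval (C : CR) where
  open CommutativeRing C hiding (zero)
  open Relation.Binary.Reasoning.Setoid setoid
  open Solve C
  open Cast C
  open Pow C

  ev : Carrier → List ℤ → Carrier
  ev s [] = 0#
  ev s (c ∷ g) = ι c + s * ev s g

  module _ (s : Carrier) where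
    private
      ev-zero : ∀ g → (∀ k → coeffy g k ≡ + 0) → ev s g ≈ 0#
      ev-zero [] e = refl
      ev-zero (c ∷ g) e = trans (+-cong (reflexive (≡.cong ι (e 0))) (trans (*-congˡ (ev-zero g (λ k → e (suc k)))) (zeroʳ s))) (+-identityʳ _)

      ev-cong : ∀ a b → a ≈y b → ev s a ≈ ev s b
      ev-cong [] b e = sym (ev-zero b (λ k → ≡.sym (e k)))
      ev-cong (x ∷ a) [] e = ev-zero (x ∷ a) e
      ev-cong (x ∷ a) (z ∷ b) e = +-cong (reflexive (≡.cong ι (e 0))) (*-congˡ (ev-cong a b (λ k → e (suc k))))

      ev-add : ∀ a b → ev s (a Y.+ b) ≈ ev s a + ev s b
      ev-add [] b = sym (+-identityˡ _)
      ev-add (x ∷ a) [] = sym (+-identityʳ _)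
      ev-add (x ∷ a) (z ∷ b) = trans (+-cong (ι-+ x z) (*-congˡ (ev-add a b)))
        (solve 5 (λ x z s a b → x :+ z :+ s :* (a :+ b) := x :+ s :* a :+ (z :+ s :* b)) refl _ _ _ _ _)

      ev-scale : ∀ c b → ev s (map (ℤ._*_ c) b) ≈ ι c * ev s b
      ev-scale c [] = sym (zeroʳ _)
      ev-scale c (z ∷ b) = trans (+-cong (ι-* c z) (*-congˡ (ev-scale c b)))
        (solve 4 (λ c z s b → c :* z :+ s :* (c :* b) := c :* (z :+ s :* b)) refl _ _ _ _)

      ev-mul : ∀ a b → ev s (a Y.* b) ≈ ev s a * ev s b
      ev-mul [] b = sym (zeroˡ _)
      ev-mul (x ∷ a) b = trans (ev-add (map (ℤ._*_ x) b) (+ 0 ∷ a Y.* b)) (trans (+-cong (ev-scale x b) (+-congˡ (*-congˡ (ev-mul a b))))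
        (solve 4 (λ x b s a → x :* b :+ (con (+ 0) :+ s :* (a :* b)) := (x :+ s :* a) :* b) refl _ _ _ _))

    evalʰ : Hom ℤY C
    evalʰ = record
      { to = ev s ; ≈-cong = λ {a} {b} → ev-cong a b ; +-hom = ev-add ; *-hom = ev-mul
      ; 1-hom = trans (+-congˡ (zeroʳ s)) (+-identityʳ _) }

    ev-y : ev s y ≈ s
    ev-y = solve 1 (λ s → con (+ 0) :+ s :* (con (+ 1) :+ s :* con (+ 0)) := s) refl s

  ev-resp : ∀ {s t} g → s ≈ t → ev s g ≈ ev t g
  ev-resp [] e = refl
  ev-resp (c ∷ g) e = +-congˡ (*-cong e (ev-resp g e))

hom-ev : ∀ {C D : CR} (h : Hom C D) s g → CommutativeRing._≈_ D (Hom.to h (Eval.ev C s g)) (Eval.ev D (Hom.to h s) g)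
hom-ev h s [] = Hom.0-hom h
hom-ev {C} {D} h s (c ∷ g) = D.trans (Hom.+-hom h _ _) (D.+-cong (hom-ι h c) (D.trans (Hom.*-hom h _ _) (D.*-congˡ (hom-ev h s g))))
  where module D = CommutativeRing D

hom-eval : ∀ {D : CR} (h : Hom ℤY D) g → CommutativeRing._≈_ D (Hom.to h g) (Eval.ev D (Hom.to h y) g)
hom-eval h [] = Hom.0-hom h
hom-eval {D} h (c ∷ g) = D.trans (Hom.≈-cong h (cons-split c g)) (D.trans (Hom.+-hom h (c ∷ []) (y Y.* g))
  (D.+-cong (hom-ℤ (h ∘ʰ constY) c) (D.trans (Hom.*-hom h y g) (D.*-congˡ (hom-eval h g)))))
  where module D = CommutativeRing D

compose-ev : ∀ g s → composey g s Y.≈ Eval.ev ℤY s g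
compose-ev [] s = Y.refl {[]}
compose-ev (c ∷ g) s = Y.+-cong {c ∷ []} {Cast.ι ℤY c} {s Y.* composey g s} {s Y.* Eval.ev ℤY s g} (hom-ℤ constY c) (Y.*-cong {s} {s} {composey g s} {Eval.ev ℤY s g} (Y.refl {s}) (compose-ev g s))

hom-compose : ∀ {D : CR} (h : Hom ℤY D) g s → CommutativeRing._≈_ D (Hom.to h (composey g s)) (Eval.ev D (Hom.to h s) g)
hom-compose {D} h g s = D.trans (Hom.≈-cong h {composey g s} {Eval.ev ℤY s g} (compose-ev g s)) (hom-ev h s g)
  where module D = CommutativeRing D

module _ {D : CR} (h : Hom ℤY D) where
  private
    module D = CommutativeRing D
    open Pow D
    open Geometric D
    z : D.Carrier
    z = Hom.to h y

  hom-mono : ∀ k → Hom.to h (yʸ k) D.≈ z ^ k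
  hom-mono zero = Hom.1-hom h
  hom-mono (suc k) = D.trans (Hom.≈-cong h {yʸ (suc k)} {(+ 0 ∷ []) Y.+ y Y.* yʸ k} (cons-split (+ 0) (yʸ k))) (D.trans (Hom.+-hom h (+ 0 ∷ []) (y Y.* yʸ k))
    (D.trans (D.+-cong (hom-ℤ (h ∘ʰ constY) (+ 0)) (D.trans (Hom.*-hom h y (yʸ k)) (D.*-congˡ (hom-mono k)))) (D.+-identityˡ _)))

  hom-cyclo : ∀ p f → Hom.to h (cyclo p f) D.≈ geom p (z ^ (p ℕ.^ (f ∸ 1)))
  hom-cyclo p f = D.trans (go p 0 (λ i → i) (λ i → ≡.refl)) (D.*-identityˡ _)
    where
    Q : ℕ
    Q = p ℕ.^ (f ∸ 1)
    w : D.Carrier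
    w = z ^ Q
    go : ∀ n j (g : ℕ → ℕ) → (∀ i → g i ≡ j ℕ.+ i) →
      Hom.to h (foldr (λ i acc → yʸ (i ℕ.* Q) +y acc) [] (applyUpTo g n)) D.≈ w ^ j D.* geom n w
    go zero j g e = D.trans (Hom.0-hom h) (D.sym (D.zeroʳ _))
    go (suc n) j g e = D.trans (Hom.+-hom h (yʸ (g 0 ℕ.* Q)) (foldr (λ i acc → yʸ (i ℕ.* Q) +y acc) [] (applyUpTo (λ i → g (suc i)) n)))
      (D.trans (D.+-cong
        (D.trans (hom-mono (g 0 ℕ.* Q)) (D.trans (D.reflexive (≡.cong (λ k → z ^ (k ℕ.* Q)) (≡.trans (e 0) (ℕₚ.+-identityʳ j)))) (^-*ℕ z j Q)))
        (go n (suc j) (λ i → g (suc i)) (λ i → ≡.trans (e (suc i)) (ℕₚ.+-suc j i))))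
        (S.solve 3 (λ a w g → a S.:+ w S.:* a S.:* g S.:= a S.:* (S.con (+ 1) S.:+ w S.:* g)) D.refl (w ^ j) w (geom n w)))
      where module S = Solve D

-- Identities stated over an abstract ring, where the solver need not unfold polynomial arithmetic.
module Identities (C : CR) where
  open CommutativeRing C
  open Solve C

  horner : ∀ c y E r g → c + y * (E + (y - r) * g) ≈ c + r * E + (y - r) * (E + y * g)
  horner = solve 5 (λ c y E r g → c :+ y :* (E :+ (y :- r) :* g) := c :+ r :* E :+ (y :- r) :* (E :+ y :* g)) refl

  minus-zero : ∀ x → x - 0# ≈ x
  minus-zero = solve 1 (λ x → x :- con (+ 0) := x) refl

  factor : ∀ w x d f → w * (x - d * f) ≈ w * x - 0# - w * d * f
  factor = solve 4 (λ w x d f → w :* (x :- d :* f) := w :* x :- con (+ 0) :- w :* d :* f) refl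

-- Cancellation of y - r modulo Φ: if (y - r) x = q Φ then q(r) Φ(r) = 0, so y - r divides q.
module RootCancel (Φ : List ℤ) (r : ℤ) (r² : r ℤ.* r ≡ + 1) where
  open Eval ℤᶜ using (ev; evalʰ; ev-y)
  open Identities ℤY
  module Q = Quotient ℤY Φ
  module ZS = Solve ℤᶜ

  [r] : List ℤ
  [r] = r ∷ []

  -- Horner's scheme: division by y - r, with the value at r as remainder.
  divide : ∀ g → ∃ (λ g′ → g Y.≈ ((ev r g ∷ []) Y.+ (y Y.- [r]) Y.* g′))
  divide [] = [] , λ { zero → ≡.refl ; (suc zero) → ≡.refl ; (suc (suc k)) → ≡.refl }
  divide (c ∷ g) = E Y.+ y Y.* proj₁ IH ,
    Y.trans {c ∷ g} {(c ∷ []) Y.+ y Y.* g} {R} (cons-split c g)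
    (Y.trans {(c ∷ []) Y.+ y Y.* g} {(c ∷ []) Y.+ y Y.* (E Y.+ (y Y.- [r]) Y.* proj₁ IH)} {R}
      (Y.+-cong {c ∷ []} {c ∷ []} {y Y.* g} {y Y.* (E Y.+ (y Y.- [r]) Y.* proj₁ IH)} (Y.refl {c ∷ []}) (Y.*-cong {y} {y} {g} {E Y.+ (y Y.- [r]) Y.* proj₁ IH} (Y.refl {y}) (proj₂ IH)))
    (Y.trans {(c ∷ []) Y.+ y Y.* (E Y.+ (y Y.- [r]) Y.* proj₁ IH)} {(c ∷ []) Y.+ [r] Y.* E Y.+ (y Y.- [r]) Y.* (E Y.+ y Y.* proj₁ IH)} {R}
      (horner (c ∷ []) y E [r] (proj₁ IH))
      (Y.+-cong {(c ∷ []) Y.+ [r] Y.* E} {ev r (c ∷ g) ∷ []} {(y Y.- [r]) Y.* (E Y.+ y Y.* proj₁ IH)} {(y Y.- [r]) Y.* (E Y.+ y Y.* proj₁ IH)} (Y.sym {ev r (c ∷ g) ∷ []} {(c ∷ []) Y.+ [r] Y.* E} value) (Y.refl {(y Y.- [r]) Y.* (E Y.+ y Y.* proj₁ IH)}))))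
    where
    IH : ∃ (λ g′ → g Y.≈ ((ev r g ∷ []) Y.+ (y Y.- [r]) Y.* g′))
    IH = divide g
    E R : List ℤ
    E = ev r g ∷ []
    R = (ev r (c ∷ g) ∷ []) Y.+ (y Y.- [r]) Y.* (E Y.+ y Y.* proj₁ IH)
    value : (ev r (c ∷ g) ∷ []) Y.≈ ((c ∷ []) Y.+ [r] Y.* E)
    value zero = ≡.cong₂ ℤ._+_ (ι-id c) (≡.sym (ℤₚ.+-identityʳ (r ℤ.* ev r g)))
    value (suc k) = ≡.refl

  -- The constant term -r of y - r is a unit, as r² = 1, so the coefficients of h vanish one after
  -- another from the lowest on.
  regular : ∀ h → ((y Y.- [r]) Y.* h) Y.≈ [] → h Y.≈ []
  regular h e = go
    where
    open PowerSeries ℤᶜ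
    module H = RawHom (polyHom ℤʳ)
    module S = CommutativeRing PS
    lin-r : H.to (y Y.- [r]) ≈ˢ lin (ℤ.- r) (+ 1)
    lin-r zero = ℤₚ.+-identityˡ _
    lin-r (suc zero) = ≡.refl
    lin-r (suc (suc k)) = ≡.refl
    prod : ∀ k → (lin (ℤ.- r) (+ 1) *ˢ H.to h) k ≡ + 0
    prod k = ≡.trans (≡.sym (S.*-congʳ {H.to h} lin-r k)) (≡.trans (≡.sym (H.to-mul (y Y.- [r]) h k)) (e k))
    unit : ∀ z → r ℤ.* z ≡ + 0 → z ≡ + 0
    unit z e = ≡.trans (≡.trans (≡.sym (ℤₚ.*-identityˡ z)) (≡.trans (≡.cong (ℤ._* z) (≡.sym r²)) (ℤₚ.*-assoc r r z))) (≡.trans (≡.cong (r ℤ.*_) e) (ℤₚ.*-zeroʳ r))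
    go : ∀ k → coeffy h k ≡ + 0
    go zero = unit (coeffy h 0) (≡.trans (ZS.solve 2 (λ r h → r ZS.:* h ZS.:= ZS.:- (ZS.:- r ZS.:* h)) ≡.refl r (coeffy h 0))
      (≡.cong ℤ.-_ (≡.trans (≡.sym (lin-*-zero (ℤ.- r) (+ 1) (H.to h))) (prod 0))))
    go (suc k) = unit (coeffy h (suc k)) (≡.trans (ZS.solve 3 (λ r h h′ → r ZS.:* h ZS.:= h′ ZS.:- (ZS.:- r ZS.:* h ZS.:+ ZS.con (+ 1) ZS.:* h′)) ≡.refl r (coeffy h (suc k)) (coeffy h k))
      (≡.cong₂ ℤ._-_ (go k) (≡.trans (≡.sym (lin-*-suc (ℤ.- r) (+ 1) (H.to h) k)) (prod (suc k)))))

  cancel : ev r Φ ≡.≢ + 0 → ∀ x → ((y Y.- [r]) Y.* x) Q.~ [] → x Q.~ []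
  cancel Φr x (q , eq) = proj₁ D , Y.trans {x Y.- []} {x} {proj₁ D Y.* Φ}
    (minus-zero x)
    (YG.x∙y⁻¹≈ε⇒x≈y x (proj₁ D Y.* Φ) (regular (x Y.- proj₁ D Y.* Φ) (Y.trans {(y Y.- [r]) Y.* (x Y.- proj₁ D Y.* Φ)} {(y Y.- [r]) Y.* x Y.- [] Y.- (y Y.- [r]) Y.* proj₁ D Y.* Φ} {[]}
      (factor (y Y.- [r]) x (proj₁ D) Φ)
      (Y.trans {(y Y.- [r]) Y.* x Y.- [] Y.- (y Y.- [r]) Y.* proj₁ D Y.* Φ} {q Y.* Φ Y.- q Y.* Φ} {[]}
        (Y.+-cong {(y Y.- [r]) Y.* x Y.- []} {q Y.* Φ} {Y.- ((y Y.- [r]) Y.* proj₁ D Y.* Φ)} {Y.- (q Y.* Φ)} eq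
          (Y.-‿cong {(y Y.- [r]) Y.* proj₁ D Y.* Φ} {q Y.* Φ} (Y.*-cong {(y Y.- [r]) Y.* proj₁ D} {q} {Φ} {Φ} (Y.sym {q} {(y Y.- [r]) Y.* proj₁ D} q≈) (Y.refl {Φ}))))
        (Y.-‿inverseʳ (q Y.* Φ))))))
    where
    module YG = Algebra.Properties.AbelianGroup Y.+-abelianGroup
    open ≡.≡-Reasoning
    D : ∃ (λ g′ → q Y.≈ ((ev r q ∷ []) Y.+ (y Y.- [r]) Y.* g′))
    D = divide q
    module E = Hom (evalʰ r)
    root : ev r q ℤ.* ev r Φ ≡ + 0
    root = begin
      ev r q ℤ.* ev r Φ                         ≡⟨ E.*-hom q Φ ⟨
      ev r (q Y.* Φ)                            ≡⟨ E.≈-cong {(y Y.- [r]) Y.* x Y.- []} {q Y.* Φ} eq ⟨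
      ev r ((y Y.- [r]) Y.* x Y.- [])           ≡⟨ E.sub-hom ((y Y.- [r]) Y.* x) [] ⟩
      ev r ((y Y.- [r]) Y.* x) ℤ.- + 0          ≡⟨ ≡.cong (ℤ._- + 0) (E.*-hom (y Y.- [r]) x) ⟩
      ev r (y Y.- [r]) ℤ.* ev r x ℤ.- + 0       ≡⟨ ≡.cong (λ w → w ℤ.* ev r x ℤ.- + 0) (≡.trans (E.sub-hom y [r]) (≡.cong₂ ℤ._-_ (ev-y r) (≡.trans (≡.cong₂ ℤ._+_ (ι-id r) (ℤₚ.*-zeroʳ r)) (ℤₚ.+-identityʳ r)))) ⟩
      (r ℤ.- r) ℤ.* ev r x ℤ.- + 0              ≡⟨ ZS.solve 2 (λ r x → (r ZS.:- r) ZS.:* x ZS.:- ZS.con (+ 0) ZS.:= ZS.con (+ 0)) ≡.refl r (ev r x) ⟩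
      + 0                                       ∎
    qr : ev r q ≡ + 0
    qr = [ (λ e → e) , (λ e → ⊥-elim (Φr e)) ] (ℤₚ.i*j≡0⇒i≡0∨j≡0 (ev r q) root)
    q≈ : q Y.≈ ((y Y.- [r]) Y.* proj₁ D)
    q≈ = Y.trans {q} {(ev r q ∷ []) Y.+ (y Y.- [r]) Y.* proj₁ D} {(y Y.- [r]) Y.* proj₁ D} (proj₂ D)
      (Y.trans {(ev r q ∷ []) Y.+ (y Y.- [r]) Y.* proj₁ D} {[] Y.+ (y Y.- [r]) Y.* proj₁ D} {(y Y.- [r]) Y.* proj₁ D}
        (Y.+-cong {ev r q ∷ []} {[]} {(y Y.- [r]) Y.* proj₁ D} {(y Y.- [r]) Y.* proj₁ D} (λ { zero → qr ; (suc k) → ≡.refl }) (Y.refl {(y Y.- [r]) Y.* proj₁ D})) (Y.+-identityˡ ((y Y.- [r]) Y.* proj₁ D)))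

-- What is used of ℤ[y]/(1 + y^P + ... + y^((p-1)P)); working over an abstract such ring
-- keeps polynomial arithmetic from being unfolded.
record CycloData (p P : ℕ) : Set₁ where
  field
    K : CR
    θ : Hom ℤY K
  open CommutativeRing K public hiding (zero)
  open Pow K public
  open Geometric K public
  open Cast K public
  ζ : Carrier
  ζ = Hom.to θ y
  field
    surjective : ∀ x → ∃ (λ g → x ≈ Hom.to θ g)
    root : geom p (ζ ^ P) ≈ 0#
    extend : ∀ s → geom p (s ^ P) ≈ 0# → Σ (Hom K K) (λ h → Hom.to h ζ ≈ s)
    cancel₁ : ∀ x → (ζ - 1#) * x ≈ 0# → x ≈ 0#
    residue : ∀ i w → ι i ≈ (1# - ζ) * w → p ∣ ∣ i ∣

-- Conjugation, real elements and ramification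

module CycloTheory (p P q-1 : ℕ) (q≡ : p ℕ.* P ≡ suc q-1) (D : CycloData p P) where
  open CycloData D public
  open Relation.Binary.Reasoning.Setoid setoid
  open Solve K
  open Algebra.Properties.AbelianGroup +-abelianGroup using () renaming (x∙y⁻¹≈ε⇒x≈y to x-y≈0⇒x≈y)
  open Eval K

  ζ̄ w v : Carrier
  ζ̄ = ζ ^ q-1
  w = ζ ^ P
  v = ζ̄ ^ P

  w^p : w ^ p ≈ 1#
  w^p = sym (x-y≈0⇒x≈y 1# (w ^ p) (trans (sym (geom-telescope p w)) (trans (*-congˡ root) (zeroʳ _))))

  ζ^q : ζ ^ (p ℕ.* P) ≈ 1#
  ζ^q = trans (^-*ℕ ζ p P) w^p

  ζζ̄ : ζ * ζ̄ ≈ 1#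
  ζζ̄ = trans (reflexive (≡.cong (ζ ^_) (≡.sym q≡))) ζ^q

  wv : w * v ≈ 1#
  wv = inverse-^ ζ ζ̄ P ζζ̄

  ζ^-period : ∀ m → (p ℕ.* P) ∣ m → ζ ^ m ≈ 1#
  ζ^-period m (divides k eq) = trans (reflexive (≡.cong (ζ ^_) eq)) (trans (^-*ℕ ζ k (p ℕ.* P)) (trans (^-cong k ζ^q) (1^ k)))

  geom-snoc : ∀ n x → geom (suc n) x ≈ x ^ n + geom n x
  geom-snoc zero x = solve 1 (λ x → con (+ 1) :+ x :* con (+ 0) := con (+ 1) :+ con (+ 0)) refl x
  geom-snoc (suc n) x = trans (+-congˡ (*-congˡ (geom-snoc n x)))
    (solve 3 (λ x a b → con (+ 1) :+ x :* (a :+ b) := x :* a :+ (con (+ 1) :+ x :* b)) refl x (x ^ n) (geom n x))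

  -- As v inverts w, multiplying by w^n reverses the order of the powers. Hence the geometric sum
  -- that vanishes at w also vanishes at v, and ζ ↦ ζ̄ extends to the ring.
  geom-reverse : ∀ n → w ^ n * (v * geom n v) ≈ geom n w
  geom-reverse zero = solve 1 (λ v → con (+ 1) :* (v :* con (+ 0)) := con (+ 0)) refl v
  geom-reverse (suc n) = begin
    w * w ^ n * (v * (1# + v * geom n v))     ≈⟨ solve 4 (λ w a v g → w :* a :* (v :* (con (+ 1) :+ v :* g)) := w :* v :* (a :+ a :* (v :* g))) refl w (w ^ n) v (geom n v) ⟩
    w * v * (w ^ n + w ^ n * (v * geom n v))  ≈⟨ *-cong wv (+-congˡ (geom-reverse n)) ⟩
    1# * (w ^ n + geom n w)                   ≈⟨ trans (*-identityˡ _) (sym (geom-snoc n w)) ⟩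
    geom (suc n) w                            ∎

  root-v : geom p v ≈ 0#
  root-v = begin
    geom p v                        ≈⟨ *-identityˡ _ ⟨
    1# * geom p v                   ≈⟨ *-congʳ (sym wv) ⟩
    w * v * geom p v                ≈⟨ solve 3 (λ w v g → w :* v :* g := w :* (con (+ 1) :* (v :* g))) refl w v (geom p v) ⟩
    w * (1# * (v * geom p v))       ≈⟨ *-congˡ (*-congʳ (sym w^p)) ⟩
    w * (w ^ p * (v * geom p v))    ≈⟨ *-congˡ (trans (geom-reverse p) root) ⟩
    w * 0#                          ≈⟨ zeroʳ w ⟩
    0#                              ∎

  conj : Hom K K
  conj = proj₁ (extend ζ̄ root-v)

  conj-ζ : Hom.to conj ζ ≈ ζ̄
  conj-ζ = proj₂ (extend ζ̄ root-v)

  conj-ζ̄ : Hom.to conj ζ̄ ≈ ζ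
  conj-ζ̄ = begin
    Hom.to conj (ζ ^ q-1)        ≈⟨ trans (hom-^ conj ζ q-1) (^-cong q-1 conj-ζ) ⟩
    ζ̄ ^ q-1                      ≈⟨ *-identityˡ _ ⟨
    1# * ζ̄ ^ q-1                 ≈⟨ *-congʳ ζζ̄ ⟨
    ζ * ζ̄ * ζ̄ ^ q-1              ≈⟨ *-assoc _ _ _ ⟩
    ζ * (ζ ^ q-1 * ζ̄ ^ q-1)      ≈⟨ *-congˡ (inverse-^ ζ ζ̄ q-1 ζζ̄) ⟩
    ζ * 1#                       ≈⟨ *-identityʳ ζ ⟩
    ζ                            ∎

  t : Carrier
  t = ζ + ζ̄

  Real : Carrier → Set
  Real x = ∃ (λ g → x ≈ ev t g)

  real-resp : ∀ {x y} → x ≈ y → Real x → Real y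
  real-resp e (g , eq) = g , trans (sym e) eq

  real-+ : ∀ {x y} → Real x → Real y → Real (x + y)
  real-+ (g , e) (h , e′) = g Y.+ h , trans (+-cong e e′) (sym (Hom.+-hom (evalʰ t) g h))

  real-* : ∀ {x y} → Real x → Real y → Real (x * y)
  real-* (g , e) (h , e′) = g Y.* h , trans (*-cong e e′) (sym (Hom.*-hom (evalʰ t) g h))

  real-ι : ∀ i → Real (ι i)
  real-ι i = i ∷ [] , sym (trans (+-congˡ (zeroʳ t)) (+-identityʳ _))

  real-t : Real t
  real-t = y , sym (ev-y t)

  real-- : ∀ {x y} → Real x → Real y → Real (x - y)
  real-- {x} {y} rx ry = real-resp (solve 2 (λ x y → x :+ con (ℤ.- + 1) :* y := x :- y) refl x y) (real-+ rx (real-* (real-ι (ℤ.- + 1)) ry))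

  conj-t : Hom.to conj t ≈ t
  conj-t = trans (Hom.+-hom conj ζ ζ̄) (trans (+-cong conj-ζ conj-ζ̄) (+-comm ζ̄ ζ))

  conj-real : ∀ {x} → Real x → Hom.to conj x ≈ x
  conj-real (g , e) = trans (Hom.≈-cong conj e) (trans (hom-ev conj t g) (trans (ev-resp g conj-t) (sym e)))

  -- ℤ[ζ] = ℤ[t] + ℤ[t] ζ, because ζ² = t ζ - 1.
  decompose : ∀ g → Σ (Carrier × Carrier) (λ ab → Real (proj₁ ab) × Real (proj₂ ab) × ev ζ g ≈ proj₁ ab + proj₂ ab * ζ)
  decompose [] = (0# , 0#) , real-ι (+ 0) , real-ι (+ 0) , solve 1 (λ z → con (+ 0) := con (+ 0) :+ con (+ 0) :* z) refl ζ
  decompose (c ∷ g) = (ι c - b , a + b * t) , real-- (real-ι c) Rb , real-+ Ra (real-* Rb real-t) , (begin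
    ι c + ζ * ev ζ g                                   ≈⟨ +-congˡ (*-congˡ eq) ⟩
    ι c + ζ * (a + b * ζ)                              ≈⟨ solve 5 (λ c z z̄ a b → c :+ z :* (a :+ b :* z) := c :- b :* (z :* z̄) :+ (a :+ b :* (z :+ z̄)) :* z) refl (ι c) ζ ζ̄ a b ⟩
    ι c - b * (ζ * ζ̄) + (a + b * t) * ζ                ≈⟨ +-congʳ (+-congˡ (-‿cong (trans (*-congˡ ζζ̄) (*-identityʳ b)))) ⟩
    ι c - b + (a + b * t) * ζ                          ∎)
    where
    a b : Carrier
    a = proj₁ (proj₁ (decompose g))
    b = proj₂ (proj₁ (decompose g))
    Ra : Real a
    Ra = proj₁ (proj₂ (decompose g))
    Rb : Real b
    Rb = proj₁ (proj₂ (proj₂ (decompose g)))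
    eq : ev ζ g ≈ a + b * ζ
    eq = proj₂ (proj₂ (proj₂ (decompose g)))

  module _ (cancel₋₁ : ∀ x → (ζ + 1#) * x ≈ 0# → x ≈ 0#) where
    -- Write x = a + bζ with a and b real. Being fixed means b (ζ - ζ̄) = 0, which after
    -- multiplication by ζ reads b (ζ - 1)(ζ + 1) = 0, and both factors can be cancelled.
    fixed-real : ∀ x → Hom.to conj x ≈ x → Real x
    fixed-real x fix = real-resp (sym (trans ex (trans (+-congˡ (trans (*-congʳ b≈0) (zeroˡ ζ))) (+-identityʳ a)))) Ra
      where
      g : List ℤ
      g = proj₁ (surjective x)
      a b : Carrier
      a = proj₁ (proj₁ (decompose g))
      b = proj₂ (proj₁ (decompose g))
      Ra : Real a
      Ra = proj₁ (proj₂ (decompose g))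
      Rb : Real b
      Rb = proj₁ (proj₂ (proj₂ (decompose g)))
      ex : x ≈ a + b * ζ
      ex = trans (proj₂ (surjective x)) (trans (hom-eval θ g) (proj₂ (proj₂ (proj₂ (decompose g)))))
      conj-x : x ≈ a + b * ζ̄
      conj-x = trans (sym fix) (trans (Hom.≈-cong conj ex) (trans (Hom.+-hom conj a (b * ζ))
        (+-cong (conj-real Ra) (trans (Hom.*-hom conj b ζ) (*-cong (conj-real Rb) conj-ζ)))))
      b≈0 : b ≈ 0#
      b≈0 = cancel₋₁ b (cancel₁ ((ζ + 1#) * b) (begin
        (ζ - 1#) * ((ζ + 1#) * b)                       ≈⟨ solve 4 (λ z z̄ a b → (z :- con (+ 1)) :* ((z :+ con (+ 1)) :* b)
                                                             := z :* ((a :+ b :* z) :- (a :+ b :* z̄)) :+ (z :* z̄ :- con (+ 1)) :* b) refl ζ ζ̄ a b ⟩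
        ζ * ((a + b * ζ) - (a + b * ζ̄)) + (ζ * ζ̄ - 1#) * b  ≈⟨ +-cong (*-congˡ (trans (+-cong (sym ex) (-‿cong (sym conj-x))) (-‿inverseʳ x))) (*-congʳ (trans (+-congʳ ζζ̄) (-‿inverseʳ 1#))) ⟩
        ζ * 0# + 0# * b                                 ≈⟨ solve 2 (λ z b → z :* con (+ 0) :+ con (+ 0) :* b := con (+ 0)) refl ζ b ⟩
        0#                                              ∎))

  ρ : Carrier
  ρ = (1# - ζ) * (1# - ζ̄)

  ρ-t : ρ ≈ 1# + 1# - t
  ρ-t = trans (solve 2 (λ z z̄ → (con (+ 1) :- z) :* (con (+ 1) :- z̄) := con (+ 1) :+ z :* z̄ :- (z :+ z̄)) refl ζ ζ̄) (+-congʳ (+-congˡ ζζ̄))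

  real-ρ : Real ρ
  real-ρ = real-resp (sym ρ-t) (real-- (real-+ (real-ι (+ 1)) (real-ι (+ 1))) real-t)

  -- Since t = 2 - ρ, Horner's scheme modulo ρ evaluates the polynomial at the integer 2.
  expand-ρ : ∀ g → Σ ℤ (λ c → Σ Carrier (λ r → Real r × ev t g ≈ ι c + ρ * r))
  expand-ρ [] = + 0 , 0# , real-ι (+ 0) , sym (trans (+-congˡ (zeroʳ ρ)) (+-identityʳ _))
  expand-ρ (c ∷ g) = c ℤ.+ + 2 ℤ.* c′ , (ι (+ 2) - ρ) * r - ι c′ ,
    real-- (real-* (real-- (real-ι (+ 2)) real-ρ) Rr) (real-ι c′) , (begin
      ι c + t * ev t g                       ≈⟨ +-congˡ (*-cong (trans (solve 1 (λ t → t := con (+ 2) :- (con (+ 1) :+ con (+ 1) :- t)) refl t) (+-congˡ (-‿cong (sym ρ-t)))) eq) ⟩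
      ι c + (ι (+ 2) - ρ) * (ι c′ + ρ * r)   ≈⟨ solve 4 (λ c c′ q r → c :+ (con (+ 2) :- q) :* (c′ :+ q :* r) := c :+ con (+ 2) :* c′ :+ q :* ((con (+ 2) :- q) :* r :- c′)) refl (ι c) (ι c′) ρ r ⟩
      ι c + ι (+ 2) * ι c′ + ρ * ((ι (+ 2) - ρ) * r - ι c′)  ≈⟨ +-congʳ (trans (+-congˡ (sym (ι-* (+ 2) c′))) (sym (ι-+ c (+ 2 ℤ.* c′)))) ⟩
      ι (c ℤ.+ + 2 ℤ.* c′) + ρ * ((ι (+ 2) - ρ) * r - ι c′)  ∎)
    where
    c′ : ℤ
    c′ = proj₁ (expand-ρ g)
    r : Carrier
    r = proj₁ (proj₂ (expand-ρ g))
    Rr : Real r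
    Rr = proj₁ (proj₂ (proj₂ (expand-ρ g)))
    eq : ev t g ≈ ι c′ + ρ * r
    eq = proj₂ (proj₂ (proj₂ (expand-ρ g)))

  -- Division with remainder brings the integer c into the range of digits. The multiple of p split
  -- off is absorbed by the real cofactor, because ϖ divides p with real quotient μ.
  reduce-digit : .{{_ : ℕ.NonZero p}} (ϖ μ : Carrier) → Real μ → ιℕ p ≈ ϖ * μ →
    ∀ c r x → Real r → x ≈ ι c + ϖ * r → Σ (Fin p) (λ d → Σ Carrier (λ r′ → Real r′ × (x ≈ ιℕ (toℕ d) + ϖ * r′)))
  reduce-digit ϖ μ Rμ ep c r x Rr ex = fromℕ< (n%ℕd<d c p) , μ * ι m + r , real-+ (real-* Rμ (real-ι m)) Rr , (begin
    x                                      ≈⟨ ex ⟩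
    ι c + ϖ * r                            ≈⟨ +-congʳ (reflexive (≡.cong ι (a≡a%ℕn+[a/ℕn]*n c p))) ⟩
    ι (+ (c %ℕ p) ℤ.+ m ℤ.* + p) + ϖ * r   ≈⟨ +-congʳ (trans (ι-+ (+ (c %ℕ p)) (m ℤ.* + p)) (+-congˡ (trans (ι-* m (+ p)) (*-congˡ ep)))) ⟩
    ιℕ (c %ℕ p) + ι m * (ϖ * μ) + ϖ * r    ≈⟨ solve 5 (λ d m w u r → d :+ m :* (w :* u) :+ w :* r := d :+ w :* (u :* m :+ r)) refl (ιℕ (c %ℕ p)) (ι m) ϖ μ r ⟩
    ιℕ (c %ℕ p) + ϖ * (μ * ι m + r)        ≈⟨ +-congʳ (reflexive (≡.cong ιℕ (≡.sym (Finₚ.toℕ-fromℕ< (n%ℕd<d c p))))) ⟩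
    ιℕ (toℕ (fromℕ< (n%ℕd<d c p))) + ϖ * (μ * ι m + r) ∎)
    where
    m : ℤ
    m = c /ℕ p

  digitSystem : .{{_ : ℕ.NonZero p}} (μ : Carrier) → Real μ → ιℕ p ≈ ρ * μ → DigitSystem K
  digitSystem μ Rμ ep = record
    { p = p ; ϖ = ρ ; Real = Real ; real-resp = real-resp ; real-+ = real-+ ; real-* = real-* ; real-ι = real-ι ; real-ϖ = real-ρ
    ; digit = λ r R → reduce-digit ρ μ Rμ ep (proj₁ (expand-ρ (proj₁ R))) (proj₁ (proj₂ (expand-ρ (proj₁ R)))) r
        (proj₁ (proj₂ (proj₂ (expand-ρ (proj₁ R))))) (trans (proj₂ R) (proj₂ (proj₂ (proj₂ (expand-ρ (proj₁ R)))))) }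

  cyclotomic : .{{_ : ℕ.NonZero p}} (μ : Carrier) → Real μ → ιℕ p ≈ ρ * μ →
    (∀ x → (ζ + 1#) * x ≈ 0# → x ≈ 0#) → Cyclotomic K
  cyclotomic μ Rμ ep cancel₋₁ = record
    { ζ = ζ ; ζ̄ = ζ̄ ; ζζ̄ = ζζ̄ ; digits = digitSystem μ Rμ ep ; ϖ-def = refl
    ; π-cancel = λ x e → cancel₁ x (trans (solve 2 (λ z x → (z :- con (+ 1)) :* x := :- ((con (+ 1) :- z) :* x)) refl ζ x)
        (trans (-‿cong e) (solve 0 (:- con (+ 0) := con (+ 0)) refl)))
    ; residue = residue ; conj = conj ; conj-ζ = conj-ζ ; fixed-real = fixed-real cancel₋₁ }

  -- cheb m = |1 - ζ^m|²; the recursion is that of the Chebyshev polynomials.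
  cheb : ℕ → Carrier
  cheb m = 1# + 1# - (ζ ^ m + ζ̄ ^ m)

  cheb-step : ∀ m → cheb (suc (suc m)) ≈ (1# + 1#) * ρ + t * cheb (suc m) - cheb m
  cheb-step m = begin
    1# + 1# - (ζ * (ζ * x) + ζ̄ * (ζ̄ * z))
      ≈⟨ solve 4 (λ a b x z → con (+ 1) :+ con (+ 1) :- (a :* (a :* x) :+ b :* (b :* z))
           := (con (+ 1) :+ con (+ 1)) :* (con (+ 1) :+ con (+ 1) :- (a :+ b)) :+ (a :+ b) :* (con (+ 1) :+ con (+ 1) :- (a :* x :+ b :* z))
              :- (con (+ 1) :+ con (+ 1) :- (a :* b) :* (x :+ z))) refl ζ ζ̄ x z ⟩
    (1# + 1#) * (1# + 1# - t) + t * cheb (suc m) - (1# + 1# - ζ * ζ̄ * (x + z))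
      ≈⟨ +-cong (+-congʳ (*-congˡ (sym ρ-t))) (-‿cong (+-congˡ (-‿cong (trans (*-congʳ ζζ̄) (*-identityˡ _))))) ⟩
    (1# + 1#) * ρ + t * cheb (suc m) - cheb m ∎
    where
    x z : Carrier
    x = ζ ^ m
    z = ζ̄ ^ m

  RealMultiple : Carrier → Carrier → Set
  RealMultiple d x = Σ Carrier (λ r → Real r × x ≈ d * r)

  -- The cofactor has to be real, so divisibility is drawn from the recursion, whose coefficients
  -- are real, with the starting values `cheb` 0 = 0 and `cheb` 1 = ρ.
  cheb-ρ : ∀ m → RealMultiple ρ (cheb m) × RealMultiple ρ (cheb (suc m))
  cheb-ρ zero = (0# , real-ι (+ 0) , solve 1 (λ r → con (+ 1) :+ con (+ 1) :- (con (+ 1) :+ con (+ 1)) := r :* con (+ 0)) refl ρ) ,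
    (1# , real-ι (+ 1) , (begin
      1# + 1# - (ζ * 1# + ζ̄ * 1#)   ≈⟨ +-congˡ (-‿cong (+-cong (*-identityʳ ζ) (*-identityʳ ζ̄))) ⟩
      1# + 1# - t                   ≈⟨ ρ-t ⟨
      ρ                             ≈⟨ *-identityʳ ρ ⟨
      ρ * 1#                        ∎))
  cheb-ρ (suc m) = proj₂ (cheb-ρ m) ,
    (ι (+ 2) + t * s - r , real-- (real-+ (real-ι (+ 2)) (real-* real-t (proj₁ (proj₂ (proj₂ (cheb-ρ m)))))) (proj₁ (proj₂ (proj₁ (cheb-ρ m)))) , (begin
      cheb (suc (suc m))                           ≈⟨ cheb-step m ⟩
      (1# + 1#) * ρ + t * cheb (suc m) - cheb m    ≈⟨ +-cong (+-congˡ (*-congˡ (proj₂ (proj₂ (proj₂ (cheb-ρ m)))))) (-‿cong (proj₂ (proj₂ (proj₁ (cheb-ρ m))))) ⟩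
      (1# + 1#) * ρ + t * (ρ * s) - ρ * r          ≈⟨ solve 4 (λ q t s r → (con (+ 1) :+ con (+ 1)) :* q :+ t :* (q :* s) :- q :* r := q :* (con (+ 2) :+ t :* s :- r)) refl ρ t s r ⟩
      ρ * (ι (+ 2) + t * s - r)                    ∎))
    where
    r s : Carrier
    r = proj₁ (proj₁ (cheb-ρ m))
    s = proj₁ (proj₂ (cheb-ρ m))

  -- For odd p, p = Σ |1 - w^i|² over 1 ≤ i ≤ (p-1)/2.
  private
    symSum : ℕ → Carrier
    symSum zero = 1#
    symSum (suc h) = symSum h + (ζ ^ (suc h ℕ.* P) + ζ̄ ^ (suc h ℕ.* P))

    symSum-geom : ∀ h → w ^ h * symSum h ≈ geom (suc (dbl h)) w
    symSum-geom zero = solve 1 (λ w → con (+ 1) :* con (+ 1) := con (+ 1) :+ w :* con (+ 0)) refl w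
    symSum-geom (suc h) = begin
      w * w ^ h * (symSum h + (ζ ^ (suc h ℕ.* P) + ζ̄ ^ (suc h ℕ.* P)))
        ≈⟨ *-congˡ (+-congˡ (+-cong (^-*ℕ ζ (suc h) P) (^-*ℕ ζ̄ (suc h) P))) ⟩
      w * w ^ h * (symSum h + (w ^ suc h + v ^ suc h))
        ≈⟨ solve 5 (λ w a s b c → w :* a :* (s :+ (b :+ c)) := w :* (a :* s) :+ w :* a :* b :+ w :* a :* c) refl w (w ^ h) (symSum h) (w ^ suc h) (v ^ suc h) ⟩
      w * (w ^ h * symSum h) + w ^ suc h * w ^ suc h + w ^ suc h * v ^ suc h
        ≈⟨ +-cong (+-cong (*-congˡ (symSum-geom h)) (trans (sym (^-+ w (suc h) (suc h))) (reflexive (≡.cong (w ^_) (≡.sym (dbl-+ (suc h))))))) (inverse-^ w v (suc h) wv) ⟩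
      w * geom (suc (dbl h)) w + w ^ dbl (suc h) + 1#
        ≈⟨ solve 3 (λ a b c → a :+ b :+ con (+ 1) := b :+ (con (+ 1) :+ a)) refl (w * geom (suc (dbl h)) w) (w ^ dbl (suc h)) w ⟩
      w ^ dbl (suc h) + geom (dbl (suc h)) w
        ≈⟨ geom-snoc (dbl (suc h)) w ⟨
      geom (suc (dbl (suc h))) w ∎

    symSum-real : ∀ h → RealMultiple ρ (ιℕ (suc (dbl h)) - symSum h)
    symSum-real zero = 0# , real-ι (+ 0) , trans (-‿inverseʳ 1#) (sym (zeroʳ ρ))
    symSum-real (suc h) = r + s , real-+ (proj₁ (proj₂ (symSum-real h))) (proj₁ (proj₂ (proj₁ (cheb-ρ (suc h ℕ.* P))))) , (begin
      1# + (1# + ιℕ (suc (dbl h))) - (symSum h + z)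
        ≈⟨ solve 3 (λ n s z → con (+ 1) :+ (con (+ 1) :+ n) :- (s :+ z) := n :- s :+ (con (+ 1) :+ con (+ 1) :- z)) refl (ιℕ (suc (dbl h))) (symSum h) z ⟩
      ιℕ (suc (dbl h)) - symSum h + cheb (suc h ℕ.* P)
        ≈⟨ +-cong (proj₂ (proj₂ (symSum-real h))) (proj₂ (proj₂ (proj₁ (cheb-ρ (suc h ℕ.* P))))) ⟩
      ρ * r + ρ * s
        ≈⟨ distribˡ ρ r s ⟨
      ρ * (r + s) ∎)
      where
      r s z : Carrier
      r = proj₁ (symSum-real h)
      s = proj₁ (proj₁ (cheb-ρ (suc h ℕ.* P)))
      z = ζ ^ (suc h ℕ.* P) + ζ̄ ^ (suc h ℕ.* P)

  p-ramified-odd : ∀ h → p ≡ suc (dbl h) → RealMultiple ρ (ιℕ p)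
  p-ramified-odd h eq = proj₁ (symSum-real h) , proj₁ (proj₂ (symSum-real h)) , (begin
    ιℕ p                               ≡⟨ ≡.cong ιℕ eq ⟩
    ιℕ (suc (dbl h))                   ≈⟨ solve 1 (λ x → x := x :- con (+ 0)) refl _ ⟩
    ιℕ (suc (dbl h)) - 0#              ≈⟨ +-congˡ (-‿cong S≈0) ⟨
    ιℕ (suc (dbl h)) - symSum h        ≈⟨ proj₂ (proj₂ (symSum-real h)) ⟩
    ρ * proj₁ (symSum-real h)          ∎)
    where
    S≈0 : symSum h ≈ 0#
    S≈0 = begin
      symSum h                       ≈⟨ *-identityˡ _ ⟨
      1# * symSum h                  ≈⟨ *-congʳ (trans (*-comm _ _) (inverse-^ w v h wv)) ⟨
      v ^ h * w ^ h * symSum h       ≈⟨ *-assoc _ _ _ ⟩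
      v ^ h * (w ^ h * symSum h)     ≈⟨ *-congˡ (trans (symSum-geom h) (trans (reflexive (≡.cong (λ n → geom n w) (≡.sym eq))) root)) ⟩
      v ^ h * 0#                     ≈⟨ zeroʳ _ ⟩
      0#                             ∎

  -- 1 - ζ^(2m) = (1 - ζ^m)(1 + ζ^m), and |1 + ζ^m|² = 4 - |1 - ζ^m|².
  cheb-double : ∀ m → cheb (m ℕ.+ m) ≈ cheb m * (1# + 1# + (1# + 1#) - cheb m)
  cheb-double m = begin
    1# + 1# - (ζ ^ (m ℕ.+ m) + ζ̄ ^ (m ℕ.+ m))
      ≈⟨ +-congˡ (-‿cong (+-cong (^-+ ζ m m) (^-+ ζ̄ m m))) ⟩
    1# + 1# - (x * x + z * z)
      ≈⟨ solve 2 (λ x z → con (+ 1) :+ con (+ 1) :- (x :* x :+ z :* z)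
           := (con (+ 1) :+ con (+ 1) :- (x :+ z)) :* (con (+ 1) :+ con (+ 1) :+ (con (+ 1) :+ con (+ 1)) :- (con (+ 1) :+ con (+ 1) :- (x :+ z))) :+ (con (+ 1) :+ con (+ 1)) :* (x :* z :- con (+ 1))) refl x z ⟩
    cheb m * (1# + 1# + (1# + 1#) - cheb m) + (1# + 1#) * (x * z - 1#)
      ≈⟨ +-congˡ (trans (*-congˡ (trans (+-congʳ (inverse-^ ζ ζ̄ m ζζ̄)) (-‿inverseʳ 1#))) (zeroʳ _)) ⟩
    cheb m * (1# + 1# + (1# + 1#) - cheb m) + 0#
      ≈⟨ +-identityʳ _ ⟩
    cheb m * (1# + 1# + (1# + 1#) - cheb m) ∎
    where
    x z : Carrier
    x = ζ ^ m
    z = ζ̄ ^ m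

  cheb-real : ∀ m → Real (cheb m)
  cheb-real m = real-resp (sym (proj₂ (proj₂ (proj₁ (cheb-ρ m))))) (real-* real-ρ (proj₁ (proj₂ (proj₁ (cheb-ρ m)))))

  -- 2 = |1 - i|² for the power i = ζ^Q with i² = -1.
  two-cheb : ∀ Q → ζ ^ (Q ℕ.+ Q) ≈ - 1# → cheb Q ≈ 1# + 1#
  two-cheb Q i² = begin
    1# + 1# - (x + z)      ≈⟨ +-congˡ (-‿cong (+-congˡ z≈)) ⟩
    1# + 1# - (x + - x)    ≈⟨ solve 1 (λ x → con (+ 1) :+ con (+ 1) :- (x :+ :- x) := con (+ 1) :+ con (+ 1)) refl x ⟩
    1# + 1#                ∎
    where
    x z : Carrier
    x = ζ ^ Q
    z = ζ̄ ^ Q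
    z≈ : z ≈ - x
    z≈ = begin
      z                     ≈⟨ solve 1 (λ z → z := :- (:- con (+ 1) :* z)) refl z ⟩
      - (- 1# * z)          ≈⟨ -‿cong (*-congʳ (trans (sym i²) (^-+ ζ Q Q))) ⟩
      - (x * x * z)         ≈⟨ -‿cong (*-assoc x x z) ⟩
      - (x * (x * z))       ≈⟨ -‿cong (trans (*-congˡ (inverse-^ ζ ζ̄ Q ζζ̄)) (*-identityʳ x)) ⟩
      - x                   ∎

  private
    cheb-divides : ∀ i m → RealMultiple (cheb m) (cheb (2 ℕ.^ i ℕ.* m))
    cheb-divides zero m = 1# , real-ι (+ 1) , trans (reflexive (≡.cong cheb (ℕₚ.+-identityʳ m))) (sym (*-identityʳ _))
    cheb-divides (suc i) m = u * proj₁ IH , real-* Ru (proj₁ (proj₂ IH)) , (begin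
      cheb (2 ℕ.^ suc i ℕ.* m)        ≡⟨ ≡.cong cheb (≡.trans (≡.cong (ℕ._* m) (ℕₚ.*-comm 2 (2 ℕ.^ i))) (≡.trans (ℕₚ.*-assoc (2 ℕ.^ i) 2 m) (≡.cong (λ k → 2 ℕ.^ i ℕ.* (m ℕ.+ k)) (ℕₚ.+-identityʳ m)))) ⟩
      cheb (2 ℕ.^ i ℕ.* (m ℕ.+ m))    ≈⟨ proj₂ (proj₂ IH) ⟩
      cheb (m ℕ.+ m) * proj₁ IH       ≈⟨ *-congʳ (cheb-double m) ⟩
      cheb m * u * proj₁ IH           ≈⟨ *-assoc _ _ _ ⟩
      cheb m * (u * proj₁ IH)         ∎)
      where
      IH : RealMultiple (cheb (m ℕ.+ m)) (cheb (2 ℕ.^ i ℕ.* (m ℕ.+ m)))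
      IH = cheb-divides i (m ℕ.+ m)
      u : Carrier
      u = 1# + 1# + (1# + 1#) - cheb m
      Ru : Real u
      Ru = real-- (real-+ (real-+ (real-ι (+ 1)) (real-ι (+ 1))) (real-+ (real-ι (+ 1)) (real-ι (+ 1)))) (cheb-real m)

  module _ (g : ℕ) (two : cheb (2 ℕ.^ g) ≈ 1# + 1#) where
    private
      two-divides : ∀ i j → i ℕ.+ j ≡ g → RealMultiple (cheb (2 ℕ.^ j)) (1# + 1#)
      two-divides i j eq = proj₁ M , proj₁ (proj₂ M) , trans (sym two) (trans (reflexive (≡.cong cheb (≡.trans (≡.cong (2 ℕ.^_) (≡.sym eq)) (ℕₚ.^-distribˡ-+-* 2 i j)))) (proj₂ (proj₂ M)))
        where
        M : RealMultiple (cheb (2 ℕ.^ j)) (cheb (2 ℕ.^ i ℕ.* 2 ℕ.^ j))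
        M = cheb-divides i (2 ℕ.^ j)

      -- Doubling multiplies `cheb N` by 4 - `cheb N`. As `cheb N` divides 2, it divides this factor
      -- too, so `cheb N` enters squared and the exponent of ρ doubles with N. The condition i + j =
      -- g keeps N below the index 2^g at which `cheb` is 2.
      cheb-power : ∀ j i → i ℕ.+ j ≡ g → RealMultiple (ρ ^ (2 ℕ.^ j)) (cheb (2 ℕ.^ j))
      cheb-power zero i eq = r , Rr , trans er (*-congʳ (sym (*-identityʳ ρ)))
        where
        r : Carrier
        r = proj₁ (proj₂ (cheb-ρ 0))
        Rr : Real r
        Rr = proj₁ (proj₂ (proj₂ (cheb-ρ 0)))
        er : cheb 1 ≈ ρ * r
        er = proj₂ (proj₂ (proj₂ (cheb-ρ 0)))
      cheb-power (suc j) i eq = u * u * ((1# + 1#) * m - 1#) , real-* (real-* Ru Ru) (real-- (real-* (real-+ (real-ι (+ 1)) (real-ι (+ 1))) Rm) (real-ι (+ 1))) , (begin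
        cheb (2 ℕ.^ suc j)                             ≡⟨ ≡.cong cheb (≡.cong (2 ℕ.^ j ℕ.+_) (ℕₚ.+-identityʳ (2 ℕ.^ j))) ⟩
        cheb (N ℕ.+ N)                                 ≈⟨ cheb-double N ⟩
        cheb N * (1# + 1# + (1# + 1#) - cheb N)        ≈⟨ *-congˡ (+-congʳ (trans (solve 0 (con (+ 1) :+ con (+ 1) :+ (con (+ 1) :+ con (+ 1)) := (con (+ 1) :+ con (+ 1)) :* (con (+ 1) :+ con (+ 1))) refl) (*-congˡ em))) ⟩
        cheb N * ((1# + 1#) * (cheb N * m) - cheb N)   ≈⟨ *-cong eu (+-cong (*-congˡ (*-congʳ eu)) (-‿cong eu)) ⟩
        R * u * ((1# + 1#) * (R * u * m) - R * u)      ≈⟨ solve 3 (λ r u m → r :* u :* ((con (+ 1) :+ con (+ 1)) :* (r :* u :* m) :- r :* u) := r :* r :* (u :* u :* ((con (+ 1) :+ con (+ 1)) :* m :- con (+ 1)))) refl R u m ⟩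
        R * R * (u * u * ((1# + 1#) * m - 1#))         ≈⟨ *-congʳ (trans (sym (^-+ ρ N N)) (reflexive (≡.cong (ρ ^_) (≡.sym (≡.cong (2 ℕ.^ j ℕ.+_) (ℕₚ.+-identityʳ (2 ℕ.^ j))))))) ⟩
        ρ ^ (2 ℕ.^ suc j) * (u * u * ((1# + 1#) * m - 1#)) ∎)
        where
        N : ℕ
        N = 2 ℕ.^ j
        eq′ : suc i ℕ.+ j ≡ g
        eq′ = ≡.trans (≡.sym (ℕₚ.+-suc i j)) eq
        R u m : Carrier
        R = ρ ^ N
        u = proj₁ (cheb-power j (suc i) eq′)
        m = proj₁ (two-divides (suc i) j eq′)
        Ru : Real u
        Ru = proj₁ (proj₂ (cheb-power j (suc i) eq′))
        eu : cheb N ≈ R * u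
        eu = proj₂ (proj₂ (cheb-power j (suc i) eq′))
        Rm : Real m
        Rm = proj₁ (proj₂ (two-divides (suc i) j eq′))
        em : 1# + 1# ≈ cheb N * m
        em = proj₂ (proj₂ (two-divides (suc i) j eq′))

    two-ramified : RealMultiple ρ (1# + 1#)
    two-ramified = proj₁ (proj₁ (cheb-ρ (2 ℕ.^ g))) , proj₁ (proj₂ (proj₁ (cheb-ρ (2 ℕ.^ g)))) , trans (sym two) (proj₂ (proj₂ (proj₁ (cheb-ρ (2 ℕ.^ g)))))

    real-^ⁿ : ∀ {x} n → Real x → Real (x ^ n)
    real-^ⁿ zero R = real-ι (+ 1)
    real-^ⁿ (suc n) R = real-* R (real-^ⁿ n R)

    -- 2 is divisible by ρ^(2^g), where g = f - 2. The least s for which this makes 2^s divisible by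
    -- ρ^e is therefore ⌈2^(2-f) e⌉, the ceiling in (d) and (e).
    two-power : ∀ e s → e ℕ.≤ s ℕ.* 2 ℕ.^ g → RealMultiple (ρ ^ e) (ι (+ (2 ℕ.^ s)))
    two-power e s le = ρ ^ (s ℕ.* N ∸ e) * u ^ s , real-* (real-^ⁿ (s ℕ.* N ∸ e) real-ρ) (real-^ⁿ s Ru) , (begin
      ιℕ (2 ℕ.^ s)                         ≈⟨ ι-2^ s ⟩
      (1# + 1#) ^ s                        ≈⟨ ^-cong s (trans (sym two) eu) ⟩
      (ρ ^ N * u) ^ s                      ≈⟨ ^-*-distrib (ρ ^ N) u s ⟩
      (ρ ^ N) ^ s * u ^ s                  ≈⟨ *-congʳ (sym (^-*ℕ ρ s N)) ⟩
      ρ ^ (s ℕ.* N) * u ^ s                ≈⟨ *-congʳ (trans (reflexive (≡.cong (ρ ^_) (≡.sym (ℕₚ.m+[n∸m]≡n le)))) (^-+ ρ e (s ℕ.* N ∸ e))) ⟩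
      ρ ^ e * ρ ^ (s ℕ.* N ∸ e) * u ^ s    ≈⟨ *-assoc _ _ _ ⟩
      ρ ^ e * (ρ ^ (s ℕ.* N ∸ e) * u ^ s)  ∎)
      where
      N : ℕ
      N = 2 ℕ.^ g
      u : Carrier
      u = proj₁ (cheb-power g 0 ≡.refl)
      Ru : Real u
      Ru = proj₁ (proj₂ (cheb-power g 0 ≡.refl))
      eu : cheb N ≈ ρ ^ N * u
      eu = proj₂ (proj₂ (cheb-power g 0 ≡.refl))
      ι-2^ : ∀ s → ιℕ (2 ℕ.^ s) ≈ (1# + 1#) ^ s
      ι-2^ zero = refl
      ι-2^ (suc s) = trans (ιℕ-* 2 (2 ℕ.^ s)) (*-congˡ (ι-2^ s))

diag-cases : ∀ q a → a ℕ.< q → q ∣ (a ℕ.+ a) → a ≡ 0 ⊎ a ℕ.+ a ≡ q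
diag-cases q zero _ _ = inj₁ ≡.refl
diag-cases q (suc a) a<q (divides 1 eq) = inj₂ (≡.trans eq (ℕₚ.*-identityˡ q))
diag-cases q (suc a) a<q (divides (suc (suc k)) eq) = ⊥-elim (ℕₚ.<⇒≱ (ℕₚ.+-mono-< a<q a<q)
  (≡.subst (q ℕ.+ q ℕ.≤_) (≡.sym eq) (ℕₚ.+-monoʳ-≤ q (ℕₚ.m≤m+n q (k ℕ.* q)))))

-- The ceiling is exposed as a successor s + 1. Since t enters a₁ and a₂ through 2t, its class
-- modulo 2^s decides them modulo 2^(s+1), whence the -1 beside the ceiling in (d) and (e).
ceilDiv-spec : ∀ e Q → .{{_ : ℕ.NonZero Q}} → ∃ (λ s → ceilDiv (suc e) Q ≡ suc s × suc e ℕ.≤ suc s ℕ.* Q)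
ceilDiv-spec e (suc d) = go ((suc e ℕ.+ d) / suc d) ≡.refl
  where
  x : ℕ
  x = suc e ℕ.+ d
  big : suc e ℕ.≤ x / suc d ℕ.* suc d
  big = ℕₚ.+-cancelˡ-≤ d (suc e) _ (≡.subst (ℕ._≤ d ℕ.+ x / suc d ℕ.* suc d) (ℕₚ.+-comm (suc e) d)
    (≡.subst (ℕ._≤ d ℕ.+ x / suc d ℕ.* suc d) (≡.sym (m≡m%n+[m/n]*n x (suc d)))
      (ℕₚ.+-monoˡ-≤ (x / suc d ℕ.* suc d) (ℕₚ.≤-pred (m%n<n x (suc d))))))
  go : ∀ s → x / suc d ≡ s → ∃ (λ s → x / suc d ≡ suc s × suc e ℕ.≤ suc s ℕ.* suc d)
  go zero eq = ⊥-elim (ℕₚ.1+n≰n (ℕₚ.≤-trans (≡.subst (λ s → suc e ℕ.≤ s ℕ.* suc d) eq big) ℕ.z≤n))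
  go (suc s) eq = s , eq , ≡.subst (λ s → suc e ℕ.≤ s ℕ.* suc d) eq big

-- For p = 2 a nonzero exponent on the diagonal is q/2, so the flag marks the diagonal entries -1.
sign-flag : ℕ → ℕ
sign-flag zero = 0
sign-flag (suc _) = 1

sumFin : ∀ {n} → (Fin n → ℕ) → ℕ
sumFin {zero} f = 0
sumFin {suc n} f = f zero ℕ.+ sumFin (λ i → f (suc i))

pow-bound : ∀ s {w k} → s ℕ.+ w ℕ.≤ k → 2 ℕ.^ s ℕ.* 2 ℕ.^ w ℕ.≤ 2 ℕ.^ k
pow-bound s {w} {k} le = ≡.subst (ℕ._≤ 2 ℕ.^ k) (ℕₚ.^-distribˡ-+-* 2 s w) (ℕₚ.^-monoʳ-≤ 2 le)

-- The class maps

module Family (p P q-1 : ℕ) (q≡ : p ℕ.* P ≡ suc q-1) (D : CycloData p P) (n : ℕ) where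
  open CycloTheory p P q-1 q≡ D
  open Relation.Binary.Reasoning.Setoid setoid
  open Solve K
  open Det′ K using (sumF)

  ℋ : Set
  ℋ = Herm (p ℕ.* P) n

  exps : ℋ → Fin n → Fin n → ℕ
  exps H i j = toℕ (proj₁ H i j)

  coefs : ℋ → ℕ → Carrier
  coefs H = UnitEntries.coef K ζ (exps H)

  unitary : ∀ H i j → ζ ^ exps H i j * ζ ^ exps H j i ≈ 1#
  unitary H i j = trans (sym (^-+ ζ (exps H i j) (exps H j i))) (ζ^-period _ (proj₂ H i j))

  diagonal : ∀ H i → exps H i i ≡ 0 ⊎ exps H i i ℕ.+ exps H i i ≡ p ℕ.* P
  diagonal H i = diag-cases _ _ (Finₚ.toℕ<n (proj₁ H i i)) (proj₂ H i i)

  -- The counterpart of `XCardLe` for the coefficients of det (I - xH). Three are settled by the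
  -- diagonal and n more by codes, so that every index up to n is reached also for n < 3.
  Classified : ℕ → (Carrier → Set) → Carrier → ℕ → Set
  Classified N R ϖ e = Σ (ℋ → Fin N) (λ cls → ∀ H H′ → cls H ≡ cls H′ → ∀ k → k ℕ.< 3 ℕ.+ n →
    Σ Carrier (λ u → R u × (coefs H k - coefs H′ k ≈ ϖ ^ e * u)))

  classified-0 : ∀ N ϖ → 0 ℕ.< N → (∀ H k → Real (coefs H k)) → Classified N Real ϖ 0
  classified-0 N ϖ N>0 R = (λ _ → fromℕ< N>0) , λ H H′ _ k _ →
    coefs H k - coefs H′ k , real-- (R H k) (R H′ k) , sym (*-identityˡ _)

  first : ∀ H (b : Fin n → Carrier) → (∀ i → ζ ^ exps H i i ≈ 1# - (b i + b i)) → (∀ i → b i * b i ≈ b i) →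
      coefs H 0 ≈ 1#
    × coefs H 1 ≈ sumF b + sumF b - ιℕ n
    × coefs H 2 ≈ (sumF b + sumF b) * (sumF b - ιℕ n)
  first H b = FirstCoefficients.first-coefficients K n (UnitEntries.h K ζ (exps H)) b (unitary H)

  negatives : ℋ → ℕ
  negatives H = sumFin (λ i → sign-flag (exps H i i))

  sum-flags : ∀ {m} (f : Fin m → ℕ) → sumF (λ i → ιℕ (f i)) ≈ ιℕ (sumFin f)
  sum-flags {zero} f = refl
  sum-flags {suc m} f = trans (+-congˡ (sum-flags (λ i → f (suc i)))) (sym (ιℕ-+ (f zero) (sumFin (λ i → f (suc i)))))

  flag-idem : ∀ m → ιℕ (sign-flag m) * ιℕ (sign-flag m) ≈ ιℕ (sign-flag m)
  flag-idem zero = zeroˡ _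
  flag-idem (suc m) = *-identityˡ _

  module _ (w≈-1 : ζ ^ P ≈ - 1#) (p≡2 : p ≡ 2) where
    diag-sign : ∀ H i → ζ ^ exps H i i ≈ 1# - (ιℕ (sign-flag (exps H i i)) + ιℕ (sign-flag (exps H i i)))
    diag-sign H i = go (exps H i i) (diagonal H i)
      where
      zero-case : ζ ^ 0 ≈ 1# - (ιℕ 0 + ιℕ 0)
      zero-case = solve 0 (con (+ 1) := con (+ 1) :- (con (+ 0) :+ con (+ 0))) refl
      go : ∀ a → a ≡ 0 ⊎ a ℕ.+ a ≡ p ℕ.* P → ζ ^ a ≈ 1# - (ιℕ (sign-flag a) + ιℕ (sign-flag a))
      go .0 (inj₁ ≡.refl) = zero-case
      go zero (inj₂ _) = zero-case
      go (suc a) (inj₂ eq) = trans (reflexive (≡.cong (ζ ^_) (dbl-injective (suc a) P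
        (≡.trans (dbl-+ (suc a)) (≡.trans eq (≡.trans (≡.cong (ℕ._* P) p≡2) (≡.trans (≡.cong (P ℕ.+_) (ℕₚ.+-identityʳ P)) (≡.sym (dbl-+ P)))))))))
        (trans w≈-1 (solve 0 (:- con (+ 1) := con (+ 1) :- (con (+ 1) :+ con (+ 1))) refl))

    first₂ : ∀ H → coefs H 0 ≈ 1#
      × coefs H 1 ≈ ιℕ (negatives H) + ιℕ (negatives H) - ιℕ n
      × coefs H 2 ≈ (ιℕ (negatives H) + ιℕ (negatives H)) * (ιℕ (negatives H) - ιℕ n)
    first₂ H = proj₁ F , trans (proj₁ (proj₂ F)) (+-congʳ (+-cong τ τ)) , trans (proj₂ (proj₂ F)) (*-cong (+-cong τ τ) (+-congʳ τ))
      where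
      b : Fin n → Carrier
      b i = ιℕ (sign-flag (exps H i i))
      τ : sumF b ≈ ιℕ (negatives H)
      τ = sum-flags (λ i → sign-flag (exps H i i))
      F : coefs H 0 ≈ 1# × coefs H 1 ≈ sumF b + sumF b - ιℕ n × coefs H 2 ≈ (sumF b + sumF b) * (sumF b - ιℕ n)
      F = first H b (diag-sign H) (λ i → flag-idem (exps H i i))

    module _ (DS : DigitSystem K) where
      open Coding K DS hiding (real-^)
      private module DS = DigitSystem DS

      traceCode : ∀ s → ℋ → Fin (2 ℕ.^ s)
      traceCode s H = _mod_ (negatives H) (2 ℕ.^ s) {{ℕₚ.m^n≢0 2 s}}

      trace-first : ∀ e s ν → DS.Real ν → ι (+ (2 ℕ.^ suc s)) ≈ DS.ϖ ^ e * ν →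
        ∀ H H′ → traceCode s H ≡ traceCode s H′ → ∀ k → k ℕ.< 3 → CongMod e (coefs H k) (coefs H′ k)
      trace-first e s ν Rν 2ˢ H H′ eq k k<3 = go k k<3
        where
        T : CongMod e (ιℕ (negatives H) + ιℕ (negatives H) - ιℕ n) (ιℕ (negatives H′) + ιℕ (negatives H′) - ιℕ n)
          × CongMod e ((ιℕ (negatives H) + ιℕ (negatives H)) * (ιℕ (negatives H) - ιℕ n)) ((ιℕ (negatives H′) + ιℕ (negatives H′)) * (ιℕ (negatives H′) - ιℕ n))
        T = trace-step e s ν Rν 2ˢ {{ℕₚ.m^n≢0 2 s}} n (negatives H) (negatives H′) eq
        transport : ∀ {x x′ y y′} → x ≈ x′ → y ≈ y′ → CongMod e x′ y′ → CongMod e x y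
        transport ex ey (u , R , eq) = u , R , trans (+-cong ex (-‿cong ey)) eq
        go : ∀ k → k ℕ.< 3 → CongMod e (coefs H k) (coefs H′ k)
        go 0 _ = cong-refl e (trans (proj₁ (first₂ H)) (sym (proj₁ (first₂ H′))))
        go 1 _ = transport (proj₁ (proj₂ (first₂ H))) (proj₁ (proj₂ (first₂ H′))) (proj₁ T)
        go 2 _ = transport (proj₂ (proj₂ (first₂ H))) (proj₂ (proj₂ (first₂ H′))) (proj₂ T)
        go (suc (suc (suc k))) (ℕ.s≤s (ℕ.s≤s (ℕ.s≤s ())))

  module OddPrime .{{_ : ℕ.NonZero p}} (μ : Carrier) (Rμ : Real μ) (ep : ιℕ p ≈ ρ * μ)
    (cancel₋₁ : ∀ x → (ζ + 1#) * x ≈ 0# → x ≈ 0#) (h : ℕ) (q-odd : p ℕ.* P ≡ suc (dbl h)) where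
    Z : Cyclotomic K
    Z = cyclotomic μ Rμ ep cancel₋₁
    open CyclotomicTheory K Z using (module Hermitian)
    open Coding K (Cyclotomic.digits Z) using (CongMod; cong-refl; code; code-step)

    private
      -- A diagonal entry -1 would have exponent a with 2a = q, impossible for odd q. With all
      -- diagonal entries 1 the first three coefficients are the same for every H, and one class
      -- suffices for them.
      diag-1 : ∀ H i → ζ ^ exps H i i ≈ 1# - (0# + 0#)
      diag-1 H i = go (exps H i i) (diagonal H i)
        where
        go : ∀ a → a ≡ 0 ⊎ a ℕ.+ a ≡ p ℕ.* P → ζ ^ a ≈ 1# - (0# + 0#)
        go .0 (inj₁ ≡.refl) = solve 0 (con (+ 1) := con (+ 1) :- (con (+ 0) :+ con (+ 0))) refl
        go a (inj₂ eq) = ⊥-elim (dbl≢odd a h (≡.trans (dbl-+ a) (≡.trans eq q-odd)))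

      firstₒ : ∀ H → coefs H 0 ≈ 1# × coefs H 1 ≈ sumF {n} (λ _ → 0#) + sumF {n} (λ _ → 0#) - ιℕ n
        × coefs H 2 ≈ (sumF {n} (λ _ → 0#) + sumF {n} (λ _ → 0#)) * (sumF {n} (λ _ → 0#) - ιℕ n)
      firstₒ H = first H (λ _ → 0#) (diag-1 H) (λ _ → zeroˡ _)

    real-coefs : ∀ H k → Real (coefs H k)
    real-coefs H k = Hermitian.coef-real (exps H) (unitary H) k

    leads : ∀ H i → Σ Carrier (λ b → Real b × coefs H (3 ℕ.+ i) ≈ ρ ^ halfFloor (parity i) * b)
    leads H i = Hermitian.lead (exps H) (unitary H) i

    classify : ∀ e → Classified (p ℕ.^ ((e ℕ.* e ℕ.+ 1) ∸ (2 ℕ.* e))) Real ρ e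
    classify zero = classified-0 _ ρ (ℕₚ.m^n>0 p 1) real-coefs
    classify (suc e) = assemble (λ H H′ k → CongMod (suc e) (coefs H k) (coefs H′ k)) p (λ i → suc e ∸ halfFloor (parity i)) n
      (λ _ → zero {0}) (λ H i → code (suc e ∸ halfFloor (parity i)) (proj₁ (leads H i)) (proj₁ (proj₂ (leads H i))))
      (λ H H′ _ → initial H H′)
      (λ H H′ i _ eq → code-step (suc e) (halfFloor (parity i)) (proj₁ (proj₂ (leads H i))) (proj₁ (proj₂ (leads H′ i)))
        (proj₂ (proj₂ (leads H i))) (proj₂ (proj₂ (leads H′ i))) eq)
      _ (≡.subst (ℕ._≤ _) (≡.sym (ℕₚ.*-identityˡ _)) (ℕₚ.^-monoʳ-≤ p
        (ℕₚ.≤-trans (sumTo-∸ (λ i → halfFloor (parity i)) (λ e → dbl e ∸ 1) count-floor (suc e) n) (bound-floor e))))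
      where
      initial : ∀ H H′ k → k ℕ.< 3 → CongMod (suc e) (coefs H k) (coefs H′ k)
      initial H H′ 0 _ = cong-refl (suc e) (trans (proj₁ (firstₒ H)) (sym (proj₁ (firstₒ H′))))
      initial H H′ 1 _ = cong-refl (suc e) (trans (proj₁ (proj₂ (firstₒ H))) (sym (proj₁ (proj₂ (firstₒ H′)))))
      initial H H′ 2 _ = cong-refl (suc e) (trans (proj₂ (proj₂ (firstₒ H))) (sym (proj₂ (proj₂ (firstₒ H′)))))
      initial H H′ (suc (suc (suc k))) (ℕ.s≤s (ℕ.s≤s (ℕ.s≤s ())))

w≈-1 : ∀ {P} (D : CycloData 2 P) → let open CycloData D in ζ ^ P ≈ - 1#
w≈-1 {P} D = begin
  ζ ^ P                                    ≈⟨ solve 1 (λ w → w := con (+ 1) :+ w :* (con (+ 1) :+ w :* con (+ 0)) :- con (+ 1)) refl (ζ ^ P) ⟩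
  1# + ζ ^ P * (1# + ζ ^ P * 0#) - 1#      ≈⟨ +-congʳ root ⟩
  0# - 1#                                  ≈⟨ +-identityˡ _ ⟩
  - 1#                                     ∎
  where
  open CycloData D
  open Solve K
  open Relation.Binary.Reasoning.Setoid setoid

-- q = 2^(g+2)
module TwoPowerFamily (g q-1 : ℕ) (q≡ : 2 ℕ.* 2 ℕ.^ suc g ≡ suc q-1) (D : CycloData 2 (2 ℕ.^ suc g))
  (cancel₋₁ : ∀ x → CycloData._≈_ D (CycloData._*_ D (CycloData._+_ D (CycloData.ζ D) (CycloData.1# D)) x) (CycloData.0# D) → CycloData._≈_ D x (CycloData.0# D))
  (n : ℕ) where
  open CycloTheory 2 (2 ℕ.^ suc g) q-1 q≡ D
  open Family 2 (2 ℕ.^ suc g) q-1 q≡ D n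
  open Solve K

  i² : ζ ^ (2 ℕ.^ g ℕ.+ 2 ℕ.^ g) ≈ - 1#
  i² = trans (reflexive (≡.cong (ζ ^_) (≡.cong (2 ℕ.^ g ℕ.+_) (≡.sym (ℕₚ.+-identityʳ (2 ℕ.^ g)))))) (w≈-1 D)

  two : cheb (2 ℕ.^ g) ≈ 1# + 1#
  two = two-cheb (2 ℕ.^ g) i²

  ram : RealMultiple ρ (1# + 1#)
  ram = two-ramified g two

  Z : Cyclotomic K
  Z = cyclotomic (proj₁ ram) (proj₁ (proj₂ ram)) (proj₂ (proj₂ ram)) cancel₋₁
  open CyclotomicTheory K Z using (module Hermitian)
  open Coding K (Cyclotomic.digits Z) using (CongMod; cong-refl; code; code-step)
  module TP = TwoPower K Z (proj₁ ram) (proj₂ (proj₂ ram))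

  real-coefs : ∀ H k → Real (coefs H k)
  real-coefs H k = Hermitian.coef-real (exps H) (unitary H) k

  module _ (e s : ℕ) (le : suc e ℕ.≤ suc s ℕ.* 2 ℕ.^ g) where
    private
      pw : RealMultiple (ρ ^ suc e) (ι (+ (2 ℕ.^ suc s)))
      pw = two-power g two (suc e) (suc s) le

      firsts : ∀ H H′ → traceCode (w≈-1 D) ≡.refl (Cyclotomic.digits Z) s H ≡ traceCode (w≈-1 D) ≡.refl (Cyclotomic.digits Z) s H′ →
        ∀ k → k ℕ.< 3 → CongMod (suc e) (coefs H k) (coefs H′ k)
      firsts = trace-first (w≈-1 D) ≡.refl (Cyclotomic.digits Z) (suc e) s (proj₁ pw) (proj₁ (proj₂ pw)) (proj₂ (proj₂ pw))

    classify-even′ : ∀ r → n ≡ dbl r → Classified (2 ℕ.^ ((suc e ℕ.* suc e ℕ.+ 2 ℕ.+ suc s) ∸ (3 ℕ.* suc e ℕ.+ 1))) Real ρ (suc e)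
    classify-even′ r n≡ = assemble (λ H H′ k → CongMod (suc e) (coefs H k) (coefs H′ k)) 2 (λ i → suc e ∸ halfCeil (parity i)) n
      (traceCode (w≈-1 D) ≡.refl (Cyclotomic.digits Z) s) (λ H i → code (suc e ∸ halfCeil (parity i)) (proj₁ (leads H i)) (proj₁ (proj₂ (leads H i))))
      firsts
      (λ H H′ i _ eq → code-step (suc e) (halfCeil (parity i)) (proj₁ (proj₂ (leads H i))) (proj₁ (proj₂ (leads H′ i)))
        (proj₂ (proj₂ (leads H i))) (proj₂ (proj₂ (leads H′ i))) eq)
      _ (pow-bound s (ℕₚ.≤-trans (ℕₚ.+-monoʳ-≤ s (sumTo-∸ (λ i → halfCeil (parity i)) (λ e → dbl e ∸ 2) count-ceil (suc e) n)) (bound-ceil e s)))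
      where
      leads : ∀ H i → Σ Carrier (λ b → Real b × coefs H (3 ℕ.+ i) ≈ ρ ^ halfCeil (parity i) * b)
      leads H i = TP.Herm₂.lead-ceil (exps H) (unitary H) r n≡ i

    classify-odd′ : ∀ r → n ≡ suc (dbl r) → Classified (2 ℕ.^ ((suc e ℕ.* suc e ℕ.+ 1 ℕ.+ suc s) ∸ (2 ℕ.* suc e ℕ.+ 1 ℕ.+ suc e / 4))) Real ρ (suc e)
    classify-odd′ r n≡ = assemble (λ H H′ k → CongMod (suc e) (coefs H k) (coefs H′ k)) 2 (λ i → suc e ∸ halfSaved (parity i)) n
      (traceCode (w≈-1 D) ≡.refl (Cyclotomic.digits Z) s) (λ H i → TP.κ-saved (suc e) (profile H) i)
      firsts
      (λ H H′ i early eq → TP.step-saved (suc e) (profile H) (profile H′) i early eq)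
      _ (pow-bound s (ℕₚ.≤-trans (ℕₚ.+-monoʳ-≤ s (sumTo-∸ (λ i → halfSaved (parity i)) c-saved count-saved (suc e) n)) (bound-saved e s)))
      where
      P : ℕ
      P = 2 ℕ.^ suc g
      two* : ∀ x → 2 ℕ.* x ≡ dbl x
      two* x = ≡.trans (≡.cong (x ℕ.+_) (ℕₚ.+-identityʳ x)) (≡.sym (dbl-+ x))
      ev : ∀ H i j → ∃ (λ z → exps H i j ℕ.+ exps H j i ≡ dbl z)
      ev H i j = go (proj₂ H i j)
        where
        go : ∀ {m} → (2 ℕ.* P) ∣ m → ∃ (λ z → m ≡ dbl z)
        go (divides k eq) = k ℕ.* P , ≡.trans eq (≡.trans (≡.sym (ℕₚ.*-assoc k 2 P)) (≡.trans (≡.cong (ℕ._* P) (ℕₚ.*-comm k 2)) (≡.trans (ℕₚ.*-assoc 2 k P) (two* (k ℕ.* P)))))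
      -- A diagonal exponent is 0 or q/2, and q/2 is even because 4 divides q.
      ed : ∀ H i → ∃ (λ z → exps H i i ≡ dbl z)
      ed H i = go (exps H i i) (diagonal H i)
        where
        go : ∀ a → a ≡ 0 ⊎ a ℕ.+ a ≡ 2 ℕ.* P → ∃ (λ z → a ≡ dbl z)
        go .0 (inj₁ ≡.refl) = 0 , ≡.refl
        go a (inj₂ eq) = 2 ℕ.^ g , ≡.trans (dbl-injective a P (≡.trans (dbl-+ a) (≡.trans eq (two* P)))) (two* (2 ℕ.^ g))
      profile : ℋ → TP.Profile
      profile H = record
        { co = coefs H ; g = O.g ; b = O.b ; g-real = O.g-real ; b-real = O.b-real ; g-eq = O.g-eq ; b-eq = O.b-eq
        ; g0 = g0 ; rel = O.relation (ev H) (ed H) }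
        where
        module O = TP.Herm₂.OddOrder (exps H) (unitary H) r n≡
        open ModPi K ζ using (module F; module FR)
        τ x : Carrier
        τ = ιℕ (negatives H)
        x = τ + τ - ιℕ n
        n~1 : ιℕ n F.~ 1#
        n~1 = FR.trans {ιℕ n} {Cast.ιℕ F.Quot n} {1#} (hom-ιℕ F.quot n)
          (≡.subst (λ m → Cast.ιℕ F.Quot m F.~ 1#) (≡.sym n≡) (CharTwo.ιℕ-odd F.Quot TP.twoF r))
        -- a₁ = 2t - n is odd for odd n. This makes g₀ the unit by which the relation is solved for
        -- the saved digit.
        g0 : coefs H 1 F.~ 1#
        g0 = FR.trans {coefs H 1} {x} {1#} (F.≈⇒~ (proj₁ (proj₂ (first₂ (w≈-1 D) ≡.refl H))))
          (FR.trans {x} {0# - 1#} {1#}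
            (FR.+-cong {τ + τ} {0#} { - ιℕ n} { - 1#}
              (FR.trans {τ + τ} {(1# + 1#) * τ} {0#} (F.≈⇒~ (solve 1 (λ x → x :+ x := (con (+ 1) :+ con (+ 1)) :* x) refl τ))
                (FR.trans {(1# + 1#) * τ} {0# * τ} {0#} (FR.*-cong {1# + 1#} {0#} {τ} {τ} TP.twoF (FR.refl {τ})) (FR.zeroˡ τ)))
              (FR.-‿cong {ιℕ n} {1#} n~1))
            (FR.trans {0# - 1#} { - 1#} {1#} (FR.+-identityˡ (- 1#)) (CharTwo.neg-id F.Quot TP.twoF 1#)))

  classify-even : ∀ r → n ≡ dbl r → ∀ e → Classified (2 ℕ.^ ((e ℕ.* e ℕ.+ 2 ℕ.+ ceilDiv e (2 ℕ.^ g)) ∸ (3 ℕ.* e ℕ.+ 1))) Real ρ e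
  classify-even r n≡ zero = classified-0 _ ρ (ℕₚ.m^n>0 2 ((0 ℕ.+ 2 ℕ.+ ceilDiv 0 (2 ℕ.^ g)) ∸ 1)) real-coefs
  classify-even r n≡ (suc e) = ≡.subst (λ s → Classified (2 ℕ.^ ((suc e ℕ.* suc e ℕ.+ 2 ℕ.+ s) ∸ (3 ℕ.* suc e ℕ.+ 1))) Real ρ (suc e))
    (≡.sym s≡) (classify-even′ e (proj₁ C) (proj₂ (proj₂ C)) r n≡)
    where
    C : ∃ (λ s → ceilDiv (suc e) (2 ℕ.^ g) ≡ suc s × suc e ℕ.≤ suc s ℕ.* 2 ℕ.^ g)
    C = ceilDiv-spec e (2 ℕ.^ g) {{ℕₚ.m^n≢0 2 g}}
    s≡ : ceilDiv (suc e) (2 ℕ.^ g) ≡ suc (proj₁ C)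
    s≡ = proj₁ (proj₂ C)

  classify-odd : ∀ r → n ≡ suc (dbl r) → ∀ e → Classified (2 ℕ.^ ((e ℕ.* e ℕ.+ 1 ℕ.+ ceilDiv e (2 ℕ.^ g)) ∸ (2 ℕ.* e ℕ.+ 1 ℕ.+ e / 4))) Real ρ e
  classify-odd r n≡ zero = classified-0 _ ρ (ℕₚ.m^n>0 2 ((0 ℕ.+ 1 ℕ.+ ceilDiv 0 (2 ℕ.^ g)) ∸ (0 ℕ.+ 1 ℕ.+ 0 / 4))) real-coefs
  classify-odd r n≡ (suc e) = ≡.subst (λ s → Classified (2 ℕ.^ ((suc e ℕ.* suc e ℕ.+ 1 ℕ.+ s) ∸ (2 ℕ.* suc e ℕ.+ 1 ℕ.+ suc e / 4))) Real ρ (suc e))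
    (≡.sym s≡) (classify-odd′ e (proj₁ C) (proj₂ (proj₂ C)) r n≡)
    where
    C : ∃ (λ s → ceilDiv (suc e) (2 ℕ.^ g) ≡ suc s × suc e ℕ.≤ suc s ℕ.* 2 ℕ.^ g)
    C = ceilDiv-spec e (2 ℕ.^ g) {{ℕₚ.m^n≢0 2 g}}
    s≡ : ceilDiv (suc e) (2 ℕ.^ g) ≡ suc (proj₁ C)
    s≡ = proj₁ (proj₂ C)

-- q = 2, where every element of the ring is real and the prime is 1 - ζ = 2.
module SignFamily (D : CycloData 2 1) (n : ℕ) where
  open CycloTheory 2 1 1 ≡.refl D
  open Family 2 1 1 ≡.refl D n
  open Relation.Binary.Reasoning.Setoid setoid
  open Solve K
  open ModPi K ζ using (module F; module FR)

  ζ≈-1 : ζ ≈ - 1#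
  ζ≈-1 = trans (sym (*-identityʳ ζ)) (w≈-1 D)

  π≈2 : 1# - ζ ≈ ι (+ 2)
  π≈2 = trans (+-congˡ (-‿cong ζ≈-1)) (solve 0 (con (+ 1) :- :- con (+ 1) := con (+ 2)) refl)

  integer : ∀ g → ∃ (λ c → Eval.ev K ζ g ≈ ι c)
  integer g = Eval.ev ℤᶜ (ℤ.- + 1) g , trans (Eval.ev-resp K g (trans ζ≈-1 (solve 0 (:- con (+ 1) := con (ℤ.- + 1)) refl))) (sym (hom-ev (ιʰ K) (ℤ.- + 1) g))

  all-integer : ∀ x → ∃ (λ c → x ≈ ι c)
  all-integer x = proj₁ (integer (proj₁ (surjective x))) , trans (proj₂ (surjective x)) (trans (hom-eval θ (proj₁ (surjective x))) (proj₂ (integer (proj₁ (surjective x)))))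

  all-real : ∀ x → Real x
  all-real x = real-resp (sym (proj₂ (all-integer x))) (real-ι (proj₁ (all-integer x)))

  DS : DigitSystem K
  DS = record
    { p = 2 ; ϖ = ι (+ 2) ; Real = Real ; real-resp = real-resp ; real-+ = real-+ ; real-* = real-* ; real-ι = real-ι ; real-ϖ = real-ι (+ 2)
    ; digit = λ r R → reduce-digit (ι (+ 2)) 1# (real-ι (+ 1)) (sym (*-identityʳ _)) (proj₁ (all-integer r)) 0# r (real-ι (+ 0))
        (trans (proj₂ (all-integer r)) (solve 2 (λ x w → x := x :+ w :* con (+ 0)) refl _ (ι (+ 2)))) }
  open Coding K DS using (CongMod; code; code-step)

  twoF : (1# + 1#) F.~ 0#
  twoF = 1# , trans (solve 0 (con (+ 1) :+ con (+ 1) :- con (+ 0) := con (+ 2)) refl) (trans (sym π≈2) (sym (*-identityˡ _)))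

  exps-sym : ∀ H i j → exps H j i ≡ exps H i j
  exps-sym H i j = go (proj₁ H j i) (proj₁ H i j) (proj₂ H j i)
    where
    go : ∀ (x y : Fin 2) → 2 ∣ (toℕ x ℕ.+ toℕ y) → toℕ x ≡ toℕ y
    go zero zero _ = ≡.refl
    go (suc zero) (suc zero) _ = ≡.refl
    go zero (suc zero) (divides zero ())
    go zero (suc zero) (divides (suc k) ())
    go (suc zero) zero (divides zero ())
    go (suc zero) zero (divides (suc k) ())

  module _ (H : ℋ) where
    open UnitEntries K ζ (exps H)
    open Charpoly K using (c; e)
    private
      module CF = CharTwo F.Quot
      A-sym : ∀ i j → A j i F.~ (1# * A i j)
      A-sym i j = FR.trans {A j i} {A i j} {1# * A i j} (F.≈⇒~ (reflexive (≡.cong (λ m → geom m ζ) (exps-sym H i j)))) (FR.sym {1# * A i j} {A i j} (FR.*-identityˡ (A i j)))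

    Lead₂ : ℕ → ℕ → Set
    Lead₂ u k = Σ Carrier (λ b → coefs H k ≈ ι (+ 2) ^ u * b)

    plain : ∀ k → Lead₂ k (suc k)
    plain k = π * c n A (suc k) - e n A k , trans (coef-expand k) (*-congʳ (^-cong k π≈2))

    -- π equals 2 here, so the vanishing modulo π of the derivative along J yields one full extra
    -- factor 2.
    improved : ∀ k → e n A k F.~ 0# → Lead₂ (suc k) (suc k)
    improved k (z , eq) = c n A (suc k) - z , (begin
      coefs H (suc k)                          ≈⟨ coef-expand k ⟩
      π ^ k * (π * c n A (suc k) - e n A k)    ≈⟨ *-congˡ (+-congˡ (-‿cong (trans (solve 1 (λ x → x := x :- con (+ 0)) refl _) eq))) ⟩
      π ^ k * (π * c n A (suc k) - z * π)      ≈⟨ solve 4 (λ q p x z → q :* (p :* x :- z :* p) := p :* q :* (x :- z)) refl (π ^ k) π (c n A (suc k)) z ⟩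
      π ^ suc k * (c n A (suc k) - z)          ≈⟨ *-congʳ (^-cong (suc k) π≈2) ⟩
      ι (+ 2) ^ suc k * (c n A (suc k) - z)    ∎)

    e~ : ∀ k → e n A k F.~ Charpoly.e F.Quot n A k
    e~ k = hom-e F.quot n A k

    lead-even-order : ∀ r → n ≡ dbl r → ∀ i → Lead₂ (valEven (parity i)) (3 ℕ.+ i)
    lead-even-order r n≡ i = go (parity i)
      where
      go : ∀ {i} (Q : Parity i) → Lead₂ (valEven Q) (3 ℕ.+ i)
      go (even m) = improved (dbl (suc m)) (FR.trans {e n A (dbl (suc m))} {Charpoly.e F.Quot n A (dbl (suc m))} {0#} (e~ (dbl (suc m)))
        (CF.e-even-even twoF 1# (FR.*-identityˡ 1#) A A-sym r n≡ (suc m)))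
      go (odd m) = plain (3 ℕ.+ dbl m)

    lead-odd-order : ∀ r → n ≡ suc (dbl r) → ∀ i → Lead₂ (valOdd (parity i)) (3 ℕ.+ i)
    lead-odd-order r n≡ i = go (parity i)
      where
      go : ∀ {i} (Q : Parity i) → Lead₂ (valOdd Q) (3 ℕ.+ i)
      go (even m) = plain (2 ℕ.+ dbl m)
      go (odd m) = improved k (FR.trans {e n A k} {Charpoly.e F.Quot n A k} {0#} (e~ k)
        (FR.trans {Charpoly.e F.Quot n A k} {(1# + 1#) * Charpoly.d F.Quot n A k} {0#} (CF.e-odd-odd twoF 1# (FR.*-identityˡ 1#) A A-sym r n≡ (suc m))
          (FR.trans {(1# + 1#) * Charpoly.d F.Quot n A k} {0# * Charpoly.d F.Quot n A k} {0#} (FR.*-cong {1# + 1#} {0#} {Charpoly.d F.Quot n A k} {Charpoly.d F.Quot n A k} twoF (FR.refl {Charpoly.d F.Quot n A k})) (FR.zeroˡ (Charpoly.d F.Quot n A k)))))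
        where
        k : ℕ
        k = suc (dbl (suc m))

  module _ (e : ℕ) where
    private
      two-pow : ∀ s → ι (+ (2 ℕ.^ s)) ≈ ι (+ 2) ^ s * 1#
      two-pow zero = sym (*-identityʳ _)
      two-pow (suc s) = trans (ιℕ-* 2 (2 ℕ.^ s)) (trans (*-congˡ (two-pow s)) (sym (*-assoc _ _ _)))

    classify-by : (u c : ℕ → ℕ) → (∀ e i → u i ℕ.≤ e → i ℕ.< c e) → (∀ H i → Lead₂ H (u i) (3 ℕ.+ i)) →
      ∀ k → e ℕ.+ sumTo c (suc e) ℕ.≤ k → Classified (2 ℕ.^ k) Real (ι (+ 2)) (suc e)
    classify-by u c count leads k le = assemble (λ H H′ k → CongMod (suc e) (coefs H k) (coefs H′ k)) 2 (λ i → suc e ∸ u i) n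
      (traceCode (w≈-1 D) ≡.refl DS e) (λ H i → code (suc e ∸ u i) (proj₁ (leads H i)) (all-real _))
      (trace-first (w≈-1 D) ≡.refl DS (suc e) e 1# (real-ι (+ 1)) (two-pow (suc e)))
      (λ H H′ i _ eq → code-step (suc e) (u i) (all-real _) (all-real _) (proj₂ (leads H i)) (proj₂ (leads H′ i)) eq)
      _ (pow-bound e (ℕₚ.≤-trans (ℕₚ.+-monoʳ-≤ e (sumTo-∸ u c count (suc e) n)) le))

  classify-even : ∀ r → n ≡ dbl r → ∀ e → Classified (2 ℕ.^ ((⌊ e ℕ.* e /2⌋ ℕ.+ 1) ∸ e)) Real (ι (+ 2)) e
  classify-even r n≡ zero = classified-0 _ (ι (+ 2)) (ℕₚ.m^n>0 2 1) (λ H k → all-real _)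
  classify-even r n≡ (suc e) = classify-by e (λ i → valEven (parity i)) cEven count-even (λ H → lead-even-order H r n≡) _ (bound-even e)

  classify-odd : ∀ r → n ≡ suc (dbl r) → ∀ e → Classified (2 ℕ.^ ((⌈ e ℕ.* e /2⌉ ℕ.+ 1) ∸ e)) Real (ι (+ 2)) e
  classify-odd r n≡ zero = classified-0 _ (ι (+ 2)) (ℕₚ.m^n>0 2 1) (λ H k → all-real _)
  classify-odd r n≡ (suc e) = classify-by e (λ i → valOdd (parity i)) cOdd count-odd (λ H → lead-odd-order H r n≡) _ (bound-odd e)

-- The ring ℤ[y]/(Φ) and the return to the statement

module Concrete (p f : ℕ) .{{nz : ℕ.NonZero p}} where
  P : ℕ
  P = p ℕ.^ f

  Φ : List ℤ
  Φ = cyclo p (suc f)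

  module Q = Quotient ℤY Φ
  K : CR
  K = Q.Quot
  module K = CommutativeRing K
  module EK = Eval K
  module EZ = Eval ℤᶜ
  module GZ = Geometric ℤᶜ
  module PZ = Pow ℤᶜ

  Φ-at : ∀ r → EZ.ev r Φ ≡ GZ.geom p (r PZ.^ P)
  Φ-at r = ≡.trans (hom-cyclo (EZ.evalʰ r) p (suc f)) (≡.cong (λ z → GZ.geom p (z PZ.^ P)) (EZ.ev-y r))

  Φ-at-1 : EZ.ev (+ 1) Φ ≡ + p
  Φ-at-1 = ≡.trans (Φ-at (+ 1)) (≡.trans (≡.cong (GZ.geom p) (PZ.1^ P)) (geom-1 p))
    where
    geom-1 : ∀ n → GZ.geom n (+ 1) ≡ + n
    geom-1 zero = ≡.refl
    geom-1 (suc n) = ≡.cong (λ z → + 1 ℤ.+ z) (≡.trans (ℤₚ.*-identityˡ _) (geom-1 n))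

  Φ-zero : Φ Q.~ []
  Φ-zero = Y.1# , Y.trans {Φ Y.- []} {Φ} {Y.1# Y.* Φ} (Identities.minus-zero ℤY Φ) (Y.sym {Y.1# Y.* Φ} {Φ} (Y.*-identityˡ Φ))

  Φ-1≢0 : EZ.ev (+ 1) Φ ≢ + 0
  Φ-1≢0 e = ℕ.≢-nonZero⁻¹ p (ℤₚ.+-injective (≡.trans (≡.sym Φ-at-1) e))

  opaque
    -- Evaluate at y = 1: this kills 1 - y, fixes the integer i and sends Φ to p.
    residue : ∀ i w → Cast.ι K i Q.~ ((Y.1# Y.- y) Y.* w) → p ∣ ∣ i ∣
    residue i w (c , eq) = divides ∣ EZ.ev (+ 1) c ∣ (≡.trans (≡.cong ∣_∣ i≡) (ℤₚ.abs-* (EZ.ev (+ 1) c) (+ p)))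
      where
      module E = Hom (EZ.evalʰ (+ 1))
      open ≡.≡-Reasoning
      x : List ℤ
      x = (Y.1# Y.- y) Y.* w
      x-at : EZ.ev (+ 1) x ≡ + 0
      x-at = ≡.trans (E.*-hom (Y.1# Y.- y) w) (ℤₚ.*-zeroˡ (EZ.ev (+ 1) w))
      ι-same : ∀ i → Cast.ι K i ≡ Cast.ι ℤY i
      ι-same (+ n) = nat n
        where
        nat : ∀ n → Cast.ιℕ K n ≡ Cast.ιℕ ℤY n
        nat 0 = ≡.refl
        nat 1 = ≡.refl
        nat (suc (suc n)) = ≡.cong (Y.1# Y.+_) (nat (suc n))
      ι-same -[1+ n ] = ≡.cong Y.-_ (ι-same (+ suc n))
      i≡ : i ≡ EZ.ev (+ 1) c ℤ.* + p
      i≡ = begin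
        i                                             ≡⟨ ι-id i ⟨
        Cast.ι ℤᶜ i                                   ≡⟨ hom-ι (EZ.evalʰ (+ 1)) i ⟨
        EZ.ev (+ 1) (Cast.ι ℤY i)                     ≡⟨ ≡.cong (EZ.ev (+ 1)) (ι-same i) ⟨
        EZ.ev (+ 1) (Cast.ι K i)                      ≡⟨ ℤₚ.+-identityʳ _ ⟨
        EZ.ev (+ 1) (Cast.ι K i) ℤ.- + 0              ≡⟨ ≡.cong (λ z → EZ.ev (+ 1) (Cast.ι K i) ℤ.- z) x-at ⟨
        EZ.ev (+ 1) (Cast.ι K i) ℤ.- EZ.ev (+ 1) x    ≡⟨ E.sub-hom (Cast.ι K i) x ⟨
        EZ.ev (+ 1) (Cast.ι K i Y.- x)                ≡⟨ E.≈-cong {Cast.ι K i Y.- x} {c Y.* Φ} eq ⟩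
        EZ.ev (+ 1) (c Y.* Φ)                         ≡⟨ E.*-hom c Φ ⟩
        EZ.ev (+ 1) c ℤ.* EZ.ev (+ 1) Φ               ≡⟨ ≡.cong (EZ.ev (+ 1) c ℤ.*_) Φ-at-1 ⟩
        EZ.ev (+ 1) c ℤ.* + p                         ∎

    extend : ∀ s → Geometric.geom K p (Pow._^_ K s P) K.≈ K.0# → Σ (Hom K K) (λ h → Hom.to h y K.≈ s)
    extend s e = Q.lift-hom (EK.evalʰ s) vanish , EK.ev-y s
      where
      vanish : EK.ev s Φ K.≈ K.0#
      vanish = K.trans {EK.ev s Φ} {G (Pow._^_ K (EK.ev s y) P)} {K.0#} (hom-cyclo (EK.evalʰ s) p (suc f))
        (K.trans {G (Pow._^_ K (EK.ev s y) P)} {G (Pow._^_ K s P)} {K.0#} (Geometric.geom-cong K p (Pow.^-cong K P (EK.ev-y s))) e)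
        where
        G : List ℤ → List ℤ
        G = Geometric.geom K p

    root : Geometric.geom K p (Pow._^_ K y P) K.≈ K.0#
    root = K.trans {Geometric.geom K p (Pow._^_ K y P)} {Φ} {K.0#} (K.sym {Φ} {Geometric.geom K p (Pow._^_ K y P)} (hom-cyclo Q.quot p (suc f))) Φ-zero

    cancel₁ : ∀ x → ((y K.- K.1#) K.* x) K.≈ K.0# → x K.≈ K.0#
    cancel₁ = RootCancel.cancel Φ (+ 1) ≡.refl Φ-1≢0

    cancel₋₁ : EZ.ev (ℤ.- + 1) Φ ≢ + 0 → ∀ x → ((y K.+ K.1#) K.* x) K.≈ K.0# → x K.≈ K.0#
    cancel₋₁ = RootCancel.cancel Φ (ℤ.- + 1) ≡.refl

  data′ : CycloData p P
  data′ = record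
    { K = K ; θ = Q.quot
    ; surjective = λ x → x , K.refl {x}
    ; root = root ; extend = extend ; cancel₁ = cancel₁ ; residue = residue }

  Kʳ : RawHom ℤy K
  Kʳ = record
    { to = λ x → x ; to-0 = K.refl {[]} ; to-1 = K.refl {K.1#} ; to-add = λ x z → K.refl {x K.+ z}
    ; to-mul = λ x z → K.refl {x K.* z} ; to-neg = λ x → K.refl {K.- x} }

  q q-1 : ℕ
  q = p ℕ.* P
  q-1 = q ∸ 1

  opaque
    q≡ : q ≡ suc q-1
    q≡ = go q (ℕₚ.m*n≢0 p P {{nz}} {{ℕₚ.m^n≢0 p f}})
      where
      go : ∀ q → ℕ.NonZero q → q ≡ suc (q ∸ 1)
      go (suc q) _ = ≡.refl

  module _ (n : ℕ) where
    open Family p P q-1 q≡ data′ n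
    open PowerSeries K using (Series; lin; lin-cong; _≈ˢ_; +ˢ-at; -ˢ-at)
    open Charpoly K using (pencil; pencil-reverse; pencil-degree; module Sᴹ)
    open Det′ K using (idMat)
    private
      module H = RawHom (polyHom Kʳ)

      h : ℋ → Fin n → Fin n → List ℤ
      h = λ H → UnitEntries.h K y (exps H)

      entry : ∀ H i j → H.to (P.subP ℤy (if ⌊ i Fin.≟ j ⌋ then xˣ 1 else []) (yʸ (exps H i j) ∷ [])) ≈ˢ lin (K.- h H i j) (idMat n i j)
      entry H i j k = K.trans {coeffx (δ K′- E) k} {coeffx δ k K.+ K.- coeffx E k} {lin (K.- h H i j) (idMat n i j) k}
        (K.trans {coeffx (δ K′- E) k} {(H.to δ S.+ H.to (P.negP ℤy E)) k} {coeffx δ k K.+ K.- coeffx E k} (H.to-add δ (P.negP ℤy E) k)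
          (K.trans {(H.to δ S.+ H.to (P.negP ℤy E)) k} {coeffx δ k K.+ coeffx (P.negP ℤy E) k} {coeffx δ k K.+ K.- coeffx E k} (K.reflexive (+ˢ-at (H.to δ) (H.to (P.negP ℤy E)) k))
            (K.+-cong {coeffx δ k} {coeffx δ k} {coeffx (P.negP ℤy E) k} {K.- coeffx E k} (K.refl {coeffx δ k})
              (K.trans {coeffx (P.negP ℤy E) k} {(S.- H.to E) k} {K.- coeffx E k} (H.to-neg E k) (K.reflexive (-ˢ-at (H.to E) k))))))
        (at k)
        where
        module S = CommutativeRing (PowerSeries.PS K)
        δ E : List (List ℤ)
        δ = if ⌊ i Fin.≟ j ⌋ then xˣ 1 else []
        E = yʸ (exps H i j) ∷ []
        _K′-_ : List (List ℤ) → List (List ℤ) → List (List ℤ)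
        _K′-_ = P.subP ℤy
        δ-1 : ∀ n (i j : Fin n) → coeffx (if ⌊ i Fin.≟ j ⌋ then xˣ 1 else []) 1 ≡ Det′.idMat K n i j
        δ-1 (suc n) zero zero = ≡.refl
        δ-1 (suc n) zero (suc j) = ≡.refl
        δ-1 (suc n) (suc i) zero = ≡.refl
        δ-1 (suc n) (suc i) (suc j) with i Fin.≟ j | δ-1 n i j
        ... | yes _ | e = e
        ... | no _ | e = e
        δ-0 : ∀ k → k ≢ 1 → coeffx δ k ≡ []
        δ-0 k k≢1 with i Fin.≟ j
        δ-0 zero k≢1 | yes _ = ≡.refl
        δ-0 (suc zero) k≢1 | yes _ = ⊥-elim (k≢1 ≡.refl)
        δ-0 (suc (suc k)) k≢1 | yes _ = ≡.refl
        δ-0 k k≢1 | no _ = ≡.refl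
        at : ∀ k → (coeffx δ k K.+ K.- coeffx E k) K.≈ lin (K.- h H i j) (idMat n i j) k
        at zero = K.trans {coeffx δ 0 K.+ K.- yʸ (exps H i j)} {K.0# K.+ K.- h H i j} {K.- h H i j}
          (K.+-cong {coeffx δ 0} {K.0#} {K.- yʸ (exps H i j)} {K.- h H i j} (K.reflexive (δ-0 0 (λ ())))
            (K.-‿cong {yʸ (exps H i j)} {h H i j} (hom-mono Q.quot (exps H i j)))) (K.+-identityˡ (K.- h H i j))
        at (suc zero) = K.trans {coeffx δ 1 K.+ []} {coeffx δ 1} {idMat n i j} (K.+-identityʳ (coeffx δ 1)) (K.reflexive (δ-1 n i j))
        at (suc (suc k)) = K.trans {coeffx δ (suc (suc k)) K.+ []} {coeffx δ (suc (suc k))} {[]} (K.+-identityʳ (coeffx δ (suc (suc k)))) (K.reflexive (δ-0 (suc (suc k)) (λ ())))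

      B : ℋ → Fin n → Fin n → List ℤ
      B H i j = K.- h H i j

      charPoly-pencil : ∀ H j → coeffx (charPoly q n H) j K.≈ Sᴹ.det n (pencil n (B H) (idMat n)) j
      charPoly-pencil H j = K.trans {coeffx (charPoly q n H) j} {Sᴹ.det n (λ i j → H.to (M i j)) j} {Sᴹ.det n (pencil n (B H) (idMat n)) j}
        (raw-det (polyHom Kʳ) n M j) (Sᴹ.det-cong n (entry H) j)
        where
        M : Fin n → Fin n → List (List ℤ)
        M i j = P.subP ℤy (if ⌊ i Fin.≟ j ⌋ then xˣ 1 else []) (yʸ (exps H i j) ∷ [])

    charPoly-low : ∀ H j → j ℕ.≤ n → coeffx (charPoly q n H) j K.≈ coefs H (n ∸ j)
    charPoly-low H j j≤n = K.trans {coeffx (charPoly q n H) j} {Sᴹ.det n (pencil n (B H) (idMat n)) j} {coefs H (n ∸ j)} (charPoly-pencil H j)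
      (pencil-reverse n (idMat n) (B H) j (n ∸ j) (ℕₚ.m+[n∸m]≡n j≤n))

    charPoly-high : ∀ H j → n ℕ.< j → coeffx (charPoly q n H) j K.≈ K.0#
    charPoly-high H j n<j = K.trans {coeffx (charPoly q n H) j} {Sᴹ.det n (pencil n (B H) (idMat n)) j} {K.0#} (charPoly-pencil H j)
      (pencil-degree n (B H) (idMat n) j n<j)

    open CycloTheory p P q-1 q≡ data′ using (Real; t)

    T : List ℤ
    T = yʸ 1 +y yʸ (q ∸ 1)

    t≈T : t K.≈ T
    t≈T = K.+-cong {y} {y} {Pow._^_ K y q-1} {yʸ (q ∸ 1)} (K.refl {y}) (K.sym {yʸ (q ∸ 1)} {Pow._^_ K y q-1} (hom-mono Q.quot (q ∸ 1)))

    -- The coefficient of x^j is a_(n-j) for j at most n; beyond the degree both polynomials have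
    -- coefficient 0 and g = 0 serves. Reality of the cofactor is exactly the demand that the
    -- quotient be a polynomial in ζ + ζ⁻¹.
    toXCardLe : ∀ e N ϖ → modulus q e K.≈ (Pow._^_ K ϖ e) → Classified N Real ϖ e → XCardLe p (suc f) n e N
    toXCardLe e N ϖ modulus≈ (cls , sound) = cls , λ H H′ eq j → congr H H′ (sound H H′ eq) j
      where
      congr : ∀ H H′ → (∀ k → k ℕ.< 3 ℕ.+ n → Σ (List ℤ) (λ u → Real u × ((coefs H k K.- coefs H′ k) K.≈ (Pow._^_ K ϖ e K.* u)))) →
        Congr p (suc f) e (charPoly q n H) (charPoly q n H′)
      congr H H′ cg j = decide (j ℕ.≤? n)
        where
        x x′ : List ℤ
        x = coeffx (charPoly q n H) j
        x′ = coeffx (charPoly q n H′) j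
        Goal : Set
        Goal = Σ (List ℤ) (λ g → EqMod Φ (x -y x′) (modulus q e *y composey g T))
        low : j ℕ.≤ n → Goal
        low j≤n = g , K.trans {x K.- x′} {a K.- a′} {modulus q e K.* composey g T}
          (K.+-cong {x} {a} {K.- x′} {K.- a′} (charPoly-low H j j≤n) (K.-‿cong {x′} {a′} (charPoly-low H′ j j≤n)))
          (K.trans {a K.- a′} {Pow._^_ K ϖ e K.* u} {modulus q e K.* composey g T} (proj₂ (proj₂ C))
            (K.*-cong {Pow._^_ K ϖ e} {modulus q e} {u} {composey g T} (K.sym {modulus q e} {Pow._^_ K ϖ e} modulus≈)
              (K.trans {u} {EK.ev t g} {composey g T} (proj₂ (proj₁ (proj₂ C)))
                (K.trans {EK.ev t g} {EK.ev T g} {composey g T} (EK.ev-resp {t} {T} g t≈T) (K.sym {composey g T} {EK.ev T g} (hom-compose Q.quot g T))))))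
          where
          C : Σ (List ℤ) (λ u → Real u × ((coefs H (n ∸ j) K.- coefs H′ (n ∸ j)) K.≈ (Pow._^_ K ϖ e K.* u)))
          C = cg (n ∸ j) (ℕₚ.≤-trans (ℕ.s≤s (ℕₚ.m∸n≤m n j)) (ℕₚ.m≤n+m (suc n) 2))
          g u a a′ : List ℤ
          u = proj₁ C
          g = proj₁ (proj₁ (proj₂ C))
          a = coefs H (n ∸ j)
          a′ = coefs H′ (n ∸ j)
        high : n ℕ.< j → Goal
        high n<j = [] , K.trans {x K.- x′} {K.0# K.- K.0#} {modulus q e K.* []}
          (K.+-cong {x} {K.0#} {K.- x′} {K.- K.0#} (charPoly-high H j n<j) (K.-‿cong {x′} {K.0#} (charPoly-high H′ j n<j)))
          (K.trans {K.0# K.- K.0#} {K.0#} {modulus q e K.* []} (K.-‿inverseʳ K.0#) (K.sym {modulus q e K.* []} {K.0#} (K.zeroʳ (modulus q e))))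
        decide : Dec (j ℕ.≤ n) → Goal
        decide (yes j≤n) = low j≤n
        decide (no j≰n) = high (ℕₚ.≰⇒> j≰n)

    open CycloTheory p P q-1 q≡ data′ using (ρ; ζ̄)

    modulus-ρ : q ≢ 2 → ∀ e → modulus q e K.≈ (Pow._^_ K ρ e)
    modulus-ρ q≢2 e = K.trans {modulus q e} {ρy q ^y e} {Pow._^_ K ρ e} (K.reflexive m≡) (power e)
      where
      m≡ : modulus q e ≡ ρy q ^y e
      m≡ = ≡.cong (λ b → if b then + (2 ℕ.^ e) ∷ [] else (ρy q ^y e)) (≡.cong ⌊_⌋ (dec-no (q ℕ.≟ 2) q≢2))
      base : ρy q K.≈ ρ
      base = K.*-cong {K.1# K.- y} {K.1# K.- y} {K.1# K.- yʸ (q ∸ 1)} {K.1# K.- ζ̄} (K.refl {K.1# K.- y})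
        (K.+-cong {K.1#} {K.1#} {K.- yʸ (q ∸ 1)} {K.- ζ̄} (K.refl {K.1#}) (K.-‿cong {yʸ (q ∸ 1)} {ζ̄} (hom-mono Q.quot (q ∸ 1))))
      power : ∀ e → (ρy q ^y e) K.≈ (Pow._^_ K ρ e)
      power zero = K.refl {K.1#}
      power (suc e) = K.*-cong {ρy q} {ρ} {ρy q ^y e} {Pow._^_ K ρ e} base (power e)

-- Odd primes, powers of two from 4 on, and q = 2

geom-neg1 : ∀ h → Geometric.geom ℤᶜ (suc (dbl h)) (ℤ.- + 1) ≡ + 1
geom-neg1 zero = ≡.refl
geom-neg1 (suc h) = ≡.cong (λ z → + 1 ℤ.+ (ℤ.- + 1) ℤ.* (+ 1 ℤ.+ (ℤ.- + 1) ℤ.* z)) (geom-neg1 h)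

odd-* : ∀ a b → ∃ (λ h → suc (dbl a) ℕ.* suc (dbl b) ≡ suc (dbl h))
odd-* zero b = b , ℕₚ.+-identityʳ _
odd-* (suc a) b = suc (dbl b ℕ.+ h) ,
  ≡.trans (≡.cong (λ z → suc (dbl b) ℕ.+ (suc (dbl b) ℕ.+ z)) (≡.trans (proj₂ (odd-* a b)) (≡.cong suc (dbl-+ h))))
  (≡.trans (solve 2 (λ x h → con 1 :+ x :+ (con 1 :+ x :+ (con 1 :+ (h :+ h))) := con 3 :+ (x :+ h :+ (x :+ h))) ≡.refl (dbl b) h)
  (≡.cong (3 ℕ.+_) (≡.sym (dbl-+ (dbl b ℕ.+ h)))))
  where
  open +-*-Solver
  h : ℕ
  h = proj₁ (odd-* a b)

odd-^ : ∀ a f → ∃ (λ h → suc (dbl a) ℕ.^ f ≡ suc (dbl h))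
odd-^ a zero = 0 , ≡.refl
odd-^ a (suc f) = proj₁ M , ≡.trans (≡.cong (suc (dbl a) ℕ.*_) (proj₂ (odd-^ a f))) (proj₂ M)
  where
  M : ∃ (λ h → suc (dbl a) ℕ.* suc (dbl (proj₁ (odd-^ a f))) ≡ suc (dbl h))
  M = odd-* a (proj₁ (odd-^ a f))

odd-prime : ∀ p → Prime p → p ≢ 2 → ∃ (λ h → p ≡ suc (dbl h))
odd-prime p pr p≢2 = go (parity p) pr p≢2
  where
  go : ∀ {p} → Parity p → Prime p → p ≢ 2 → ∃ (λ h → p ≡ suc (dbl h))
  go (odd h) _ _ = h , ≡.refl
  go (even m) pr p≢2 = bad (prime⇒irreducible pr (divides m (≡.trans (dbl-+ m) (≡.trans (≡.cong (m ℕ.+_) (≡.sym (ℕₚ.+-identityʳ m))) (ℕₚ.*-comm 2 m)))))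
    where
    bad : 2 ≡ 1 ⊎ 2 ≡ dbl m → ∃ (λ h → dbl m ≡ suc (dbl h))
    bad (inj₁ ())
    bad (inj₂ e) = ⊥-elim (p≢2 (≡.sym e))

even-order : ∀ n → n % 2 ≡ 0 → ∃ (λ r → n ≡ dbl r)
even-order n = go (parity n)
  where
  contra : ∀ r → suc (dbl r) % 2 ≢ 0
  contra zero ()
  contra (suc r) e = contra r e
  go : ∀ {n} → Parity n → n % 2 ≡ 0 → ∃ (λ r → n ≡ dbl r)
  go (even r) _ = r , ≡.refl
  go (odd r) e = ⊥-elim (contra r e)

odd-order : ∀ n → n % 2 ≡ 1 → ∃ (λ r → n ≡ suc (dbl r))
odd-order n = go (parity n)
  where
  contra : ∀ r → dbl r % 2 ≢ 1
  contra zero ()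
  contra (suc r) e = contra r e
  go : ∀ {n} → Parity n → n % 2 ≡ 1 → ∃ (λ r → n ≡ suc (dbl r))
  go (odd r) _ = r , ≡.refl
  go (even r) e = ⊥-elim (contra r e)

neg1-odd : ∀ m → Pow._^_ ℤᶜ (ℤ.- + 1) (suc (dbl m)) ≡ ℤ.- + 1
neg1-odd m = ≡.cong ((ℤ.- + 1) ℤ.*_) (DerivativeScale.neg1^dbl ℤᶜ m)

module OddCase (p : ℕ) (pr : Prime p) (p≢2 : p ≢ 2) (f n : ℕ) where
  instance
    nz : ℕ.NonZero p
    nz = prime⇒nonZero pr

  module C = Concrete p f

  h : ℕ
  h = proj₁ (odd-prime p pr p≢2)

  p≡ : p ≡ suc (dbl h)
  p≡ = proj₂ (odd-prime p pr p≢2)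

  P-odd : ∃ (λ m → C.P ≡ suc (dbl m))
  P-odd = proj₁ (odd-^ h f) , ≡.trans (≡.cong (ℕ._^ f) p≡) (proj₂ (odd-^ h f))

  q-odd : ∃ (λ m → C.q ≡ suc (dbl m))
  q-odd = proj₁ (odd-* h (proj₁ P-odd)) , ≡.trans (≡.cong₂ ℕ._*_ p≡ (proj₂ P-odd)) (proj₂ (odd-* h (proj₁ P-odd)))

  q≢2 : C.q ≢ 2
  q≢2 eq = dbl≢odd 1 (proj₁ q-odd) (≡.trans (≡.sym eq) (proj₂ q-odd))

  -- An odd power of -1 is -1, and an alternating sum of the p terms 1, -1, ..., 1 is 1.
  Φ-1 : C.EZ.ev (ℤ.- + 1) C.Φ ≡ + 1
  Φ-1 = ≡.trans (C.Φ-at (ℤ.- + 1)) (≡.trans (≡.cong₂ C.GZ.geom p≡ (≡.trans (≡.cong ((ℤ.- + 1) C.PZ.^_) (proj₂ P-odd)) (neg1-odd (proj₁ P-odd)))) (geom-neg1 h))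

  Φ≢0 : C.EZ.ev (ℤ.- + 1) C.Φ ≢ + 0
  Φ≢0 eq = absurd (≡.trans (≡.sym Φ-1) eq)
    where
    absurd : + 1 ≢ + 0
    absurd ()

  module T = CycloTheory p C.P C.q-1 C.q≡ C.data′

  ram : T.RealMultiple T.ρ (T.ιℕ p)
  ram = T.p-ramified-odd h p≡

  module F = Family p C.P C.q-1 C.q≡ C.data′ n
  module O = F.OddPrime (proj₁ ram) (proj₁ (proj₂ ram)) (proj₂ (proj₂ ram)) (C.cancel₋₁ Φ≢0) (proj₁ q-odd) (proj₂ q-odd)

  bound : ∀ e → XCardLe p (suc f) n e (p ℕ.^ ((e ℕ.* e ℕ.+ 1) ∸ (2 ℕ.* e)))
  bound e = C.toXCardLe n e (p ℕ.^ ((e ℕ.* e ℕ.+ 1) ∸ (2 ℕ.* e))) T.ρ (C.modulus-ρ n q≢2 e) (O.classify e)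

module TwoCase (g n : ℕ) where
  module C = Concrete 2 (suc g)

  q≢2 : C.q ≢ 2
  q≢2 eq = ℕₚ.<⇒≱ (ℕ.s≤s (ℕ.s≤s (ℕ.s≤s ℕ.z≤n))) (≡.subst (4 ℕ.≤_) eq four)
    where
    four : 4 ℕ.≤ C.q
    four = ℕₚ.*-monoʳ-≤ 2 (ℕₚ.*-monoʳ-≤ 2 (ℕₚ.m^n>0 2 g))

  -- The exponent 2^(g+1) is even, so Φ(-1) = 1 + 1 = 2. For q = 2 the value is 0, which is why that
  -- case takes another path.
  Φ≢0 : C.EZ.ev (ℤ.- + 1) C.Φ ≢ + 0
  Φ≢0 eq = absurd (≡.trans (≡.sym value) eq)
    where
    absurd : + 2 ≢ + 0
    absurd ()
    value : C.EZ.ev (ℤ.- + 1) C.Φ ≡ + 2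
    value = ≡.trans (C.Φ-at (ℤ.- + 1)) (≡.cong (C.GZ.geom 2) (≡.trans (≡.cong ((ℤ.- + 1) C.PZ.^_)
      (≡.trans (≡.cong (2 ℕ.^ g ℕ.+_) (ℕₚ.+-identityʳ (2 ℕ.^ g))) (≡.sym (dbl-+ (2 ℕ.^ g))))) (DerivativeScale.neg1^dbl ℤᶜ (2 ℕ.^ g))))

  module F = TwoPowerFamily g C.q-1 C.q≡ C.data′ (C.cancel₋₁ Φ≢0) n

module SignCase (n : ℕ) where
  module C = Concrete 2 0
  module F = SignFamily C.data′ n

  modulus≈ : ∀ e → modulus 2 e C.K.≈ (Pow._^_ C.K (Cast.ι C.K (+ 2)) e)
  modulus≈ e = C.K.trans {+ (2 ℕ.^ e) ∷ []} {Cast.ι C.K (+ (2 ℕ.^ e))} {Pow._^_ C.K (Cast.ι C.K (+ 2)) e} (hom-ℤ (C.Q.quot ∘ʰ constY) (+ (2 ℕ.^ e))) (go e)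
    where
    go : ∀ e → Cast.ι C.K (+ (2 ℕ.^ e)) C.K.≈ (Pow._^_ C.K (Cast.ι C.K (+ 2)) e)
    go zero = C.K.refl {C.K.1#}
    go (suc e) = C.K.trans {Cast.ι C.K (+ (2 ℕ.^ suc e))} {Cast.ι C.K (+ 2) C.K.* Cast.ι C.K (+ (2 ℕ.^ e))} {Pow._^_ C.K (Cast.ι C.K (+ 2)) (suc e)}
      (Cast.ιℕ-* C.K 2 (2 ℕ.^ e)) (C.K.*-cong {Cast.ι C.K (+ 2)} {Cast.ι C.K (+ 2)} {Cast.ι C.K (+ (2 ℕ.^ e))} {Pow._^_ C.K (Cast.ι C.K (+ 2)) e} (C.K.refl {Cast.ι C.K (+ 2)}) (go e))

theorem1p1 : (n e f : ℕ) →
    (n % 2 ≡ 0 → XCardLe 2 1 n e (2 ℕ.^ ((⌊ e ℕ.* e /2⌋ ℕ.+ 1) ∸ e)))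
    × (n % 2 ≡ 1 → XCardLe 2 1 n e (2 ℕ.^ ((⌈ e ℕ.* e /2⌉ ℕ.+ 1) ∸ e)))
    × ((p : ℕ) → Prime p → p ≢ 2 → 1 ℕ.≤ f →
    XCardLe p f n e (p ℕ.^ ((e ℕ.* e ℕ.+ 1) ∸ (2 ℕ.* e))))
    × (1 ℕ.< f → n % 2 ≡ 0 →
    XCardLe 2 f n e (2 ℕ.^ ((e ℕ.* e ℕ.+ 2 ℕ.+ ceilDiv e (2 ℕ.^ (f ∸ 2))) ∸ (3 ℕ.* e ℕ.+ 1))))
    × (1 ℕ.< f → n % 2 ≡ 1 →
    XCardLe 2 f n e (2 ℕ.^ ((e ℕ.* e ℕ.+ 1 ℕ.+ ceilDiv e (2 ℕ.^ (f ∸ 2))) ∸ (2 ℕ.* e ℕ.+ 1 ℕ.+ e / 4))))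
theorem1p1 n e f = a , b , c f , d f , e′ f
  where
  a : n % 2 ≡ 0 → XCardLe 2 1 n e (2 ℕ.^ ((⌊ e ℕ.* e /2⌋ ℕ.+ 1) ∸ e))
  a ev = S.C.toXCardLe n e _ _ (S.modulus≈ e) (S.F.classify-even (proj₁ (even-order n ev)) (proj₂ (even-order n ev)) e)
    where module S = SignCase n
  b : n % 2 ≡ 1 → XCardLe 2 1 n e (2 ℕ.^ ((⌈ e ℕ.* e /2⌉ ℕ.+ 1) ∸ e))
  b od = S.C.toXCardLe n e _ _ (S.modulus≈ e) (S.F.classify-odd (proj₁ (odd-order n od)) (proj₂ (odd-order n od)) e)
    where module S = SignCase n
  c : ∀ f p → Prime p → p ≢ 2 → 1 ℕ.≤ f → XCardLe p f n e (p ℕ.^ ((e ℕ.* e ℕ.+ 1) ∸ (2 ℕ.* e)))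
  c (suc f) p pr p≢2 _ = OddCase.bound p pr p≢2 f n e
  d : ∀ f → 1 ℕ.< f → n % 2 ≡ 0 → XCardLe 2 f n e (2 ℕ.^ ((e ℕ.* e ℕ.+ 2 ℕ.+ ceilDiv e (2 ℕ.^ (f ∸ 2))) ∸ (3 ℕ.* e ℕ.+ 1)))
  d (suc zero) (ℕ.s≤s ()) _
  d (suc (suc g)) _ ev = T.C.toXCardLe n e _ _ (T.C.modulus-ρ n T.q≢2 e) (T.F.classify-even (proj₁ (even-order n ev)) (proj₂ (even-order n ev)) e)
    where module T = TwoCase g n
  e′ : ∀ f → 1 ℕ.< f → n % 2 ≡ 1 → XCardLe 2 f n e (2 ℕ.^ ((e ℕ.* e ℕ.+ 1 ℕ.+ ceilDiv e (2 ℕ.^ (f ∸ 2))) ∸ (2 ℕ.* e ℕ.+ 1 ℕ.+ e / 4)))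
  e′ (suc zero) (ℕ.s≤s ()) _
  e′ (suc (suc g)) _ od = T.C.toXCardLe n e _ _ (T.C.modulus-ρ n T.q≢2 e) (T.F.classify-odd (proj₁ (odd-order n od)) (proj₂ (odd-order n od)) e)
    where module T = TwoCase g n
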